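{- Let $\mathsf{M}=(E,\operatorname{rk})$ be a nonempty loopless polymatroid (i.e. $E\neq\varnothing$) and let $\mathcal{G}$ be a building set on $\mathcal{L}(\mathsf{M})$. Then, as an identity of rational functions in $x$, \[ \mathrm{H}_\mathsf{M}^\mathcal{G}(x) = \sum_{\varnothing \neq F \in \mathcal L(\mathsf{M})} \frac{ -\chi_{\mathsf{M}|_F}(x)}{(1-x)^{|f(\mathcal{G}|_F)|}} \cdot \mathrm{H}_{\mathsf{M}/F}^{\mathcal{G}/F}(x), \] and \[ \mathrm{H}_\mathsf{M}^{\mathcal{G}}(x) = \sum_{E\neq F \in \mathcal L(\mathsf{M})} \mathrm{H}_{\mathsf{M}|_F}^{\mathcal{G}|_F}(x) \cdot \frac{ -\chi_{\mathsf{M}/F}(x)}{(1-x)^{\lvert f(\mathcal{G}/F) \rvert}}. \]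
   Context: A polymatroid $\mathsf{M}=(E,\operatorname{rk})$ consists of a finite set $E$ and a function $\operatorname{rk}:2^E\to\mathbb{Z}_{\ge0}$ with $\operatorname{rk}(\varnothing)=0$, $\operatorname{rk}(A_1)\le\operatorname{rk}(A_2)$ whenever $A_1\subseteq A_2$, and $\operatorname{rk}(A_1)+\operatorname{rk}(A_2)\ge\operatorname{rk}(A_1\cup A_2)+\operatorname{rk}(A_1\cap A_2)$. A flat is a set $F\subseteq E$ with $\operatorname{rk}(F\cup\{e\})>\operatorname{rk}(F)$ for all $e\in E\setminus F$; the flats ordered by inclusion form a lattice $\mathcal L(\mathsf{M})$ with join $\vee$. Loopless means $\varnothing\in\mathcal L(\mathsf{M})$. For a set $\mathcal{G}$ of flats, $f(\mathcal{G})$ denotes the set of inclusion-maximal elements of $\mathcal{G}$ (the $\mathcal{G}$-factors), and $\mathcal{G}_{\le F}=\{G\in\mathcal{G}:G\subseteq F\}$. A building set is a subset $\mathcal{G}\subseteq\mathcal L(\mathsf{M})\setminus\{\varnothing\}$ such that for every flat $F$ the lattice map $\prod_{G\in f(\mathcal{G}_{\le F})}[\varnothing,G]\to[\varnothing,F]$, $(F_G)_G\mapsto\bigvee_G F_G$, is an isomorphism and $\operatorname{rk}(F)=\sum_{G\in f(\mathcal{G}_{\le F})}\operatorname{rk}(G)$. For a flat $F$: the restriction $\mathsf{M}|_F=(F,\operatorname{rk}|_{2^F})$, with induced building set $\mathcal{G}|_F=\{G\in\mathcal{G}:G\subseteq F\}$; the contraction $\mathsf{M}/F$ is the polymatroid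 on $E\setminus F$ with rank $A\mapsto\operatorname{rk}(A\cup F)-\operatorname{rk}(F)$, whose lattice of flats is identified with the interval $[F,E]$ of $\mathcal L(\mathsf{M})$, with induced building set $\mathcal{G}/F=\{G\vee F: G\in\mathcal{G},\ G\not\subseteq F\}$. The characteristic polynomial is $\chi_\mathsf{M}(x)=\sum_{F\in\mathcal L(\mathsf{M})}\mu(\varnothing,F)x^{\operatorname{rk}(E)-\operatorname{rk}(F)}$, $\mu$ the Möbius function of $\mathcal L(\mathsf{M})$. The Chow ring $D(\mathsf{M},\mathcal{G})$ is the quotient of $\mathbb{Q}[x_G:G\in\mathcal{G}]$ (each $x_G$ of degree 1) by the ideal generated by $\big(\prod_{i=1}^m x_{G_i}\big)\big(\sum_{H\in\mathcal{G},H\supseteq G}x_H\big)^{b}$ for every subset $S=\{G_1,\dots,G_m\}\subseteq\mathcal{G}$ and every $G\in\mathcal{G}$, where $b=\operatorname{rk}(G)-\operatorname{rk}(\sup(S,G))$ and $\sup(S,G)=\bigvee_{G'\in S,\,G'\subsetneq G}G'$ (empty join $=\varnothing$). It is a graded Artinian ring, and $\mathrm{H}_\mathsf{M}^{\mathcal{G}}(x)=\sum_i\dim_\mathbb{Q} D^i(\mathsf{M},\mathcal{G})x^i$ is its Hilbert series; by convention $\mathrm{H}^{\mathcal{G}}_\mathsf{M}(x)=1$ when $\mathsf{M}$ is the empty polymatroid (ground set $\varnothing$). -}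

module Defs where

open import Data.Bool using (Bool; true; false; _∧_; _∨_; not; T; if_then_else_)
open import Data.Nat as ℕ using (ℕ; zero; suc; _∸_; _≤_; _<_; _≤ᵇ_; _<ᵇ_)
open import Data.Nat.Properties using () renaming (_≟_ to _≟ℕ_)
open import Data.Integer as ℤ using (ℤ)
open import Data.Rational as ℚ using (ℚ; 0ℚ; 1ℚ)
open import Data.Rational.Properties using () renaming (_≟_ to _≟ℚ_)
open import Data.Fin using (Fin; zero; suc)
open import Data.Fin.Subset using (Subset; _∈_; _⊆_; _∪_; _∩_; _─_; ⁅_⁆; ⊥; ⊤; ∣_∣; Nonempty; ⋃)
open import Data.Fin.Subset.Properties using (_⊆?_; _∈?_)
open import Data.Vec as Vec using (Vec; []; _∷_)
open import Data.Vec.Properties using (≡-dec)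
open import Data.List as List using (List; []; _∷_; filter; map; length; foldr; concatMap; allFin)
open import Data.Bool.ListAction using (any; all)
open import Data.Nat.ListAction using (sum)
open import Data.Product using (Σ; ∃; _×_; _,_; proj₁; proj₂)
open import Function.Bundles using (_⇔_)
open import Relation.Nullary using (¬_; Dec; yes; no)
open import Relation.Nullary.Decidable using (⌊_⌋)
open import Relation.Binary.PropositionalEquality using (_≡_; _≢_)
import Data.Bool as B

-- Finite sets: a finite ground set E is encoded as a subset of Fin n.

allSubsets : (n : ℕ) → List (Subset n)
allSubsets zero    = [] ∷ []
allSubsets (suc n) = map (false ∷_) (allSubsets n) List.++ map (true ∷_) (allSubsets n)

_≟S_ : ∀ {n} (A B : Subset n) → Dec (A ≡ B)
_≟S_ = ≡-dec B._≟_

_⊆ᵇ_ : ∀ {n} → Subset n → Subset n → Bool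
A ⊆ᵇ B = ⌊ A ⊆? B ⌋

_≡ᵇ_ : ∀ {n} → Subset n → Subset n → Bool
A ≡ᵇ B = ⌊ A ≟S B ⌋

_⊊ᵇ_ : ∀ {n} → Subset n → Subset n → Bool
A ⊊ᵇ B = (A ⊆ᵇ B) ∧ not (A ≡ᵇ B)

_∈ᵇ_ : ∀ {n} → Fin n → Subset n → Bool
e ∈ᵇ A = ⌊ e ∈? A ⌋

Tdec : (b : Bool) → Dec (T b)
Tdec = B.T?

-- Polymatroids.  A polymatroid (E, rk) with E ⊆ Fin n; rk is given on all
-- of Subset n but only its values on subsets of E are meaningful.

record Polymatroid (n : ℕ) : Set where
  constructor polymatroid
  field
    ground : Subset n
    rk     : Subset n → ℕ
open Polymatroid public

record IsPolymatroid {n : ℕ} (P : Polymatroid n) : Set where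
  field
    rk-∅      : rk P ⊥ ≡ 0
    rk-mono   : ∀ A₁ A₂ → A₂ ⊆ ground P → A₁ ⊆ A₂ → rk P A₁ ≤ rk P A₂
    rk-submod : ∀ A₁ A₂ → A₁ ⊆ ground P → A₂ ⊆ ground P →
                rk P (A₁ ∪ A₂) ℕ.+ rk P (A₁ ∩ A₂) ≤ rk P A₁ ℕ.+ rk P A₂

module _ {n : ℕ} (P : Polymatroid n) where

  isFlat : Subset n → Bool
  isFlat F = (F ⊆ᵇ ground P) ∧
    all (λ e → if (e ∈ᵇ ground P) ∧ not (e ∈ᵇ F)
               then rk P F <ᵇ rk P (F ∪ ⁅ e ⁆) else true) (allFin n)

  flats : List (Subset n)
  flats = filter (λ F → Tdec (isFlat F)) (allSubsets n)

  closure : Subset n → Subset n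
  closure A = foldr _∩_ (ground P) (filter (λ F → A ⊆? F) flats)

  -- join of a list of flats (empty join = closure ∅, i.e. ∅ when loopless)
  ⋁ : List (Subset n) → Subset n
  ⋁ Fs = closure (⋃ Fs)

  Loopless : Set
  Loopless = T (isFlat ⊥)

  -- Möbius function μ(∅, F) of L(P), by the recursion
  -- μ(∅,∅) = 1,  μ(∅,F) = - Σ_{flats K ⊊ F} μ(∅,K);  fuel bounds |F|.
  μ-fuel : ℕ → Subset n → ℤ
  μ-fuel zero    F = ℤ.1ℤ
  μ-fuel (suc k) F = if F ≡ᵇ ⊥ then ℤ.1ℤ
    else ℤ.- List.foldr ℤ._+_ ℤ.0ℤ
           (map (μ-fuel k) (filter (λ K → Tdec (K ⊊ᵇ F)) flats))

  μ : Subset n → ℤ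
  μ F = μ-fuel n F

_∣ʳ_ : ∀ {n} → Polymatroid n → Subset n → Polymatroid n
P ∣ʳ F = polymatroid F (rk P)

_/ᶜ_ : ∀ {n} → Polymatroid n → Subset n → Polymatroid n
P /ᶜ F = polymatroid (ground P ─ F) (λ A → rk P (A ∪ F) ∸ rk P F)

SetOfFlats : ℕ → Set
SetOfFlats n = Subset n → Bool

module _ {n : ℕ} where

  elems : SetOfFlats n → List (Subset n)
  elems 𝒢 = filter (λ G → Tdec (𝒢 G)) (allSubsets n)

  maxElems : SetOfFlats n → List (Subset n)
  maxElems 𝒢 = filter (λ G → Tdec (not (any (λ H → G ⊊ᵇ H) (elems 𝒢)))) (elems 𝒢)

  below : SetOfFlats n → Subset n → SetOfFlats n
  below 𝒢 F G = 𝒢 G ∧ (G ⊆ᵇ F)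

restrictBS : ∀ {n} → SetOfFlats n → Subset n → SetOfFlats n
restrictBS 𝒢 F = below 𝒢 F

-- 𝒢/F = { G ∨ F : G ∈ 𝒢, G ⊄ F }, flats of M/F identified with [F,E]
-- via H ↦ H ∖ F
contractBS : ∀ {n} → Polymatroid n → SetOfFlats n → Subset n → SetOfFlats n
contractBS P 𝒢 F H =
  any (λ G → 𝒢 G ∧ not (G ⊆ᵇ F) ∧ (H ≡ᵇ (⋁ P (G ∷ F ∷ []) ─ F))) (allSubsets _)

module _ {n : ℕ} (P : Polymatroid n) (𝒢 : SetOfFlats n) where

  Tuple : Subset n → Set
  Tuple F = Fin (length (maxElems (below 𝒢 F))) → Subset n

  ValidTuple : (F : Subset n) → Tuple F → Set
  ValidTuple F t = ∀ i → T (isFlat P (t i)) × (t i ⊆ List.lookup (maxElems (below 𝒢 F)) i)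

  joinTuple : (F : Subset n) → Tuple F → Subset n
  joinTuple F t = ⋁ P (List.map t (List.allFin _))

  record IsBuildingSet : Set where
    field
      flats-nonempty : ∀ G → T (𝒢 G) → T (isFlat P G) × Nonempty G
      -- the map  ∏ [∅,G] → [∅,F] , (F_G) ↦ ⋁ F_G  is a lattice isomorphism:
      -- well-defined, order-preserving and order-reflecting, surjective
      iso-into : ∀ F → T (isFlat P F) → ∀ t → ValidTuple F t → joinTuple F t ⊆ F
      iso-order : ∀ F → T (isFlat P F) → ∀ t t' → ValidTuple F t → ValidTuple F t' →
                  (∀ i → t i ⊆ t' i) ⇔ (joinTuple F t ⊆ joinTuple F t')
      iso-onto : ∀ F → T (isFlat P F) → ∀ H → T (isFlat P H) → H ⊆ F →
                 ∃ λ t → ValidTuple F t × joinTuple F t ≡ H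
      rank-sum : ∀ F → T (isFlat P F) →
                 rk P F ≡ sum (List.map (rk P) (maxElems (below 𝒢 F)))

Monomial : ℕ → Set
Monomial k = Vec ℕ k

Poly : ℕ → Set
Poly k = List (ℚ × Monomial k)

module _ {k : ℕ} where

  coeff : Poly k → Monomial k → ℚ
  coeff p m = List.foldr ℚ._+_ 0ℚ
    (List.map proj₁ (filter (λ t → ≡-dec _≟ℕ_ (proj₂ t) m) p))

  _≈P_ : Poly k → Poly k → Set
  p ≈P q = ∀ m → coeff p m ≡ coeff q m

  _+P_ : Poly k → Poly k → Poly k
  _+P_ = List._++_

  _·P_ : ℚ → Poly k → Poly k
  c ·P p = map (λ t → (c ℚ.* proj₁ t , proj₂ t)) p

  -P_ : Poly k → Poly k
  -P p = (ℚ.- 1ℚ) ·P p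

  _*P_ : Poly k → Poly k → Poly k
  p *P q = concatMap (λ s → map (λ t → (proj₁ s ℚ.* proj₁ t , Vec.zipWith ℕ._+_ (proj₂ s) (proj₂ t))) q) p

  1P : Poly k
  1P = (1ℚ , Vec.replicate k 0) ∷ []

  0P : Poly k
  0P = []

  varP : Fin k → Poly k
  varP i = (1ℚ , Vec.tabulate (λ j → if ⌊ Data.Fin._≟_ i j ⌋ then 1 else 0)) ∷ []
    where import Data.Fin

  _^P_ : Poly k → ℕ → Poly k
  p ^P zero  = 1P
  p ^P suc b = p *P (p ^P b)

  sumP : List (Poly k) → Poly k
  sumP = List.foldr _+P_ 0P

  degree : Monomial k → ℕ
  degree = Vec.sum

  Homogeneous : ℕ → Poly k → Set
  Homogeneous d p = ∀ m → coeff p m ≢ 0ℚ → degree m ≡ d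

module _ {n : ℕ} (P : Polymatroid n) (𝒢 : SetOfFlats n) where

  gens : List (Subset n)
  gens = elems 𝒢

  nvars : ℕ
  nvars = length gens

  G# : Fin nvars → Subset n
  G# = List.lookup gens

  relation : Subset nvars → Fin nvars → Poly nvars
  relation S j =
    List.foldr _*P_ 1P (map varP (filter (λ i → i ∈? S) (allFin nvars)))
    *P (sumP (map varP (filter (λ i → Tdec (G# j ⊆ᵇ G# i)) (allFin nvars))) ^P b)
    where
    sup : Subset n
    sup = ⋁ P (map G# (filter (λ i → Tdec ((i ∈ᵇ S) ∧ (G# i ⊊ᵇ G# j))) (allFin nvars)))
    b : ℕ
    b = rk P (G# j) ∸ rk P sup

  InIdeal : Poly nvars → Set
  InIdeal p = ∃ λ (cs : List (Poly nvars × Subset nvars × Fin nvars)) →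
    p ≈P sumP (map (λ c → proj₁ c *P relation (proj₁ (proj₂ c)) (proj₂ (proj₂ c))) cs)

  lincomb : ∀ {r} → Vec ℚ r → Vec (Poly nvars) r → Poly nvars
  lincomb cs bs = sumP (Vec.toList (Vec.zipWith _·P_ cs bs))

  -- dim_ℚ D^d(M,𝒢) = r : there are r homogeneous degree-d polynomials whose
  -- classes form a ℚ-basis of the degree-d part of the quotient ring
  DimDeg : ℕ → ℕ → Set
  DimDeg d r = ∃ λ (bs : Vec (Poly nvars) r) →
      (∀ j → Homogeneous d (Vec.lookup bs j))
    × (∀ p → Homogeneous d p → ∃ λ (cs : Vec ℚ r) → InIdeal (p +P (-P lincomb cs bs)))
    × (∀ (cs : Vec ℚ r) → InIdeal (lincomb cs bs) → ∀ j → Vec.lookup cs j ≡ 0ℚ)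

  IsHilbertFn : (ℕ → ℕ) → Set
  IsHilbertFn h = ∀ d → DimDeg d (h d)

Series : Set
Series = ℕ → ℤ

sumℤ : List ℤ → ℤ
sumℤ = List.foldr ℤ._+_ ℤ.0ℤ

_⊛_ : Series → Series → Series
(f ⊛ g) d = sumℤ (map (λ i → f i ℤ.* g (d ∸ i)) (List.upTo (suc d)))

negS : Series → Series
negS f d = ℤ.- f d

fromℕS : (ℕ → ℕ) → Series
fromℕS h d = ℤ.+ h d

oneMinusX : Series
oneMinusX zero          = ℤ.1ℤ
oneMinusX (suc zero)    = ℤ.-1ℤ
oneMinusX (suc (suc _)) = ℤ.0ℤ

oneS : Series
oneS zero    = ℤ.1ℤ
oneS (suc _) = ℤ.0ℤ

_^S_ : Series → ℕ → Series
f ^S zero  = oneS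
f ^S suc m = f ⊛ (f ^S m)

sumS : List Series → Series
sumS fs d = sumℤ (map (λ f → f d) fs)

χ : ∀ {n} → Polymatroid n → Series
χ P d = sumℤ (map (μ P)
  (filter (λ F → (rk P (ground P) ∸ rk P F) ≟ℕ d) (flats P)))

{-# OPTIONS --safe #-}
-- Order 𝒢 by a linear extension of inclusion.  For a final segment L of 𝒢 and chosen flats T ⊆ 𝒢, let
-- I(L,T) ⊆ ℚ[x_G : G ∈ L] be generated by the Chow ring relations with S replaced by S ∪ T.  If G is put in
-- front of L, b = rk G − rk sup(T,G) and Y = Σ_{K ∈ L, K ⊋ G} x_K, then
--   I(G ∷ L, T) = I(L,T) + x_G I(L, G ∷ T) + (x_G + Y)^b,
-- and Y^b I(L, G ∷ T) ⊆ I(L,T), so for b > 0 the quotient is Q(L,T) ⊕ ⨁_{1≤i<b} x_G^i Q(L, G ∷ T) (for b = 0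
-- it vanishes).  Hence the Hilbert series is a sum over nested sets S of ∏_{G ∈ S} (x + … + x^(b_G − 1)).
--
-- Let W(F) collect the nested sets with join F, so that H(K) = Σ_{F ⊆ K} W(F).  If K = K₁ ⊕ R with K₁ a factor,
-- adding K₁ to a nested set shows W(K₁ ∨ B) = Σ_{A ⊊ K₁} W(A ∨ B) (x + … + x^(rk K₁ − rk A − 1)) for B ⊆ R.
-- Together with Σ_{A ⊆ J ⊆ K} χ(J,K) = x^(rk K − rk A) this gives
--   Σ_{F ⊆ J ⊆ K} H(F,J) χ(J,K) (1−x)^(−c(J,K)) = δ(F,K)
-- in the incidence algebra, c(J,K) being the number of factors.  This is the second identity; the first one
-- holds because a left inverse in the incidence algebra is also a right inverse.

module Submission where

open import Defs
open import Algebra.Bundles using (CommutativeRing)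
open import Algebra.Structures using (IsCommutativeRing)
open import Data.Bool using (Bool; true; false; T; not; _∧_; if_then_else_)
open import Data.Bool.Properties using (T-irrelevant)
open import Data.Bool.ListAction using (any)
open import Data.Nat as ℕ using (ℕ; zero; suc; _∸_; _≤_; _<_; s≤s)
import Data.Nat.Properties as ℕ
open import Data.Nat.ListAction using (sum)
open import Data.Integer as ℤ using (ℤ)
import Data.Integer.Properties as ℤ
open import Data.Rational as ℚ using (ℚ; 0ℚ; 1ℚ)
import Data.Rational.Properties as ℚ
open import Data.Fin as Fin using (Fin; zero; suc)
open import Data.Fin.Subset using (Subset; _⊆_; _⊈_; _∪_; _∩_; _─_; ⁅_⁆; ⊥; ∣_∣; Nonempty; ⋃) renaming (_∈_ to _∈ˢ_; _∉_ to _∉ˢ_)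
open import Data.Fin.Subset.Properties using (_⊆?_; _∈?_; ⊆-refl; ⊆-trans; ⊆-antisym; ⊥⊆; ∉⊥; p∩q⊆p; p∩q⊆q; x∈p∩q⁺; p⊆p∪q; q⊆p∪q; x∈p∪q⁻; x∈⁅x⁆; ∣⁅x⁆∣≡1; x∈⁅y⁆⇒x≡y; drop-∷-⊆; p⊂q⇒∣p∣<∣q∣; ∣p∣≤n; ⊆-reflexive; p⊆q⇒∣p∣≤∣q∣; p─q⊆p; x∈p∧x∉q⇒x∈p─q; ∪-identityˡ; ∪-identityʳ; p─⊥≡p; ∪-distribʳ-∩)
import Data.Fin.Properties as Fin
open import Data.List using (List; []; _∷_; _++_; filter; map; length; foldr; allFin; cartesianProduct)
import Data.List as List
import Data.List.Properties as List
open import Data.List.Membership.Propositional using (_∈_; find; lose)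
open import Data.List.Membership.Propositional.Properties using (∈-filter⁺; ∈-filter⁻; ∈-map⁺; ∈-map⁻; ∈-++⁺ˡ; ∈-++⁺ʳ; ∈-++⁻; ∈-cartesianProduct⁺; ∈-cartesianProduct⁻; ∈-deduplicate⁺; ∈-lookup; ∈-allFin; ∈-∃++)
open import Data.List.Membership.Propositional.Properties.WithK using (unique∧set⇒bag)
open import Data.List.Relation.Binary.BagAndSetEquality using (∼bag⇒↭)
open import Data.List.Relation.Binary.Permutation.Propositional as Perm using (_↭_)
open import Data.List.Relation.Binary.Permutation.Propositional.Properties using (↭-length)
open import Data.List.Relation.Binary.Pointwise as Pointwise using (Pointwise; []; _∷_)
open import Data.List.Relation.Unary.All as All using (All; []; _∷_)
import Data.List.Relation.Unary.All.Properties as All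
open import Data.List.Relation.Unary.AllPairs as AllPairs using (AllPairs; []; _∷_)
import Data.List.Relation.Unary.AllPairs.Properties as AllPairs
open import Data.List.Relation.Unary.Any as Any using (here; there)
open import Data.List.Relation.Unary.Any.Properties as Any using (lookup-index)
open import Data.List.Relation.Unary.Unique.DecPropositional.Properties using (deduplicate-!)
open import Data.List.Relation.Unary.Unique.Propositional using (Unique)
import Data.List.Relation.Unary.Unique.Propositional.Properties as Unique
open import Data.Product using (∃; _×_; _,_; proj₁; proj₂)
open import Data.Sum using (_⊎_; inj₁; inj₂; [_,_]′)
open import Data.Vec as Vec using (Vec; []; _∷_)
import Data.Vec.Properties as Vec
open import Data.Empty using (⊥-elim)
open import Level using (0ℓ)
open import Data.Unit using (⊤; tt)
open import Function using (_∘_; id; mk⇔; Equivalence)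
open import Relation.Binary.Structures using (IsEquivalence)
open import Relation.Nullary using (¬_; Dec; yes; no; contradiction; does)
open import Relation.Nullary.Decidable using (¬?; _×-dec_; toWitness; fromWitness; ⌊_⌋; decidable-stable)
open import Relation.Binary.PropositionalEquality using (_≡_; _≢_; refl; sym; trans; cong; cong₂; subst; subst₂; module ≡-Reasoning)
import Relation.Binary.Reasoning.Setoid

-- Finite sums

-- The order puts small flats first: when a minimal G is eliminated, every member strictly
-- containing it is still in the list and every chosen flat strictly below it is in T, so its
-- exponent b is already final. The hard point is Y^b I(L, G ∷ T) ⊆ I(L,T). For a relation at H,
-- submodularity only yields the b-th power of the sum over K ⊇ H. The surplus variables x_N in Y
-- have N ⊇ G but N ⊉ H, and each of them lowers the exponent at H as x_G would, because overlapping
-- members of 𝒢 have their join in 𝒢. The direct sum is read off the coefficients of an expansion in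
-- powers of x_G + Y. Dually this gives finitely many graded functionals whose common kernel is the
-- ideal, so dimensions are counted without normal forms. In the identities, splitting off K₁ costs
-- one factor 1/(1-x): it is the denominator of x + ... + x^(d-1) = (x - x^d)/(1-x), and c(J,K)
-- stops counting K₁ exactly when J contains it. All intervals are treated inside the lattice of M;
-- minors enter only at the end, through A ↦ A ∪ F.

↭-unique : ∀ {A : Set} {xs ys : List A} → Unique xs → Unique ys →
  (∀ {x} → x ∈ xs → x ∈ ys) → (∀ {x} → x ∈ ys → x ∈ xs) → xs ↭ ys
↭-unique u v f g = ∼bag⇒↭ (unique∧set⇒bag u v (mk⇔ f g))

map-unique : ∀ {A B : Set} {f : A → B} {xs : List A} →
  (∀ {x y} → x ∈ xs → y ∈ xs → f x ≡ f y → x ≡ y) → Unique xs → Unique (map f xs)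
map-unique {xs = []} inj [] = []
map-unique {f = f} {xs = x ∷ xs} inj (p ∷ u) =
  All.map⁺ (All.tabulate λ y∈ eq → All.lookup p y∈ (inj (here refl) (there y∈) eq))
  ∷ map-unique (λ a b → inj (there a) (there b)) u

map-bijection : ∀ {A B : Set} {xs : List A} {ys : List B} (g : B → A) (h : A → B) →
  Unique xs → Unique ys →
  (∀ {y} → y ∈ ys → g y ∈ xs × h (g y) ≡ y) → (∀ {x} → x ∈ xs → h x ∈ ys × g (h x) ≡ x) →
  map g ys ↭ xs
map-bijection g h uxs uys to from = ↭-unique
  (map-unique (λ a b eq → trans (sym (proj₂ (to a))) (trans (cong h eq) (proj₂ (to b)))) uys)
  uxs
  (λ i → let y , y∈ , eq = ∈-map⁻ g i in subst (_∈ _) (sym eq) (proj₁ (to y∈)))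
  (λ i → subst (_∈ _) (proj₂ (from i)) (∈-map⁺ g (proj₁ (from i))))

T-∧⁻ : ∀ {a b} → T (a ∧ b) → T a × T b
T-∧⁻ {true} {true} _ = tt , tt

T-∧⁺ : ∀ {a b} → T a → T b → T (a ∧ b)
T-∧⁺ {true} {true} _ _ = tt

T-not⁻ : ∀ {a} → T (not a) → ¬ T a
T-not⁻ {false} _ ()

T-not⁺ : ∀ {a} → ¬ T a → T (not a)
T-not⁺ {false} _ = tt
T-not⁺ {true} h  = h tt

module _ {n : ℕ} (A B : Subset n) where

  ⊆ᵇ⁺ : A ⊆ B → T (A ⊆ᵇ B)
  ⊆ᵇ⁺ h with A ⊆? B
  ... | yes _ = tt
  ... | no ¬h = ¬h h

  ⊆ᵇ⁻ : T (A ⊆ᵇ B) → A ⊆ B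
  ⊆ᵇ⁻ t with A ⊆? B
  ... | yes h = h

  ≡ᵇ⁺ : A ≡ B → T (A ≡ᵇ B)
  ≡ᵇ⁺ h = fromWitness h

  ≡ᵇ⁻ : T (A ≡ᵇ B) → A ≡ B
  ≡ᵇ⁻ t = toWitness t

module Sums {c ℓ} (R : CommutativeRing c ℓ) where
  open CommutativeRing R renaming (refl to ≈-refl; sym to ≈-sym; trans to ≈-trans; reflexive to ≈-reflexive) hiding (zero)
  open import Relation.Binary.Reasoning.Setoid setoid
  open import Algebra.Solver.Ring.NaturalCoefficients.Default commutativeSemiring using (solve; _:+_; _:=_)

  opaque
    ∑ : ∀ {A : Set} → List A → (A → Carrier) → Carrier
    ∑ xs f = foldr (λ x s → f x + s) 0# xs

    ∑-foldr : ∀ {A : Set} (xs : List A) f → ∑ xs f ≡ foldr (λ x s → f x + s) 0# xs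
    ∑-foldr xs f = refl

    ∑-∷ : ∀ {A : Set} y (ys : List A) f → ∑ (y ∷ ys) f ≈ f y + ∑ ys f
    ∑-∷ y ys f = ≈-refl

  ⟦_⟧ : ∀ {P : Set} → Dec P → Carrier
  ⟦ yes _ ⟧ = 1#
  ⟦ no _ ⟧  = 0#

  ⟦⟧-yes : ∀ {P : Set} (d : Dec P) → P → ⟦ d ⟧ ≈ 1#
  ⟦⟧-yes (yes _) p = ≈-refl
  ⟦⟧-yes (no ¬p) p = contradiction p ¬p

  ⟦⟧-no : ∀ {P : Set} (d : Dec P) → ¬ P → ⟦ d ⟧ ≈ 0#
  ⟦⟧-no (yes p) ¬p = contradiction p ¬p
  ⟦⟧-no (no _) ¬p  = ≈-refl

  ⟦⟧-cong : ∀ {P Q : Set} (d : Dec P) (e : Dec Q) → (P → Q) → (Q → P) → ⟦ d ⟧ ≈ ⟦ e ⟧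
  ⟦⟧-cong (yes p) e f g = ≈-sym (⟦⟧-yes e (f p))
  ⟦⟧-cong (no ¬p) e f g = ≈-sym (⟦⟧-no e (¬p ∘ g))

  module _ {A : Set} where opaque
    unfolding ∑

    ∑-cong : ∀ (xs : List A) {f g} → (∀ {x} → x ∈ xs → f x ≈ g x) → ∑ xs f ≈ ∑ xs g
    ∑-cong [] h       = ≈-refl
    ∑-cong (x ∷ xs) h = +-cong (h (here refl)) (∑-cong xs (h ∘ there))

    ∑-zero : ∀ (xs : List A) {f} → (∀ {x} → x ∈ xs → f x ≈ 0#) → ∑ xs f ≈ 0#
    ∑-zero [] h       = ≈-refl
    ∑-zero (x ∷ xs) h = begin
      _       ≈⟨ +-cong (h (here refl)) (∑-zero xs (h ∘ there)) ⟩
      0# + 0# ≈⟨ +-identityˡ 0# ⟩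
      0#      ∎

    ∑-++ : ∀ (xs ys : List A) {f} → ∑ (xs ++ ys) f ≈ ∑ xs f + ∑ ys f
    ∑-++ [] ys           = ≈-sym (+-identityˡ _)
    ∑-++ (x ∷ xs) ys {f} = begin
      f x + ∑ (xs ++ ys) f      ≈⟨ +-congˡ (∑-++ xs ys) ⟩
      f x + (∑ xs f + ∑ ys f)   ≈⟨ +-assoc _ _ _ ⟨
      f x + ∑ xs f + ∑ ys f     ∎

    ∑-+ : ∀ (xs : List A) f g → ∑ xs (λ x → f x + g x) ≈ ∑ xs f + ∑ xs g
    ∑-+ [] f g       = ≈-sym (+-identityˡ 0#)
    ∑-+ (x ∷ xs) f g = begin
      f x + g x + ∑ xs (λ x → f x + g x)  ≈⟨ +-congˡ (∑-+ xs f g) ⟩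
      f x + g x + (∑ xs f + ∑ xs g)
        ≈⟨ solve 4 (λ a b c d → a :+ b :+ (c :+ d) := a :+ c :+ (b :+ d)) (≈-refl) _ _ _ _ ⟩
      f x + ∑ xs f + (g x + ∑ xs g)       ∎

    ∑-*ˡ : ∀ (xs : List A) a f → a * ∑ xs f ≈ ∑ xs (λ x → a * f x)
    ∑-*ˡ [] a f       = zeroʳ a
    ∑-*ˡ (x ∷ xs) a f = ≈-trans (distribˡ a _ _) (+-congˡ (∑-*ˡ xs a f))

    ∑-*ʳ : ∀ (xs : List A) a f → ∑ xs f * a ≈ ∑ xs (λ x → f x * a)
    ∑-*ʳ [] a f       = zeroˡ a
    ∑-*ʳ (x ∷ xs) a f = ≈-trans (distribʳ a _ _) (+-congˡ (∑-*ʳ xs a f))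

    ∑-filter : ∀ {P : A → Set} (P? : ∀ x → Dec (P x)) (xs : List A) f →
      ∑ (filter P? xs) f ≈ ∑ xs (λ x → ⟦ P? x ⟧ * f x)
    ∑-filter P? [] f = ≈-refl
    ∑-filter P? (x ∷ xs) f with P? x
    ... | yes _ = +-cong (≈-sym (*-identityˡ _)) (∑-filter P? xs f)
    ... | no _  = ≈-trans (∑-filter P? xs f)
                    (≈-trans (≈-sym (+-identityˡ _)) (+-congʳ (≈-sym (zeroˡ _))))

    ∑-↭ : ∀ {xs ys : List A} f → xs ↭ ys → ∑ xs f ≈ ∑ ys f
    ∑-↭ f Perm.refl         = ≈-refl
    ∑-↭ f (Perm.prep x p)   = +-congˡ (∑-↭ f p)
    ∑-↭ f (Perm.swap x y p) = begin
      f x + (f y + _) ≈⟨ +-congˡ (+-congˡ (∑-↭ f p)) ⟩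
      f x + (f y + _) ≈⟨ solve 3 (λ a b c → a :+ (b :+ c) := b :+ (a :+ c)) (≈-refl) _ _ _ ⟩
      f y + (f x + _) ∎
    ∑-↭ f (Perm.trans p q)  = ≈-trans (∑-↭ f p) (∑-↭ f q)

    ∑-single : ∀ {xs : List A} {x} f → Unique xs → x ∈ xs → (∀ {y} → y ∈ xs → y ≢ x → f y ≈ 0#) →
      ∑ xs f ≈ f x
    ∑-single {x ∷ xs} f (p ∷ u) (here refl) h = begin
      f x + ∑ xs f ≈⟨ +-congˡ (∑-zero xs (λ i → h (there i) (λ eq → All.lookup p i (sym eq)))) ⟩
      f x + 0#     ≈⟨ +-identityʳ _ ⟩
      f x          ∎
    ∑-single {z ∷ xs} {x} f (p ∷ u) (there i) h = begin
      f z + ∑ xs f ≈⟨ +-cong (h (here refl) (All.lookup p i)) (∑-single f u i (h ∘ there)) ⟩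
      0# + f x     ≈⟨ +-identityˡ _ ⟩
      f x          ∎

  opaque
    unfolding ∑

    ∑-map : ∀ {A B : Set} (h : A → B) (xs : List A) {f} → ∑ (map h xs) f ≈ ∑ xs (f ∘ h)
    ∑-map h []       = ≈-refl
    ∑-map h (x ∷ xs) = +-congˡ (∑-map h xs)

    ∑-swap : ∀ {A B : Set} (xs : List A) (ys : List B) (f : A → B → Carrier) →
      ∑ xs (λ x → ∑ ys (f x)) ≈ ∑ ys (λ y → ∑ xs (λ x → f x y))
    ∑-swap [] ys f       = ≈-sym (∑-zero ys (λ _ → ≈-refl))
    ∑-swap (x ∷ xs) ys f = ≈-trans (+-congˡ (∑-swap xs ys f)) (≈-sym (∑-+ ys _ _))

  ∑-remove : ∀ {A : Set} {xs : List A} {y} f (_≟_ : ∀ u v → Dec (u ≡ v)) → Unique xs → y ∈ xs →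
    ∑ xs f ≈ f y + ∑ (filter (λ z → ¬? (z ≟ y)) xs) f
  ∑-remove {xs = z ∷ xs} f _≟_ (p ∷ u) (here refl) = ≈-trans (∑-∷ z xs f) (+-congˡ (≈-reflexive (cong (λ l → ∑ l f)
    (sym (trans (List.filter-reject (λ v → ¬? (v ≟ z)) (λ ne → ne refl)) (List.filter-all _ (All.map (λ ne eq → ne (sym eq)) p)))))))
  ∑-remove {xs = z ∷ xs} {y} f _≟_ (p ∷ u) (there i) = begin
    ∑ (z ∷ xs) f                                          ≈⟨ ∑-∷ z xs f ⟩
    f z + ∑ xs f                                          ≈⟨ +-congˡ (∑-remove f _≟_ u i) ⟩
    f z + (f y + ∑ (filter (λ z → ¬? (z ≟ y)) xs) f)      ≈⟨ solve 3 (λ a b c → a :+ (b :+ c) := b :+ (a :+ c)) ≈-refl _ _ _ ⟩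
    f y + (f z + ∑ (filter (λ z → ¬? (z ≟ y)) xs) f)      ≈⟨ +-congˡ (∑-∷ z _ f) ⟨
    f y + ∑ (z ∷ filter (λ z → ¬? (z ≟ y)) xs) f
      ≈⟨ +-congˡ (≈-reflexive (cong (λ l → ∑ l f) (List.filter-accept (λ z → ¬? (z ≟ y)) (All.lookup p i)))) ⟨
    f y + ∑ (filter (λ z → ¬? (z ≟ y)) (z ∷ xs)) f        ∎

  ∑-reindex : ∀ {A B : Set} {xs : List A} {ys : List B} f (g : B → A) (h : A → B) →
    Unique xs → Unique ys →
    (∀ {y} → y ∈ ys → g y ∈ xs × h (g y) ≡ y) → (∀ {x} → x ∈ xs → h x ∈ ys × g (h x) ≡ x) →
    ∑ xs f ≈ ∑ ys (f ∘ g)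
  ∑-reindex {ys = ys} f g h uxs uys to from = ≈-trans
    (≈-sym (∑-↭ f (map-bijection g h uxs uys to from))) (∑-map g ys)

  opaque
    unfolding ∑

    ∑-cartesianProduct : ∀ {A B : Set} (xs : List A) (ys : List B) f →
      ∑ (cartesianProduct xs ys) f ≈ ∑ xs (λ x → ∑ ys (λ y → f (x , y)))
    ∑-cartesianProduct [] ys f       = ≈-refl
    ∑-cartesianProduct (x ∷ xs) ys f = ≈-trans (∑-++ (map (x ,_) ys) _)
      (+-cong (∑-map (x ,_) ys) (∑-cartesianProduct xs ys f))

-- Power series

-- The product by recursion on the left factor, in place of a sum over indices with truncated
-- subtraction. Every ring law becomes an induction on the degree, with the tail `f ∘ suc` as the
-- new left factor.
cauchy : Series → Series → Series
cauchy f g zero    = f 0 ℤ.* g 0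
cauchy f g (suc d) = f 0 ℤ.* g (suc d) ℤ.+ cauchy (f ∘ suc) g d

module _ where
  open import Data.Integer.Tactic.RingSolver using (solve-∀)
  open ≡-Reasoning

  ⊛≡cauchy : ∀ f g d → (f ⊛ g) d ≡ cauchy f g d
  ⊛≡cauchy f g d = trans (cong sumℤ (List.map-upTo (λ i → f i ℤ.* g (d ∸ i)) (suc d))) (go f d)
    where
    go : ∀ f d → sumℤ (List.applyUpTo (λ i → f i ℤ.* g (d ∸ i)) (suc d)) ≡ cauchy f g d
    go f zero    = ℤ.+-identityʳ _
    go f (suc d) = cong (λ u → f 0 ℤ.* g (suc d) ℤ.+ u) (go (f ∘ suc) d)

  infix 4 _≗_
  _≗_ : Series → Series → Set
  f ≗ g = ∀ d → f d ≡ g d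

  infixl 6 _⊕_
  _⊕_ : Series → Series → Series
  (f ⊕ g) d = f d ℤ.+ g d

  zeroS : Series
  zeroS _ = ℤ.0ℤ

  cauchy-cong : ∀ {f f′ g g′} → f ≗ f′ → g ≗ g′ → cauchy f g ≗ cauchy f′ g′
  cauchy-cong p q zero    = cong₂ ℤ._*_ (p 0) (q 0)
  cauchy-cong p q (suc d) = cong₂ ℤ._+_ (cong₂ ℤ._*_ (p 0) (q (suc d))) (cauchy-cong (p ∘ suc) q d)

  cauchy-⊕ : ∀ f g h → cauchy (f ⊕ g) h ≗ cauchy f h ⊕ cauchy g h
  cauchy-⊕ f g h zero    = ℤ.*-distribʳ-+ (h 0) (f 0) (g 0)
  cauchy-⊕ f g h (suc d) = trans (cong (λ u → (f 0 ℤ.+ g 0) ℤ.* h (suc d) ℤ.+ u) (cauchy-⊕ (f ∘ suc) (g ∘ suc) h d))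
    (lem (f 0) (g 0) (h (suc d)) (cauchy (f ∘ suc) h d) (cauchy (g ∘ suc) h d))
    where
    lem : ∀ a b c u v → (a ℤ.+ b) ℤ.* c ℤ.+ (u ℤ.+ v) ≡ (a ℤ.* c ℤ.+ u) ℤ.+ (b ℤ.* c ℤ.+ v)
    lem = solve-∀

  cauchy-scale : ∀ c f g → cauchy (λ d → c ℤ.* f d) g ≗ (λ d → c ℤ.* cauchy f g d)
  cauchy-scale c f g zero    = ℤ.*-assoc c (f 0) (g 0)
  cauchy-scale c f g (suc d) = trans (cong (λ u → c ℤ.* f 0 ℤ.* g (suc d) ℤ.+ u) (cauchy-scale c (f ∘ suc) g d))
    (lem c (f 0) (g (suc d)) (cauchy (f ∘ suc) g d))
    where
    lem : ∀ c a b u → c ℤ.* a ℤ.* b ℤ.+ c ℤ.* u ≡ c ℤ.* (a ℤ.* b ℤ.+ u)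
    lem = solve-∀

  cauchy-zero : ∀ g → cauchy zeroS g ≗ zeroS
  cauchy-zero g zero    = refl
  cauchy-zero g (suc d) = trans (ℤ.+-identityˡ _) (cauchy-zero g d)

  cauchy-identity : ∀ g → cauchy oneS g ≗ g
  cauchy-identity g zero    = ℤ.*-identityˡ (g 0)
  cauchy-identity g (suc d) = trans (cong₂ ℤ._+_ (ℤ.*-identityˡ (g (suc d))) (cauchy-zero g d)) (ℤ.+-identityʳ (g (suc d)))

  -- Splits off the last term instead of the first; commutativity compares this recursion with the
  -- defining one.
  cauchy-sucʳ : ∀ f g d → cauchy f g (suc d) ≡ cauchy f (g ∘ suc) d ℤ.+ f (suc d) ℤ.* g 0
  cauchy-sucʳ f g zero    = refl
  cauchy-sucʳ f g (suc d) = trans (cong (λ u → f 0 ℤ.* g (suc (suc d)) ℤ.+ u) (cauchy-sucʳ (f ∘ suc) g d)) (sym (ℤ.+-assoc (f 0 ℤ.* _) _ _))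

  cauchy-comm : ∀ f g → cauchy f g ≗ cauchy g f
  cauchy-comm f g zero    = ℤ.*-comm (f 0) (g 0)
  cauchy-comm f g (suc d) = begin
    f 0 ℤ.* g (suc d) ℤ.+ cauchy (f ∘ suc) g d   ≡⟨ cong₂ ℤ._+_ (ℤ.*-comm (f 0) _) (cauchy-comm (f ∘ suc) g d) ⟩
    g (suc d) ℤ.* f 0 ℤ.+ cauchy g (f ∘ suc) d   ≡⟨ ℤ.+-comm (g (suc d) ℤ.* f 0) _ ⟩
    cauchy g (f ∘ suc) d ℤ.+ g (suc d) ℤ.* f 0   ≡⟨ cauchy-sucʳ g f d ⟨
    cauchy g f (suc d)                           ∎

  cauchy-assoc : ∀ f g h → cauchy (cauchy f g) h ≗ cauchy f (cauchy g h)
  cauchy-assoc f g h zero    = ℤ.*-assoc (f 0) (g 0) (h 0)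
  cauchy-assoc f g h (suc d) = begin
    f 0 ℤ.* g 0 ℤ.* h (suc d) ℤ.+ cauchy ((λ d → f 0 ℤ.* g (suc d)) ⊕ cauchy (f ∘ suc) g) h d
      ≡⟨ cong (λ u → f 0 ℤ.* g 0 ℤ.* h (suc d) ℤ.+ u) (cauchy-⊕ (λ d → f 0 ℤ.* g (suc d)) (cauchy (f ∘ suc) g) h d) ⟩
    f 0 ℤ.* g 0 ℤ.* h (suc d) ℤ.+ (cauchy (λ d → f 0 ℤ.* g (suc d)) h d ℤ.+ cauchy (cauchy (f ∘ suc) g) h d)
      ≡⟨ cong₂ (λ u v → f 0 ℤ.* g 0 ℤ.* h (suc d) ℤ.+ (u ℤ.+ v)) (cauchy-scale (f 0) (g ∘ suc) h d) (cauchy-assoc (f ∘ suc) g h d) ⟩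
    f 0 ℤ.* g 0 ℤ.* h (suc d) ℤ.+ (f 0 ℤ.* cauchy (g ∘ suc) h d ℤ.+ cauchy (f ∘ suc) (cauchy g h) d)
      ≡⟨ lem (f 0) (g 0) (h (suc d)) (cauchy (g ∘ suc) h d) (cauchy (f ∘ suc) (cauchy g h) d) ⟩
    f 0 ℤ.* (g 0 ℤ.* h (suc d) ℤ.+ cauchy (g ∘ suc) h d) ℤ.+ cauchy (f ∘ suc) (cauchy g h) d ∎
    where
    lem : ∀ a b c u v → a ℤ.* b ℤ.* c ℤ.+ (a ℤ.* u ℤ.+ v) ≡ a ℤ.* (b ℤ.* c ℤ.+ u) ℤ.+ v
    lem = solve-∀

  ⊛-cong : ∀ {f f′ g g′} → f ≗ f′ → g ≗ g′ → f ⊛ g ≗ f′ ⊛ g′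
  ⊛-cong p q d = trans (⊛≡cauchy _ _ d) (trans (cauchy-cong p q d) (sym (⊛≡cauchy _ _ d)))

  ⊛-comm : ∀ f g → f ⊛ g ≗ g ⊛ f
  ⊛-comm f g d = trans (⊛≡cauchy f g d) (trans (cauchy-comm f g d) (sym (⊛≡cauchy g f d)))

  ⊛-assoc : ∀ f g h → (f ⊛ g) ⊛ h ≗ f ⊛ (g ⊛ h)
  ⊛-assoc f g h d = begin
    ((f ⊛ g) ⊛ h) d         ≡⟨ ⊛≡cauchy (f ⊛ g) h d ⟩
    cauchy (f ⊛ g) h d      ≡⟨ cauchy-cong {g = h} (⊛≡cauchy f g) (λ _ → refl) d ⟩
    cauchy (cauchy f g) h d ≡⟨ cauchy-assoc f g h d ⟩
    cauchy f (cauchy g h) d ≡⟨ cauchy-cong {f = f} (λ _ → refl) (⊛≡cauchy g h) d ⟨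
    cauchy f (g ⊛ h) d      ≡⟨ ⊛≡cauchy f (g ⊛ h) d ⟨
    (f ⊛ (g ⊛ h)) d         ∎

  ⊛-identityˡ : ∀ g → oneS ⊛ g ≗ g
  ⊛-identityˡ g d = trans (⊛≡cauchy oneS g d) (cauchy-identity g d)

  ⊛-distribʳ : ∀ h f g → (f ⊕ g) ⊛ h ≗ (f ⊛ h) ⊕ (g ⊛ h)
  ⊛-distribʳ h f g d = trans (⊛≡cauchy (f ⊕ g) h d)
    (trans (cauchy-⊕ f g h d) (sym (cong₂ ℤ._+_ (⊛≡cauchy f h d) (⊛≡cauchy g h d))))

  ≗-isEquivalence : IsEquivalence _≗_
  ≗-isEquivalence = record
    { refl = λ _ → refl ; sym = λ p d → sym (p d) ; trans = λ p q d → trans (p d) (q d) }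

seriesRing : CommutativeRing _ _
seriesRing = record
  { Carrier = Series ; _≈_ = _≗_ ; _+_ = _⊕_ ; _*_ = _⊛_ ; -_ = negS ; 0# = zeroS ; 1# = oneS
  ; isCommutativeRing = record
    { isRing = record
      { +-isAbelianGroup = record
        { isGroup = record
          { isMonoid = record
            { isSemigroup = record
              { isMagma = record
                { isEquivalence = ≗-isEquivalence
                ; ∙-cong = λ p q d → cong₂ ℤ._+_ (p d) (q d) }
              ; assoc = λ f g h d → ℤ.+-assoc (f d) (g d) (h d) }
            ; identity = (λ f d → ℤ.+-identityˡ (f d)) , (λ f d → ℤ.+-identityʳ (f d)) }
          ; inverse = (λ f d → ℤ.+-inverseˡ (f d)) , (λ f d → ℤ.+-inverseʳ (f d))
          ; ⁻¹-cong = λ p d → cong ℤ.-_ (p d) }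
        ; comm = λ f g d → ℤ.+-comm (f d) (g d) }
      ; *-cong = ⊛-cong
      ; *-assoc = ⊛-assoc
      ; *-identity = ⊛-identityˡ , λ g d → trans (⊛-comm g oneS d) (⊛-identityˡ g d)
      ; distrib = (λ f g h d → trans (⊛-comm f (g ⊕ h) d)
            (trans (⊛-distribʳ f g h d) (cong₂ ℤ._+_ (⊛-comm g f d) (⊛-comm h f d))))
          , ⊛-distribʳ }
    ; *-comm = ⊛-comm } }

xS : Series
xS zero          = ℤ.0ℤ
xS (suc zero)    = ℤ.1ℤ
xS (suc (suc _)) = ℤ.0ℤ

-- This is 1/(1 - x), so that negative powers of 1 - x become ordinary powers of a series.
geometric : Series
geometric _ = ℤ.1ℤ

xS⊛-zero : ∀ f → (xS ⊛ f) 0 ≡ ℤ.0ℤ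
xS⊛-zero f = refl

xS⊛-suc : ∀ f d → (xS ⊛ f) (suc d) ≡ f d
xS⊛-suc f d = trans (⊛≡cauchy xS f (suc d)) (trans (ℤ.+-identityˡ _)
  (trans (cauchy-cong {xS ∘ suc} {oneS} {f} (λ { zero → refl ; (suc _) → refl }) (λ _ → refl) d) (cauchy-identity f d)))

-- The equation a = 1 + x a is all that the combinatorial identities use about a = 1/(1 - x); they
-- are proved over any commutative ring with such a pair x, a.
geometric-unfold : ∀ d → geometric d ≡ oneS d ℤ.+ (xS ⊛ geometric) d
geometric-unfold zero    = refl
geometric-unfold (suc d) = sym (trans (ℤ.+-identityˡ _) (xS⊛-suc geometric d))

oneMinusX⊛geometric : ∀ d → (oneMinusX ⊛ geometric) d ≡ oneS d
oneMinusX⊛geometric d = trans (⊛≡cauchy oneMinusX geometric d) (go d)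
  where
  go : ∀ d → cauchy oneMinusX geometric d ≡ oneS d
  go zero          = refl
  go (suc zero)    = refl
  go (suc (suc d)) = cong (λ u → ℤ.1ℤ ℤ.+ (ℤ.-1ℤ ℤ.+ u)) (cauchy-zero geometric d)

-- Polynomials

module ℚ∑ = Sums ℚ.+-*-commutativeRing

module _ {k : ℕ} where
  open ℚ∑ using (∑; ∑-cong; ∑-zero; ∑-++; ∑-+; ∑-*ˡ; ∑-map; ∑-single; ⟦_⟧; ⟦⟧-no; ⟦⟧-yes)

  infixl 7 _∙_
  _∙_ : Monomial k → Monomial k → Monomial k
  _∙_ = Vec.zipWith ℕ._+_

  _≟ᵐ_ : (m m′ : Monomial k) → Dec (m ≡ m′)
  _≟ᵐ_ = Vec.≡-dec ℕ._≟_

  opaque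
    -- The linear functional on polynomials that takes the value `φ m` at the monomial `m`.
    eval : (Monomial k → ℚ) → Poly k → ℚ
    eval φ p = ∑ p (λ t → proj₁ t ℚ.* φ (proj₂ t))

  opaque
    unfolding ∑ eval

    eval-[] : ∀ φ → eval φ [] ≡ 0ℚ
    eval-[] φ = refl

    eval-∷ : ∀ φ c m p → eval φ ((c , m) ∷ p) ≡ c ℚ.* φ m ℚ.+ eval φ p
    eval-∷ φ c m p = refl


  opaque
    unfolding eval

    eval-cong : ∀ {φ ψ} p → (∀ m → φ m ≡ ψ m) → eval φ p ≡ eval ψ p
    eval-cong p h = ∑-cong p (λ {t} _ → cong (proj₁ t ℚ.*_) (h (proj₂ t)))

    eval-++ : ∀ φ p q → eval φ (p ++ q) ≡ eval φ p ℚ.+ eval φ q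
    eval-++ φ p q = ∑-++ p q

    eval-·P : ∀ φ c p → eval φ (c ·P p) ≡ c ℚ.* eval φ p
    eval-·P φ c p = trans (∑-map _ p) (trans (∑-cong p (λ {t} _ → ℚ.*-assoc c (proj₁ t) _)) (sym (∑-*ˡ p c _)))

    eval-scale : ∀ φ c p → eval (λ m → c ℚ.* φ m) p ≡ c ℚ.* eval φ p
    eval-scale φ c p = trans (∑-cong p (λ {t} _ → trans (sym (ℚ.*-assoc (proj₁ t) c _))
      (trans (cong (ℚ._* φ (proj₂ t)) (ℚ.*-comm (proj₁ t) c)) (ℚ.*-assoc c (proj₁ t) _)))) (sym (∑-*ˡ p c _))

    eval-+ : ∀ φ ψ p → eval (λ m → φ m ℚ.+ ψ m) p ≡ eval φ p ℚ.+ eval ψ p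
    eval-+ φ ψ p = trans (∑-cong p (λ {t} _ → ℚ.*-distribˡ-+ (proj₁ t) _ _)) (∑-+ p _ _)

    eval-0 : ∀ {φ} p → (∀ m → φ m ≡ 0ℚ) → eval φ p ≡ 0ℚ
    eval-0 p h = ∑-zero p (λ {t} _ → trans (cong (proj₁ t ℚ.*_) (h (proj₂ t))) (ℚ.*-zeroʳ (proj₁ t)))

  opaque
    unfolding eval

    eval-*P : ∀ φ p q → eval φ (p *P q) ≡ eval (λ m → eval (λ m′ → φ (m ∙ m′)) q) p
    eval-*P φ [] q            = trans (eval-[] φ) (sym (eval-[] (λ m → eval (λ m′ → φ (m ∙ m′)) q)))
    eval-*P φ ((c , m) ∷ p) q = trans (eval-++ φ (map _ q) (p *P q)) (trans (cong₂ ℚ._+_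
      (trans (∑-map _ q) (trans (∑-cong q (λ {t} _ → ℚ.*-assoc c (proj₁ t) _)) (sym (∑-*ˡ q c _))))
      (eval-*P φ p q)) (sym (eval-∷ _ c m p)))

  eval-mono : ∀ φ m → eval φ ((1ℚ , m) ∷ []) ≡ φ m
  eval-mono φ m = trans (eval-∷ φ 1ℚ m []) (trans (cong₂ ℚ._+_ (ℚ.*-identityˡ (φ m)) (eval-[] φ)) (ℚ.+-identityʳ (φ m)))

  -- Equality of polynomials tested by all linear functionals, a form of _≈P_ that makes the ring laws immediate.
  infix 4 _≋_
  record _≋_ (p q : Poly k) : Set where
    constructor ≋-by
    field on : ∀ φ → eval φ p ≡ eval φ q
  open _≋_ public

  coeff-∷ : ∀ c m p m′ → coeff ((c , m) ∷ p) m′ ≡ ⟦ m ≟ᵐ m′ ⟧ ℚ.* c ℚ.+ coeff p m′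
  coeff-∷ c m p m′ with m ≟ᵐ m′
  ... | yes _ = cong (ℚ._+ coeff p m′) (sym (ℚ.*-identityˡ c))
  ... | no _  = sym (trans (cong (ℚ._+ coeff p m′) (ℚ.*-zeroˡ c)) (ℚ.+-identityˡ (coeff p m′)))

  -- A polynomial is a list in which monomials may repeat. Collecting its terms over a
  -- duplicate-free list of monomials shows that the coefficients determine the value of every
  -- functional.
  eval-by-coeff : ∀ φ p ms → Unique ms → (∀ {t} → t ∈ p → proj₂ t ∈ ms) →
    eval φ p ≡ ∑ ms (λ m → coeff p m ℚ.* φ m)
  eval-by-coeff φ [] ms u h = trans (eval-[] φ) (sym (∑-zero ms (λ {m} _ → ℚ.*-zeroˡ (φ m))))
  eval-by-coeff φ ((c , m) ∷ p) ms u h = sym (begin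
    ∑ ms (λ m′ → coeff ((c , m) ∷ p) m′ ℚ.* φ m′)
      ≡⟨ ∑-cong ms (λ {m′} _ → trans (cong (ℚ._* φ m′) (coeff-∷ c m p m′)) (ℚ.*-distribʳ-+ (φ m′) (⟦ m ≟ᵐ m′ ⟧ ℚ.* c) (coeff p m′))) ⟩
    ∑ ms (λ m′ → ⟦ m ≟ᵐ m′ ⟧ ℚ.* c ℚ.* φ m′ ℚ.+ coeff p m′ ℚ.* φ m′)
      ≡⟨ ∑-+ ms _ _ ⟩
    ∑ ms (λ m′ → ⟦ m ≟ᵐ m′ ⟧ ℚ.* c ℚ.* φ m′) ℚ.+ ∑ ms (λ m′ → coeff p m′ ℚ.* φ m′)
      ≡⟨ cong₂ ℚ._+_ (trans (∑-single _ u (h (here refl)) (λ {m′} _ ne → trans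
             (cong (λ z → z ℚ.* c ℚ.* φ m′) (⟦⟧-no (m ≟ᵐ m′) (ne ∘ sym)))
             (trans (cong (ℚ._* φ m′) (ℚ.*-zeroˡ c)) (ℚ.*-zeroˡ (φ m′)))))
           (cong (ℚ._* φ m) (trans (cong (ℚ._* c) (⟦⟧-yes (m ≟ᵐ m) refl)) (ℚ.*-identityˡ c))))
         (sym (eval-by-coeff φ p ms u (h ∘ there))) ⟩
    c ℚ.* φ m ℚ.+ eval φ p
      ≡⟨ eval-∷ φ c m p ⟨
    eval φ ((c , m) ∷ p) ∎)
    where open ≡-Reasoning

  support : Poly k → List (Monomial k)
  support p = List.deduplicate _≟ᵐ_ (map proj₂ p)

  eval-support : ∀ φ p q → eval φ p ≡ ∑ (support (p ++ q)) (λ m → coeff p m ℚ.* φ m)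
  eval-support φ p q = eval-by-coeff φ p _ (deduplicate-! _≟ᵐ_ (map proj₂ (p ++ q)))
    (λ i → ∈-deduplicate⁺ _≟ᵐ_ (∈-map⁺ proj₂ (∈-++⁺ˡ i)))

  eval-supportʳ : ∀ φ p q → eval φ q ≡ ∑ (support (p ++ q)) (λ m → coeff q m ℚ.* φ m)
  eval-supportʳ φ p q = eval-by-coeff φ q _ (deduplicate-! _≟ᵐ_ (map proj₂ (p ++ q)))
    (λ i → ∈-deduplicate⁺ _≟ᵐ_ (∈-map⁺ proj₂ (∈-++⁺ʳ p i)))

  ≈P⇒≋ : ∀ {p q} → p ≈P q → p ≋ q
  ≈P⇒≋ {p} {q} h .on φ = trans (eval-support φ p q)
    (trans (∑-cong (support (p ++ q)) (λ {m} _ → cong (ℚ._* φ m) (h m))) (sym (eval-supportʳ φ p q)))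

  coeff≡eval : ∀ p m′ → coeff p m′ ≡ eval (λ m → ⟦ m ≟ᵐ m′ ⟧) p
  coeff≡eval [] m′            = sym (eval-[] _)
  coeff≡eval ((c , m) ∷ p) m′ = trans (coeff-∷ c m p m′) (trans (cong₂ ℚ._+_ (ℚ.*-comm ⟦ m ≟ᵐ m′ ⟧ c) (coeff≡eval p m′)) (sym (eval-∷ _ c m p)))

  ≋⇒≈P : ∀ {p q} → p ≋ q → p ≈P q
  ≋⇒≈P {p} {q} h m = trans (coeff≡eval p m) (trans (h .on _) (sym (coeff≡eval q m)))

  eval-homogeneous : ∀ {φ d e p} → (∀ m → degree m ≢ e → φ m ≡ 0ℚ) → Homogeneous d p → d ≢ e → eval φ p ≡ 0ℚ
  eval-homogeneous {φ} {d} {e} {p} hφ hp d≢e = trans (eval-support φ p []) (∑-zero (support (p ++ [])) vanish)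
    where
    vanish : ∀ {m} → m ∈ support (p ++ []) → coeff p m ℚ.* φ m ≡ 0ℚ
    vanish {m} _ with coeff p m ℚ.≟ 0ℚ
    ... | yes eq = trans (cong (ℚ._* φ m) eq) (ℚ.*-zeroˡ (φ m))
    ... | no ne  = trans (cong (coeff p m ℚ.*_) (hφ m (λ eq → d≢e (trans (sym (hp m ne)) eq)))) (ℚ.*-zeroʳ (coeff p m))

  -- A condition on the listed terms, including those that cancel; it passes to sums and products
  -- without computing any coefficient.
  AllDegree : ℕ → Poly k → Set
  AllDegree d = All (λ t → degree (proj₂ t) ≡ d)

  AllDegree⇒Homogeneous : ∀ {d p} → AllDegree d p → Homogeneous d p
  AllDegree⇒Homogeneous {d} {p} h m ne with degree m ℕ.≟ d
  ... | yes eq = eq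
  ... | no nd  = contradiction (cong (λ l → foldr ℚ._+_ 0ℚ (map proj₁ l))
                   (List.filter-none (λ t → proj₂ t ≟ᵐ m) (All.map (λ e eq → nd (trans (cong degree (sym eq)) e)) h))) ne

  ∙-assoc : ∀ a b c → (a ∙ b) ∙ c ≡ a ∙ (b ∙ c)
  ∙-assoc = Vec.zipWith-assoc ℕ.+-assoc

  ∙-comm : ∀ a b → a ∙ b ≡ b ∙ a
  ∙-comm = Vec.zipWith-comm ℕ.+-comm

  ∙-identityˡ : ∀ a → Vec.replicate k 0 ∙ a ≡ a
  ∙-identityˡ = Vec.zipWith-identityˡ ℕ.+-identityˡ

module _ where
  open ℚ∑ using (∑-cong; ∑-*ˡ; ∑-swap)

  opaque
    unfolding eval

    eval-swap : ∀ {k l} (φ : Monomial k → Monomial l → ℚ) p q →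
      eval (λ m → eval (φ m) q) p ≡ eval (λ m′ → eval (λ m → φ m m′) p) q
    eval-swap φ p q = trans (∑-cong p (λ {s} _ → ∑-*ˡ q (proj₁ s) _))
      (trans (∑-swap p q _) (∑-cong q (λ {t} _ → trans (∑-cong p (λ {s} _ → lem (proj₁ s) (proj₁ t) _)) (sym (∑-*ˡ p (proj₁ t) _)))))
      where
      lem : ∀ a b c → a ℚ.* (b ℚ.* c) ≡ b ℚ.* (a ℚ.* c)
      lem a b c = trans (sym (ℚ.*-assoc a b c)) (trans (cong (ℚ._* c) (ℚ.*-comm a b)) (ℚ.*-assoc b a c))

module _ {k : ℕ} where

  private
    *P-cong : ∀ {p p′ q q′ : Poly k} → p ≋ p′ → q ≋ q′ → p *P q ≋ p′ *P q′
    *P-cong {p} {p′} {q} {q′} h g .on φ = trans (eval-*P φ p q)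
      (trans (h .on _) (trans (eval-cong p′ (λ m → g .on _)) (sym (eval-*P φ p′ q′))))

    *P-assoc : ∀ (p q r : Poly k) → (p *P q) *P r ≋ p *P (q *P r)
    *P-assoc p q r .on φ = trans (eval-*P φ (p *P q) r) (trans (eval-*P _ p q) (sym (trans (eval-*P φ p (q *P r))
      (eval-cong p (λ m → trans (eval-*P _ q r) (eval-cong q (λ m′ → eval-cong r (λ m″ → cong φ (sym (∙-assoc m m′ m″))))))))))

    *P-comm : ∀ (p q : Poly k) → p *P q ≋ q *P p
    *P-comm p q .on φ = trans (eval-*P φ p q) (trans (eval-swap _ p q)
      (trans (eval-cong q (λ m → eval-cong p (λ m′ → cong φ (∙-comm m′ m)))) (sym (eval-*P φ q p))))

    *P-identityˡ : ∀ (p : Poly k) → 1P *P p ≋ p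
    *P-identityˡ p .on φ = trans (eval-*P φ 1P p) (trans (eval-mono _ _)
      (eval-cong p (λ m → cong φ (∙-identityˡ m))))

    *P-distribʳ : ∀ (r p q : Poly k) → (p ++ q) *P r ≋ (p *P r) ++ (q *P r)
    *P-distribʳ r p q .on φ = trans (eval-*P φ (p ++ q) r) (trans (eval-++ _ p q)
      (sym (trans (eval-++ φ (p *P r) (q *P r)) (cong₂ ℚ._+_ (eval-*P φ p r) (eval-*P φ q r)))))

    ++-cong : ∀ {p p′ q q′ : Poly k} → p ≋ p′ → q ≋ q′ → p ++ q ≋ p′ ++ q′
    ++-cong {p} {p′} {q} {q′} h g .on φ = trans (eval-++ φ p q) (trans (cong₂ ℚ._+_ (h .on φ) (g .on φ)) (sym (eval-++ φ p′ q′)))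

    ++-comm : ∀ (p q : Poly k) → p ++ q ≋ q ++ p
    ++-comm p q .on φ = trans (eval-++ φ p q) (trans (ℚ.+-comm (eval φ p) (eval φ q)) (sym (eval-++ φ q p)))

    -P-inverseˡ : ∀ (p : Poly k) → (-P p) ++ p ≋ []
    -P-inverseˡ p .on φ = trans (eval-++ φ (-P p) p) (trans (cong (ℚ._+ eval φ p) (eval-·P φ (ℚ.- 1ℚ) p))
      (trans (cong₂ ℚ._+_ (sym (ℚ.neg-distribˡ-* 1ℚ (eval φ p))) (sym (ℚ.*-identityˡ (eval φ p)))) (trans (ℚ.+-inverseˡ (1ℚ ℚ.* eval φ p)) (sym (eval-[] φ)))))

    -P-cong : ∀ {p q : Poly k} → p ≋ q → -P p ≋ -P q
    -P-cong {p} {q} h .on φ = trans (eval-·P φ (ℚ.- 1ℚ) p) (trans (cong (ℚ.- 1ℚ ℚ.*_) (h .on φ)) (sym (eval-·P φ (ℚ.- 1ℚ) q)))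

    ≋-isEquivalence : IsEquivalence (_≋_ {k})
    ≋-isEquivalence = record
      { refl = ≋-by λ _ → refl ; sym = λ h → ≋-by λ φ → sym (h .on φ) ; trans = λ h g → ≋-by λ φ → trans (h .on φ) (g .on φ) }

    trans-≋ : ∀ {p q r : Poly k} → p ≋ q → q ≋ r → p ≋ r
    trans-≋ h g = ≋-by λ φ → trans (h .on φ) (g .on φ)

  infixl 6 _+ᵖ_
  infixl 7 _*ᵖ_
  infix 8 -ᵖ_

  -- Opaque copies of the operations, so that unification treats them as injective.
  opaque
    _+ᵖ_ _*ᵖ_ : Poly k → Poly k → Poly k
    _+ᵖ_ = _+P_
    _*ᵖ_ = _*P_

    -ᵖ_ : Poly k → Poly k
    -ᵖ_ = -P_

    +ᵖ≡+P : ∀ p q → p +ᵖ q ≡ p +P q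
    +ᵖ≡+P p q = refl

    *ᵖ≡*P : ∀ p q → p *ᵖ q ≡ p *P q
    *ᵖ≡*P p q = refl

    -ᵖ≡-P : ∀ p → -ᵖ p ≡ -P p
    -ᵖ≡-P p = refl

    eval-+ᵖ : ∀ φ p q → eval φ (p +ᵖ q) ≡ eval φ p ℚ.+ eval φ q
    eval-+ᵖ = eval-++

    eval-*ᵖ : ∀ φ p q → eval φ (p *ᵖ q) ≡ eval (λ m → eval (λ m′ → φ (m ∙ m′)) q) p
    eval-*ᵖ = eval-*P

    polyRing-isCommutativeRing : IsCommutativeRing (_≋_ {k}) _+ᵖ_ _*ᵖ_ -ᵖ_ 0P 1P
    polyRing-isCommutativeRing = record
      { isRing = record
        { +-isAbelianGroup = record
          { isGroup = record
            { isMonoid = record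
              { isSemigroup = record
                { isMagma = record { isEquivalence = ≋-isEquivalence ; ∙-cong = ++-cong }
                ; assoc = λ p q r → ≋-by λ φ → cong (eval φ) (List.++-assoc p q r) }
              ; identity = (λ p → ≋-by λ φ → refl) , (λ p → ≋-by λ φ → cong (eval φ) (List.++-identityʳ p)) }
            ; inverse = -P-inverseˡ , λ p → trans-≋ (++-comm p (-P p)) (-P-inverseˡ p)
            ; ⁻¹-cong = -P-cong }
          ; comm = ++-comm }
        ; *-cong = *P-cong
        ; *-assoc = *P-assoc
        ; *-identity = *P-identityˡ , λ p → trans-≋ (*P-comm p 1P) (*P-identityˡ p)
        ; distrib = (λ r p q → trans-≋ (*P-comm r (p ++ q)) (trans-≋ (*P-distribʳ r p q) (++-cong (*P-comm p r) (*P-comm q r))))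
            , *P-distribʳ }
      ; *-comm = *P-comm }

  polyRing : CommutativeRing _ _
  polyRing = record { isCommutativeRing = polyRing-isCommutativeRing }

  infixr 8 _^ᵖ_
  _^ᵖ_ : Poly k → ℕ → Poly k
  p ^ᵖ zero  = 1P
  p ^ᵖ suc a = p *ᵖ (p ^ᵖ a)

-- ℚ[x₀,…,x_k] as a polynomial ring in x₀ over ℚ[x₁,…,x_k].
module _ {k : ℕ} where

  ι : Poly k → Poly (suc k)
  ι = map (λ t → proj₁ t , 0 ∷ proj₂ t)

  x₀ : Poly (suc k)
  x₀ = (1ℚ , 1 ∷ Vec.replicate k 0) ∷ []

  monomial : Monomial k → Poly k
  monomial m = (1ℚ , m) ∷ []

  eval-ι : ∀ φ p → eval φ (ι p) ≡ eval (φ ∘ (0 ∷_)) p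
  eval-ι φ []            = trans (eval-[] φ) (sym (eval-[] _))
  eval-ι φ ((c , m) ∷ p) = trans (eval-∷ φ c (0 ∷ m) (ι p))
    (trans (cong (c ℚ.* φ (0 ∷ m) ℚ.+_) (eval-ι φ p)) (sym (eval-∷ _ c m p)))

  eval-mono* : ∀ φ (m : Monomial k) p → eval φ (monomial m *ᵖ p) ≡ eval (λ m′ → φ (m ∙ m′)) p
  eval-mono* φ m p = trans (eval-*ᵖ φ (monomial m) p) (eval-mono _ m)

  eval-x₀* : ∀ φ p → eval φ (x₀ *ᵖ p) ≡ eval (λ m → φ ((1 ∷ Vec.replicate k 0) ∙ m)) p
  eval-x₀* φ p = trans (eval-*ᵖ φ x₀ p) (eval-mono _ _)

  ι-cong : ∀ {p q} → p ≋ q → ι p ≋ ι q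
  ι-cong {p} {q} h .on φ = trans (eval-ι φ p) (trans (h .on _) (sym (eval-ι φ q)))

  ι-++ : ∀ p q → ι (p +ᵖ q) ≡ ι p +ᵖ ι q
  ι-++ p q = trans (cong ι (+ᵖ≡+P p q)) (trans (List.map-++ _ p q) (sym (+ᵖ≡+P (ι p) (ι q))))

  ι-* : ∀ p q → ι (p *ᵖ q) ≋ ι p *ᵖ ι q
  ι-* p q .on φ = trans (eval-ι φ (p *ᵖ q)) (trans (eval-*ᵖ _ p q)
    (sym (trans (eval-*ᵖ φ (ι p) (ι q)) (trans (eval-ι _ p) (eval-cong p (λ m → eval-ι _ q))))))

  term≋ : ∀ c m (β : Monomial k) → (c , suc m ∷ β) ∷ [] ≋ x₀ *ᵖ ((c , m ∷ β) ∷ [])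
  term≋ c m β .on φ = trans (eval-∷ φ c _ []) (sym (trans (eval-x₀* φ _) (trans (eval-∷ _ c _ [])
    (cong₂ (λ a b → c ℚ.* φ (suc m ∷ a) ℚ.+ b) (∙-identityˡ β) (trans (eval-[] _) (sym (eval-[] φ)))))))

  poly-induction : (Q : Poly (suc k) → Set) → (∀ {p q} → p ≋ q → Q p → Q q) →
    (∀ {p q} → Q p → Q q → Q (p +ᵖ q)) → (∀ a → Q (ι a)) → (∀ {p} → Q p → Q (x₀ *ᵖ p)) → ∀ p → Q p
  poly-induction Q resp add const shift = go
    where
    term : ∀ c m β → Q ((c , m ∷ β) ∷ [])
    term c zero β    = const ((c , β) ∷ [])
    term c (suc m) β = resp (CommutativeRing.sym polyRing (term≋ c m β)) (shift (term c m β))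
    go : ∀ p → Q p
    go []                = const []
    go ((c , m ∷ β) ∷ p) = subst Q (+ᵖ≡+P ((c , m ∷ β) ∷ []) p) (add (term c m β) (go p))

  -- q Y i p is the i-th coefficient of p expanded in powers of x₀ + Y.
  module Taylor (Y : Poly k) where
    open CommutativeRing (polyRing {k}) using () renaming (refl to ≋-refl; sym to ≋-sym; trans to ≋-trans; *-cong to *≋; +-cong to +≋)
    import Algebra.Solver.Ring.NaturalCoefficients.Default
    module N = Algebra.Solver.Ring.NaturalCoefficients.Default (CommutativeRing.commutativeSemiring (polyRing {k}))

    -- The coefficient of (x₀ + Y)^i in x₀^m, that is binom(m,i) (-Y)^(m-i). The recursion
    -- multiplies by x₀ = (x₀ + Y) - Y.
    τ : ℕ → ℕ → Poly k
    τ zero zero       = 1P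
    τ (suc i) zero    = 0P
    τ zero (suc m)    = (-ᵖ Y) *ᵖ τ zero m
    τ (suc i) (suc m) = τ i m +ᵖ ((-ᵖ Y) *ᵖ τ (suc i) m)

    q : ℕ → Poly (suc k) → Poly k
    q i []                = []
    q i ((c , m ∷ β) ∷ p) = (((c , β) ∷ []) *ᵖ τ i m) +ᵖ q i p

    infix 8 _▹_
    -- The transpose of `q i`: the functional `φ` pulled back along the i-th Taylor coefficient.
    _▹_ : (Monomial k → ℚ) → ℕ → Monomial (suc k) → ℚ
    (φ ▹ i) (m ∷ β) = eval φ (monomial β *ᵖ τ i m)

    eval-q : ∀ φ i p → eval φ (q i p) ≡ eval (φ ▹ i) p
    eval-q φ i []                = trans (eval-[] φ) (sym (eval-[] _))
    eval-q φ i ((c , m ∷ β) ∷ p) = trans (eval-+ᵖ φ (((c , β) ∷ []) *ᵖ τ i m) (q i p))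
      (trans (cong₂ ℚ._+_ scaled (eval-q φ i p)) (sym (eval-∷ (φ ▹ i) c _ p)))
      where
      scaled : eval φ (((c , β) ∷ []) *ᵖ τ i m) ≡ c ℚ.* eval φ (monomial β *ᵖ τ i m)
      scaled = trans (eval-*ᵖ φ ((c , β) ∷ []) (τ i m)) (trans (eval-∷ _ c β []) (trans (cong₂ ℚ._+_
        (cong (c ℚ.*_) (sym (eval-mono* φ β (τ i m)))) (eval-[] _)) (ℚ.+-identityʳ (c ℚ.* eval φ (monomial β *ᵖ τ i m)))))

    q-cong : ∀ i {p p′} → p ≋ p′ → q i p ≋ q i p′
    q-cong i {p} {p′} h .on φ = trans (eval-q φ i p) (trans (h .on _) (sym (eval-q φ i p′)))

    q-++ : ∀ i p p′ → q i (p +ᵖ p′) ≋ q i p +ᵖ q i p′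
    q-++ i p p′ .on φ = trans (eval-q φ i (p +ᵖ p′)) (trans (eval-+ᵖ _ p p′)
      (sym (trans (eval-+ᵖ φ (q i p) (q i p′)) (cong₂ ℚ._+_ (eval-q φ i p) (eval-q φ i p′)))))

    q-ι* : ∀ i a p → q i (ι a *ᵖ p) ≋ a *ᵖ q i p
    q-ι* i a p .on φ = trans (eval-q φ i (ι a *ᵖ p)) (trans (eval-*ᵖ (φ ▹ i) (ι a) p) (trans (eval-ι _ a)
      (sym (trans (eval-*ᵖ φ a (q i p)) (eval-cong a (λ m₁ → trans (eval-q _ i p) (eval-cong p (λ { (m ∷ β) → lem m₁ m β }))))))))
      where
      lem : ∀ m₁ m β → eval (λ m′ → φ (m₁ ∙ m′)) (monomial β *ᵖ τ i m) ≡ eval φ (monomial (m₁ ∙ β) *ᵖ τ i m)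
      lem m₁ m β = trans (eval-mono* _ β (τ i m)) (sym (trans (eval-mono* φ (m₁ ∙ β) (τ i m))
        (eval-cong (τ i m) (λ m″ → cong φ (∙-assoc m₁ β m″)))))

    q-ι : ∀ i a → q i (ι a) ≋ a *ᵖ τ i 0
    q-ι i a .on φ = trans (eval-q φ i (ι a)) (trans (eval-ι _ a) (sym (trans (eval-*ᵖ φ a (τ i 0))
      (eval-cong a (λ m → sym (eval-mono* φ m (τ i 0)))))))

    private
      shifted : ∀ φ i p → eval φ (q i (x₀ *ᵖ p)) ≡ eval (λ m → eval φ (monomial (Vec.tail m) *ᵖ τ i (suc (Vec.head m)))) p
      shifted φ i p = trans (eval-q φ i (x₀ *ᵖ p)) (trans (eval-x₀* _ p)
        (eval-cong p (λ { (m ∷ β) → cong (λ v → eval φ (monomial v *ᵖ τ i (suc m))) (∙-identityˡ β) })))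

      scaled : ∀ φ i (a : Poly k) p → eval φ (a *ᵖ q i p) ≡ eval (λ m → eval φ (monomial (Vec.tail m) *ᵖ (a *ᵖ τ i (Vec.head m)))) p
      scaled φ i a p = trans (eval-*ᵖ φ a (q i p)) (trans (eval-cong a (λ m₁ → eval-q _ i p)) (trans (eval-swap _ a p)
        (eval-cong p (λ { (m ∷ β) → trans (sym (eval-*ᵖ φ a (monomial β *ᵖ τ i m)))
          (N.solve 3 (λ a b c → a N.:* (b N.:* c) N.:= b N.:* (a N.:* c)) ≋-refl a (monomial β) (τ i m) .on φ) }))))

    q-x₀*-zero : ∀ p → q 0 (x₀ *ᵖ p) ≋ (-ᵖ Y) *ᵖ q 0 p
    q-x₀*-zero p .on φ = trans (shifted φ 0 p) (trans (eval-cong p (λ _ → refl)) (sym (scaled φ 0 (-ᵖ Y) p)))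

    q-x₀*-suc : ∀ i p → q (suc i) (x₀ *ᵖ p) ≋ q i p +ᵖ ((-ᵖ Y) *ᵖ q (suc i) p)
    q-x₀*-suc i p .on φ = trans (shifted φ (suc i) p) (trans (eval-cong p (λ { (m ∷ β) →
        trans (CommutativeRing.distribˡ polyRing (monomial β) (τ i m) ((-ᵖ Y) *ᵖ τ (suc i) m) .on φ)
              (eval-+ᵖ φ (monomial β *ᵖ τ i m) (monomial β *ᵖ ((-ᵖ Y) *ᵖ τ (suc i) m))) }))
      (trans (eval-+ (φ ▹ i) ψ p) (sym (trans (eval-+ᵖ φ (q i p) _) (cong₂ ℚ._+_ (eval-q φ i p) (scaled φ (suc i) (-ᵖ Y) p))))))
      where
      ψ : Monomial (suc k) → ℚ
      ψ m = eval φ (monomial (Vec.tail m) *ᵖ ((-ᵖ Y) *ᵖ τ (suc i) (Vec.head m)))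

    u : Poly (suc k)
    u = x₀ +ᵖ ι Y

    q-u*-zero : ∀ p → q 0 (u *ᵖ p) ≋ 0P
    q-u*-zero p = ≋-trans (q-cong 0 (CommutativeRing.distribʳ polyRing p x₀ (ι Y)))
      (≋-trans (q-++ 0 (x₀ *ᵖ p) (ι Y *ᵖ p)) (≋-trans (+≋ (q-x₀*-zero p) (q-ι* 0 Y p))
      (≋-trans (≋-sym (CommutativeRing.distribʳ polyRing (q 0 p) (-ᵖ Y) Y))
      (≋-trans (*≋ (CommutativeRing.-‿inverseˡ polyRing Y) ≋-refl) (CommutativeRing.zeroˡ polyRing (q 0 p))))))

    q-u*-suc : ∀ i p → q (suc i) (u *ᵖ p) ≋ q i p
    q-u*-suc i p = ≋-trans (q-cong (suc i) (CommutativeRing.distribʳ polyRing p x₀ (ι Y)))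
      (≋-trans (q-++ (suc i) (x₀ *ᵖ p) (ι Y *ᵖ p)) (≋-trans (+≋ (q-x₀*-suc i p) (q-ι* (suc i) Y p))
      (≋-trans (CommutativeRing.+-assoc polyRing (q i p) _ _) (≋-trans (+≋ (≋-refl {q i p})
      (≋-trans (≋-sym (CommutativeRing.distribʳ polyRing (q (suc i) p) (-ᵖ Y) Y))
      (≋-trans (*≋ (CommutativeRing.-‿inverseˡ polyRing Y) ≋-refl) (CommutativeRing.zeroˡ polyRing (q (suc i) p)))))
      (CommutativeRing.+-identityʳ polyRing (q i p))))))

    -- tay₀ is tay at x₀ = 0, where u becomes Y.
    tay : ℕ → Poly (suc k) → Poly (suc k)
    tay zero p    = 0P
    tay (suc c) p = tay c p +ᵖ (ι (q c p) *ᵖ (u ^ᵖ c))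

    tay₀ : ℕ → Poly (suc k) → Poly k
    tay₀ zero p    = 0P
    tay₀ (suc c) p = tay₀ c p +ᵖ (q c p *ᵖ (Y ^ᵖ c))

-- Ideals

record IsIdeal {k : ℕ} (I : Poly k → Set) : Set where
  field
    zero∈ : I 0P
    +∈    : ∀ {p q} → I p → I q → I (p +ᵖ q)
    *∈    : ∀ r {p} → I p → I (r *ᵖ p)
    resp  : ∀ {p q} → p ≋ q → I p → I q

data ⟨_⟩ {k : ℕ} (R : Poly k → Set) : Poly k → Set where
  gen   : ∀ {p} → R p → ⟨ R ⟩ p
  ⟨⟩-0  : ⟨ R ⟩ 0P
  ⟨⟩-+  : ∀ {p q} → ⟨ R ⟩ p → ⟨ R ⟩ q → ⟨ R ⟩ (p +ᵖ q)
  ⟨⟩-*  : ∀ r {p} → ⟨ R ⟩ p → ⟨ R ⟩ (r *ᵖ p)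
  ⟨⟩-≋  : ∀ {p q} → p ≋ q → ⟨ R ⟩ p → ⟨ R ⟩ q

⟨⟩-isIdeal : ∀ {k} {R : Poly k → Set} → IsIdeal ⟨ R ⟩
⟨⟩-isIdeal = record { zero∈ = ⟨⟩-0 ; +∈ = ⟨⟩-+ ; *∈ = ⟨⟩-* ; resp = ⟨⟩-≋ }

⟨⟩-least : ∀ {k} {R I : Poly k → Set} → IsIdeal I → (∀ {p} → R p → I p) → ∀ {p} → ⟨ R ⟩ p → I p
⟨⟩-least isI h (gen r)     = h r
⟨⟩-least isI h ⟨⟩-0        = IsIdeal.zero∈ isI
⟨⟩-least isI h (⟨⟩-+ i j)  = IsIdeal.+∈ isI (⟨⟩-least isI h i) (⟨⟩-least isI h j)
⟨⟩-least isI h (⟨⟩-* r i)  = IsIdeal.*∈ isI r (⟨⟩-least isI h i)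
⟨⟩-least isI h (⟨⟩-≋ e i)  = IsIdeal.resp isI e (⟨⟩-least isI h i)

-- The ideal quotient (I : a). It reduces a claim of the form a J ⊆ I to the generators of J.
colon : ∀ {k} {I : Poly k → Set} → IsIdeal I → ∀ a → IsIdeal (λ p → I (a *ᵖ p))
colon {k} isI a = record
  { zero∈ = resp (≋.sym (≋.zeroʳ a)) zero∈
  ; +∈ = λ i j → resp (≋.sym (≋.distribˡ a _ _)) (+∈ i j)
  ; *∈ = λ r {p} i → resp (solve 3 (λ a r p → r :* (a :* p) := a :* (r :* p)) ≋.refl a r p) (*∈ r i)
  ; resp = λ e i → resp (≋.*-congˡ e) i }
  where
  open IsIdeal isI
  module ≋ = CommutativeRing (polyRing {k})
  open import Algebra.Solver.Ring.NaturalCoefficients.Default ≋.commutativeSemiring using (solve; _:*_; _:=_)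

module _ {k : ℕ} where
  private module ≋ = CommutativeRing (polyRing {k})

  ^-+ : ∀ (p : Poly k) a b → p ^ᵖ (a ℕ.+ b) ≋ (p ^ᵖ a) *ᵖ (p ^ᵖ b)
  ^-+ p zero b    = ≋.sym (≋.*-identityˡ _)
  ^-+ p (suc a) b = ≋.trans (≋.*-congˡ (^-+ p a b)) (≋.sym (≋.*-assoc p _ _))

  ^-cong : ∀ {p q : Poly k} a → p ≋ q → p ^ᵖ a ≋ q ^ᵖ a
  ^-cong zero e    = ≋.refl
  ^-cong (suc a) e = ≋.*-cong e (^-cong a e)

  ^-∈ : ∀ {I : Poly k → Set} → IsIdeal I → ∀ r p {a b} → a ≤ b → I (r *ᵖ (p ^ᵖ a)) → I (r *ᵖ (p ^ᵖ b))
  ^-∈ isI r p {a} {b} a≤b i = IsIdeal.resp isI (≋.trans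
      (solve 3 (λ s r t → s :* (r :* t) := r :* (t :* s)) ≋.refl (p ^ᵖ (b ∸ a)) r (p ^ᵖ a))
      (≋.*-congˡ (≋.trans (≋.sym (^-+ p a (b ∸ a))) (≋.reflexive (cong (p ^ᵖ_) (ℕ.m+[n∸m]≡n a≤b))))))
    (IsIdeal.*∈ isI (p ^ᵖ (b ∸ a)) i)
    where open import Algebra.Solver.Ring.NaturalCoefficients.Default ≋.commutativeSemiring using (solve; _:*_; _:=_)

  ^-split : ∀ (y w : Poly k) c → ∃ λ r → (y +ᵖ w) ^ᵖ c ≋ (y ^ᵖ c) +ᵖ (w *ᵖ r)
  ^-split y w zero    = 0P , ≋.sym (≋.trans (≋.+-congˡ {1P} (≋.zeroʳ w)) (≋.+-identityʳ 1P))
  ^-split y w (suc c) = let r , h = ^-split y w c in (y *ᵖ r) +ᵖ ((y ^ᵖ c) +ᵖ (w *ᵖ r)) , ≋.trans (≋.*-congˡ h)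
      (solve 4 (λ y w v r → (y :+ w) :* (v :+ w :* r) := y :* v :+ w :* (y :* r :+ (v :+ w :* r))) ≋.refl y w (y ^ᵖ c) r)
    where open import Algebra.Solver.Ring.NaturalCoefficients.Default ≋.commutativeSemiring using (solve; _:*_; _:+_; _:=_)

  -- If a w lies in I, then multiplication by a sees no difference between y + w and y, hence none
  -- between their powers.
  ^-∈-mod : ∀ {I : Poly k → Set} → IsIdeal I → ∀ a y w c → I (a *ᵖ w) → I (a *ᵖ (y ^ᵖ c)) → I (a *ᵖ ((y +ᵖ w) ^ᵖ c))
  ^-∈-mod isI a y w c i j = let r , h = ^-split y w c in
    resp (≋.sym h) (+∈ j (resp (≋.*-comm r w) (*∈ r i)))
    where open IsIdeal (colon isI a)

  ι-^ : ∀ (p : Poly k) a → ι (p ^ᵖ a) ≋ (ι p) ^ᵖ a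
  ι-^ p zero    = CommutativeRing.refl polyRing
  ι-^ p (suc a) = CommutativeRing.trans polyRing (ι-* p (p ^ᵖ a)) (CommutativeRing.*-congˡ polyRing (ι-^ p a))

module _ {k : ℕ} where
  private module ≋ = CommutativeRing (polyRing {k})

  module Extension (Y : Poly k) where
    open Taylor Y
    private
      module ≋⁺ = CommutativeRing (polyRing {suc k})
    open import Algebra.Solver.Ring.NaturalCoefficients.Default ≋.commutativeSemiring using (solve; _:*_; _:+_; _:=_)
    open import Algebra.Solver.Ring.NaturalCoefficients.Default ≋⁺.commutativeSemiring using ()
      renaming (solve to solve⁺; _:*_ to _:*⁺_; _:+_ to _:+⁺_; _:=_ to _:=⁺_)

    q-u^* : ∀ {i c} p → i < c → q i ((u ^ᵖ c) *ᵖ p) ≋ 0P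
    q-u^* {i} {suc c} p i<c = ≋.trans (q-cong i (≋⁺.*-assoc u (u ^ᵖ c) p)) (go i i<c)
      where
      go : ∀ i → i < suc c → q i (u *ᵖ ((u ^ᵖ c) *ᵖ p)) ≋ 0P
      go zero    _         = q-u*-zero _
      go (suc i) (s≤s i<c) = ≋.trans (q-u*-suc i _) (q-u^* p i<c)

    tay-cong : ∀ c {p p′} → p ≋ p′ → tay c p ≋ tay c p′
    tay-cong zero e    = ≋⁺.refl
    tay-cong (suc c) e = ≋⁺.+-cong (tay-cong c e) (≋⁺.*-congʳ (ι-cong (q-cong c e)))

    tay₀-cong : ∀ c {p p′} → p ≋ p′ → tay₀ c p ≋ tay₀ c p′
    tay₀-cong zero e    = ≋.refl
    tay₀-cong (suc c) e = ≋.+-cong (tay₀-cong c e) (≋.*-congʳ (q-cong c e))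

    tay-+ : ∀ c p p′ → tay c (p +ᵖ p′) ≋ tay c p +ᵖ tay c p′
    tay-+ zero p p′    = ≋⁺.sym (≋⁺.+-identityˡ 0P)
    tay-+ (suc c) p p′ = ≋⁺.trans (≋⁺.+-cong (tay-+ c p p′) (≋⁺.*-congʳ (≋⁺.trans (ι-cong (q-++ c p p′)) (≋⁺.reflexive (ι-++ (q c p) (q c p′))))))
      (solve⁺ 5 (λ a b s t w → (a :+⁺ b) :+⁺ (s :+⁺ t) :*⁺ w :=⁺ (a :+⁺ s :*⁺ w) :+⁺ (b :+⁺ t :*⁺ w)) ≋⁺.refl
        (tay c p) (tay c p′) (ι (q c p)) (ι (q c p′)) (u ^ᵖ c))

    tay₀-+ : ∀ c p p′ → tay₀ c (p +ᵖ p′) ≋ tay₀ c p +ᵖ tay₀ c p′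
    tay₀-+ zero p p′    = ≋.sym (≋.+-identityˡ 0P)
    tay₀-+ (suc c) p p′ = ≋.trans (≋.+-cong (tay₀-+ c p p′) (≋.*-congʳ (q-++ c p p′)))
      (solve 5 (λ a b s t w → (a :+ b) :+ (s :+ t) :* w := (a :+ s :* w) :+ (b :+ t :* w)) ≋.refl
        (tay₀ c p) (tay₀ c p′) (q c p) (q c p′) (Y ^ᵖ c))

    tay₀-ι* : ∀ c a p → tay₀ c (ι a *ᵖ p) ≋ a *ᵖ tay₀ c p
    tay₀-ι* zero a p    = ≋.sym (≋.zeroʳ a)
    tay₀-ι* (suc c) a p = ≋.trans (≋.+-cong (tay₀-ι* c a p) (≋.*-congʳ (q-ι* c a p)))
      (solve 4 (λ a t s w → a :* t :+ a :* s :* w := a :* (t :+ s :* w)) ≋.refl a (tay₀ c p) (q c p) (Y ^ᵖ c))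

    private
      Y-Y : ∀ p → ((-ᵖ Y) *ᵖ p) +ᵖ (Y *ᵖ p) ≋ 0P
      Y-Y p = ≋.trans (≋.sym (≋.distribʳ p (-ᵖ Y) Y)) (≋.trans (≋.*-congʳ (≋.-‿inverseˡ Y)) (≋.zeroˡ p))

      nY : Poly (suc k)
      nY = ι (-ᵖ Y)

      x₀≋ : x₀ ≋ u +ᵖ nY
      x₀≋ = ≋⁺.sym (≋⁺.trans (≋⁺.+-assoc x₀ (ι Y) nY) (≋⁺.trans (≋⁺.+-congˡ {x₀} (≋⁺.trans
        (≋⁺.reflexive (sym (ι-++ Y (-ᵖ Y)))) (ι-cong (≋.-‿inverseʳ Y)))) (≋⁺.+-identityʳ x₀)))

      ι-nY* : ∀ p → ι ((-ᵖ Y) *ᵖ p) ≋ nY *ᵖ ι p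
      ι-nY* p = ι-* (-ᵖ Y) p

    -- Since x₀ = u - Y, the i-th coefficient of x₀ p is `q (i−1) p` minus Y times `q i p`. Summed
    -- against Y^i this telescopes, and only the last term survives the truncation.
    tay₀-x₀* : ∀ c p → tay₀ (suc c) (x₀ *ᵖ p) ≋ (-ᵖ Y) *ᵖ (q c p *ᵖ (Y ^ᵖ c))
    tay₀-x₀* zero p = ≋.trans (≋.+-identityˡ _) (≋.trans (≋.*-congʳ (q-x₀*-zero p)) (≋.*-assoc (-ᵖ Y) (q 0 p) 1P))
    tay₀-x₀* (suc c) p = ≋.trans (≋.+-cong (tay₀-x₀* c p) (≋.*-congʳ (q-x₀*-suc c p)))
      (≋.trans (solve 5 (λ n y a b w → n :* (a :* w) :+ (a :+ n :* b) :* (y :* w) := (n :* (a :* w) :+ y :* (a :* w)) :+ n :* (b :* (y :* w))) ≋.refl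
        (-ᵖ Y) Y (q c p) (q (suc c) p) (Y ^ᵖ c))
      (≋.trans (≋.+-congʳ (Y-Y (q c p *ᵖ (Y ^ᵖ c)))) (≋.+-identityˡ _)))

    tay-x₀* : ∀ c p → tay (suc c) (x₀ *ᵖ p) ≋ (u *ᵖ tay c p) +ᵖ (nY *ᵖ tay (suc c) p)
    tay-x₀* zero p = ≋⁺.trans (≋⁺.+-identityˡ _) (≋⁺.trans (≋⁺.*-congʳ (≋⁺.trans (ι-cong (q-x₀*-zero p)) (ι-nY* (q 0 p))))
      (≋⁺.trans (≋⁺.*-assoc nY (ι (q 0 p)) 1P) (≋⁺.sym (≋⁺.trans (≋⁺.+-cong (≋⁺.zeroʳ u) (≋⁺.*-congˡ {nY} (≋⁺.+-identityˡ _))) (≋⁺.+-identityˡ _)))))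
    tay-x₀* (suc c) p = ≋⁺.trans (≋⁺.+-cong (tay-x₀* c p) (≋⁺.*-congʳ (≋⁺.trans (ι-cong (q-x₀*-suc c p))
        (≋⁺.trans (≋⁺.reflexive (ι-++ (q c p) _)) (≋⁺.+-congˡ {ι (q c p)} (ι-nY* (q (suc c) p)))))))
      (solve⁺ 6 (λ u n t a b w → (u :*⁺ t :+⁺ n :*⁺ (t :+⁺ a :*⁺ w)) :+⁺ (a :+⁺ n :*⁺ b) :*⁺ (u :*⁺ w)
          :=⁺ u :*⁺ (t :+⁺ a :*⁺ w) :+⁺ n :*⁺ ((t :+⁺ a :*⁺ w) :+⁺ b :*⁺ (u :*⁺ w))) ≋⁺.refl
        u nY (tay c p) (ι (q c p)) (ι (q (suc c) p)) (u ^ᵖ c))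

    tay-ι : ∀ c a → tay (suc c) (ι a) ≋ ι a
    tay-ι zero a    = ≋⁺.trans (≋⁺.trans (≋⁺.+-identityˡ _) (≋⁺.*-identityʳ _)) (ι-cong (≋.trans (q-ι 0 a) (≋.*-identityʳ a)))
    tay-ι (suc c) a = ≋⁺.trans (≋⁺.+-cong (tay-ι c a) (≋⁺.trans (≋⁺.*-congʳ (ι-cong (≋.trans (q-ι (suc c) a) (≋.zeroʳ a)))) (≋⁺.zeroˡ (u ^ᵖ suc c))))
      (≋⁺.+-identityʳ (ι a))

    tay₀-ι : ∀ c a → tay₀ (suc c) (ι a) ≋ a
    tay₀-ι zero a    = ≋.trans (≋.trans (≋.+-identityˡ _) (≋.*-identityʳ _)) (≋.trans (q-ι 0 a) (≋.*-identityʳ a))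
    tay₀-ι (suc c) a = ≋.trans (≋.+-cong (tay₀-ι c a) (≋.trans (≋.*-congʳ (≋.trans (q-ι (suc c) a) (≋.zeroʳ a))) (≋.zeroˡ (Y ^ᵖ suc c))))
      (≋.+-identityʳ a)

    -- Division with remainder by u^c, which is monic in x₀. Multiplying p by x₀ moves the
    -- coefficient of u^c from the remainder into the quotient.
    taylor : ∀ c p → ∃ λ s → p ≋ tay c p +ᵖ ((u ^ᵖ c) *ᵖ s)
    taylor zero p    = p , ≋⁺.sym (≋⁺.trans (≋⁺.+-identityˡ _) (≋⁺.*-identityˡ p))
    taylor (suc c) p = poly-induction (λ p → ∃ λ s → p ≋ tay (suc c) p +ᵖ ((u ^ᵖ suc c) *ᵖ s))
      (λ { e (s , h) → s , ≋⁺.trans (≋⁺.sym e) (≋⁺.trans h (≋⁺.+-congʳ (tay-cong (suc c) e))) })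
      (λ { {p} {p′} (s , h) (s′ , h′) → s +ᵖ s′ , ≋⁺.trans (≋⁺.+-cong h h′) (≋⁺.trans
        (solve⁺ 5 (λ a b w s t → (a :+⁺ w :*⁺ s) :+⁺ (b :+⁺ w :*⁺ t) :=⁺ (a :+⁺ b) :+⁺ w :*⁺ (s :+⁺ t)) ≋⁺.refl
          (tay (suc c) p) (tay (suc c) p′) (u ^ᵖ suc c) s s′)
        (≋⁺.+-congʳ (≋⁺.sym (tay-+ (suc c) p p′)))) })
      (λ a → 0P , ≋⁺.sym (≋⁺.trans (≋⁺.+-cong (tay-ι c a) (≋⁺.zeroʳ (u ^ᵖ suc c))) (≋⁺.+-identityʳ (ι a))))
      (λ { {p} (s , h) → (x₀ *ᵖ s) +ᵖ ι (q c p) , shift p s h }) p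
      where
      shift : ∀ p s → p ≋ tay (suc c) p +ᵖ ((u ^ᵖ suc c) *ᵖ s) →
        x₀ *ᵖ p ≋ tay (suc c) (x₀ *ᵖ p) +ᵖ ((u ^ᵖ suc c) *ᵖ ((x₀ *ᵖ s) +ᵖ ι (q c p)))
      shift p s h = ≋⁺.trans (≋⁺.*-congˡ {x₀} h) (≋⁺.trans (≋⁺.*-congʳ x₀≋) (≋⁺.trans
        (solve⁺ 6 (λ u n t a w s → (u :+⁺ n) :*⁺ ((t :+⁺ a :*⁺ w) :+⁺ (u :*⁺ w) :*⁺ s)
            :=⁺ (u :*⁺ t :+⁺ n :*⁺ (t :+⁺ a :*⁺ w)) :+⁺ (u :*⁺ w) :*⁺ ((u :+⁺ n) :*⁺ s :+⁺ a)) ≋⁺.refl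
          u nY (tay c p) (ι (q c p)) (u ^ᵖ c) s)
        (≋⁺.+-cong (≋⁺.sym (tay-x₀* c p)) (≋⁺.*-congˡ {u ^ᵖ suc c} (≋⁺.+-congʳ (≋⁺.*-congʳ (≋⁺.sym x₀≋)))))))

    u^-split : ∀ c → ∃ λ r → u ^ᵖ c ≋ ι (Y ^ᵖ c) +ᵖ (x₀ *ᵖ r)
    u^-split c = let r , h = ^-split (ι Y) x₀ c in r , ≋⁺.trans (^-cong c (≋⁺.+-comm x₀ (ι Y))) (≋⁺.trans h (≋⁺.+-congʳ (≋⁺.sym (ι-^ Y c))))

    -- Membership in the ideal (I, x₀ J, u^c), read off the Taylor coefficients.
    Test : ℕ → (I J : Poly k → Set) → Poly (suc k) → Set
    Test zero I J p    = ⊤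
    Test (suc c) I J p = I (tay₀ (suc c) p) × (∀ j → j < c → J (q (suc j) p))

    module _ {I J : Poly k → Set} (isI : IsIdeal I) (isJ : IsIdeal J) where
      private
        module I = IsIdeal isI
        module J = IsIdeal isJ

      -- Modulo u^c only the expansion in powers of u remains. As u^j - Y^j is divisible by x₀,
      -- replacing each u^j by Y^j changes it by elements of x₀ J, and what is left is
      -- `ι (tay₀ c p)`, which comes from I.
      Test⇒ : ∀ {I′ : Poly (suc k) → Set} → IsIdeal I′ → (∀ {p} → I p → I′ (ι p)) → (∀ {p} → J p → I′ (x₀ *ᵖ ι p)) →
        ∀ c → I′ (u ^ᵖ c) → ∀ {p} → Test c I J p → I′ p
      Test⇒ isI′ hI hJ zero hu {p} _ = I′.resp (≋⁺.*-identityʳ p) (I′.*∈ p hu)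
        where module I′ = IsIdeal isI′
      Test⇒ {I′} isI′ hI hJ (suc c) hu {p} (t₀ , t) =
        let s , h = taylor (suc c) p in
        I′.resp (≋⁺.sym h) (I′.+∈ (split (suc c) (λ j lt → t j (ℕ.≤-pred lt)) t₀) (I′.resp (≋⁺.*-comm s _) (I′.*∈ s hu)))
        where
        module I′ = IsIdeal isI′
        tail : ∀ j → J (q (suc j) p) → ∀ r → I′ (ι (q (suc j) p) *ᵖ (x₀ *ᵖ r))
        tail j i r = I′.resp (solve⁺ 3 (λ r x a → r :*⁺ (x :*⁺ a) :=⁺ a :*⁺ (x :*⁺ r)) ≋⁺.refl r x₀ (ι (q (suc j) p))) (I′.*∈ r (hJ i))
        decompose : ∀ c → (∀ j → suc j < c → J (q (suc j) p)) → ∃ λ e → I′ e × tay c p ≋ ι (tay₀ c p) +ᵖ e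
        decompose zero t          = 0P , I′.zero∈ , ≋⁺.sym (≋⁺.+-identityˡ 0P)
        decompose (suc zero) t    = 0P , I′.zero∈ , ≋⁺.trans (≋⁺.trans (≋⁺.+-identityˡ _) (≋⁺.*-identityʳ (ι (q 0 p))))
          (≋⁺.trans (ι-cong (≋.sym (≋.trans (≋.+-identityˡ _) (≋.*-identityʳ (q 0 p))))) (≋⁺.sym (≋⁺.+-identityʳ _)))
        decompose (suc (suc c)) t =
          let e , i , h = decompose (suc c) (λ j lt → t j (ℕ.m≤n⇒m≤1+n lt))
              r , g = u^-split (suc c) in
          e +ᵖ (ι (q (suc c) p) *ᵖ (x₀ *ᵖ r)) , I′.+∈ i (tail c (t c ℕ.≤-refl) r) ,
          ≋⁺.trans (≋⁺.+-cong h (≋⁺.*-congˡ {ι (q (suc c) p)} g))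
            (≋⁺.trans (solve⁺ 5 (λ a e b y z → (a :+⁺ e) :+⁺ b :*⁺ (y :+⁺ z) :=⁺ (a :+⁺ b :*⁺ y) :+⁺ (e :+⁺ b :*⁺ z)) ≋⁺.refl
              (ι (tay₀ (suc c) p)) e (ι (q (suc c) p)) (ι (Y ^ᵖ suc c)) (x₀ *ᵖ r))
            (≋⁺.+-congʳ (≋⁺.trans (≋⁺.+-congˡ {ι (tay₀ (suc c) p)} (≋⁺.sym (ι-* (q (suc c) p) (Y ^ᵖ suc c)))) (≋⁺.reflexive (sym (ι-++ (tay₀ (suc c) p) _))))))
        split : ∀ c → (∀ j → suc j < c → J (q (suc j) p)) → I (tay₀ c p) → I′ (tay c p)
        split c t i₀ = let e , i , h = decompose c t in I′.resp (≋⁺.sym h) (I′.+∈ (hI i₀) i)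

      module _ (I⊆J : ∀ {p} → I p → J p) where

        private
          -- The test does not mention `q 0 p`, but it determines its class: `tay₀` is `q 0 p` plus
          -- multiples of the higher coefficients, and I ⊆ J. Multiplication by x₀ moves this
          -- coefficient to position 1, where membership in J is required.
          q₀∈J : ∀ c {p} → I (tay₀ (suc c) p) → (∀ j → j < c → J (q (suc j) p)) → J (q 0 p)
          q₀∈J c {p} i t = J.resp cancel (J.+∈ (I⊆J i) (J.*∈ (-ᵖ 1P) (proj₁ (proj₂ (rest c t)))))
            where
            rest : ∀ c → (∀ j → j < c → J (q (suc j) p)) → ∃ λ e → J e × tay₀ (suc c) p ≋ q 0 p +ᵖ e
            rest zero t    = 0P , J.zero∈ , ≋.trans (≋.trans (≋.+-identityˡ _) (≋.*-identityʳ (q 0 p))) (≋.sym (≋.+-identityʳ (q 0 p)))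
            rest (suc c) t = let e , j , h = rest c (λ i lt → t i (ℕ.m≤n⇒m≤1+n lt)) in
              e +ᵖ (q (suc c) p *ᵖ (Y ^ᵖ suc c)) ,
              J.+∈ j (J.resp (≋.*-comm (Y ^ᵖ suc c) (q (suc c) p)) (J.*∈ (Y ^ᵖ suc c) (t c ℕ.≤-refl))) ,
              ≋.trans (≋.+-congʳ h) (≋.+-assoc (q 0 p) e _)
            cancel : tay₀ (suc c) p +ᵖ ((-ᵖ 1P) *ᵖ proj₁ (rest c t)) ≋ q 0 p
            cancel = let e , _ , h = rest c t in ≋.trans (≋.+-congʳ h) (≋.trans (≋.+-assoc (q 0 p) e _)
              (≋.trans (≋.+-congˡ {q 0 p} (≋.trans (≋.+-congʳ (≋.sym (≋.*-identityˡ e))) (≋.trans (≋.sym (≋.distribʳ e 1P (-ᵖ 1P)))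
                (≋.trans (≋.*-congʳ (≋.-‿inverseʳ 1P)) (≋.zeroˡ e))))) (≋.+-identityʳ (q 0 p))))

        private
          negate : ∀ {y} w b → I ((y *ᵖ w) *ᵖ b) → I ((-ᵖ y) *ᵖ (b *ᵖ w))
          negate {y} w b i = I.resp (≋.trans (≋.*-congˡ { -ᵖ 1P} (solve 3 (λ y w b → (y :* w) :* b := y :* (b :* w)) ≋.refl y w b))
              (≋.trans (≋.sym (≋.*-assoc (-ᵖ 1P) y _)) (≋.*-congʳ (-1*x≈-x y))))
            (I.*∈ (-ᵖ 1P) i)
            where open import Algebra.Properties.Ring ≋.ring using (-1*x≈-x)

        -- Closure under x₀ is the substantial case. By the telescoping formula the new value at x₀
        -- = 0 is, up to sign, the top coefficient times the full power of Y, and this lies in I by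
        -- the inclusion of Y^c J in I.
        Test-isIdeal : ∀ c → (∀ {p} → J p → I ((Y ^ᵖ c) *ᵖ p)) → IsIdeal (Test c I J)
        Test-isIdeal zero Y^cJ⊆I = record { zero∈ = tt ; +∈ = λ _ _ → tt ; *∈ = λ _ _ → tt ; resp = λ _ _ → tt }
        Test-isIdeal (suc c) Y^cJ⊆I = record
          { zero∈ = I.resp (≋.sym (tay₀-ι c 0P)) I.zero∈ , λ j _ → J.zero∈
          ; +∈ = plus
          ; *∈ = λ r {p} t → poly-induction (λ r → Test (suc c) I J (r *ᵖ p))
              (λ e → respect (≋⁺.*-congʳ e))
              (λ {r} {s} a b → respect (≋⁺.sym (≋⁺.distribʳ p r s)) (plus a b))
              (λ a → I.resp (≋.sym (tay₀-ι* (suc c) a p)) (I.*∈ a (proj₁ t)) ,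
                     λ j lt → J.resp (≋.sym (q-ι* (suc j) a p)) (J.*∈ a (proj₂ t j lt)))
              (λ {r} a → respect (≋⁺.sym (≋⁺.*-assoc x₀ r p)) (shift a)) r
          ; resp = respect }
          where
          plus : ∀ {p p′} → Test (suc c) I J p → Test (suc c) I J p′ → Test (suc c) I J (p +ᵖ p′)
          plus {p} {p′} (a , f) (b , g) = I.resp (≋.sym (tay₀-+ (suc c) p p′)) (I.+∈ a b) ,
            λ j lt → J.resp (≋.sym (q-++ (suc j) p p′)) (J.+∈ (f j lt) (g j lt))
          respect : ∀ {p p′} → p ≋ p′ → Test (suc c) I J p → Test (suc c) I J p′
          respect e (a , f) = I.resp (tay₀-cong (suc c) e) a , λ j lt → J.resp (q-cong (suc j) e) (f j lt)
          top∈ : ∀ d {p} → c ≡ d → Test (suc c) I J p → I ((-ᵖ Y) *ᵖ (q d p *ᵖ (Y ^ᵖ d)))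
          top∈ zero    refl (a , f) = I.*∈ (-ᵖ Y) (I.resp (≋.+-identityˡ _) a)
          top∈ (suc d) {p} refl (a , f) = negate (Y ^ᵖ suc d) (q (suc d) p) (Y^cJ⊆I (f d ℕ.≤-refl))
          shift : ∀ {p} → Test (suc c) I J p → Test (suc c) I J (x₀ *ᵖ p)
          shift {p} t@(a , f) = I.resp (≋.sym (tay₀-x₀* c p)) (top∈ c refl t) ,
            λ j lt → J.resp (≋.sym (q-x₀*-suc j p)) (J.+∈ (prev j lt) (J.*∈ (-ᵖ Y) (f j lt)))
            where
            prev : ∀ j → j < c → J (q j p)
            prev zero lt    = q₀∈J c a f
            prev (suc j) lt = f j (ℕ.<-trans (ℕ.n<1+n j) lt)

        Test-ι : ∀ c {a} → I a → Test c I J (ι a)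
        Test-ι zero i        = tt
        Test-ι (suc c) {a} i = I.resp (≋.sym (tay₀-ι c a)) i ,
          λ j _ → J.resp (≋.sym (≋.trans (q-ι (suc j) a) (≋.zeroʳ a))) J.zero∈

        Test-x₀ι : ∀ c {a} → (∀ {p} → J p → I ((Y ^ᵖ c) *ᵖ p)) → J a → Test c I J (x₀ *ᵖ ι a)
        Test-x₀ι zero _ i        = tt
        Test-x₀ι (suc c) {a} Y^cJ⊆I i = I.resp (≋.sym (tay₀-x₀* c (ι a))) (low c refl) ,
            λ j _ → J.resp (≋.sym (q-x₀*-suc j (ι a))) (J.+∈ (coef j) (J.*∈ (-ᵖ Y) (coef (suc j))))
          where
          coef : ∀ j → J (q j (ι a))
          coef j = J.resp (≋.trans (≋.*-comm (τ j 0) a) (≋.sym (q-ι j a))) (J.*∈ (τ j 0) i)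
          low : ∀ d → c ≡ d → I ((-ᵖ Y) *ᵖ (q d (ι a) *ᵖ (Y ^ᵖ d)))
          low d refl = negate (Y ^ᵖ d) (q d (ι a)) (Y^cJ⊆I (coef d))

        Test-u^ : ∀ c r → Test c I J (r *ᵖ (u ^ᵖ c))
        Test-u^ zero r    = tt
        Test-u^ (suc c) r = low (suc c) ℕ.≤-refl , λ j lt → J.resp (≋.sym (vanish (suc j) (s≤s lt))) J.zero∈
          where
          vanish : ∀ j → j < suc c → q j (r *ᵖ (u ^ᵖ suc c)) ≋ 0P
          vanish j lt = ≋.trans (q-cong j (≋⁺.*-comm r (u ^ᵖ suc c))) (q-u^* r lt)
          low : ∀ d → d ≤ suc c → I (tay₀ d (r *ᵖ (u ^ᵖ suc c)))
          low zero le    = I.zero∈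
          low (suc d) le = I.+∈ (low d (ℕ.≤-trans (ℕ.n≤1+n d) le))
            (I.resp (≋.sym (≋.trans (≋.*-congʳ (vanish d le)) (≋.zeroˡ (Y ^ᵖ d)))) I.zero∈)

-- The relations of the Chow ring

module _ {n : ℕ} where

  infix 4 _⊊_
  _⊊_ : Subset n → Subset n → Set
  A ⊊ B = A ⊆ B × B ⊈ A

  -- What the ideals need to know about the exponents b(S,G) = rk G − rk sup(S,G).
  record Exponents (𝒢 : Subset n → Set) (b : List (Subset n) → Subset n → ℕ) : Set where
    field
      b-local : ∀ {T T′ H} → All 𝒢 T → All 𝒢 T′ → 𝒢 H → (∀ {x} → x ∈ T′ → x ⊊ H → x ∈ T) → b T H ≤ b T′ H
      b-chain : ∀ {T G K H} → All 𝒢 T → 𝒢 G → 𝒢 K → 𝒢 H → G ⊆ K → K ⊊ H → b (K ∷ T) H ≤ b (G ∷ T) H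
      -- Choosing G lowers the exponent at H by at most the exponent of G itself. For ranks this is
      -- submodularity for G and sup(T,H).
      b-drop  : ∀ {T G H} → All 𝒢 T → 𝒢 G → 𝒢 H → G ⊊ H → b T H ≤ b (G ∷ T) H ℕ.+ b T G
      -- Incomparable members that share a lower member have their join Z in the family. The final
      -- exponent 0 turns the relation of {K,H} at Z into the monomial x_K x_H.
      b-join  : ∀ {G K H} → 𝒢 G → 𝒢 K → 𝒢 H → G ⊆ K → G ⊆ H → K ⊈ H → H ⊈ K → ∃ λ Z →
        𝒢 Z × K ⊆ Z × H ⊆ Z × (∀ {N} → 𝒢 N → K ⊆ N → H ⊆ N → Z ⊆ N) ×
        (∀ T → All 𝒢 T → b (K ∷ T) Z ≤ b (G ∷ T) H) × (∀ T → All 𝒢 T → b (K ∷ H ∷ T) Z ≡ 0)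

module Relations {n : ℕ} where
  private X = Subset n

  vars : ∀ {k} → Subset k → Poly k
  vars []          = 1P
  vars (false ∷ S) = ι (vars S)
  vars (true ∷ S)  = x₀ *ᵖ ι (vars S)

  varSum : (L : List X) → (X → Bool) → Poly (length L)
  varSum [] f      = 0P
  varSum (G ∷ L) f = if f G then x₀ +ᵖ ι (varSum L f) else ι (varSum L f)

  up : (L : List X) → X → Poly (length L)
  up L H = varSum L (H ⊆ᵇ_)

  sel : (L : List X) → Subset (length L) → List X
  sel [] []                = []
  sel (G ∷ L) (false ∷ S) = sel L S
  sel (G ∷ L) (true ∷ S)  = G ∷ sel L S

  var : ∀ {L : List X} {K} → K ∈ L → Poly (length L)
  var (here _)  = x₀
  var (there i) = ι (var i)

  insert : ∀ {L : List X} {K} → K ∈ L → Subset (length L) → Subset (length L)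
  insert (here _) (s ∷ S)  = true ∷ S
  insert (there i) (s ∷ S) = s ∷ insert i S

  sel⊆ : ∀ L S {x} → x ∈ sel L S → x ∈ L
  sel⊆ [] [] ()
  sel⊆ (G ∷ L) (false ∷ S) i          = there (sel⊆ L S i)
  sel⊆ (G ∷ L) (true ∷ S) (here e)    = here e
  sel⊆ (G ∷ L) (true ∷ S) (there i)   = there (sel⊆ L S i)

  sel-⊥ : ∀ L → sel L ⊥ ≡ []
  sel-⊥ []      = refl
  sel-⊥ (G ∷ L) = sel-⊥ L

  ∈-insert : ∀ {L K} (i : K ∈ L) S → K ∈ sel L (insert i S)
  ∈-insert (here e) (s ∷ S)          = here e
  ∈-insert (there i) (false ∷ S)     = ∈-insert i S
  ∈-insert (there i) (true ∷ S)      = there (∈-insert i S)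

  sel⊆insert : ∀ {L K} (i : K ∈ L) S {x} → x ∈ sel L S → x ∈ sel L (insert i S)
  sel⊆insert (here e) (false ∷ S) j              = there j
  sel⊆insert (here e) (true ∷ S) j               = j
  sel⊆insert (there i) (false ∷ S) j             = sel⊆insert i S j
  sel⊆insert (there i) (true ∷ S) (here e)       = here e
  sel⊆insert (there i) (true ∷ S) (there j)      = there (sel⊆insert i S j)

  vars-⊥ : ∀ k → vars (⊥ {k}) ≋ 1P
  vars-⊥ zero    = CommutativeRing.refl polyRing
  vars-⊥ (suc k) = ι-cong (vars-⊥ k)

  -- The witness r is 1 if K is not yet in S, and x_K if it is, since then one copy of the variable
  -- is left over.
  var-absorb : ∀ {L K} (i : K ∈ L) S → ∃ λ r → var i *ᵖ vars S ≋ r *ᵖ vars (insert i S)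
  var-absorb (here e) (false ∷ S) = 1P , CommutativeRing.sym polyRing (CommutativeRing.*-identityˡ polyRing _)
  var-absorb (here e) (true ∷ S)  = x₀ , CommutativeRing.refl polyRing
  var-absorb (there i) (false ∷ S) = let r , h = var-absorb i S in
    ι r , CommutativeRing.trans polyRing (CommutativeRing.sym polyRing (ι-* _ _)) (CommutativeRing.trans polyRing (ι-cong h) (ι-* r _))
  var-absorb {_ ∷ L} (there i) (true ∷ S) = let r , h = var-absorb i S in ι r , ≋.trans
      (solve 3 (λ v x s → v :* (x :* s) := x :* (v :* s)) ≋.refl (ι (var i)) x₀ (ι (vars S)))
      (≋.trans (≋.*-congˡ (≋.trans (≋.sym (ι-* (var i) (vars S))) (≋.trans (ι-cong h) (ι-* r _))))
        (solve 3 (λ x r s → x :* (r :* s) := r :* (x :* s)) ≋.refl x₀ (ι r) (ι (vars (insert i S)))))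
    where
    module ≋ = CommutativeRing (polyRing {suc (length L)})
    open import Algebra.Solver.Ring.NaturalCoefficients.Default ≋.commutativeSemiring using (solve; _:*_; _:=_)

  comap-ι : ∀ {k} {I : Poly (suc k) → Set} → IsIdeal I → IsIdeal (I ∘ ι)
  comap-ι isI = record
    { zero∈ = zero∈
    ; +∈ = λ {p} {q} i j → resp (CommutativeRing.reflexive polyRing (sym (ι-++ p q))) (+∈ i j)
    ; *∈ = λ r {p} i → resp (CommutativeRing.sym polyRing (ι-* r p)) (*∈ (ι r) i)
    ; resp = λ e → resp (ι-cong e) }
    where open IsIdeal isI

  varSum-∈ : ∀ L f {I : Poly (length L) → Set} → IsIdeal I → (∀ {K} (i : K ∈ L) → T (f K) → I (var i)) → I (varSum L f)
  varSum-∈ [] f isI h = IsIdeal.zero∈ isI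
  varSum-∈ (G ∷ L) f isI h with f G in eq
  ... | true  = IsIdeal.+∈ isI (h (here refl) (subst T (sym eq) tt)) (varSum-∈ L f (comap-ι isI) (h ∘ there))
  ... | false = varSum-∈ L f (comap-ι isI) (h ∘ there)

  varSum-split : ∀ L f g → (∀ K → T (g K) → T (f K)) → varSum L f ≋ varSum L g +ᵖ varSum L (λ K → f K ∧ not (g K))
  varSum-split [] f g h = CommutativeRing.sym polyRing (CommutativeRing.+-identityˡ polyRing 0P)
  varSum-split (G ∷ L) f g h = go (f G) (g G) (h G) (≋.trans (ι-cong (varSum-split L f g h)) (≋.reflexive (ι-++ (varSum L g) _)))
    where
    module ≋ = CommutativeRing (polyRing {suc (length L)})
    open import Algebra.Solver.Ring.NaturalCoefficients.Default ≋.commutativeSemiring using (solve; _:+_; _:=_)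
    go : ∀ {s t r} a b → (T b → T a) → s ≋ t +ᵖ r →
      (if a then x₀ +ᵖ s else s) ≋ (if b then x₀ +ᵖ t else t) +ᵖ (if a ∧ not b then x₀ +ᵖ r else r)
    go {s} {t} {r} true true _ e   = ≋.trans (≋.+-congˡ e) (≋.sym (≋.+-assoc x₀ t r))
    go {s} {t} {r} true false _ e  = ≋.trans (≋.+-congˡ e) (solve 3 (λ x t r → x :+ (t :+ r) := t :+ (x :+ r)) ≋.refl x₀ t r)
    go false true h e              = ⊥-elim (h tt)
    go false false _ e             = e

  module _ {𝒢 : X → Set} {b : List X → X → ℕ} (exps : Exponents 𝒢 b) where
    open Exponents exps

    Rel : (L T : List X) → Poly (length L) → Set
    Rel L T p = ∃ λ S → ∃ λ H → H ∈ L × p ≡ vars S *ᵖ (up L H ^ᵖ b (sel L S ++ T) H)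

    -- A final segment of a linear extension of inclusion. The field `closed` keeps the joins from
    -- `b-join` in the list, so that relations at these joins are available.
    record Upper (L : List X) : Set where
      field
        sorted : AllPairs (λ A B → B ⊈ A) L
        ⊆𝒢     : All 𝒢 L
        closed : ∀ {K Z} → K ∈ L → 𝒢 Z → K ⊆ Z → Z ∈ L
    open Upper

    Upper-tail : ∀ {G L} → Upper (G ∷ L) → Upper L
    Upper-tail u .sorted = AllPairs.tail (u .sorted)
    Upper-tail u .⊆𝒢     = All.tail (u .⊆𝒢)
    Upper-tail u .closed i z le with u .closed (there i) z le
    ... | here refl = ⊥-elim (All.lookup (AllPairs.head (u .sorted)) i le)
    ... | there j   = j

    module _ {L} (upper : Upper L) where
      private
        module ≋ = CommutativeRing (polyRing {length L})
        open import Algebra.Solver.Ring.NaturalCoefficients.Default ≋.commutativeSemiring using (solve; _:*_; _:=_)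
        L𝒢 : ∀ {K} → K ∈ L → 𝒢 K
        L𝒢 = All.lookup (upper .⊆𝒢)
        sel𝒢 : ∀ {T} S → All 𝒢 T → All 𝒢 (sel L S ++ T)
        sel𝒢 S t = All.++⁺ (All.tabulate (L𝒢 ∘ sel⊆ L S)) t

      module _ {T} (T𝒢 : All 𝒢 T) where
        private
          I = ⟨ Rel L T ⟩
          isI : IsIdeal I
          isI = ⟨⟩-isIdeal

        rel∈ : ∀ S {H e} → H ∈ L → b (sel L S ++ T) H ≤ e → I (vars S *ᵖ (up L H ^ᵖ e))
        rel∈ S h le = ^-∈ isI (vars S) _ le (gen (S , _ , h , refl))

        absorb∈ : ∀ {K H e} (i : K ∈ L) S → H ∈ L → b (K ∷ sel L S ++ T) H ≤ e → I ((var i *ᵖ vars S) *ᵖ (up L H ^ᵖ e))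
        absorb∈ {K} {H} {e} i S h le = let r , eq = var-absorb i S in
          ⟨⟩-≋ (≋.trans (≋.sym (≋.*-assoc r _ _)) (≋.*-congʳ (≋.sym eq)))
            (⟨⟩-* r (rel∈ (insert i S) h (ℕ.≤-trans (b-local (sel𝒢 (insert i S) T𝒢) (L𝒢 i ∷ sel𝒢 S T𝒢) (L𝒢 h) grow) le)))
          where
          grow : ∀ {x} → x ∈ K ∷ sel L S ++ T → x ⊊ H → x ∈ sel L (insert i S) ++ T
          grow (here refl) _ = ∈-++⁺ˡ (∈-insert i S)
          grow (there j) _ with ∈-++⁻ (sel L S) j
          ... | inj₁ k = ∈-++⁺ˡ (sel⊆insert i S k)
          ... | inj₂ k = ∈-++⁺ʳ (sel L (insert i S)) k

        -- The relation at the join of K and N has exponent 0 once both are chosen, so it is their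
        -- product alone.
        nonnested∈ : ∀ {G K N} (i : K ∈ L) (j : N ∈ L) → 𝒢 G → G ⊆ K → G ⊆ N → K ⊈ N → N ⊈ K → I (var i *ᵖ var j)
        nonnested∈ {G} {K} {N} i j g gk gn kn nk =
          let Z , Z𝒢 , kz , nz , _ , _ , zero! = b-join g (L𝒢 i) (L𝒢 j) gk gn kn nk
              r , eq = var-absorb j ⊥ in
          ⟨⟩-≋ (≋.trans (≋.*-congˡ (≋.*-identityʳ _)) (≋.trans (solve 3 (λ r v s → r :* (v :* s) := v :* (r :* s)) ≋.refl r (var i) (vars (insert j ⊥)))
              (≋.*-congˡ (≋.trans (≋.sym eq) (≋.trans (≋.*-congˡ (vars-⊥ _)) (≋.*-identityʳ (var j)))))))
            (⟨⟩-* r (absorb∈ {e = 0} i (insert j ⊥) (upper .closed i Z𝒢 kz)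
              (ℕ.≤-trans (b-local (L𝒢 i ∷ sel𝒢 (insert j ⊥) T𝒢) (L𝒢 i ∷ L𝒢 j ∷ T𝒢) Z𝒢 grow) (ℕ.≤-reflexive (zero! T T𝒢)))))
          where
          grow : ∀ {x Z} → x ∈ K ∷ N ∷ T → x ⊊ Z → x ∈ K ∷ sel L (insert j ⊥) ++ T
          grow (here refl) _         = here refl
          grow (there (here refl)) _ = there (∈-++⁺ˡ (∈-insert j ⊥))
          grow (there (there t)) _   = there (∈-++⁺ʳ (sel L (insert j ⊥)) t)

        -- A variable x_K with K ⊋ G and K ⊉ H forces the smaller exponent that G itself would force.
        above∈ : ∀ {G K H e} (i : K ∈ L) S → H ∈ L → 𝒢 G → G ⊆ K → G ⊆ H → H ⊈ K → b (G ∷ sel L S ++ T) H ≤ e →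
          I ((var i *ᵖ vars S) *ᵖ (up L H ^ᵖ e))
        above∈ {G} {K} {H} {e} i S h g gk gh hk le with K ⊆? H
        ... | yes kh = absorb∈ i S h (ℕ.≤-trans (b-chain (sel𝒢 S T𝒢) g (L𝒢 i) (L𝒢 h) gk (kh , hk)) le)
        -- K and H are incomparable and both contain G, so their join Z is a member. After
        -- multiplication by x_K the sum over N ⊇ H may be replaced by the sum over N ⊇ Z: every
        -- other such N is incomparable to K and contains G, hence x_K x_N lies in I.
        ... | no kh =
          let Z , Z𝒢 , kz , hz , least , bound , _ = b-join g (L𝒢 i) (L𝒢 h) gk gh kh hk in
          ⟨⟩-≋ (≋.*-congˡ (^-cong e (≋.sym (varSum-split L (H ⊆ᵇ_) (Z ⊆ᵇ_) (λ N zn → ⊆ᵇ⁺ H N (⊆-trans hz (⊆ᵇ⁻ Z N zn)))))))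
            (^-∈-mod isI (var i *ᵖ vars S) (up L Z) _ e
              (varSum-∈ L _ (colon isI (var i *ᵖ vars S)) λ {N} j fj →
                let hn = ⊆ᵇ⁻ H N (proj₁ (T-∧⁻ fj))
                    zn = T-not⁻ (proj₂ (T-∧⁻ {H ⊆ᵇ N} fj)) in
                ⟨⟩-≋ (solve 3 (λ s v w → s :* (v :* w) := (v :* s) :* w) ≋.refl (vars S) (var i) (var j))
                  (⟨⟩-* (vars S) (nonnested∈ i j g gk (⊆-trans gh hn)
                    (λ kn → zn (⊆ᵇ⁺ Z N (least (L𝒢 j) kn hn))) (λ nk → hk (⊆-trans hn nk)))))
              (absorb∈ i S (upper .closed i Z𝒢 kz) (ℕ.≤-trans (bound _ (sel𝒢 S T𝒢)) le)))

        module _ {G} (G𝒢 : 𝒢 G) (minimal : All (_⊈ G) L) where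
          private
            Y = up L G
            J = ⟨ Rel L (G ∷ T) ⟩

          I⊆J : ∀ {p} → I p → J p
          I⊆J = ⟨⟩-least ⟨⟩-isIdeal λ { (S , H , h , refl) → ^-∈ ⟨⟩-isIdeal (vars S) (up L H)
            (b-local (sel𝒢 S (G𝒢 ∷ T𝒢)) (sel𝒢 S T𝒢) (L𝒢 h)
              (λ j _ → [ ∈-++⁺ˡ , (λ k → ∈-++⁺ʳ (sel L S) (there k)) ]′ (∈-++⁻ (sel L S) j)))
            (gen (S , H , h , refl)) }

          -- Take a generator x_S (`up L H`)^e of J. If G is not below H, then choosing G does not
          -- change the exponent at H, and the generator is in I already. If G ⊊ H, write Y as
          -- `up L H` plus variables x_N with N ⊇ G and N ⊉ H. By `above∈` each such x_N carries the
          -- generator into I, so Y^b may be replaced by (`up L H`)^b, and by `b-drop` the exponent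
          -- e + b is large enough for I.
          Y^cJ⊆I : ∀ {p} → J p → I ((Y ^ᵖ b T G) *ᵖ p)
          Y^cJ⊆I = ⟨⟩-least (colon isI (Y ^ᵖ b T G)) (λ { (S , H , h , refl) → onRel S H h })
            where
            onRel : ∀ S H (h : H ∈ L) → I ((Y ^ᵖ b T G) *ᵖ (vars S *ᵖ (up L H ^ᵖ b (sel L S ++ G ∷ T) H)))
            onRel S H h with G ⊆? H
            ... | no gh  = ⟨⟩-* _ (rel∈ S h (b-local (sel𝒢 S T𝒢) (sel𝒢 S (G𝒢 ∷ T𝒢)) (L𝒢 h) strict))
              where
              strict : ∀ {x} → x ∈ sel L S ++ G ∷ T → x ⊊ H → x ∈ sel L S ++ T
              strict j xh with ∈-++⁻ (sel L S) j
              ... | inj₁ k           = ∈-++⁺ˡ k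
              ... | inj₂ (here refl) = ⊥-elim (gh (proj₁ xh))
              ... | inj₂ (there k)   = ∈-++⁺ʳ (sel L S) k
            ... | yes gh = ⟨⟩-≋ (≋.*-comm _ _) (⟨⟩-≋ (≋.*-congˡ (^-cong (b T G) (≋.sym
                  (varSum-split L (G ⊆ᵇ_) (H ⊆ᵇ_) (λ N hn → ⊆ᵇ⁺ G N (⊆-trans gh (⊆ᵇ⁻ H N hn)))))))
                (^-∈-mod isI (vars S *ᵖ (up L H ^ᵖ e)) (up L H) _ (b T G)
                  (varSum-∈ L _ (colon isI _) λ {N} j fj →
                    ⟨⟩-≋ (solve 3 (λ v s w → (v :* s) :* w := (s :* w) :* v) ≋.refl (var j) (vars S) (up L H ^ᵖ e))
                      (above∈ j S h G𝒢 (⊆ᵇ⁻ G N (proj₁ (T-∧⁻ fj))) gh (λ hn → T-not⁻ (proj₂ (T-∧⁻ {G ⊆ᵇ N} fj)) (⊆ᵇ⁺ H N hn)) swap≤))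
                  (⟨⟩-≋ (≋.trans (≋.*-congˡ (^-+ (up L H) e (b T G))) (≋.sym (≋.*-assoc (vars S) _ _)))
                    (rel∈ S h (ℕ.≤-trans (b-drop (sel𝒢 S T𝒢) G𝒢 (L𝒢 h) (gh , All.lookup minimal h))
                      (ℕ.+-mono-≤ swap≤ (b-local (sel𝒢 S T𝒢) T𝒢 G𝒢 (λ j _ → ∈-++⁺ʳ (sel L S) j))))))))
              where
              e = b (sel L S ++ G ∷ T) H
              swap≤ : b (G ∷ sel L S ++ T) H ≤ e
              swap≤ = b-local (G𝒢 ∷ sel𝒢 S T𝒢) (sel𝒢 S (G𝒢 ∷ T𝒢)) (L𝒢 h) (λ j _ → move (∈-++⁻ (sel L S) j))
                where
                move : ∀ {x} → x ∈ sel L S ⊎ x ∈ G ∷ T → x ∈ G ∷ sel L S ++ T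
                move (inj₁ k)           = there (∈-++⁺ˡ k)
                move (inj₂ (here refl)) = here refl
                move (inj₂ (there k))   = there (∈-++⁺ʳ (sel L S) k)

-- A basis of the Chow ring

Pointwise-++⁻ : ∀ {A B : Set} {R : A → B → Set} xs {ys zs} → Pointwise R (xs ++ ys) zs →
  ∃ λ us → ∃ λ vs → zs ≡ us ++ vs × Pointwise R xs us × Pointwise R ys vs
Pointwise-++⁻ [] p = [] , _ , refl , [] , p
Pointwise-++⁻ (x ∷ xs) (r ∷ p) = let us , vs , eq , a , b = Pointwise-++⁻ xs p in
  _ ∷ us , vs , cong (_ ∷_) eq , r ∷ a , b

module Basis {n : ℕ} {𝒢 : Subset n → Set} {b : List (Subset n) → Subset n → ℕ} (exps : Exponents 𝒢 b) where
  open Exponents exps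
  open Relations {n}

  -- The number is the degree in which the functional is supported; the functionals of each degree
  -- will be counted by it.
  Functional : ℕ → Set
  Functional k = ℕ × (Monomial k → ℚ)

  module Step {G L T} (upper : Upper exps (G ∷ L)) (T𝒢 : All 𝒢 T) where
    open Upper upper
    private
      Y = up L G
      tailU = Upper-tail exps upper
      G𝒢 : 𝒢 G
      G𝒢 = All.head ⊆𝒢
      minimal : All (_⊈ G) L
      minimal = AllPairs.head sorted
      T′𝒢 : All 𝒢 (G ∷ T)
      T′𝒢 = G𝒢 ∷ T𝒢
      sel𝒢 : ∀ S {T} → All 𝒢 T → All 𝒢 (sel L S ++ T)
      sel𝒢 S t = All.++⁺ (All.tabulate (λ i → All.lookup ⊆𝒢 (there (sel⊆ L S i)))) t
      L𝒢 : ∀ {K} → K ∈ L → 𝒢 K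
      L𝒢 i = All.lookup ⊆𝒢 (there i)
      I = ⟨ Rel exps L T ⟩
      J = ⟨ Rel exps L (G ∷ T) ⟩
      I′ = ⟨ Rel exps (G ∷ L) T ⟩
    open Taylor Y
    open Extension Y
    private
      module ≋ = CommutativeRing (polyRing {suc (length L)})

      up-head : up (G ∷ L) G ≡ u
      up-head with G ⊆? G
      ... | yes _ = refl
      ... | no ¬r = ⊥-elim (¬r ⊆-refl)

      up-tail : ∀ {H} → H ∈ L → up (G ∷ L) H ≡ ι (up L H)
      up-tail {H} h with H ⊆? G
      ... | yes le = ⊥-elim (All.lookup minimal h le)
      ... | no _   = refl

      into : ∀ S {H e} → H ∈ G ∷ L → b (sel (G ∷ L) S ++ T) H ≤ e → I′ (vars S *ᵖ (up (G ∷ L) H ^ᵖ e))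
      into S h le = ^-∈ ⟨⟩-isIdeal (vars S) _ le (gen (S , _ , h , refl))

      ι-rel : ∀ S {H} (h : H ∈ L) e → ι (vars S *ᵖ (up L H ^ᵖ e)) ≋ vars (false ∷ S) *ᵖ (up (G ∷ L) H ^ᵖ e)
      ι-rel S {H} h e = ≋.trans (ι-* (vars S) (up L H ^ᵖ e)) (≋.*-congˡ {ι (vars S)}
        (≋.trans (ι-^ (up L H) e) (≋.reflexive (cong (_^ᵖ e) (sym (up-tail h))))))

      x₀ι-rel : ∀ S {H} (h : H ∈ L) e → x₀ *ᵖ ι (vars S *ᵖ (up L H ^ᵖ e)) ≋ vars (true ∷ S) *ᵖ (up (G ∷ L) H ^ᵖ e)
      x₀ι-rel S {H} h e = ≋.trans (≋.*-congˡ {x₀} (ι-rel S h e)) (≋.sym (≋.*-assoc x₀ (ι (vars S)) (up (G ∷ L) H ^ᵖ e)))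

      ιI : ∀ {p} → I p → I′ (ι p)
      ιI = ⟨⟩-least (comap-ι ⟨⟩-isIdeal) λ { (S , H , h , refl) →
        ⟨⟩-≋ (≋.sym (ι-rel S h (b (sel L S ++ T) H))) (into (false ∷ S) (there h) ℕ.≤-refl) }

      b-swap : ∀ S {H} → 𝒢 H → b (G ∷ sel L S ++ T) H ≤ b (sel L S ++ G ∷ T) H
      b-swap S h = b-local (G𝒢 ∷ sel𝒢 S T𝒢) (sel𝒢 S T′𝒢) h (λ j _ → move (∈-++⁻ (sel L S) j))
        where
        move : ∀ {x} → x ∈ sel L S ⊎ x ∈ G ∷ T → x ∈ G ∷ sel L S ++ T
        move (inj₁ k)           = there (∈-++⁺ˡ k)
        move (inj₂ (here refl)) = here refl
        move (inj₂ (there k))   = there (∈-++⁺ʳ (sel L S) k)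

      b-swap′ : ∀ S {H} → 𝒢 H → b (sel L S ++ G ∷ T) H ≤ b (G ∷ sel L S ++ T) H
      b-swap′ S h = b-local (sel𝒢 S T′𝒢) (G𝒢 ∷ sel𝒢 S T𝒢) h move
        where
        move : ∀ {x} → x ∈ G ∷ sel L S ++ T → x ⊊ _ → x ∈ sel L S ++ G ∷ T
        move (here refl) _ = ∈-++⁺ʳ (sel L S) (here refl)
        move (there j) _ with ∈-++⁻ (sel L S) j
        ... | inj₁ k = ∈-++⁺ˡ k
        ... | inj₂ k = ∈-++⁺ʳ (sel L S) (there k)

      x₀J : ∀ {p} → J p → I′ (x₀ *ᵖ ι p)
      x₀J = ⟨⟩-least (comap-ι (colon ⟨⟩-isIdeal x₀)) λ { (S , H , h , refl) →
        ⟨⟩-≋ (≋.sym (x₀ι-rel S h (b (sel L S ++ G ∷ T) H))) (into (true ∷ S) (there h) (b-swap S (L𝒢 h))) }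

      u^∈ : I′ (u ^ᵖ b T G)
      u^∈ = ⟨⟩-≋ (≋.trans (≋.*-cong (vars-⊥ (suc (length L))) (≋.reflexive (cong (_^ᵖ b T G) up-head))) (≋.*-identityˡ (u ^ᵖ b T G)))
        (into ⊥ (here refl) (ℕ.≤-reflexive (cong (λ s → b (s ++ T) G) (sel-⊥ L))))

      I⊆ = I⊆J exps tailU T𝒢 G𝒢 minimal
      Y^cJ = Y^cJ⊆I exps tailU T𝒢 G𝒢 minimal

      I′-test : IsIdeal (Test (b T G) I J)
      I′-test = Test-isIdeal ⟨⟩-isIdeal ⟨⟩-isIdeal I⊆ (b T G) Y^cJ

      chosen-below : ∀ S {x} → x ⊊ G → x ∈ sel (G ∷ L) S ⊎ x ∈ T → x ∈ T
      chosen-below S x⊊G (inj₂ t) = t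
      chosen-below S x⊊G (inj₁ j) with sel⊆ (G ∷ L) S j
      ... | here refl = ⊥-elim (proj₂ x⊊G ⊆-refl)
      ... | there i   = ⊥-elim (All.lookup minimal i (proj₁ x⊊G))

      -- A relation at G itself is a multiple of u^b, as no list entry lies strictly below G and the
      -- choice S cannot change its exponent. A relation at a later H comes from I if G is not
      -- chosen, and from x₀ J if it is.
      rel-test : ∀ {p} → Rel exps (G ∷ L) T p → Test (b T G) I J p
      rel-test (S , H , here refl , refl) = IsIdeal.resp I′-test (≋.*-congˡ {vars S} (≋.reflexive (cong (_^ᵖ b (sel (G ∷ L) S ++ T) G) (sym up-head))))
        (^-∈ I′-test (vars S) u (b-local T𝒢 (All.++⁺ (All.tabulate λ i → All.lookup ⊆𝒢 (sel⊆ (G ∷ L) S i)) T𝒢) G𝒢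
            (λ j x⊊G → chosen-below S x⊊G (∈-++⁻ (sel (G ∷ L) S) j)))
          (Test-u^ ⟨⟩-isIdeal ⟨⟩-isIdeal I⊆ (b T G) (vars S)))
      rel-test (false ∷ S , H , there h , refl) = IsIdeal.resp I′-test (ι-rel S h (b (sel L S ++ T) H))
        (Test-ι ⟨⟩-isIdeal ⟨⟩-isIdeal I⊆ (b T G) (gen (S , H , h , refl)))
      rel-test (true ∷ S , H , there h , refl) = IsIdeal.resp I′-test (x₀ι-rel S h (b (G ∷ sel L S ++ T) H))
        (Test-x₀ι ⟨⟩-isIdeal ⟨⟩-isIdeal I⊆ (b T G) Y^cJ
          (^-∈ ⟨⟩-isIdeal (vars S) (up L H) (b-swap′ S (L𝒢 h)) (gen (S , H , h , refl))))

    step⇒ : ∀ {p} → I′ p → Test (b T G) I J p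
    step⇒ = ⟨⟩-least I′-test rel-test

    step⇐ : ∀ {p} → Test (b T G) I J p → I′ p
    step⇐ = Test⇒ ⟨⟩-isIdeal ⟨⟩-isIdeal ⟨⟩-isIdeal ιI x₀J (b T G) u^∈

  module _ {k : ℕ} (Y : Poly k) where
    open Taylor Y

    -- The transpose of multiplication by Y^j, one summand of the transpose `at₀` of `tay₀`.
    weighted : (Monomial k → ℚ) → ℕ → Monomial k → ℚ
    weighted φ j m = eval (λ m′ → φ (m ∙ m′)) (Y ^ᵖ j)

    at₀ : ℕ → (Monomial k → ℚ) → Monomial (suc k) → ℚ
    at₀ zero φ m    = 0ℚ
    at₀ (suc c) φ m = at₀ c φ m ℚ.+ (weighted φ c ▹ c) m

    eval-at₀ : ∀ c φ p → eval (at₀ c φ) p ≡ eval φ (tay₀ c p)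
    eval-at₀ zero φ p    = trans (eval-0 p (λ _ → refl)) (sym (eval-[] φ))
    eval-at₀ (suc c) φ p = trans (eval-+ (at₀ c φ) _ p) (trans (cong₂ ℚ._+_ (eval-at₀ c φ p)
        (trans (sym (eval-q (weighted φ c) c p)) (sym (eval-*ᵖ φ (q c p) (Y ^ᵖ c)))))
      (sym (eval-+ᵖ φ (tay₀ c p) (q c p *ᵖ (Y ^ᵖ c)))))

    base : ℕ → Functional k → Functional (suc k)
    base c (e , φ) = e , at₀ c φ

    layer : ℕ → Functional k → Functional (suc k)
    layer j (e , φ) = suc j ℕ.+ e , φ ▹ suc j

    layers : ℕ → List (Functional k) → List (Functional (suc k))
    layers zero Φ    = []
    layers (suc c) Φ = layers c Φ ++ map (layer c) Φ

    -- Dual to the direct sum Q(L,T) ⊕ ⨁ x_G^i Q(L, G ∷ T): `base` tests the value at x₀ = 0, and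
    -- `layer j` tests the coefficient of u^(j+1), which shifts degrees by j + 1. Exponent 0 makes
    -- the ideal everything and leaves no functional.
    extend : ℕ → List (Functional k) → List (Functional k) → List (Functional (suc k))
    extend zero Φ Ψ    = []
    extend (suc c) Φ Ψ = map (base (suc c)) Φ ++ layers c Ψ

  -- Graded functionals whose common kernel is the ideal and which form a basis of the dual of the quotient.
  duals : (L T : List (Subset n)) → List (Functional (length L))
  duals [] T      = (0 , λ _ → 1ℚ) ∷ []
  duals (G ∷ L) T = extend (up L G) (b T G) (duals L T) (duals L (G ∷ T))

  Kills : ∀ {k} → Poly k → Functional k → Set
  Kills p f = eval (proj₂ f) p ≡ 0ℚ

  module _ {k} (Y : Poly k) where
    open Taylor Y
    open Extension Y

    layers⇒ : ∀ c Ψ p → (∀ j → j < c → All (Kills (q (suc j) p)) Ψ) → All (Kills p) (layers Y c Ψ)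
    layers⇒ zero Ψ p h    = []
    layers⇒ (suc c) Ψ p h = All.++⁺ (layers⇒ c Ψ p (λ j lt → h j (ℕ.m≤n⇒m≤1+n lt)))
      (All.map⁺ (All.map (λ {f} eq → trans (sym (eval-q (proj₂ f) (suc c) p)) eq) (h c ℕ.≤-refl)))

    layers⇐ : ∀ c Ψ p → All (Kills p) (layers Y c Ψ) → ∀ j → j < c → All (Kills (q (suc j) p)) Ψ
    layers⇐ (suc c) Ψ p a j (s≤s j≤c) with All.++⁻ (layers Y c Ψ) a | ℕ.m≤n⇒m<n∨m≡n j≤c
    ... | l , _ | inj₁ lt   = layers⇐ c Ψ p l j lt
    ... | _ , r | inj₂ refl = All.map (λ {f} eq → trans (eval-q (proj₂ f) (suc j) p) eq) (All.map⁻ r)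

    extend⇒ : ∀ c Φ Ψ {I J : Poly k → Set} → (∀ {p} → I p → All (Kills p) Φ) → (∀ {p} → J p → All (Kills p) Ψ) →
      ∀ {p} → Test c I J p → All (Kills p) (extend Y c Φ Ψ)
    extend⇒ zero Φ Ψ f g t              = []
    extend⇒ (suc c) Φ Ψ f g {p} (i , j) = All.++⁺
      (All.map⁺ (All.map (λ {φ} eq → trans (eval-at₀ Y (suc c) (proj₂ φ) p) eq) (f i)))
      (layers⇒ c Ψ p (λ l lt → g (j l lt)))

    extend⇐ : ∀ c Φ Ψ {I J : Poly k → Set} → (∀ {p} → All (Kills p) Φ → I p) → (∀ {p} → All (Kills p) Ψ → J p) →
      ∀ {p} → All (Kills p) (extend Y c Φ Ψ) → Test c I J p
    extend⇐ zero Φ Ψ f g a        = tt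
    extend⇐ (suc c) Φ Ψ f g {p} a = let l , r = All.++⁻ (map (base Y (suc c)) Φ) a in
      f (All.map (λ {φ} eq → trans (sym (eval-at₀ Y (suc c) (proj₂ φ) p)) eq) (All.map⁻ l)) ,
      λ j lt → g (layers⇐ c Ψ p r j lt)

  ⟨Rel⟩⇒kills : ∀ {L T} → Upper exps L → All 𝒢 T → ∀ {p} → ⟨ Rel exps L T ⟩ p → All (Kills p) (duals L T)
  ⟨Rel⟩⇒kills {[]} {T} U t i = ⟨⟩-least
    record { zero∈ = eval-[] _ ; +∈ = λ {p} {q} a b → trans (eval-+ᵖ _ p q) (cong₂ ℚ._+_ a b)
           ; *∈ = λ r {p} a → trans (eval-*ᵖ _ r p) (eval-0 r (λ _ → a))
           ; resp = λ e a → trans (sym (e .on _)) a }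
    (λ { (S , H , () , _) }) i ∷ []
  ⟨Rel⟩⇒kills {G ∷ L} {T} U t i = extend⇒ (up L G) (b T G) (duals L T) (duals L (G ∷ T))
    (⟨Rel⟩⇒kills (Upper-tail exps U) t) (⟨Rel⟩⇒kills (Upper-tail exps U) (All.head (Upper.⊆𝒢 U) ∷ t)) (Step.step⇒ U t i)

  kills⇒⟨Rel⟩ : ∀ {L T} → Upper exps L → All 𝒢 T → ∀ {p} → All (Kills p) (duals L T) → ⟨ Rel exps L T ⟩ p
  kills⇒⟨Rel⟩ {[]} {T} U t {p} (h ∷ []) = ⟨⟩-≋ (≋-by λ φ → trans (eval-[] φ) (sym (constant φ))) ⟨⟩-0
    where
    constant : ∀ φ → eval φ p ≡ 0ℚ
    constant φ = trans (eval-cong p (λ { [] → sym (ℚ.*-identityʳ (φ [])) })) (trans (eval-scale (λ _ → 1ℚ) (φ []) p)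
      (trans (cong (φ [] ℚ.*_) h) (ℚ.*-zeroʳ (φ []))))
  kills⇒⟨Rel⟩ {G ∷ L} {T} U t a = Step.step⇐ U t (extend⇐ (up L G) (b T G) (duals L T) (duals L (G ∷ T))
    (kills⇒⟨Rel⟩ (Upper-tail exps U) t) (kills⇒⟨Rel⟩ (Upper-tail exps U) (All.head (Upper.⊆𝒢 U) ∷ t)) a)

-- Grading and independence of the dual functionals

degree-∙ : ∀ {k} (m m′ : Monomial k) → degree (m ∙ m′) ≡ degree m ℕ.+ degree m′
degree-∙ [] []             = refl
degree-∙ (a ∷ m) (b ∷ m′) = trans (cong (a ℕ.+ b ℕ.+_) (degree-∙ m m′)) (lem a b (degree m) (degree m′))
  where
  open import Data.Nat.Tactic.RingSolver using (solve-∀)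
  lem : ∀ a b c d → a ℕ.+ b ℕ.+ (c ℕ.+ d) ≡ a ℕ.+ c ℕ.+ (b ℕ.+ d)
  lem = solve-∀

degree-1 : ∀ k → degree (Vec.replicate k 0) ≡ 0
degree-1 zero    = refl
degree-1 (suc k) = degree-1 k

module _ {k : ℕ} where

  eval-vanish : ∀ {φ} {p : Poly k} → All (λ t → φ (proj₂ t) ≡ 0ℚ) p → eval φ p ≡ 0ℚ
  eval-vanish {φ} []                      = eval-[] φ
  eval-vanish {φ} (_∷_ {c , m} {p} eq a) = trans (eval-∷ φ c m p)
    (trans (cong₂ ℚ._+_ (trans (cong (c ℚ.*_) eq) (ℚ.*-zeroʳ c)) (eval-vanish a)) refl)

  Terms : (Monomial k → Set) → Poly k → Set
  Terms P = All (P ∘ proj₂)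

  Terms-+ : ∀ {P p q} → Terms P p → Terms P q → Terms P (p +ᵖ q)
  Terms-+ {P} {p} {q} a b = subst (Terms P) (sym (+ᵖ≡+P p q)) (All.++⁺ a b)

  Terms-neg : ∀ {P p} → Terms P p → Terms P (-ᵖ p)
  Terms-neg {P} {p} a = subst (Terms P) (sym (-ᵖ≡-P p)) (All.map⁺ (All.map id a))

  Terms-* : ∀ {P Q R p q} → (∀ {m m′} → P m → Q m′ → R (m ∙ m′)) → Terms P p → Terms Q q → Terms R (p *ᵖ q)
  Terms-* {P} {Q} {R} {p} {q} h a b = subst (Terms R) (sym (*ᵖ≡*P p q)) (go a)
    where
    go : ∀ {p} → Terms P p → Terms R (p *P q)
    go []       = []
    go (x ∷ a) = All.++⁺ (All.map⁺ (All.map (h x) b)) (go a)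

  Terms-1 : ∀ {P} → P (Vec.replicate k 0) → Terms P (1P {k})
  Terms-1 h = h ∷ []

  AllDegree-^ : ∀ {p : Poly k} → AllDegree 1 p → ∀ c → AllDegree c (p ^ᵖ c)
  AllDegree-^ a zero    = degree-1 k ∷ []
  AllDegree-^ a (suc c) = Terms-* (λ {m} {m′} x y → trans (degree-∙ m m′) (cong₂ ℕ._+_ x y)) a (AllDegree-^ a c)

  -- Support in degree e - s. The additive form makes s > e mean that φ is zero.
  Vanishing : ℕ → ℕ → (Monomial k → ℚ) → Set
  Vanishing s e φ = ∀ m → degree m ℕ.+ s ≢ e → φ m ≡ 0ℚ

module _ {k : ℕ} (Y : Poly k) (Y₁ : AllDegree 1 Y) where
  open Taylor Y

  τ-degree : ∀ i m → Terms (λ β → degree β ℕ.+ i ≡ m) (τ i m)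
  τ-degree zero zero       = Terms-1 (trans (ℕ.+-identityʳ _) (degree-1 k))
  τ-degree (suc i) zero    = []
  τ-degree zero (suc m)    = Terms-* (λ {β} {γ} x y → trans (cong (ℕ._+ 0) (trans (degree-∙ β γ) (cong (ℕ._+ degree γ) x))) (cong suc y))
    (Terms-neg Y₁) (τ-degree zero m)
  τ-degree (suc i) (suc m) = Terms-+ (All.map (λ {t} x → trans (ℕ.+-suc _ i) (cong suc x)) (τ-degree i m))
    (Terms-* (λ {β} {γ} x y → trans (cong (ℕ._+ suc i) (trans (degree-∙ β γ) (cong (ℕ._+ degree γ) x))) (cong suc y))
      (Terms-neg Y₁) (τ-degree (suc i) m))

  ▹-vanishing : ∀ {s e ψ} i → Vanishing s e ψ → Vanishing s (i ℕ.+ e) (ψ ▹ i)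
  ▹-vanishing {s} {e} {ψ} i h (m ∷ β) ne = eval-vanish (All.map (λ {t} → vanish {t})
      (Terms-* {P = β ≡_} {R = λ γ → degree γ ℕ.+ i ≡ m ℕ.+ degree β} shift (refl ∷ []) (τ-degree i m)))
    where
    open import Data.Nat.Tactic.RingSolver using (solve-∀)
    lem₁ : ∀ a b c → a ℕ.+ b ℕ.+ c ≡ b ℕ.+ c ℕ.+ a
    lem₁ = solve-∀
    lem₂ : ∀ a s i → a ℕ.+ i ℕ.+ s ≡ i ℕ.+ (a ℕ.+ s)
    lem₂ = solve-∀
    shift : ∀ {b γ} → β ≡ b → degree γ ℕ.+ i ≡ m → degree (b ∙ γ) ℕ.+ i ≡ m ℕ.+ degree β
    shift {γ = γ} refl eq = trans (cong (ℕ._+ i) (degree-∙ β γ)) (trans (lem₁ (degree β) (degree γ) i) (cong (ℕ._+ degree β) eq))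
    vanish : ∀ {t} → degree (proj₂ t) ℕ.+ i ≡ m ℕ.+ degree β → ψ (proj₂ t) ≡ 0ℚ
    vanish {_ , γ} eq = h γ λ eq′ → ne (trans (cong (ℕ._+ s) (sym eq)) (trans (lem₂ (degree γ) s i) (cong (i ℕ.+_) eq′)))

module _ {n : ℕ} {𝒢 : Subset n → Set} {b : List (Subset n) → Subset n → ℕ} (exps : Exponents 𝒢 b) where
  open Basis exps
  open Relations {n}

  varSum-degree : ∀ (L : List (Subset n)) f → AllDegree 1 (varSum L f)
  varSum-degree [] f      = []
  varSum-degree (G ∷ L) f with f G
  ... | true  = Terms-+ (cong suc (degree-1 (length L)) ∷ []) (All.map⁺ (varSum-degree L f))
  ... | false = All.map⁺ (varSum-degree L f)

  GradedBy : ∀ {k} → Functional k → Set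
  GradedBy f = Vanishing 0 (proj₁ f) (proj₂ f)

  module _ {k} {Y : Poly k} (Y₁ : AllDegree 1 Y) where
    open Taylor Y

    weighted-vanishing : ∀ {e φ} j → Vanishing 0 e φ → Vanishing j e (weighted Y φ j)
    weighted-vanishing {e} {φ} j h m ne = eval-vanish (All.map
      (λ {t} eq → h (m ∙ proj₂ t) (λ eq′ → ne (trans (cong (degree m ℕ.+_) (sym eq))
        (trans (sym (degree-∙ m (proj₂ t))) (trans (sym (ℕ.+-identityʳ _)) eq′)))))
      (AllDegree-^ Y₁ j))

    base-graded : ∀ c {f : Functional k} → GradedBy f → GradedBy (base Y c f)
    base-graded zero h m ne        = refl
    base-graded (suc c) {e , φ} h m ne = trans (cong₂ ℚ._+_ (base-graded c {e , φ} h m ne)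
      (▹-vanishing Y Y₁ c (weighted-vanishing c h) m
        (λ eq → ne (trans (ℕ.+-identityʳ _) (ℕ.+-cancelʳ-≡ c _ _ (trans eq (ℕ.+-comm c e))))))) refl

    layers-graded : ∀ c {Ψ : List (Functional k)} → All GradedBy Ψ → All GradedBy (layers Y c Ψ)
    layers-graded zero a    = []
    layers-graded (suc c) a = All.++⁺ (layers-graded c a) (All.map⁺ (All.map (λ h → ▹-vanishing Y Y₁ (suc c) h) a))

    extend-graded : ∀ c {Φ Ψ : List (Functional k)} → All GradedBy Φ → All GradedBy Ψ → All GradedBy (extend Y c Φ Ψ)
    extend-graded zero a c    = []
    extend-graded (suc c) a d = All.++⁺ (All.map⁺ (All.map (base-graded (suc c)) a)) (layers-graded c d)

  duals-graded : ∀ L T → All GradedBy (duals L T)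
  duals-graded [] T      = (λ { [] ne → ⊥-elim (ne refl) }) ∷ []
  duals-graded (G ∷ L) T = extend-graded (varSum-degree L _) (b T G) (duals-graded L T) (duals-graded L (G ∷ T))

  Target : ∀ {k} → ℕ → Functional k → ℚ → Set
  Target d f v = v ≡ 0ℚ ⊎ proj₁ f ≡ d

  Hits : ∀ {k} → Poly k → Functional k → ℚ → Set
  Hits p f v = eval (proj₂ f) p ≡ v

  -- Linear independence of the functionals in graded form: arbitrary values on those of degree d,
  -- with zero on the others, are realized by a polynomial of degree d.
  Attains : ∀ {k} → List (Functional k) → Set
  Attains {k} Φ = ∀ d {vs} → Pointwise (Target d) Φ vs → ∃ λ (p : Poly k) → AllDegree d p × Pointwise (Hits p) Φ vs

  module _ {k} {Y : Poly k} (Y₁ : AllDegree 1 Y) where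
    open Taylor Y
    open Extension Y
    private
      module ≋ = CommutativeRing (polyRing {k})

    fromTaylor : ℕ → (ℕ → Poly k) → Poly (suc k)
    fromTaylor zero a    = 0P
    fromTaylor (suc c) a = ι (a 0) +ᵖ u *ᵖ fromTaylor c (a ∘ suc)

    q-fromTaylor : ∀ {i c} a → i < c → q i (fromTaylor c a) ≋ a i
    q-fromTaylor {zero} {suc c} a _        = ≋.trans (q-++ 0 (ι (a 0)) _) (≋.trans
      (≋.+-cong (≋.trans (q-ι 0 (a 0)) (≋.*-identityʳ (a 0))) (q-u*-zero (fromTaylor c (a ∘ suc)))) (≋.+-identityʳ (a 0)))
    q-fromTaylor {suc i} {suc c} a (s≤s lt) = ≋.trans (q-++ (suc i) (ι (a 0)) _) (≋.trans
      (≋.+-cong (≋.trans (q-ι (suc i) (a 0)) (≋.zeroʳ (a 0))) (≋.trans (q-u*-suc i (fromTaylor c (a ∘ suc))) (q-fromTaylor (a ∘ suc) lt)))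
      (≋.+-identityˡ (a (suc i))))

    fromTaylor-degree : ∀ c {a s d} → (∀ j → Terms (λ m → degree m ℕ.+ (s ℕ.+ j) ≡ d) (a j)) →
      Terms (λ m → degree m ℕ.+ s ≡ d) (fromTaylor c a)
    fromTaylor-degree zero h    = []
    fromTaylor-degree (suc c) {a} {s} {d} h = Terms-+
      (All.map⁺ (All.map (λ {t} eq → trans (cong (degree (proj₂ t) ℕ.+_) (sym (ℕ.+-identityʳ s))) eq) (h 0)))
      (Terms-* (λ {β} {γ} x y → trans (cong (ℕ._+ s) (trans (degree-∙ β γ) (cong (ℕ._+ degree γ) x))) (trans (sym (ℕ.+-suc (degree γ) s)) y))
        (Terms-+ (cong suc (degree-1 k) ∷ []) (All.map⁺ Y₁))
        (fromTaylor-degree c {a ∘ suc} {suc s} (λ j → All.map (λ {t} eq → trans (cong (degree (proj₂ t) ℕ.+_) (sym (ℕ.+-suc s j))) eq) (h (suc j)))))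

    at0 : ℕ → (ℕ → Poly k) → Poly k
    at0 zero a    = 0P
    at0 (suc c) a = at0 c a +ᵖ (a c *ᵖ (Y ^ᵖ c))

    tay₀-fromTaylor : ∀ c a {c′} → c ≤ c′ → tay₀ c (fromTaylor c′ a) ≋ at0 c a
    tay₀-fromTaylor zero a le    = ≋.refl
    tay₀-fromTaylor (suc c) a le = ≋.+-cong (tay₀-fromTaylor c a (ℕ.≤-trans (ℕ.n≤1+n c) le)) (≋.*-congʳ (q-fromTaylor a le))

    layers-attain : ∀ {Ψ} → Attains Ψ → ∀ c {d vs} → Pointwise (Target d) (layers Y c Ψ) vs →
      ∃ λ (a : ℕ → Poly k) → (∀ j → Terms (λ m → degree m ℕ.+ suc j ≡ d) (a j)) ×
        (∀ p → (∀ j → j < c → q (suc j) p ≋ a j) → Pointwise (Hits p) (layers Y c Ψ) vs)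
    layers-attain att zero []    = (λ _ → 0P) , (λ _ → []) , λ _ _ → []
    layers-attain {Ψ} att (suc c) {d} pw with Pointwise-++⁻ (layers Y c Ψ) pw
    ... | us , ws , refl , pu , pv = a′ , deg′ , hits′
      where
      prev = layers-attain att c pu
      new : ∃ λ p → Terms (λ m → degree m ℕ.+ suc c ≡ d) p × Pointwise (Hits p) Ψ ws
      new with suc c ℕ.≤? d
      ... | yes le = let p , dp , hp = att (d ∸ suc c) (Pointwise.map (λ { (inj₁ z) → inj₁ z ; (inj₂ e) →
                           inj₂ (trans (sym (ℕ.m+n∸m≡n (suc c) _)) (cong (_∸ suc c) e)) }) (Pointwise.map⁻ (layer Y c) id (subst (Pointwise _ _) (sym (List.map-id ws)) pv)))
                     in p , All.map (λ e → trans (cong (ℕ._+ suc c) e) (ℕ.m∸n+n≡m le)) dp , hp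
      -- Every functional of this layer has degree at least c + 1 > d, so all prescribed values are
      -- zero.
      ... | no gt  = 0P , [] , Pointwise.map (λ { (inj₁ z) → trans (eval-[] _) (sym z) ; (inj₂ e) → ⊥-elim (gt (subst (suc c ≤_) e (ℕ.m≤m+n (suc c) _))) })
                       (Pointwise.map⁻ (layer Y c) id (subst (Pointwise _ _) (sym (List.map-id ws)) pv))
      a′ : ℕ → Poly k
      a′ j with j ℕ.≟ c
      ... | yes _ = proj₁ new
      ... | no _  = proj₁ prev j
      deg′ : ∀ j → Terms (λ m → degree m ℕ.+ suc j ≡ d) (a′ j)
      deg′ j with j ℕ.≟ c
      ... | yes refl = proj₁ (proj₂ new)
      ... | no _     = proj₁ (proj₂ prev) j
      a′-new : a′ c ≡ proj₁ new
      a′-new with c ℕ.≟ c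
      ... | yes _ = refl
      ... | no ne = ⊥-elim (ne refl)
      a′-prev : ∀ j → j < c → a′ j ≡ proj₁ prev j
      a′-prev j lt with j ℕ.≟ c
      ... | yes refl = ⊥-elim (ℕ.<-irrefl refl lt)
      ... | no _     = refl
      hits′ : ∀ p → (∀ j → j < suc c → q (suc j) p ≋ a′ j) → Pointwise (Hits p) (layers Y c Ψ ++ map (layer Y c) Ψ) (us ++ ws)
      hits′ p h = Pointwise.++⁺ (proj₂ (proj₂ prev) p (λ j lt → ≋.trans (h j (ℕ.m≤n⇒m≤1+n lt)) (≋.reflexive (a′-prev j lt))))
        (subst (Pointwise _ _) (List.map-id ws) (Pointwise.map⁺ (layer Y c) id (Pointwise.map
          (λ {f} eq → trans (sym (eval-q (proj₂ f) (suc c) p)) (trans (≋.trans (h c ℕ.≤-refl) (≋.reflexive a′-new) .on (proj₂ f)) eq)) (proj₂ (proj₂ new)))))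

    extend-attains : ∀ c {Φ Ψ} → Attains Φ → Attains Ψ → Attains (extend Y c Φ Ψ)
    extend-attains zero attΦ attΨ d []    = 0P , [] , []
    extend-attains (suc c) {Φ} {Ψ} attΦ attΨ d pw with Pointwise-++⁻ (map (base Y (suc c)) Φ) pw
    ... | us , ws , refl , pu , pv = p , All.map (λ eq → trans (sym (ℕ.+-identityʳ _)) eq) (fromTaylor-degree (suc c) {A} {0} deg) ,
          Pointwise.++⁺ (subst (Pointwise _ _) (List.map-id us) (Pointwise.map⁺ (base Y (suc c)) id (Pointwise.map
              (λ {f} eq → trans (eval-at₀ Y (suc c) (proj₂ f) p) (trans (≋.trans (tay₀-fromTaylor (suc c) A ℕ.≤-refl) A-sum .on (proj₂ f)) eq)) hits₀)))
            (proj₂ (proj₂ lay) p (λ j lt → q-fromTaylor A (s≤s lt)))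
      where
      bottom = attΦ d (Pointwise.map⁻ (base Y (suc c)) id (subst (Pointwise _ _) (sym (List.map-id us)) pu))
      e₀ = proj₁ bottom
      hits₀ = proj₂ (proj₂ bottom)
      lay = layers-attain attΨ c pv
      a = proj₁ lay
      R : ℕ → Poly k
      R zero    = 0P
      R (suc j) = R j +ᵖ (a j *ᵖ (Y ^ᵖ suc j))
      R-degree : ∀ j → AllDegree d (R j)
      R-degree zero    = []
      R-degree (suc j) = Terms-+ (R-degree j) (Terms-* (λ {β} {γ} x y → trans (degree-∙ β γ) (trans (cong (degree β ℕ.+_) y) x))
        (proj₁ (proj₂ lay) j) (AllDegree-^ Y₁ (suc j)))
      A : ℕ → Poly k
      -- The base functionals see all coefficients, through the value at x₀ = 0. The contribution
      -- `R c` of the higher ones, already fixed by the layers, is subtracted here so that this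
      -- value is `e₀`.
      A zero    = e₀ +ᵖ (-ᵖ R c)
      A (suc j) = a j
      p = fromTaylor (suc c) A
      deg : ∀ j → Terms (λ m → degree m ℕ.+ j ≡ d) (A j)
      deg zero    = All.map (λ eq → trans (ℕ.+-identityʳ _) eq) (Terms-+ (proj₁ (proj₂ bottom)) (Terms-neg (R-degree c)))
      deg (suc j) = proj₁ (proj₂ lay) j
      A-sums : ∀ j → at0 (suc j) A ≋ A 0 +ᵖ R j
      A-sums zero    = ≋.trans (≋.+-identityˡ _) (≋.trans (≋.*-identityʳ (A 0)) (≋.sym (≋.+-identityʳ (A 0))))
      A-sums (suc j) = ≋.trans (≋.+-congʳ (A-sums j)) (≋.+-assoc (A 0) (R j) _)
      A-sum : at0 (suc c) A ≋ e₀
      A-sum = ≋.trans (A-sums c) (≋.trans (≋.+-assoc e₀ (-ᵖ R c) (R c)) (≋.trans (≋.+-congˡ (≋.-‿inverseˡ (R c))) (≋.+-identityʳ e₀)))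

  duals-attain : ∀ L T → Attains (duals L T)
  duals-attain [] T d (inj₁ refl ∷ []) = [] , [] , eval-[] _ ∷ []
  duals-attain [] T .0 (_∷_ {y = v} (inj₂ refl) []) = (v , []) ∷ [] , refl ∷ [] ,
    trans (eval-∷ _ v [] []) (trans (cong₂ ℚ._+_ (ℚ.*-identityʳ v) (eval-[] _)) (ℚ.+-identityʳ v)) ∷ []
  duals-attain (G ∷ L) T = extend-attains (varSum-degree L _) (b T G) (duals-attain L T) (duals-attain L (G ∷ T))

-- Dimension counts

dot : ∀ {r} → Vec ℚ r → Vec ℚ r → ℚ
dot [] []               = 0ℚ
dot (a ∷ as) (c ∷ cs) = a ℚ.* c ℚ.+ dot as cs

private
  module ℚSolver where
    open import Data.Rational.Solver using (module +-*-Solver)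
    open +-*-Solver

    cancel : ∀ h D → h ℚ.* (ℚ.- D) ℚ.+ h ℚ.* D ≡ 0ℚ
    cancel = solve 2 (λ h D → h :* (:- D) :+ h :* D := con 0ℚ) refl

    eliminate : ∀ h s D E → s ℚ.* (ℚ.- D) ℚ.+ h ℚ.* E ≡ h ℚ.* E ℚ.+ (ℚ.- s) ℚ.* D
    eliminate = solve 4 (λ h s D E → s :* (:- D) :+ h :* E := h :* E :+ (:- s) :* D) refl

    combine : ∀ h s a b c x y → (h ℚ.* a ℚ.+ (ℚ.- s) ℚ.* b) ℚ.* c ℚ.+ (h ℚ.* x ℚ.+ (ℚ.- s) ℚ.* y) ≡ h ℚ.* (a ℚ.* c ℚ.+ x) ℚ.+ (ℚ.- s) ℚ.* (b ℚ.* c ℚ.+ y)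
    combine = solve 7 (λ h s a b c x y → (h :* a :+ (:- s) :* b) :* c :+ (h :* x :+ (:- s) :* y) := h :* (a :* c :+ x) :+ (:- s) :* (b :* c :+ y)) refl

    scale : ∀ h a c x → a ℚ.* (h ℚ.* c) ℚ.+ h ℚ.* x ≡ h ℚ.* (a ℚ.* c ℚ.+ x)
    scale = solve 4 (λ h a c x → a :* (h :* c) :+ h :* x := h :* (a :* c :+ x)) refl

    regroup : ∀ v e c E d D → v ℚ.* (e ℚ.* c ℚ.+ E) ℚ.+ (d ℚ.* c ℚ.+ D) ≡ (v ℚ.* e ℚ.+ d) ℚ.* c ℚ.+ (v ℚ.* E ℚ.+ D)
    regroup = solve 6 (λ v e c E d D → v :* (e :* c :+ E) :+ (d :* c :+ D) := (v :* e :+ d) :* c :+ (v :* E :+ D)) refl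

dot-scaleʳ : ∀ {r} h (as cs : Vec ℚ r) → dot as (Vec.map (h ℚ.*_) cs) ≡ h ℚ.* dot as cs
dot-scaleʳ h [] []             = sym (ℚ.*-zeroʳ h)
dot-scaleʳ h (a ∷ as) (c ∷ cs) = trans (cong (a ℚ.* (h ℚ.* c) ℚ.+_) (dot-scaleʳ h as cs)) (ℚSolver.scale h a c (dot as cs))

dot-combine : ∀ {r} h s (as bs cs : Vec ℚ r) →
  dot (Vec.zipWith (λ a b → h ℚ.* a ℚ.+ (ℚ.- s) ℚ.* b) as bs) cs ≡ h ℚ.* dot as cs ℚ.+ (ℚ.- s) ℚ.* dot bs cs
dot-combine h s [] [] []                   = sym (trans (cong₂ ℚ._+_ (ℚ.*-zeroʳ h) (ℚ.*-zeroʳ (ℚ.- s))) refl)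
dot-combine h s (a ∷ as) (b ∷ bs) (c ∷ cs) = trans (cong ((h ℚ.* a ℚ.+ (ℚ.- s) ℚ.* b) ℚ.* c ℚ.+_) (dot-combine h s as bs cs)) (ℚSolver.combine h s a b c (dot as cs) (dot bs cs))

dot-zeroʳ : ∀ {r} (as : Vec ℚ r) → dot as (Vec.replicate r 0ℚ) ≡ 0ℚ
dot-zeroʳ []       = refl
dot-zeroʳ (a ∷ as) = trans (cong₂ ℚ._+_ (ℚ.*-zeroʳ a) (dot-zeroʳ as)) refl

*-≢0 : ∀ {p q} → p ≢ 0ℚ → q ≢ 0ℚ → p ℚ.* q ≢ 0ℚ
*-≢0 {p} {q} p≢0 q≢0 eq = q≢0 (trans (sym (ℚ.*-identityˡ q)) (trans (cong (ℚ._* q) (sym (ℚ.*-inverseˡ p)))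
  (trans (ℚ.*-assoc (ℚ.1/ p) p q) (trans (cong (ℚ.1/ p ℚ.*_) eq) (ℚ.*-zeroʳ (ℚ.1/ p))))))
  where instance _ = ℚ.≢-nonZero p≢0

pivot : ∀ {r} (rows : List (Vec ℚ (suc r))) → All (λ ρ → Vec.head ρ ≡ 0ℚ) rows ⊎
  ∃ λ xs → ∃ λ ρ → ∃ λ ys → rows ≡ xs ++ ρ ∷ ys × Vec.head ρ ≢ 0ℚ
pivot [] = inj₁ []
pivot (ρ ∷ rows) with Vec.head ρ ℚ.≟ 0ℚ | pivot rows
... | no ne | _                                = inj₂ ([] , ρ , rows , refl , ne)
... | yes e | inj₁ a                           = inj₁ (e ∷ a)
... | yes e | inj₂ (xs , σ , ys , eq , ne)     = inj₂ (ρ ∷ xs , σ , ys , cong (ρ ∷_) eq , ne)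

-- Elimination without division. With a pivot row (h, t), each other row (s, σ) becomes h σ - s t,
-- and a solution c′ of the reduced system lifts to (-t·c′, h c′), which is nonzero because h is.
nontrivial-solution : ∀ {r} (rows : List (Vec ℚ r)) → length rows < r →
  ∃ λ c → (∃ λ j → Vec.lookup c j ≢ 0ℚ) × All (λ ρ → dot ρ c ≡ 0ℚ) rows
nontrivial-solution {suc r} rows (s≤s lt) with pivot rows
... | inj₁ a = 1ℚ ∷ Vec.replicate r 0ℚ , (zero , λ ()) ,
      All.map (λ { {h ∷ t} eq → trans (cong₂ ℚ._+_ (trans (cong (ℚ._* 1ℚ) eq) refl) (dot-zeroʳ t)) refl }) a
... | inj₂ (xs , h ∷ t , ys , refl , h≢0) =
      (ℚ.- D) ∷ Vec.map (h ℚ.*_) c′ ,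
      (suc (proj₁ nz) , λ eq → *-≢0 h≢0 (proj₂ nz) (trans (sym (Vec.lookup-map (proj₁ nz) (h ℚ.*_) c′)) eq)) ,
      All.++⁺ (solved xs (All.++⁻ˡ (map reduce xs) zeros)) (pivotRow ∷ solved ys (All.++⁻ʳ (map reduce xs) zeros))
  where
  reduce : Vec ℚ (suc r) → Vec ℚ r
  reduce (s ∷ σ) = Vec.zipWith (λ a b → h ℚ.* a ℚ.+ (ℚ.- s) ℚ.* b) σ t
  count : length (map reduce xs ++ map reduce ys) < r
  count = subst (_< r) (sym (trans (List.length-++ (map reduce xs)) (cong₂ ℕ._+_ (List.length-map reduce xs) (List.length-map reduce ys))))
    (subst (_≤ r) (trans (List.length-++ xs) (ℕ.+-suc (length xs) (length ys))) lt)
  ih = nontrivial-solution (map reduce xs ++ map reduce ys) count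
  c′ = proj₁ ih
  nz = proj₁ (proj₂ ih)
  zeros = proj₂ (proj₂ ih)
  D = dot t c′
  pivotRow : h ℚ.* (ℚ.- D) ℚ.+ dot t (Vec.map (h ℚ.*_) c′) ≡ 0ℚ
  pivotRow = trans (cong (h ℚ.* (ℚ.- D) ℚ.+_) (dot-scaleʳ h t c′)) (ℚSolver.cancel h D)
  solved : ∀ zs → All (λ ρ → dot ρ c′ ≡ 0ℚ) (map reduce zs) → All (λ ρ → dot ρ ((ℚ.- D) ∷ Vec.map (h ℚ.*_) c′) ≡ 0ℚ) zs
  solved zs a = All.map (λ { {s ∷ σ} eq → trans (cong (s ℚ.* (ℚ.- D) ℚ.+_) (dot-scaleʳ h σ c′))
    (trans (ℚSolver.eliminate h s D (dot σ c′)) (trans (sym (dot-combine h s σ t c′)) eq)) }) (All.map⁻ a)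

dot-comm : ∀ {r} (as cs : Vec ℚ r) → dot as cs ≡ dot cs as
dot-comm [] []             = refl
dot-comm (a ∷ as) (c ∷ cs) = cong₂ ℚ._+_ (ℚ.*-comm a c) (dot-comm as cs)

unit : ∀ {r} → Fin r → Vec ℚ r
unit zero    = 1ℚ ∷ Vec.replicate _ 0ℚ
unit (suc j) = 0ℚ ∷ unit j

dot-unit : ∀ {r} (as : Vec ℚ r) j → dot as (unit j) ≡ Vec.lookup as j
dot-unit (a ∷ as) zero    = trans (cong₂ ℚ._+_ (ℚ.*-identityʳ a) (dot-zeroʳ as)) (ℚ.+-identityʳ a)
dot-unit (a ∷ as) (suc j) = trans (cong₂ ℚ._+_ (ℚ.*-zeroʳ a) (dot-unit as j)) (ℚ.+-identityˡ _)

combination : ∀ {k r} → Vec ℚ r → Vec (Poly k) r → Poly k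
combination cs bs = sumP (Vec.toList (Vec.zipWith _·P_ cs bs))

eval-combination : ∀ {k r} φ (cs : Vec ℚ r) (bs : Vec (Poly k) r) → eval φ (combination cs bs) ≡ dot (Vec.map (eval φ) bs) cs
eval-combination φ [] []             = eval-[] φ
eval-combination φ (c ∷ cs) (p ∷ bs) = trans (eval-++ φ (c ·P p) _)
  (cong₂ ℚ._+_ (trans (eval-·P φ c p) (ℚ.*-comm c _)) (eval-combination φ cs bs))

evals : ∀ {k} → (Φ : List (ℕ × (Monomial k → ℚ))) → Poly k → Vec ℚ (length Φ)
evals [] p      = []
evals (f ∷ Φ) p = eval (proj₂ f) p ∷ evals Φ p

evals-cong : ∀ {k} (Φ : List (ℕ × (Monomial k → ℚ))) {p q} → All (λ f → eval (proj₂ f) p ≡ eval (proj₂ f) q) Φ → evals Φ p ≡ evals Φ q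
evals-cong [] []           = refl
evals-cong (f ∷ Φ) (e ∷ a) = cong₂ _∷_ e (evals-cong Φ a)

dot-evals-combination : ∀ {k r} (Φ : List (ℕ × (Monomial k → ℚ))) y (cs : Vec ℚ r) bs →
  dot y (evals Φ (combination cs bs)) ≡ dot (Vec.map (λ p → dot y (evals Φ p)) bs) cs
dot-evals-combination [] [] cs bs = sym (zeros cs bs)
  where
  zeros : ∀ {r} (cs : Vec ℚ r) bs → dot (Vec.map (λ p → dot [] (evals [] p)) bs) cs ≡ 0ℚ
  zeros [] []             = refl
  zeros (c ∷ cs) (b ∷ bs) = trans (cong₂ ℚ._+_ (ℚ.*-zeroˡ c) (zeros cs bs)) refl
dot-evals-combination (f ∷ Φ) (v ∷ y) cs bs = trans (cong₂ (λ a b → v ℚ.* a ℚ.+ b) (eval-combination (proj₂ f) cs bs) (dot-evals-combination Φ y cs bs))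
  (split cs bs)
  where
  split : ∀ {r} (cs : Vec ℚ r) bs → v ℚ.* dot (Vec.map (eval (proj₂ f)) bs) cs ℚ.+ dot (Vec.map (λ p → dot y (evals Φ p)) bs) cs ≡
    dot (Vec.map (λ p → dot (v ∷ y) (evals (f ∷ Φ) p)) bs) cs
  split [] []             = trans (cong (ℚ._+ 0ℚ) (ℚ.*-zeroʳ v)) refl
  split (c ∷ cs) (p ∷ bs) = trans (ℚSolver.regroup v (eval (proj₂ f) p) c (dot (Vec.map (eval (proj₂ f)) bs) cs) (dot y (evals Φ p)) (dot (Vec.map (λ p → dot y (evals Φ p)) bs) cs))
    (cong ((v ℚ.* eval (proj₂ f) p ℚ.+ dot y (evals Φ p)) ℚ.* c ℚ.+_) (split cs bs))

module Dimension {k} (Φ : List (ℕ × (Monomial k → ℚ))) {I : Poly k → Set}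
  (I⇒kills : ∀ {p} → I p → All (λ f → eval (proj₂ f) p ≡ 0ℚ) Φ)
  (kills⇒I : ∀ {p} → All (λ f → eval (proj₂ f) p ≡ 0ℚ) Φ → I p)
  (graded : All (λ f → Vanishing 0 (proj₁ f) (proj₂ f)) Φ)
  (attains : ∀ d {vs} → Pointwise (λ f v → v ≡ 0ℚ ⊎ proj₁ f ≡ d) Φ vs →
    ∃ λ p → AllDegree d p × Pointwise (λ f v → eval (proj₂ f) p ≡ v) Φ vs)
  where

  Φ[_] : ℕ → List (ℕ × (Monomial k → ℚ))
  Φ[ d ] = filter (λ f → proj₁ f ℕ.≟ d) Φ

  other-degree : ∀ {d e φ} {p : Poly k} → Vanishing 0 e φ → Homogeneous d p → e ≢ d → eval φ p ≡ 0ℚ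
  other-degree {p = p} v h ne = eval-homogeneous {p = p} (λ m e → v m (λ eq → e (trans (sym (ℕ.+-identityʳ _)) eq))) h (ne ∘ sym)

  attain-degree : ∀ d (w : Vec ℚ (length Φ[ d ])) → ∃ λ p → Homogeneous d p × evals Φ[ d ] p ≡ w
  attain-degree d w = let vs , t , r = spread (λ f → proj₁ f ℕ.≟ d) Φ w
                          p , dp , hp = attains d t in p , AllDegree⇒Homogeneous dp , r p hp
    where
    spread : (D? : ∀ f → Dec (proj₁ f ≡ d)) → ∀ Φ (w : Vec ℚ (length (filter D? Φ))) →
      ∃ λ vs → Pointwise (λ f v → v ≡ 0ℚ ⊎ proj₁ f ≡ d) Φ vs ×
      (∀ p → Pointwise (λ f v → eval (proj₂ f) p ≡ v) Φ vs → evals (filter D? Φ) p ≡ w)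
    spread D? [] []      = [] , [] , λ _ _ → refl
    spread D? (f ∷ Φ) w with D? f
    spread D? (f ∷ Φ) (x ∷ w) | yes eq = let vs , t , r = spread D? Φ w in
      x ∷ vs , inj₂ eq ∷ t , λ { p (e ∷ h) → cong₂ _∷_ e (r p h) }
    spread D? (f ∷ Φ) w | no ne = let vs , t , r = spread D? Φ w in
      0ℚ ∷ vs , inj₁ refl ∷ t , λ { p (e ∷ h) → r p h }

  module _ {d r} (bs : Vec (Poly k) r) (bs-homogeneous : ∀ j → Homogeneous d (Vec.lookup bs j)) where

    combination-homogeneous : ∀ {f} cs → Vanishing 0 (proj₁ f) (proj₂ f) → proj₁ f ≢ d → eval (proj₂ f) (combination cs bs) ≡ 0ℚ
    combination-homogeneous {f} cs v ne = trans (eval-combination (proj₂ f) cs bs) (go bs bs-homogeneous cs)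
      where
      go : ∀ {r} (bs : Vec (Poly k) r) → (∀ j → Homogeneous d (Vec.lookup bs j)) → ∀ cs → dot (Vec.map (eval (proj₂ f)) bs) cs ≡ 0ℚ
      go [] h []             = refl
      go (p ∷ bs) h (c ∷ cs) = trans (cong₂ ℚ._+_ (trans (cong (ℚ._* c) (other-degree {p = p} v (h zero) ne)) (ℚ.*-zeroˡ c)) (go bs (h ∘ suc) cs)) refl

    -- With more polynomials than functionals of degree d, some nontrivial combination is killed by
    -- all of these. The functionals of other degrees kill it by homogeneity, so it lies in I,
    -- against independence.
    independent⇒≤ : (∀ cs → I (combination cs bs) → ∀ j → Vec.lookup cs j ≡ 0ℚ) → r ≤ length Φ[ d ]
    independent⇒≤ indep = ℕ.≮⇒≥ λ lt →
      let c , (j , ne) , zeros = nontrivial-solution (map (λ f → Vec.map (eval (proj₂ f)) bs) Φ[ d ]) (subst (_< r) (sym (List.length-map _ Φ[ d ])) lt)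
          decide : ∀ f → f ∈ Φ → Dec (proj₁ f ≡ d) → eval (proj₂ f) (combination c bs) ≡ 0ℚ
          decide = λ { f f∈ (yes eq) → trans (eval-combination (proj₂ f) c bs) (All.lookup (All.map⁻ zeros) (∈-filter⁺ (λ f → proj₁ f ℕ.≟ d) f∈ eq))
                     ; f f∈ (no ne) → combination-homogeneous {f} c (All.lookup graded f∈) ne }
      in ne (indep c (kills⇒I (All.tabulate λ {f} f∈ → decide f f∈ (proj₁ f ℕ.≟ d))) j)

    -- With fewer polynomials than functionals, some nontrivial linear relation y of the functionals
    -- holds on all of `bs`, and hence on every polynomial of degree d modulo I. A polynomial whose
    -- values form the j-th unit vector then shows that the nonzero coordinate y_j vanishes.
    spanning⇒≥ : (∀ p → Homogeneous d p → ∃ λ cs → I (p +P (-P combination cs bs))) → length Φ[ d ] ≤ r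
    spanning⇒≥ spans = ℕ.≮⇒≥ λ lt →
      let y , (j , ne) , zeros = nontrivial-solution (Vec.toList (Vec.map (evals Φ[ d ]) bs)) (subst (_< length Φ[ d ]) (sym (Vec.length-toList (Vec.map (evals Φ[ d ]) bs))) lt)
          p , hp , ep = attain-degree d (unit j)
          cs , i = spans p hp
      in ne (begin
        Vec.lookup y j                                          ≡⟨ dot-unit y j ⟨
        dot y (unit j)                                          ≡⟨ cong (dot y) ep ⟨
        dot y (evals Φ[ d ] p)                                  ≡⟨ cong (dot y) (evals-cong Φ[ d ] (All.tabulate λ {f} f∈ →
                                                                     difference (proj₂ f) p _ (All.lookup (I⇒kills i) (proj₁ (∈-filter⁻ (λ f → proj₁ f ℕ.≟ d) {xs = Φ} f∈))))) ⟩
        dot y (evals Φ[ d ] (combination cs bs))                ≡⟨ dot-evals-combination Φ[ d ] y cs bs ⟩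
        dot (Vec.map (λ p → dot y (evals Φ[ d ] p)) bs) cs      ≡⟨ vanish y bs cs zeros ⟩
        0ℚ                                                      ∎)
      where
      open ≡-Reasoning
      difference : ∀ φ p q → eval φ (p +P (-P q)) ≡ 0ℚ → eval φ p ≡ eval φ q
      difference φ p q eq = ℚgroup.x∙y⁻¹≈ε⇒x≈y (eval φ p) (eval φ q) (trans (cong (eval φ p ℚ.+_) (trans
          (trans (cong ℚ.-_ (sym (ℚ.*-identityˡ (eval φ q)))) (ℚ.neg-distribˡ-* 1ℚ (eval φ q)))
          (sym (eval-·P φ (ℚ.- 1ℚ) q)))) (trans (sym (eval-++ φ p (-P q))) eq))
        where
        import Algebra.Properties.Group
        module ℚgroup = Algebra.Properties.Group ℚ.+-0-group
      vanish : ∀ y {r} (bs : Vec (Poly k) r) cs → All (λ ρ → dot ρ y ≡ 0ℚ) (Vec.toList (Vec.map (evals Φ[ d ]) bs)) →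
        dot (Vec.map (λ p → dot y (evals Φ[ d ] p)) bs) cs ≡ 0ℚ
      vanish y [] [] []                   = refl
      vanish y (p ∷ bs) (c ∷ cs) (e ∷ a) = trans (cong₂ ℚ._+_ (trans (cong (ℚ._* c) (trans (dot-comm y _) e)) (ℚ.*-zeroˡ c)) (vanish y bs cs a)) refl

-- Translation of the given presentation of the Chow ring

filter-map : ∀ {A B : Set} {P : B → Set} (P? : ∀ y → Dec (P y)) (g : A → B) xs → filter P? (map g xs) ≡ map g (filter (λ x → P? (g x)) xs)
filter-map P? g [] = refl
filter-map P? g (x ∷ xs) with does (P? (g x))
... | true  = cong (g x ∷_) (filter-map P? g xs)
... | false = filter-map P? g xs

pick : ∀ {k} → (Fin k → Bool) → List (Fin k)
pick {k} f = filter (λ i → Tdec (f i)) (allFin k)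

filter-Tdec-cong : ∀ {A : Set} {f g : A → Bool} → (∀ x → f x ≡ g x) → ∀ xs → filter (λ x → Tdec (f x)) xs ≡ filter (λ x → Tdec (g x)) xs
filter-Tdec-cong h = List.filter-≐ _ _ ((λ {x} t → subst T (h x) t) , (λ {x} t → subst T (sym (h x)) t))

pick-suc : ∀ {k} (f : Fin (suc k) → Bool) → pick f ≡ (if f zero then zero ∷ map suc (pick (f ∘ suc)) else map suc (pick (f ∘ suc)))
pick-suc {k} f with f zero
... | true  = cong (zero ∷_) (tail k f)
  where
  tail : ∀ k (f : Fin (suc k) → Bool) → filter (λ i → Tdec (f i)) (List.tabulate suc) ≡ map suc (pick (f ∘ suc))
  tail k f = trans (cong (filter _) (sym (List.map-tabulate id suc))) (filter-map (λ i → Tdec (f i)) suc (allFin k))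
... | false = trans (cong (filter _) (sym (List.map-tabulate id suc))) (filter-map (λ i → Tdec (f i)) suc (allFin k))

varP-zero : ∀ {k} → varP {suc k} zero ≡ x₀
varP-zero {k} = cong (λ v → (1ℚ , 1 ∷ v) ∷ []) (trans (Vec.tabulate-cong (λ _ → refl)) (zeros k))
  where
  zeros : ∀ k → Vec.tabulate {n = k} (λ _ → 0) ≡ Vec.replicate k 0
  zeros zero    = refl
  zeros (suc k) = cong (0 ∷_) (zeros k)

varP-suc : ∀ {k} (i : Fin k) → varP (suc i) ≡ ι (varP i)
varP-suc i = cong (λ v → (1ℚ , 0 ∷ v) ∷ []) (Vec.tabulate-cong λ j → cong (λ t → if t then 1 else 0) (same j))
  where
  same : ∀ j → ⌊ suc i Fin.≟ suc j ⌋ ≡ ⌊ i Fin.≟ j ⌋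
  same j with i Fin.≟ j
  ... | yes _ = refl
  ... | no _  = refl

prodVars sumVars : ∀ {k} → List (Fin k) → Poly k
prodVars is = foldr _*P_ 1P (map varP is)
sumVars is  = sumP (map varP is)

sumVars-suc : ∀ {k} (is : List (Fin k)) → sumVars (map suc is) ≡ ι (sumVars is)
sumVars-suc []       = refl
sumVars-suc (i ∷ is) = trans (cong₂ _+P_ (varP-suc i) (sumVars-suc is)) (sym (List.map-++ _ (varP i) (sumVars is)))

prodVars-suc : ∀ {k} (is : List (Fin k)) → prodVars (map suc is) ≋ ι (prodVars is)
prodVars-suc []       = CommutativeRing.refl polyRing
prodVars-suc {k} (i ∷ is) = ≋.trans (≋.reflexive (trans (cong (_*P prodVars (map suc is)) (varP-suc i)) (sym (*ᵖ≡*P _ _))))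
  (≋.trans (≋.*-congˡ (prodVars-suc is)) (≋.trans (≋.sym (ι-* (varP i) (prodVars is))) (≋.reflexive (cong ι (*ᵖ≡*P _ _)))))
  where module ≋ = CommutativeRing (polyRing {suc k})

^P≡^ᵖ : ∀ {k} (p : Poly k) a → p ^P a ≡ p ^ᵖ a
^P≡^ᵖ p zero    = refl
^P≡^ᵖ p (suc a) = trans (cong (p *P_) (^P≡^ᵖ p a)) (sym (*ᵖ≡*P p _))

module _ {n : ℕ} where
  open Relations {n}

  ∈ᵇ-suc : ∀ {k} (i : Fin k) s S → (suc i ∈ᵇ (s ∷ S)) ≡ (i ∈ᵇ S)
  ∈ᵇ-suc i s S with i ∈? S
  ... | yes _ = refl
  ... | no _  = refl

  pick-∈-suc : ∀ {k} s (S : Subset k) → pick (_∈ᵇ (s ∷ S)) ≡ (if s then zero ∷ map suc (pick (_∈ᵇ S)) else map suc (pick (_∈ᵇ S)))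
  pick-∈-suc true S  = trans (pick-suc (_∈ᵇ (true ∷ S))) (cong (λ l → zero ∷ map suc l) (filter-Tdec-cong (λ i → ∈ᵇ-suc i true S) (allFin _)))
  pick-∈-suc false S = trans (pick-suc (_∈ᵇ (false ∷ S))) (cong (map suc) (filter-Tdec-cong (λ i → ∈ᵇ-suc i false S) (allFin _)))

  prodVars-vars : ∀ {k} (S : Subset k) → prodVars (pick (_∈ᵇ S)) ≋ vars S
  prodVars-vars []          = CommutativeRing.refl polyRing
  prodVars-vars (true ∷ S)  = ≋.trans (≋.reflexive (trans (cong prodVars (pick-∈-suc true S)) (trans (cong (_*P prodVars (map suc (pick (_∈ᵇ S)))) varP-zero) (sym (*ᵖ≡*P _ _)))))
    (≋.*-congˡ (≋.trans (prodVars-suc (pick (_∈ᵇ S))) (ι-cong (prodVars-vars S))))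
    where module ≋ = CommutativeRing polyRing
  prodVars-vars (false ∷ S) = ≋.trans (≋.reflexive (cong prodVars (pick-∈-suc false S)))
    (≋.trans (prodVars-suc (pick (_∈ᵇ S))) (ι-cong (prodVars-vars S)))
    where module ≋ = CommutativeRing polyRing

  sumVars-varSum : ∀ (L : List (Subset n)) f → sumVars (pick (f ∘ List.lookup L)) ≡ varSum L f
  sumVars-varSum [] f = refl
  sumVars-varSum (G ∷ L) f = trans (cong sumVars (pick-suc (f ∘ List.lookup (G ∷ L)))) (go (f G))
    where
    tail : sumVars (map suc (pick (f ∘ List.lookup L))) ≡ ι (varSum L f)
    tail = trans (sumVars-suc (pick (f ∘ List.lookup L))) (cong ι (sumVars-varSum L f))
    go : ∀ t → sumVars (if t then zero ∷ map suc (pick (f ∘ List.lookup L)) else map suc (pick (f ∘ List.lookup L))) ≡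
      (if t then x₀ +ᵖ ι (varSum L f) else ι (varSum L f))
    go true  = trans (cong₂ _+P_ varP-zero tail) (sym (+ᵖ≡+P _ _))
    go false = tail

  sel-filter : ∀ (L : List (Subset n)) (S : Subset (length L)) (f : Subset n → Bool) →
    map (List.lookup L) (pick (λ i → (i ∈ᵇ S) ∧ f (List.lookup L i))) ≡ filter (λ G → Tdec (f G)) (sel L S)
  sel-filter [] [] f = refl
  sel-filter (G ∷ L) (s ∷ S) f = trans (cong (map (List.lookup (G ∷ L))) (pick-suc (λ i → (i ∈ᵇ (s ∷ S)) ∧ f (List.lookup (G ∷ L) i)))) (go s)
    where
    tail : ∀ s → map (List.lookup (G ∷ L)) (map suc (pick (λ i → (suc i ∈ᵇ (s ∷ S)) ∧ f (List.lookup L i)))) ≡ filter (λ G → Tdec (f G)) (sel L S)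
    tail s = trans (sym (List.map-∘ (pick _))) (trans (cong (map (List.lookup L)) (filter-Tdec-cong (λ i → cong (_∧ f (List.lookup L i)) (∈ᵇ-suc i s S)) (allFin _)))
      (sel-filter L S f))
    go : ∀ s → map (List.lookup (G ∷ L)) (let g = λ i → (i ∈ᵇ (s ∷ S)) ∧ f (List.lookup (G ∷ L) i) in
        if g zero then zero ∷ map suc (pick (g ∘ suc)) else map suc (pick (g ∘ suc))) ≡ filter (λ G → Tdec (f G)) (sel (G ∷ L) (s ∷ S))
    go false = tail false
    go true with f G
    ... | true  = cong (G ∷_) (tail true)
    ... | false = tail true

module Presentation {n : ℕ} (P : Polymatroid n) (𝒢 : SetOfFlats n) where
  open Relations {n}

  exponent : List (Subset n) → Subset n → ℕ
  exponent T H = rk P H ∸ rk P (⋁ P (filter (λ G → Tdec (G ⊊ᵇ H)) T))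

  private
    L = gens P 𝒢
    module ≋ = CommutativeRing (polyRing {nvars P 𝒢})

  relation≋ : ∀ S j → relation P 𝒢 S j ≋ vars S *ᵖ (up L (G# P 𝒢 j) ^ᵖ exponent (sel L S ++ []) (G# P 𝒢 j))
  relation≋ S j = ≋.trans (≋.reflexive (sym (*ᵖ≡*P _ _))) (≋.*-cong
    (≋.trans (≋.reflexive (cong prodVars (List.filter-≐ (λ i → i ∈? S) (λ i → Tdec (i ∈ᵇ S)) ((λ {i} h → fromWitness {a? = i ∈? S} h) , (λ {i} h → toWitness {a? = i ∈? S} h)) (allFin (nvars P 𝒢))))) (prodVars-vars {nvars P 𝒢} S))
    (≋.reflexive (trans (^P≡^ᵖ (sumVars (pick (λ i → G# P 𝒢 j ⊆ᵇ G# P 𝒢 i)))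
        (rk P (G# P 𝒢 j) ∸ rk P (⋁ P (map (G# P 𝒢) (pick (λ i → (i ∈ᵇ S) ∧ (G# P 𝒢 i ⊊ᵇ G# P 𝒢 j))))))) (cong₂ _^ᵖ_ (sumVars-varSum L (G# P 𝒢 j ⊆ᵇ_))
      (cong (λ l → rk P (G# P 𝒢 j) ∸ rk P (⋁ P l)) (trans (sel-filter L S (_⊊ᵇ G# P 𝒢 j))
        (cong (filter (λ G → Tdec (G ⊊ᵇ G# P 𝒢 j))) (sym (List.++-identityʳ (sel L S))))))))))

  module _ {𝒢′ : Subset n → Set} (exps : Exponents 𝒢′ exponent) where

    private
      R = Rel exps L []
      combo : List (Poly (nvars P 𝒢) × Subset (nvars P 𝒢) × Fin (nvars P 𝒢)) → Poly (nvars P 𝒢)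
      combo cs = sumP (map (λ c → proj₁ c *P relation P 𝒢 (proj₁ (proj₂ c)) (proj₂ (proj₂ c))) cs)

      combo∈ : ∀ cs → ⟨ R ⟩ (combo cs)
      combo∈ []                = ⟨⟩-0
      combo∈ ((r , S , j) ∷ cs) = ⟨⟩-≋ (≋.reflexive (trans (+ᵖ≡+P _ _) (cong (_+P combo cs) (*ᵖ≡*P _ _))))
        (⟨⟩-+ (⟨⟩-* r (⟨⟩-≋ (≋.sym (relation≋ S j)) (gen (S , _ , ∈-lookup j , refl)))) (combo∈ cs))

      combo-++ : ∀ cs ds → combo (cs ++ ds) ≋ combo cs +ᵖ combo ds
      combo-++ [] ds       = ≋.sym (≋.+-identityˡ _)
      combo-++ (c ∷ cs) ds = ≋.trans (≋.reflexive (sym (+ᵖ≡+P _ _))) (≋.trans (≋.+-congˡ (combo-++ cs ds))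
        (≋.trans (≋.sym (≋.+-assoc _ _ _)) (≋.+-congʳ (≋.reflexive (+ᵖ≡+P _ _)))))

      combo-* : ∀ r cs → combo (map (λ c → r *ᵖ proj₁ c , proj₂ c) cs) ≋ r *ᵖ combo cs
      combo-* r []       = ≋.sym (≋.zeroʳ r)
      combo-* r (c ∷ cs) = ≋.trans (≋.reflexive (sym (+ᵖ≡+P _ _))) (≋.trans (≋.+-cong
          (≋.trans (≋.reflexive (sym (*ᵖ≡*P _ _))) (≋.trans (≋.*-assoc r (proj₁ c) _) (≋.*-congˡ (≋.reflexive (*ᵖ≡*P _ _))))) (combo-* r cs))
        (≋.trans (≋.sym (≋.distribˡ r _ _)) (≋.*-congˡ (≋.reflexive (+ᵖ≡+P _ _)))))

    InIdeal⇒ : ∀ {p} → InIdeal P 𝒢 p → ⟨ R ⟩ p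
    InIdeal⇒ (cs , e) = ⟨⟩-≋ (≋.sym (≈P⇒≋ e)) (combo∈ cs)

    InIdeal⇐ : ∀ {p} → ⟨ R ⟩ p → InIdeal P 𝒢 p
    InIdeal⇐ i = let cs , e = collect i in cs , ≋⇒≈P e
      where
      collect : ∀ {p} → ⟨ R ⟩ p → ∃ λ cs → p ≋ combo cs
      collect (gen (S , H , h , refl)) = let j = Any.index h in (1P , S , j) ∷ [] ,
        ≋.trans (≋.reflexive (cong (λ H → vars S *ᵖ (up L H ^ᵖ exponent (sel L S ++ []) H)) (lookup-index h)))
        (≋.trans (≋.sym (relation≋ S j)) (≋.trans (≋.sym (≋.*-identityˡ _)) (≋.trans (≋.sym (≋.+-identityʳ _))
          (≋.reflexive (trans (+ᵖ≡+P _ _) (cong (_+P 0P) (*ᵖ≡*P _ _)))))))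
      collect ⟨⟩-0       = [] , ≋.refl
      collect (⟨⟩-+ a b) = let cs , e = collect a ; ds , f = collect b in cs ++ ds , ≋.trans (≋.+-cong e f) (≋.sym (combo-++ cs ds))
      collect (⟨⟩-* r a) = let cs , e = collect a in map (λ c → r *ᵖ proj₁ c , proj₂ c) cs , ≋.trans (≋.*-congˡ e) (≋.sym (combo-* r cs))
      collect (⟨⟩-≋ e a) = let cs , f = collect a in cs , ≋.trans (≋.sym e) f

    -- The size of the given basis is bounded above by its independence and below by its spanning
    -- property.
    hilbert-count : Upper exps L → ∀ {h} → IsHilbertFn P 𝒢 h → ∀ d →
      h d ≡ length (filter (λ f → proj₁ f ℕ.≟ d) (Basis.duals exps L []))
    hilbert-count upper hilb d = let bs , hom , spans , indep = hilb d in
      ℕ.≤-antisym (independent⇒≤ bs hom (λ cs i → indep cs (InIdeal⇐ i))) (spanning⇒≥ bs hom (λ p hp → let cs , i = spans p hp in cs , InIdeal⇒ i))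
      where
      open Dimension (Basis.duals exps L []) {⟨ R ⟩} (Basis.⟨Rel⟩⇒kills exps upper []) (Basis.kills⇒⟨Rel⟩ exps upper [])
        (duals-graded exps L []) (λ d → duals-attain exps L [] d)

-- Flats of a polymatroid

module _ {n : ℕ} where

  ∪-least : ∀ {A B C : Subset n} → A ⊆ C → B ⊆ C → A ∪ B ⊆ C
  ∪-least {A} {B} f g x∈ = [ f , g ]′ (x∈p∪q⁻ A B x∈)

  ∩-greatest : ∀ {A B C : Subset n} → C ⊆ A → C ⊆ B → C ⊆ A ∩ B
  ∩-greatest f g x∈ = x∈p∩q⁺ (f x∈ , g x∈)

  ∩ˡ : ∀ {A B : Subset n} → A ∩ B ⊆ A
  ∩ˡ {A} {B} = p∩q⊆p A B

  ∩ʳ : ∀ {A B : Subset n} → A ∩ B ⊆ B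
  ∩ʳ {A} {B} = p∩q⊆q A B

  ∪ˡ : ∀ {A B : Subset n} → A ⊆ A ∪ B
  ∪ˡ {A} {B} = p⊆p∪q B

  ∪ʳ : ∀ {A B : Subset n} → B ⊆ A ∪ B
  ∪ʳ {A} {B} = q⊆p∪q A B

  ⁅⁆⊆ : ∀ {e} {A : Subset n} → e ∈ˢ A → ⁅ e ⁆ ⊆ A
  ⁅⁆⊆ {e} {A} h x∈ = subst (_∈ˢ A) (sym (x∈⁅y⁆⇒x≡y e x∈)) h

  ⋃-upper : ∀ {A : Subset n} {As} → A ∈ As → A ⊆ ⋃ As
  ⋃-upper (here refl) = ∪ˡ
  ⋃-upper (there i)   = ⊆-trans (⋃-upper i) ∪ʳ

  ⋃-least : ∀ {C : Subset n} As → (∀ {A} → A ∈ As → A ⊆ C) → ⋃ As ⊆ C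
  ⋃-least [] h       = ⊥⊆
  ⋃-least (A ∷ As) h = ∪-least (h (here refl)) (⋃-least As (h ∘ there))

  ⊈⇒∃ : ∀ {A B : Subset n} → A ⊈ B → ∃ λ e → e ∈ˢ A × e ∉ˢ B
  ⊈⇒∃ {A} {B} h with Fin.any? (λ e → (e ∈? A) ×-dec ¬? (e ∈? B))
  ... | yes p = p
  ... | no ¬p = ⊥-elim (h λ {e} e∈ → decidable-stable (e ∈? B) (λ e∉ → ¬p (e , e∈ , e∉)))

∈-allSubsets : ∀ {n} (A : Subset n) → A ∈ allSubsets n
∈-allSubsets []          = here refl
∈-allSubsets (false ∷ A) = ∈-++⁺ˡ (∈-map⁺ (false ∷_) (∈-allSubsets A))
∈-allSubsets (true ∷ A)  = ∈-++⁺ʳ (map (false ∷_) (allSubsets _)) (∈-map⁺ (true ∷_) (∈-allSubsets A))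

allSubsets-unique : ∀ n → Unique (allSubsets n)
allSubsets-unique zero    = [] ∷ []
allSubsets-unique (suc n) = Unique.++⁺ (Unique.map⁺ (λ { refl → refl }) (allSubsets-unique n)) (Unique.map⁺ (λ { refl → refl }) (allSubsets-unique n))
  λ { (i , j) → let _ , _ , p = ∈-map⁻ (false ∷_) i ; _ , _ , q = ∈-map⁻ (true ∷_) j in case (trans (sym p) q) }
  where
  case : ∀ {A B : Subset n} → false ∷ A ≢ true ∷ B
  case ()

allSubsets-sorted : ∀ n → AllPairs (λ A B → B ⊈ A) (allSubsets n)
allSubsets-sorted zero    = [] ∷ []
allSubsets-sorted (suc n) = AllPairs.++⁺
  (AllPairs.map⁺ (AllPairs.map (drop false) (allSubsets-sorted n)))
  (AllPairs.map⁺ (AllPairs.map (drop true) (allSubsets-sorted n)))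
  (All.map⁺ (All.universal (λ A → All.map⁺ (All.universal (λ B s → zero∉ (s Vec.here)) (allSubsets n))) (allSubsets n)))
  where
  drop : ∀ b {A B : Subset n} → B ⊈ A → (b ∷ B) ⊈ (b ∷ A)
  drop b h s = h (drop-∷-⊆ s)
  zero∉ : ∀ {A : Subset n} → zero ∉ˢ (false ∷ A)
  zero∉ ()

module Flats {n : ℕ} (P : Polymatroid n) (isP : IsPolymatroid P) where
  open IsPolymatroid isP
  private
    X = Subset n
    E = ground P
    r = rk P

  Flat : X → Set
  Flat F = T (isFlat P F)

  flat⊆ : ∀ {F} → Flat F → F ⊆ E
  flat⊆ {F} f = ⊆ᵇ⁻ F E (proj₁ (T-∧⁻ f))

  private
    extends : X → Fin n → Bool
    extends F e = if (e ∈ᵇ E) ∧ not (e ∈ᵇ F) then r F ℕ.<ᵇ r (F ∪ ⁅ e ⁆) else true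

    extends⁻ : ∀ F e → T (extends F e) → e ∈ˢ E → e ∉ˢ F → r F < r (F ∪ ⁅ e ⁆)
    extends⁻ F e t e∈ e∉ with e ∈? E | e ∈? F
    ... | no ¬p | _     = ⊥-elim (¬p e∈)
    ... | yes _ | yes p = ⊥-elim (e∉ p)
    ... | yes _ | no _  = ℕ.<ᵇ⇒< _ _ t

    extends⁺ : ∀ F e → (e ∈ˢ E → e ∉ˢ F → r F < r (F ∪ ⁅ e ⁆)) → T (extends F e)
    extends⁺ F e h with e ∈? E | e ∈? F
    ... | no _  | _     = tt
    ... | yes _ | yes _ = tt
    ... | yes p | no q  = ℕ.<⇒<ᵇ (h p q)

  flat-rank : ∀ {F} → Flat F → ∀ {e} → e ∈ˢ E → e ∉ˢ F → r F < r (F ∪ ⁅ e ⁆)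
  flat-rank {F} f {e} = extends⁻ F e (All.lookup (All.all⁺ (extends F) (allFin n) (proj₂ (T-∧⁻ {F ⊆ᵇ E} f))) (∈-allFin e))

  flat⁺ : ∀ {F} → F ⊆ E → (∀ {e} → e ∈ˢ E → e ∉ˢ F → r F < r (F ∪ ⁅ e ⁆)) → Flat F
  flat⁺ {F} s h = T-∧⁺ (⊆ᵇ⁺ F E s) (All.all⁻ (extends F) (All.universal (λ e → extends⁺ F e h) (allFin n)))

  flat-ground : Flat E
  flat-ground = flat⁺ ⊆-refl (λ e∈ e∉ → ⊥-elim (e∉ e∈))

  -- An element outside A ∩ B is outside one of the two flats, say C. By submodularity the rank
  -- increase it causes over C is at most the one over the smaller set A ∩ B, which is therefore
  -- positive.
  flat-∩ : ∀ {A B} → Flat A → Flat B → Flat (A ∩ B)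
  flat-∩ {A} {B} a b = flat⁺ (⊆-trans ∩ˡ (flat⊆ a)) λ {e} e∈ e∉ → cases e∈ e∉ (e ∈? A) (e ∈? B)
    where
    grow : ∀ {C e} → Flat C → A ∩ B ⊆ C → e ∈ˢ E → e ∉ˢ C → r (A ∩ B) < r ((A ∩ B) ∪ ⁅ e ⁆)
    grow {C} {e} c le e∈ e∉ = ℕ.+-cancelˡ-< (r C) _ _ (begin-strict
      r C ℕ.+ r (A ∩ B)                                      <⟨ ℕ.+-monoˡ-< (r (A ∩ B)) (flat-rank c e∈ e∉) ⟩
      r (C ∪ ⁅ e ⁆) ℕ.+ r (A ∩ B)                            ≤⟨ ℕ.+-mono-≤ (rk-mono _ _ (∪-least (flat⊆ c) D⊆E) (∪-least ∪ˡ (⊆-trans ∪ʳ ∪ʳ)))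
                                                                            (rk-mono _ _ (⊆-trans ∩ˡ (flat⊆ c)) (∩-greatest le ∪ˡ)) ⟩
      r (C ∪ D) ℕ.+ r (C ∩ D)                                ≤⟨ rk-submod C D (flat⊆ c) D⊆E ⟩
      r C ℕ.+ r D                                            ∎)
      where
      open ℕ.≤-Reasoning
      D = (A ∩ B) ∪ ⁅ e ⁆
      D⊆E : D ⊆ E
      D⊆E = ∪-least (⊆-trans ∩ˡ (flat⊆ a)) (⁅⁆⊆ e∈)
    cases : ∀ {e} → e ∈ˢ E → e ∉ˢ A ∩ B → Dec (e ∈ˢ A) → Dec (e ∈ˢ B) → r (A ∩ B) < r ((A ∩ B) ∪ ⁅ e ⁆)
    cases e∈ e∉ (no a∉) _       = grow a ∩ˡ e∈ a∉
    cases e∈ e∉ (yes _) (no b∉) = grow b ∩ʳ e∈ b∉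
    cases e∈ e∉ (yes p) (yes q) = ⊥-elim (e∉ (x∈p∩q⁺ (p , q)))

  ∈-flats : ∀ {F} → Flat F → F ∈ flats P
  ∈-flats {F} f = ∈-filter⁺ (λ F → Tdec (isFlat P F)) (∈-allSubsets F) f

  ∈-flats⁻ : ∀ {F} → F ∈ flats P → Flat F
  ∈-flats⁻ i = proj₂ (∈-filter⁻ (λ F → Tdec (isFlat P F)) {xs = allSubsets n} i)

  flats-unique : Unique (flats P)
  flats-unique = Unique.filter⁺ (λ F → Tdec (isFlat P F)) (allSubsets-unique n)

  cl : X → X
  cl = closure P

  closure-flat : ∀ A → Flat (cl A)
  closure-flat A = go (flats P) ∈-flats⁻
    where
    go : ∀ Fs → (∀ {F} → F ∈ Fs → Flat F) → Flat (foldr _∩_ E (filter (A ⊆?_) Fs))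
    go [] h       = flat-ground
    go (F ∷ Fs) h with A ⊆? F
    ... | yes _ = flat-∩ (h (here refl)) (go Fs (h ∘ there))
    ... | no _  = go Fs (h ∘ there)

  closure-⊇ : ∀ {A} → A ⊆ E → A ⊆ cl A
  closure-⊇ {A} s = go (flats P)
    where
    go : ∀ Fs → A ⊆ foldr _∩_ E (filter (A ⊆?_) Fs)
    go []       = s
    go (F ∷ Fs) with A ⊆? F
    ... | yes h = ∩-greatest h (go Fs)
    ... | no _  = go Fs

  closure-least : ∀ {A F} → Flat F → A ⊆ F → cl A ⊆ F
  closure-least {A} {F} f s = go (flats P) (∈-flats f)
    where
    go : ∀ Fs → F ∈ Fs → foldr _∩_ E (filter (A ⊆?_) Fs) ⊆ F
    go (G ∷ Fs) (here refl) with A ⊆? G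
    ... | yes _ = ∩ˡ
    ... | no ¬h = ⊥-elim (¬h s)
    go (G ∷ Fs) (there i) with A ⊆? G
    ... | yes _ = ⊆-trans ∩ʳ (go Fs i)
    ... | no _  = go Fs i

  rank-mono : ∀ {A B} → Flat B → A ⊆ B → r A ≤ r B
  rank-mono b h = rk-mono _ _ (flat⊆ b) h

  rank-strict : ∀ {A B} → Flat A → Flat B → A ⊆ B → B ⊈ A → r A < r B
  rank-strict {A} {B} a b le nle = let e , e∈ , e∉ = ⊈⇒∃ nle in
    ℕ.<-≤-trans (flat-rank a (flat⊆ b e∈) e∉) (rank-mono b (∪-least le (⁅⁆⊆ e∈)))

  -- Adding elements that do not raise the rank ends at a flat of the same rank that contains A, and
  -- the closure lies between A and this flat.
  rank-closure : ∀ {A} → A ⊆ E → r (cl A) ≡ r A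
  rank-closure {A} s = let F , f , le , eq = saturate n s ⊆-refl refl (ℕ.m∸n≤m n ∣ A ∣) in
    ℕ.≤-antisym (ℕ.≤-trans (rank-mono f (closure-least f le)) (ℕ.≤-reflexive eq)) (rank-mono (closure-flat A) (closure-⊇ s))
    where
    saturate : ∀ k {B} → B ⊆ E → A ⊆ B → r B ≡ r A → n ∸ ∣ B ∣ ≤ k → ∃ λ F → Flat F × A ⊆ F × r F ≡ r A
    saturate k {B} bE ab eq le with Tdec (isFlat P B)
    ... | yes f = B , f , ab , eq
    ... | no ¬f with Fin.any? (λ e → (e ∈? E) ×-dec (¬? (e ∈? B) ×-dec (r (B ∪ ⁅ e ⁆) ℕ.≤? r B)))
    ... | no none = ⊥-elim (¬f (flat⁺ bE (λ {e} e∈ e∉ → ℕ.≰⇒> (λ h → none (e , e∈ , e∉ , h)))))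
    ... | yes (e , e∈ , e∉ , h) = next k le
      where
      B⁺ = B ∪ ⁅ e ⁆
      B⁺⊆E : B⁺ ⊆ E
      B⁺⊆E = ∪-least bE (⁅⁆⊆ e∈)
      bigger : ∣ B ∣ < ∣ B⁺ ∣
      bigger = p⊂q⇒∣p∣<∣q∣ (∪ˡ , e , ∪ʳ (x∈⁅x⁆ e) , e∉)
      next : ∀ k → n ∸ ∣ B ∣ ≤ k → ∃ λ F → Flat F × A ⊆ F × r F ≡ r A
      next zero le    = ⊥-elim (ℕ.<⇒≱ (ℕ.<-≤-trans bigger (∣p∣≤n B⁺)) (ℕ.m∸n≡0⇒m≤n (ℕ.n≤0⇒n≡0 le)))
      next (suc k) le = saturate k B⁺⊆E (⊆-trans ab ∪ˡ) (trans (ℕ.≤-antisym h (rk-mono _ _ B⁺⊆E ∪ˡ)) eq)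
        (ℕ.≤-pred (ℕ.≤-trans (ℕ.∸-monoʳ-< bigger (∣p∣≤n B⁺)) le))

  rank-join : ∀ {A B} → Flat A → Flat B → r (cl (A ∪ B)) ℕ.+ r (A ∩ B) ≤ r A ℕ.+ r B
  rank-join {A} {B} a b = subst (λ v → v ℕ.+ r (A ∩ B) ≤ r A ℕ.+ r B) (sym (rank-closure (∪-least (flat⊆ a) (flat⊆ b))))
    (rk-submod A B (flat⊆ a) (flat⊆ b))

  ⋁-flat : ∀ Fs → Flat (⋁ P Fs)
  ⋁-flat Fs = closure-flat (⋃ Fs)

  ⋁-upper : ∀ {Fs F} → (∀ {A} → A ∈ Fs → A ⊆ E) → F ∈ Fs → F ⊆ ⋁ P Fs
  ⋁-upper {Fs} h i = ⊆-trans (⋃-upper i) (closure-⊇ (⋃-least Fs h))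

  ⋁-least : ∀ {Fs F} → Flat F → (∀ {A} → A ∈ Fs → A ⊆ F) → ⋁ P Fs ⊆ F
  ⋁-least {Fs} f h = closure-least f (⋃-least Fs h)

⊊ᵇ⁻ : ∀ {n} (A B : Subset n) → T (A ⊊ᵇ B) → A ⊊ B
⊊ᵇ⁻ A B t = le , λ h → T-not⁻ (proj₂ (T-∧⁻ {A ⊆ᵇ B} t)) (≡ᵇ⁺ A B (⊆-antisym le h))
  where
  le : A ⊆ B
  le = ⊆ᵇ⁻ A B (proj₁ (T-∧⁻ {A ⊆ᵇ B} t))

⊊ᵇ⁺ : ∀ {n} (A B : Subset n) → A ⊊ B → T (A ⊊ᵇ B)
⊊ᵇ⁺ A B (le , nle) = T-∧⁺ (⊆ᵇ⁺ A B le) (T-not⁺ λ t → nle (⊆-reflexive (sym (≡ᵇ⁻ A B t))))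

-- Turns an inequality of submodular type between ranks into one between exponents, with truncated
-- subtraction. The bounds `u ≤ h` and `t ≤ g` make the two differences on the right genuine.
∸-triangle : ∀ {h s g t u} → u ≤ h → t ≤ g → u ℕ.+ t ≤ g ℕ.+ s → h ∸ s ≤ (h ∸ u) ℕ.+ (g ∸ t)
∸-triangle {h} {s} {g} {t} {u} u≤h t≤g le = ℕ.m≤n+o⇒m∸n≤o h s (begin
  h                                     ≡⟨ ℕ.m∸n+n≡m u≤h ⟨
  (h ∸ u) ℕ.+ u                         ≤⟨ ℕ.+-monoʳ-≤ (h ∸ u) u≤ ⟩
  (h ∸ u) ℕ.+ ((g ∸ t) ℕ.+ s)           ≡⟨ ℕ.+-assoc (h ∸ u) _ s ⟨
  (h ∸ u) ℕ.+ (g ∸ t) ℕ.+ s             ≡⟨ ℕ.+-comm _ s ⟩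
  s ℕ.+ ((h ∸ u) ℕ.+ (g ∸ t))           ∎)
  where
  open ℕ.≤-Reasoning
  u≤ : u ≤ (g ∸ t) ℕ.+ s
  u≤ = ℕ.+-cancelʳ-≤ t u _ (begin
    u ℕ.+ t                   ≤⟨ le ⟩
    g ℕ.+ s                   ≡⟨ cong (ℕ._+ s) (ℕ.m∸n+n≡m t≤g) ⟨
    (g ∸ t) ℕ.+ t ℕ.+ s       ≡⟨ ℕ.+-assoc (g ∸ t) t s ⟩
    (g ∸ t) ℕ.+ (t ℕ.+ s)     ≡⟨ cong ((g ∸ t) ℕ.+_) (ℕ.+-comm t s) ⟩
    (g ∸ t) ℕ.+ (s ℕ.+ t)     ≡⟨ ℕ.+-assoc (g ∸ t) s t ⟨
    (g ∸ t) ℕ.+ s ℕ.+ t       ∎)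

∸-exchange : ∀ {z x h y} → y ≤ h → z ℕ.+ y ≤ x ℕ.+ h → z ∸ x ≤ h ∸ y
∸-exchange {z} {x} {h} {y} y≤h le = subst (z ∸ x ≤_) (ℕ.+-identityˡ _)
  (subst (λ v → z ∸ x ≤ v ℕ.+ (h ∸ y)) (ℕ.n∸n≡0 z) (∸-triangle {z} {x} {h} {y} {z} ℕ.≤-refl y≤h (ℕ.≤-trans le (ℕ.≤-reflexive (ℕ.+-comm x h)))))

-- The hypothesis on the family is closure under joins of members that share a lower member. It is
-- in this form that minors inherit what the exponents need from a building set.
module JoinClosed {n : ℕ} (P : Polymatroid n) (isP : IsPolymatroid P) (𝒢 : SetOfFlats n)
  (𝒢-flat : ∀ {G} → T (𝒢 G) → T (isFlat P G))
  (𝒢-join : ∀ {G K H} → T (𝒢 G) → T (𝒢 K) → T (𝒢 H) → G ⊆ K → G ⊆ H → T (𝒢 (⋁ P (K ∷ H ∷ []))))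
  where
  open Flats P isP
  open Presentation P 𝒢 using (exponent)
  private
    X = Subset n
    r = rk P
    𝒢′ = T ∘ 𝒢

  below-in : List X → X → List X
  below-in T H = filter (λ G → Tdec (G ⊊ᵇ H)) T

  sup : List X → X → X
  sup T H = ⋁ P (below-in T H)

  ∈-below⁺ : ∀ {T H x} → x ∈ T → x ⊊ H → x ∈ below-in T H
  ∈-below⁺ {H = H} {x} i lt = ∈-filter⁺ (λ G → Tdec (G ⊊ᵇ H)) i (⊊ᵇ⁺ x H lt)

  ∈-below⁻ : ∀ {T H x} → x ∈ below-in T H → x ∈ T × x ⊊ H
  ∈-below⁻ {T} {H} {x} i = let j , t = ∈-filter⁻ (λ G → Tdec (G ⊊ᵇ H)) {xs = T} i in j , ⊊ᵇ⁻ x H t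

  sup-flat : ∀ T H → Flat (sup T H)
  sup-flat T H = ⋁-flat (below-in T H)

  sup-upper : ∀ {T} H {x} → All 𝒢′ T → x ∈ T → x ⊊ H → x ⊆ sup T H
  sup-upper {T} H a i lt = ⋁-upper {below-in T H} (λ j → flat⊆ (𝒢-flat (All.lookup a (proj₁ (∈-below⁻ {T} {H} j))))) (∈-below⁺ i lt)

  sup-least : ∀ T H {F} → Flat F → (∀ {x} → x ∈ T → x ⊊ H → x ⊆ F) → sup T H ⊆ F
  sup-least T H f h = ⋁-least {below-in T H} f (λ i → let j , lt = ∈-below⁻ {T} {H} i in h j lt)

  sup⊆ : ∀ T {H} → Flat H → sup T H ⊆ H
  sup⊆ T {H} h = sup-least T H h (λ _ → proj₁)

  sup-mono : ∀ T T′ H H′ → All 𝒢′ T′ → (∀ {x} → x ∈ T → x ⊊ H → x ∈ T′ × x ⊊ H′) → sup T H ⊆ sup T′ H′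
  sup-mono T T′ H H′ a h = sup-least T H (sup-flat T′ H′) (λ i lt → let j , lt′ = h i lt in sup-upper H′ a j lt′)

  exponents : Exponents 𝒢′ exponent
  exponents = record { b-local = local ; b-chain = chain ; b-drop = drop ; b-join = join }
    where
    local : ∀ {T T′ H} → All 𝒢′ T → All 𝒢′ T′ → 𝒢′ H → (∀ {x} → x ∈ T′ → x ⊊ H → x ∈ T) → exponent T H ≤ exponent T′ H
    local {T} {T′} {H} t t′ h sub = ℕ.∸-monoʳ-≤ (r H) (rank-mono (sup-flat T H) (sup-mono T′ T H H t (λ i lt → sub i lt , lt)))
    chain : ∀ {T G K H} → All 𝒢′ T → 𝒢′ G → 𝒢′ K → 𝒢′ H → G ⊆ K → K ⊊ H → exponent (K ∷ T) H ≤ exponent (G ∷ T) H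
    chain {T} {G} {K} {H} t g k h gk kh = ℕ.∸-monoʳ-≤ (r H) (rank-mono (sup-flat (K ∷ T) H) (sup-least (G ∷ T) H (sup-flat (K ∷ T) H) (λ
        { (here refl) lt → ⊆-trans gk (sup-upper H (k ∷ t) (here refl) kh)
        ; (there i) lt → sup-upper H (k ∷ t) (there i) lt })))
    drop : ∀ {T G H} → All 𝒢′ T → 𝒢′ G → 𝒢′ H → G ⊊ H → exponent T H ≤ exponent (G ∷ T) H ℕ.+ exponent T G
    -- Submodularity for G and sup(T,H): their join contains sup(G ∷ T, H), and their intersection
    -- contains sup(T,G).
    drop {T} {G} {H} t g h gh = ∸-triangle (rank-mono (𝒢-flat h) (sup⊆ (G ∷ T) (𝒢-flat h))) (rank-mono (𝒢-flat g) (sup⊆ T (𝒢-flat g)))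
      (ℕ.≤-trans (ℕ.+-mono-≤ (rank-mono (closure-flat (G ∪ sup T H)) (sup-least (G ∷ T) H (closure-flat (G ∪ sup T H)) λ
          { (here refl) _ → ⊆-trans ∪ˡ (closure-⊇ within)
          ; (there i) lt → ⊆-trans (sup-upper H t i lt) (⊆-trans ∪ʳ (closure-⊇ within)) }))
        (rank-mono (flat-∩ (𝒢-flat g) (sup-flat T H)) (∩-greatest (sup⊆ T (𝒢-flat g))
          (sup-mono T T G H t (λ i lt → i , ⊆-trans (proj₁ lt) (proj₁ gh) , λ hx → proj₂ gh (⊆-trans hx (proj₁ lt)))))))
      (rank-join (𝒢-flat g) (sup-flat T H)))
      where
      within : G ∪ sup T H ⊆ ground P
      within = ∪-least (flat⊆ (𝒢-flat g)) (flat⊆ (sup-flat T H))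
    join : ∀ {G K H} → 𝒢′ G → 𝒢′ K → 𝒢′ H → G ⊆ K → G ⊆ H → K ⊈ H → H ⊈ K → ∃ λ Z →
      𝒢′ Z × K ⊆ Z × H ⊆ Z × (∀ {N} → 𝒢′ N → K ⊆ N → H ⊆ N → Z ⊆ N) ×
      (∀ T → All 𝒢′ T → exponent (K ∷ T) Z ≤ exponent (G ∷ T) H) × (∀ T → All 𝒢′ T → exponent (K ∷ H ∷ T) Z ≡ 0)
    join {G} {K} {H} g k h gk gh kh hk = Z , 𝒢-join g k h gk gh , KZ , HZ ,
        (λ N𝒢 kn hn → least (𝒢-flat N𝒢) kn hn) , bound , zero!
      where
      Z = ⋁ P (K ∷ H ∷ [])
      inE : ∀ {A} → A ∈ K ∷ H ∷ [] → A ⊆ ground P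
      inE (here refl)         = flat⊆ (𝒢-flat k)
      inE (there (here refl)) = flat⊆ (𝒢-flat h)
      KZ : K ⊆ Z
      KZ = ⋁-upper {K ∷ H ∷ []} inE (here refl)
      HZ : H ⊆ Z
      HZ = ⋁-upper {K ∷ H ∷ []} inE (there (here refl))
      least : ∀ {N} → Flat N → K ⊆ N → H ⊆ N → Z ⊆ N
      least f kn hn = ⋁-least {K ∷ H ∷ []} f λ { (here refl) → kn ; (there (here refl)) → hn }
      K⊊Z : K ⊊ Z
      K⊊Z = KZ , λ zk → hk (⊆-trans HZ zk)
      H⊊Z : H ⊊ Z
      H⊊Z = HZ , λ zh → kh (⊆-trans KZ zh)
      bound : ∀ T → All 𝒢′ T → exponent (K ∷ T) Z ≤ exponent (G ∷ T) H
      -- Submodularity for S = sup(K ∷ T, Z) and H: their join contains Z because K ⊆ S, and their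
      -- intersection contains sup(G ∷ T, H) because G ⊆ K.
      bound T t = ∸-exchange (rank-mono (𝒢-flat h) (sup⊆ (G ∷ T) (𝒢-flat h)))
        (ℕ.≤-trans (ℕ.+-mono-≤ (rank-mono (closure-flat (S ∪ H)) (least (closure-flat (S ∪ H))
            (⊆-trans K⊆S (⊆-trans ∪ˡ (closure-⊇ within))) (⊆-trans ∪ʳ (closure-⊇ within))))
          (rank-mono (flat-∩ (sup-flat (K ∷ T) Z) (𝒢-flat h)) (∩-greatest (sup-least (G ∷ T) H (sup-flat (K ∷ T) Z) (λ
            { (here refl) _ → ⊆-trans gk K⊆S
            ; (there i) lt → sup-upper Z (k ∷ t) (there i) (⊆-trans (proj₁ lt) HZ , λ zx → proj₂ lt (⊆-trans HZ zx)) }))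
            (sup⊆ (G ∷ T) (𝒢-flat h)))))
        (rank-join (sup-flat (K ∷ T) Z) (𝒢-flat h)))
        where
        S = sup (K ∷ T) Z
        K⊆S : K ⊆ S
        K⊆S = sup-upper Z (k ∷ t) (here refl) K⊊Z
        within : S ∪ H ⊆ ground P
        within = ∪-least (flat⊆ (sup-flat (K ∷ T) Z)) (flat⊆ (𝒢-flat h))
      zero! : ∀ T → All 𝒢′ T → exponent (K ∷ H ∷ T) Z ≡ 0
      zero! T t = ℕ.m≤n⇒m∸n≡0 (rank-mono (sup-flat (K ∷ H ∷ T) Z) (least (sup-flat (K ∷ H ∷ T) Z)
        (sup-upper Z (k ∷ h ∷ t) (here refl) K⊊Z) (sup-upper Z (k ∷ h ∷ t) (there (here refl)) H⊊Z)))

  upper : Relations.Upper exponents (gens P 𝒢)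
  upper = record
    { sorted = AllPairs.filter⁺ (λ G → Tdec (𝒢 G)) (allSubsets-sorted n)
    ; ⊆𝒢 = All.all-filter (λ G → Tdec (𝒢 G)) (allSubsets n)
    ; closed = λ _ z _ → ∈-filter⁺ (λ G → Tdec (𝒢 G)) (∈-allSubsets _) z }

-- Building sets

module Building {n : ℕ} (M : Polymatroid n) (𝒢 : SetOfFlats n)
  (isM : IsPolymatroid M) (loopless : Loopless M) (isB : IsBuildingSet M 𝒢) where
  open Flats M isM public
  open IsBuildingSet isB
  private
    X = Subset n
    r = rk M

  opaque
    J : X → X → X
    J A B = ⋁ M (A ∷ B ∷ [])

    J≡⋁ : ∀ A B → J A B ≡ ⋁ M (A ∷ B ∷ [])
    J≡⋁ A B = refl

    J-flat : ∀ A B → Flat (J A B)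
    J-flat A B = ⋁-flat (A ∷ B ∷ [])

    inE : ∀ {A B C} → Flat A → Flat B → C ∈ A ∷ B ∷ [] → C ⊆ ground M
    inE a b (here refl)         = flat⊆ a
    inE a b (there (here refl)) = flat⊆ b

    Jˡ : ∀ {A B} → Flat A → Flat B → A ⊆ J A B
    Jˡ {A} {B} a b = ⋁-upper {A ∷ B ∷ []} (inE a b) (here refl)

    Jʳ : ∀ {A B} → Flat A → Flat B → B ⊆ J A B
    Jʳ {A} {B} a b = ⋁-upper {A ∷ B ∷ []} (inE a b) (there (here refl))

    J-least : ∀ {A B C} → Flat C → A ⊆ C → B ⊆ C → J A B ⊆ C
    J-least {A} {B} c p q = ⋁-least {A ∷ B ∷ []} c λ { (here refl) → p ; (there (here refl)) → q }

    J-rank : ∀ {A B} → Flat A → Flat B → r (J A B) ℕ.+ r (A ∩ B) ≤ r A ℕ.+ r B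
    J-rank {A} {B} a b = ℕ.≤-trans (ℕ.+-monoˡ-≤ (r (A ∩ B)) (rank-mono (closure-flat (A ∪ B))
      (J-least (closure-flat (A ∪ B)) (⊆-trans ∪ˡ (closure-⊇ within)) (⊆-trans ∪ʳ (closure-⊇ within))))) (rank-join a b)
      where
      within : A ∪ B ⊆ ground M
      within = ∪-least (flat⊆ a) (flat⊆ b)

  𝒢-flat : ∀ {G} → T (𝒢 G) → Flat G
  𝒢-flat {G} g = proj₁ (flats-nonempty G g)

  𝒢-nonempty : ∀ {G} → T (𝒢 G) → G ⊈ ⊥
  𝒢-nonempty {G} g le = let e , e∈ = proj₂ (flats-nonempty G g) in ∉⊥ (le e∈)

  factors : X → List X
  factors K = maxElems (below 𝒢 K)

  private
    ∈-elems⁺ : ∀ {𝒮 : SetOfFlats n} {G} → T (𝒮 G) → G ∈ elems 𝒮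
    ∈-elems⁺ {𝒮} g = ∈-filter⁺ (λ G → Tdec (𝒮 G)) (∈-allSubsets _) g

    ∈-elems⁻ : ∀ {𝒮 : SetOfFlats n} {G} → G ∈ elems 𝒮 → T (𝒮 G)
    ∈-elems⁻ {𝒮} i = proj₂ (∈-filter⁻ (λ G → Tdec (𝒮 G)) {xs = allSubsets n} i)

  Maximal : SetOfFlats n → X → Set
  Maximal 𝒮 A = T (𝒮 A) × (∀ {H} → T (𝒮 H) → A ⊆ H → H ⊆ A)

  ∈-maxElems⁻ : ∀ {𝒮 A} → A ∈ maxElems 𝒮 → Maximal 𝒮 A
  ∈-maxElems⁻ {𝒮} {A} i = let j , t = ∈-filter⁻ (λ G → Tdec (not (any (G ⊊ᵇ_) (elems 𝒮)))) {xs = elems 𝒮} i in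
    ∈-elems⁻ {𝒮} j , λ {H} h le → decidable-stable (H ⊆? A) λ nle → T-not⁻ t
      (Any.any⁺ (A ⊊ᵇ_) (lose (∈-elems⁺ {𝒮} h) (⊊ᵇ⁺ A H (le , nle))))

  ∈-maxElems⁺ : ∀ {𝒮 A} → Maximal 𝒮 A → A ∈ maxElems 𝒮
  ∈-maxElems⁺ {𝒮} {A} (a , m) = ∈-filter⁺ (λ G → Tdec (not (any (G ⊊ᵇ_) (elems 𝒮)))) (∈-elems⁺ {𝒮} a)
    (T-not⁺ λ t → let H , i , lt = find (Any.any⁻ (A ⊊ᵇ_) (elems 𝒮) t) ; le , nle = ⊊ᵇ⁻ A H lt in nle (m (∈-elems⁻ {𝒮} i) le))

  maxElems-unique : ∀ 𝒮 → Unique (maxElems 𝒮)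
  maxElems-unique 𝒮 = Unique.filter⁺ _ (Unique.filter⁺ (λ G → Tdec (𝒮 G)) (allSubsets-unique n))

  ∈-factors⁻ : ∀ {K A} → A ∈ factors K → T (𝒢 A) × A ⊆ K
  ∈-factors⁻ {K} {A} i = let t , _ = ∈-maxElems⁻ {below 𝒢 K} i in proj₁ (T-∧⁻ {𝒢 A} t) , ⊆ᵇ⁻ A K (proj₂ (T-∧⁻ {𝒢 A} t))

  below-factor : ∀ {K G} → T (𝒢 G) → G ⊆ K → ∃ λ A → A ∈ factors K × G ⊆ A
  below-factor {K} {G} g le = climb n G (T-∧⁺ g (⊆ᵇ⁺ G K le)) ⊆-refl (ℕ.m∸n≤m n ∣ G ∣)
    where
    𝒮 = below 𝒢 K
    climb : ∀ k H → T (𝒮 H) → G ⊆ H → n ∸ ∣ H ∣ ≤ k → ∃ λ A → A ∈ factors K × G ⊆ A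
    climb k H h gh bd with All.all? (λ N → ¬? (Tdec (H ⊊ᵇ N))) (elems 𝒮)
    ... | yes a = H , ∈-maxElems⁺ {𝒮} (h , λ {N} t hn → decidable-stable (N ⊆? H) λ nle →
                    All.lookup a (∈-elems⁺ {𝒮} t) (⊊ᵇ⁺ H N (hn , nle))) , gh
    ... | no ¬a = let N , i , ¬¬lt = find (All.¬All⇒Any¬ (λ N → ¬? (Tdec (H ⊊ᵇ N))) (elems 𝒮) ¬a)
                      lt = ⊊ᵇ⁻ H N (decidable-stable (Tdec (H ⊊ᵇ N)) ¬¬lt) in next k bd N (∈-elems⁻ {𝒮} i) lt
      where
      next : ∀ k → n ∸ ∣ H ∣ ≤ k → ∀ N → T (𝒮 N) → H ⊊ N → ∃ λ A → A ∈ factors K × G ⊆ A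
      next k bd N t (hn , nle) with p⊂q⇒∣p∣<∣q∣ {p = H} {q = N} (hn , ⊈⇒∃ nle)
      next zero bd N t (hn , nle) | bigger    = ⊥-elim (ℕ.<⇒≱ (ℕ.<-≤-trans bigger (∣p∣≤n N)) (ℕ.m∸n≡0⇒m≤n (ℕ.n≤0⇒n≡0 bd)))
      next (suc k) bd N t (hn , nle) | bigger = climb k N t (⊆-trans gh hn)
        (ℕ.≤-pred (ℕ.≤-trans (ℕ.∸-monoʳ-< bigger (∣p∣≤n N)) bd))

  module _ {K : X} (K-flat : Flat K) where
    private
      f : Fin (length (factors K)) → X
      f = List.lookup (factors K)

      f∈ : ∀ i → f i ∈ factors K
      f∈ i = ∈-lookup i

      f-flat : ∀ i → Flat (f i)
      f-flat i = 𝒢-flat (proj₁ (∈-factors⁻ (f∈ i)))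

      Valid = ValidTuple M 𝒢 K
      join = joinTuple M 𝒢 K

      join-upper : ∀ {t} → Valid t → ∀ i → t i ⊆ join t
      join-upper {t} v i = ⋁-upper {map t (allFin _)} (λ j → let l , _ , eq = ∈-map⁻ t j in subst (_⊆ ground M) (sym eq) (flat⊆ (proj₁ (v l))))
        (∈-map⁺ t (∈-allFin i))

      join-least : ∀ {t C} → Flat C → (∀ i → t i ⊆ C) → join t ⊆ C
      join-least {t} c h = ⋁-least {map t (allFin _)} c (λ j → let l , _ , eq = ∈-map⁻ t j in subst (_⊆ _) (sym eq) (h l))

      meet : X → Fin (length (factors K)) → X
      meet H i = H ∩ f i

      meet-valid : ∀ {H} → Flat H → Valid (meet H)
      meet-valid h i = flat-∩ h (f-flat i) , ∩ʳ

      -- By surjectivity H is the join of some tuple with t_i ⊆ f_i. Each t_i lies in H ∩ f_i, so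
      -- the tuple of these intersections also joins to all of H.
      components : ∀ {H} → Flat H → H ⊆ K → H ⊆ join (meet H)
      components {H} h le = let t , v , eq = iso-onto K K-flat H h le in
        subst (_⊆ join (meet H)) eq (join-least (⋁-flat (map (meet H) (allFin _))) λ i →
          ⊆-trans (∩-greatest (subst (t i ⊆_) eq (join-upper v i)) (proj₂ (v i))) (join-upper (meet-valid h) i))

      -- The tuple of intersections of `join t` with the factors has its join inside `join t`. As
      -- the isomorphism reflects the order, this tuple lies below t componentwise.
      component : ∀ {t} → Valid t → ∀ i → join t ∩ f i ⊆ t i
      component {t} v = Equivalence.from (iso-order K K-flat (meet (join t)) t (meet-valid jf) v) (join-least jf λ i → ∩ˡ)
        where
        jf : Flat (join t)
        jf = ⋁-flat (map t (allFin _))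

    factors-cover : ∀ {C} → Flat C → (∀ {A} → A ∈ factors K → A ⊆ C) → K ⊆ C
    factors-cover c h = ⊆-trans (components K-flat ⊆-refl) (join-least c λ i → ⊆-trans ∩ʳ (h (f∈ i)))

    module Decomposition {E₁ : X} (E₁∈ : E₁ ∈ factors K) where
      private
        E₁-flat : Flat E₁
        E₁-flat = 𝒢-flat (proj₁ (∈-factors⁻ E₁∈))

        choose : X → (X → X) → X → X
        choose A g B with B ≟S E₁
        ... | yes _ = A
        ... | no _  = g B

        choose-valid : ∀ {A g} → Flat A → A ⊆ E₁ → (∀ {B} → B ∈ factors K → Flat (g B) × g B ⊆ B) → Valid (choose A g ∘ f)
        choose-valid a le h i with f i ≟S E₁
        ... | yes eq = a , subst (_ ⊆_) (sym eq) le
        ... | no _   = h (f∈ i)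

        choose-yes : ∀ A g → choose A g E₁ ≡ A
        choose-yes A g with E₁ ≟S E₁
        ... | yes _ = refl
        ... | no ne = ⊥-elim (ne refl)

        choose-no : ∀ A g {B} → B ≢ E₁ → choose A g B ≡ g B
        choose-no A g {B} ne with B ≟S E₁
        ... | yes eq = ⊥-elim (ne eq)
        ... | no _   = refl

        rest : Fin (length (factors K)) → X
        rest = choose ⊥ id ∘ f

        rest-valid : Valid rest
        rest-valid = choose-valid loopless ⊥⊆ (λ i → 𝒢-flat (proj₁ (∈-factors⁻ i)) , ⊆-refl)

        at : ∀ {t : X → X} → Valid (t ∘ f) → ∀ {A} → A ∈ factors K → t A ⊆ join (t ∘ f)
        at {t} v i = subst (λ A → t A ⊆ join (t ∘ f)) (sym (lookup-index i)) (join-upper v (Any.index i))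

        component-at : ∀ {t : X → X} → Valid (t ∘ f) → ∀ {A} → A ∈ factors K → join (t ∘ f) ∩ A ⊆ t A
        component-at {t} v i = subst (λ A → join (t ∘ f) ∩ A ⊆ t A) (sym (lookup-index i)) (component v (Any.index i))

      -- The join of all factors except E₁, from the tuple with ⊥ in the slot of E₁. It complements
      -- E₁: the interval [∅,K] is the product of [∅,E₁] and [∅,R].
      R : X
      R = join rest

      R-flat : Flat R
      R-flat = ⋁-flat (map rest (allFin _))

      R⊆K : R ⊆ K
      R⊆K = iso-into K K-flat rest rest-valid

      E₁⊆K : E₁ ⊆ K
      E₁⊆K = proj₂ (∈-factors⁻ E₁∈)

      other⊆R : ∀ {A} → A ∈ factors K → A ≢ E₁ → A ⊆ R
      other⊆R {A} i ne = subst (_⊆ R) (choose-no ⊥ id ne) (at {choose ⊥ id} rest-valid i)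

      disjoint : R ∩ E₁ ⊆ ⊥
      disjoint = ⊆-trans (component-at {choose ⊥ id} rest-valid E₁∈) (⊆-reflexive (choose-yes ⊥ id))

      cover : ∀ {H} → Flat H → H ⊆ K → H ⊆ J (H ∩ E₁) (H ∩ R)
      cover {H} h le = ⊆-trans (components h le) (join-least (J-flat _ _) λ i → piece i (f i ≟S E₁))
        where
        piece : ∀ i → Dec (f i ≡ E₁) → H ∩ f i ⊆ J (H ∩ E₁) (H ∩ R)
        piece i (yes eq) = subst (λ A → H ∩ A ⊆ J (H ∩ E₁) (H ∩ R)) (sym eq) (Jˡ (flat-∩ h E₁-flat) (flat-∩ h R-flat))
        piece i (no ne)  = ⊆-trans (∩-greatest ∩ˡ (⊆-trans ∩ʳ (other⊆R (f∈ i) ne))) (Jʳ (flat-∩ h E₁-flat) (flat-∩ h R-flat))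

      module _ {A B : X} (a : Flat A) (A⊆E₁ : A ⊆ E₁) (b : Flat B) (B⊆R : B ⊆ R) where
        private
          t : X → X
          t = choose A (B ∩_)

          t-valid : Valid (t ∘ f)
          t-valid = choose-valid a A⊆E₁ (λ i → flat-∩ b (𝒢-flat (proj₁ (∈-factors⁻ i))) , ∩ʳ)

          B⊆join : B ⊆ join (t ∘ f)
          B⊆join = ⊆-trans (components b (⊆-trans B⊆R R⊆K)) (join-least (⋁-flat (map (t ∘ f) (allFin _))) λ i → piece i (f i ≟S E₁))
            where
            piece : ∀ i → Dec (f i ≡ E₁) → B ∩ f i ⊆ join (t ∘ f)
            piece i (yes eq) = ⊆-trans (⊆-trans (∩-greatest (⊆-trans ∩ˡ B⊆R) (subst (B ∩ f i ⊆_) eq ∩ʳ)) disjoint) ⊥⊆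
            piece i (no ne)  = subst (_⊆ join (t ∘ f)) (choose-no A (B ∩_) ne) (join-upper t-valid i)

          J⊆join : J A B ⊆ join (t ∘ f)
          J⊆join = J-least (⋁-flat (map (t ∘ f) (allFin _))) (subst (_⊆ join (t ∘ f)) (choose-yes A (B ∩_)) (at {t} t-valid E₁∈)) B⊆join

        left : J A B ∩ E₁ ⊆ A
        left = ⊆-trans (∩-greatest (⊆-trans ∩ˡ J⊆join) ∩ʳ) (⊆-trans (component-at {t} t-valid E₁∈) (⊆-reflexive (choose-yes A (B ∩_))))

        right : J A B ∩ R ⊆ B
        right = ⊆-trans (components (flat-∩ (J-flat A B) R-flat) (⊆-trans ∩ʳ R⊆K)) (join-least b λ i → piece i (f i ≟S E₁))
          where
          piece : ∀ i → Dec (f i ≡ E₁) → (J A B ∩ R) ∩ f i ⊆ B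
          piece i (yes eq) = ⊆-trans (⊆-trans (∩-greatest (⊆-trans ∩ˡ ∩ʳ) (subst ((J A B ∩ R) ∩ f i ⊆_) eq ∩ʳ)) disjoint) ⊥⊆
          piece i (no ne)  = ⊆-trans (∩-greatest (⊆-trans (⊆-trans ∩ˡ ∩ˡ) J⊆join) ∩ʳ)
            (⊆-trans (component t-valid i) (⊆-trans (⊆-reflexive (choose-no A (B ∩_) ne)) ∩ˡ))

      private
        others : List X
        others = filter (λ A → ¬? (A ≟S E₁)) (factors K)

        sum-remove : ∀ {Fs} → Unique Fs → E₁ ∈ Fs → sum (map r Fs) ≡ r E₁ ℕ.+ sum (map r (filter (λ A → ¬? (A ≟S E₁)) Fs))
        sum-remove {A ∷ Fs} (p ∷ u) (here refl) = cong (λ l → r A ℕ.+ sum (map r l)) (sym (trans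
          (List.filter-reject (λ B → ¬? (B ≟S E₁)) (λ ne → ne refl)) (List.filter-all _ (All.map (λ ne eq → ne (sym eq)) p))))
        sum-remove {A ∷ Fs} (p ∷ u) (there i)   = trans (cong (r A ℕ.+_) (sum-remove u i)) (trans (lem (r A) (r E₁) _)
          (cong (λ l → r E₁ ℕ.+ sum (map r l)) (sym (List.filter-accept (λ B → ¬? (B ≟S E₁)) (All.lookup p i)))))
          where
          lem : ∀ a b c → a ℕ.+ (b ℕ.+ c) ≡ b ℕ.+ (a ℕ.+ c)
          lem a b c = trans (sym (ℕ.+-assoc a b c)) (trans (cong (ℕ._+ c) (ℕ.+-comm a b)) (ℕ.+-assoc b a c))

        rank-⋁ : ∀ Fs → (∀ {A} → A ∈ Fs → Flat A) → r (⋁ M Fs) ≤ sum (map r Fs)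
        rank-⋁ [] h       = ℕ.≤-trans (rank-mono loopless (⋁-least {[]} loopless λ ())) (ℕ.≤-reflexive (IsPolymatroid.rk-∅ isM))
        rank-⋁ (A ∷ Fs) h = ℕ.≤-trans (rank-mono (J-flat A (⋁ M Fs)) (⋁-least {A ∷ Fs} (J-flat A (⋁ M Fs)) λ
              { (here refl) → Jˡ (h (here refl)) (⋁-flat Fs)
              ; (there i) → ⊆-trans (⋁-upper (flat⊆ ∘ h ∘ there) i) (Jʳ (h (here refl)) (⋁-flat Fs)) }))
          (ℕ.≤-trans (ℕ.m≤m+n _ _) (ℕ.≤-trans (J-rank (h (here refl)) (⋁-flat Fs)) (ℕ.+-monoʳ-≤ (r A) (rank-⋁ Fs (h ∘ there)))))

        rank-R : r R ≤ sum (map r others)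
        rank-R = ℕ.≤-trans (rank-mono (⋁-flat others) (join-least (⋁-flat others) λ i → piece i (f i ≟S E₁))) (rank-⋁ others other-flat)
          where
          other-flat : ∀ {A} → A ∈ others → Flat A
          other-flat i = 𝒢-flat (proj₁ (∈-factors⁻ (proj₁ (∈-filter⁻ (λ A → ¬? (A ≟S E₁)) {xs = factors K} i))))
          piece : ∀ i → Dec (f i ≡ E₁) → rest i ⊆ ⋁ M others
          piece i (yes eq) = ⊆-trans (⊆-reflexive (trans (cong (choose ⊥ id) eq) (choose-yes ⊥ id))) ⊥⊆
          piece i (no ne)  = ⊆-trans (⊆-reflexive (choose-no ⊥ id ne)) (⋁-upper {others} (flat⊆ ∘ other-flat) (∈-filter⁺ (λ A → ¬? (A ≟S E₁)) (f∈ i) ne))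

        rank-split : r E₁ ℕ.+ r R ≤ r K
        rank-split = ℕ.≤-trans (ℕ.+-monoʳ-≤ (r E₁) rank-R) (ℕ.≤-reflexive (sym (trans (rank-sum K K-flat) (sum-remove (maxElems-unique (below 𝒢 K)) E₁∈))))

      -- Additivity at the top forces it below. Enlarging A ∨ B first by E₁ and then by R reaches K,
      -- and by submodularity the rank grows by at most r E₁ - r A and then by at most r R - r B.
      -- Since r E₁ + r R ≤ r K, the rank of A ∨ B is at least r A + r B.
      rank-additive : ∀ {A B} → Flat A → A ⊆ E₁ → Flat B → B ⊆ R → r (J A B) ≡ r A ℕ.+ r B
      rank-additive {A} {B} a la b lb = ℕ.≤-antisym (ℕ.≤-trans (ℕ.m≤m+n _ _) (J-rank a b))
        (ℕ.+-cancelˡ-≤ (r K) _ _ (begin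
          r K ℕ.+ (r A ℕ.+ r B)           ≡⟨ solve 3 (λ k a b → k :+ (a :+ b) := k :+ b :+ a) refl (r K) (r A) (r B) ⟩
          r K ℕ.+ r B ℕ.+ r A             ≤⟨ ℕ.+-monoˡ-≤ (r A) (ℕ.+-mono-≤ (rank-mono (J-flat Y R) K⊆) (rank-mono (flat-∩ (J-flat Z E₁) R-flat)
                                                (∩-greatest (⊆-trans (Jʳ a b) (Jˡ (J-flat A B) E₁-flat)) lb))) ⟩
          r (J Y R) ℕ.+ r (Y ∩ R) ℕ.+ r A ≤⟨ ℕ.+-mono-≤ (J-rank (J-flat Z E₁) R-flat) (rank-mono (flat-∩ (J-flat A B) E₁-flat) (∩-greatest (Jˡ a b) la)) ⟩
          r Y ℕ.+ r R ℕ.+ r (Z ∩ E₁)      ≡⟨ solve 3 (λ y s m → y :+ s :+ m := y :+ m :+ s) refl (r Y) (r R) (r (Z ∩ E₁)) ⟩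
          r Y ℕ.+ r (Z ∩ E₁) ℕ.+ r R      ≤⟨ ℕ.+-monoˡ-≤ (r R) (J-rank (J-flat A B) E₁-flat) ⟩
          r Z ℕ.+ r E₁ ℕ.+ r R            ≡⟨ ℕ.+-assoc (r Z) (r E₁) (r R) ⟩
          r Z ℕ.+ (r E₁ ℕ.+ r R)          ≤⟨ ℕ.+-monoʳ-≤ (r Z) rank-split ⟩
          r Z ℕ.+ r K                     ≡⟨ ℕ.+-comm (r Z) (r K) ⟩
          r K ℕ.+ r Z                     ∎))
        where
        open ℕ.≤-Reasoning
        open import Data.Nat.Solver using (module +-*-Solver)
        open +-*-Solver using (solve; _:+_; _:=_)
        Z = J A B
        Y = J Z E₁
        K⊆ : K ⊆ J Y R
        K⊆ = ⊆-trans (cover K-flat ⊆-refl) (J-least (J-flat Y R)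
          (⊆-trans ∩ʳ (⊆-trans (Jʳ (J-flat A B) E₁-flat) (Jˡ (J-flat Z E₁) R-flat))) (⊆-trans ∩ʳ (Jʳ (J-flat Z E₁) R-flat)))

      below-split : ∀ {G} → T (𝒢 G) → G ⊆ K → G ⊆ E₁ ⊎ G ⊆ R
      below-split g le with below-factor g le
      ... | A , i , ga with A ≟S E₁
      ... | yes refl = inj₁ ga
      ... | no ne    = inj₂ (⊆-trans ga (other⊆R i ne))

-- Induced building sets on intervals

length-filter-remove : ∀ {A : Set} {P Q : A → Set} (P? : ∀ x → Dec (P x)) (Q? : ∀ x → Dec (Q x)) {xs e} →
  Unique xs → e ∈ xs → ¬ Q e → (∀ {x} → x ∈ xs → x ≢ e → P x → Q x) → (∀ {x} → x ∈ xs → x ≢ e → Q x → P x) →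
  length (filter P? xs) ≡ (if does (P? e) then 1 else 0) ℕ.+ length (filter Q? xs)
length-filter-remove {P = P} {Q} P? Q? {xs} {e} u i ¬q f g = go u i f g
  where
  same : ∀ {xs} → (∀ {x} → x ∈ xs → P x → Q x) → (∀ {x} → x ∈ xs → Q x → P x) → length (filter P? xs) ≡ length (filter Q? xs)
  same {[]} f g     = refl
  same {x ∷ xs} f g with P? x | Q? x
  ... | yes _ | yes _ = cong suc (same (f ∘ there) (g ∘ there))
  ... | no _  | no _  = same (f ∘ there) (g ∘ there)
  ... | yes p | no q  = ⊥-elim (q (f (here refl) p))
  ... | no p  | yes q = ⊥-elim (p (g (here refl) q))
  go : ∀ {xs} → Unique xs → e ∈ xs → (∀ {x} → x ∈ xs → x ≢ e → P x → Q x) → (∀ {x} → x ∈ xs → x ≢ e → Q x → P x) →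
    length (filter P? xs) ≡ (if does (P? e) then 1 else 0) ℕ.+ length (filter Q? xs)
  go {x ∷ xs} (p ∷ u) (here refl) f g with P? x | Q? x
  ... | _     | yes q = ⊥-elim (¬q q)
  ... | yes _ | no _  = cong suc (same (λ i → f (there i) (λ eq → All.lookup p i (sym eq))) (λ i → g (there i) (λ eq → All.lookup p i (sym eq))))
  ... | no _  | no _  = same (λ i → f (there i) (λ eq → All.lookup p i (sym eq))) (λ i → g (there i) (λ eq → All.lookup p i (sym eq)))
  go {x ∷ xs} (p ∷ u) (there i) f g with P? x | Q? x
  ... | yes _ | yes _ = trans (cong suc (go u i (f ∘ there) (g ∘ there))) (sym (ℕ.+-suc _ _))
  ... | no _  | no _  = go u i (f ∘ there) (g ∘ there)
  ... | yes a | no b  = ⊥-elim (b (f (here refl) (All.lookup p i) a))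
  ... | no a  | yes b = ⊥-elim (a (g (here refl) (All.lookup p i) b))

module Relative {n : ℕ} (M : Polymatroid n) (𝒢 : SetOfFlats n)
  (isM : IsPolymatroid M) (loopless : Loopless M) (isB : IsBuildingSet M 𝒢) where
  open Building M 𝒢 isM loopless isB public
  private
    X = Subset n
    r = rk M

  opaque
    -- The building set induced on the flats containing F, without passing to complements of F.
    relBS : X → SetOfFlats n
    relBS F A = any (λ G → 𝒢 G ∧ (not (G ⊆ᵇ F) ∧ (A ≡ᵇ J G F))) (allSubsets n)

    relBS⁻ : ∀ F A → T (relBS F A) → ∃ λ G → T (𝒢 G) × G ⊈ F × A ≡ J G F
    relBS⁻ F A t = let G , _ , h = find (Any.any⁻ _ (allSubsets n) t)
                       g , h′ = T-∧⁻ {𝒢 G} h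
                       s , e = T-∧⁻ {not (G ⊆ᵇ F)} h′
                   in G , g , (λ le → T-not⁻ s (⊆ᵇ⁺ G F le)) , ≡ᵇ⁻ A (J G F) e

    relBS⁺ : ∀ F {G} → T (𝒢 G) → G ⊈ F → T (relBS F (J G F))
    relBS⁺ F {G} g nle = Any.any⁺ _ (lose (∈-allSubsets G) (T-∧⁺ g (T-∧⁺ (T-not⁺ (nle ∘ ⊆ᵇ⁻ G F)) (≡ᵇ⁺ (J G F) (J G F) refl))))

  relBS-flat : ∀ {F A} → T (relBS F A) → Flat A
  relBS-flat {F} {A} t = let G , _ , _ , eq = relBS⁻ F A t in subst Flat (sym eq) (J-flat G F)

  -- This is |f| of the building set induced on [H,K].
  factorCount : X → X → ℕ
  factorCount H K = length (filter (λ A → ¬? (A ⊆? H)) (factors K))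

  -- A product decomposition of [F,K] into [F,K₁] and [F,R], with K₁ a member of the induced
  -- building set. The field `count` says that K₁ is one of the factors outside A ∨ B exactly when A
  -- ≠ K₁.
  record Split (F K : X) : Set where
    field
      K₁ R : X
      K₁-flat : Flat K₁
      R-flat  : Flat R
      F⊆K₁ : F ⊆ K₁
      K₁⊆K : K₁ ⊆ K
      F⊆R : F ⊆ R
      R⊆K : R ⊆ K
      K₁∈ : T (relBS F K₁)
      K₁⊈F : K₁ ⊈ F
      side  : ∀ {G} → T (relBS F G) → G ⊆ K → G ⊆ K₁ ⊎ G ⊆ R
      cover : ∀ {H} → Flat H → F ⊆ H → H ⊆ K → H ⊆ J (H ∩ K₁) (H ∩ R)
      left  : ∀ {A B} → Flat A → F ⊆ A → A ⊆ K₁ → Flat B → F ⊆ B → B ⊆ R → J A B ∩ K₁ ⊆ A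
      right : ∀ {A B} → Flat A → F ⊆ A → A ⊆ K₁ → Flat B → F ⊆ B → B ⊆ R → J A B ∩ R ⊆ B
      rank  : ∀ {A B} → Flat A → F ⊆ A → A ⊆ K₁ → Flat B → F ⊆ B → B ⊆ R → r (J A B) ℕ.+ r F ≡ r A ℕ.+ r B
      count : ∀ {A B} → Flat A → F ⊆ A → A ⊆ K₁ → Flat B → F ⊆ B → B ⊆ R →
        factorCount (J A B) K ≡ (if does (A ≟S K₁) then 0 else 1) ℕ.+ factorCount (J K₁ B) K

  module _ {F K : X} (F-flat : Flat F) (K-flat : Flat K) (F⊆K : F ⊆ K) (K⊈F : K ⊈ F) where
    private
      outside-factor : ∃ λ A → A ∈ factors K × A ⊈ F
      outside-factor with All.all? (_⊆? F) (factors K)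
      ... | yes a = ⊥-elim (K⊈F (factors-cover K-flat F-flat (λ i → All.lookup a i)))
      ... | no ¬a = find (All.¬All⇒Any¬ (_⊆? F) (factors K) ¬a)

      E₁ : X
      E₁ = proj₁ outside-factor
      E₁∈ = proj₁ (proj₂ outside-factor)
      open Decomposition K-flat E₁∈ renaming (R to R₀; R-flat to R₀-flat; R⊆K to R₀⊆K; cover to cover₀; left to left₀; right to right₀)
      E₁-flat : Flat E₁
      E₁-flat = 𝒢-flat (proj₁ (∈-factors⁻ E₁∈))
      K₁ = J E₁ F
      R = J R₀ F
      FR = F ∩ R₀
      F₁ = F ∩ E₁
      K₁-flat = J-flat E₁ F
      R-flat = J-flat R₀ F
      FR-flat = flat-∩ F-flat R₀-flat
      F₁-flat = flat-∩ F-flat E₁-flat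
      K₁⊆K : K₁ ⊆ K
      K₁⊆K = J-least K-flat E₁⊆K F⊆K
      R⊆K : R ⊆ K
      R⊆K = J-least K-flat R₀⊆K F⊆K
      F⊆K₁ : F ⊆ K₁
      F⊆K₁ = Jʳ E₁-flat F-flat
      F⊆R : F ⊆ R
      F⊆R = Jʳ R₀-flat F-flat

      J-mono : ∀ {A A′ B B′} → Flat A′ → Flat B′ → A ⊆ A′ → B ⊆ B′ → J A B ⊆ J A′ B′
      J-mono a b p q = J-least (J-flat _ _) (⊆-trans p (Jˡ a b)) (⊆-trans q (Jʳ a b))

      -- As F is the join of F ∩ E₁ and F ∩ R₀, the flat K₁ = E₁ ∨ F is E₁ ∨ (F ∩ R₀), whose
      -- component in R₀ is F ∩ R₀.
      K₁∩R₀ : K₁ ∩ R₀ ⊆ FR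
      K₁∩R₀ = ⊆-trans (∩-greatest (⊆-trans ∩ˡ (J-least (J-flat E₁ FR) (Jˡ E₁-flat FR-flat)
          (⊆-trans (cover₀ F-flat F⊆K) (J-mono E₁-flat FR-flat ∩ʳ ⊆-refl)))) ∩ʳ)
        (right₀ E₁-flat ⊆-refl FR-flat ∩ʳ)

      R∩E₁ : R ∩ E₁ ⊆ F₁
      R∩E₁ = ⊆-trans (∩-greatest (⊆-trans ∩ˡ (J-least (J-flat F₁ R₀) (Jʳ F₁-flat R₀-flat)
          (⊆-trans (cover₀ F-flat F⊆K) (J-mono F₁-flat R₀-flat ⊆-refl ∩ʳ)))) ∩ʳ)
        (left₀ F₁-flat ∩ʳ R₀-flat ⊆-refl)

      module _ {A B : X} (a : Flat A) (FA : F ⊆ A) (AK : A ⊆ K₁) (b : Flat B) (FB : F ⊆ B) (BR : B ⊆ R) where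
        A₁ = A ∩ E₁
        B₂ = B ∩ R₀
        a₁ = flat-∩ a E₁-flat
        b₂ = flat-∩ b R₀-flat

        A⊆ : A ⊆ J A₁ FR
        A⊆ = ⊆-trans (cover₀ a (⊆-trans AK K₁⊆K)) (J-mono a₁ FR-flat ⊆-refl (⊆-trans (∩-greatest (⊆-trans ∩ˡ AK) ∩ʳ) K₁∩R₀))

        B⊆ : B ⊆ J F₁ B₂
        B⊆ = ⊆-trans (cover₀ b (⊆-trans BR R⊆K)) (J-mono F₁-flat b₂ (⊆-trans (∩-greatest (⊆-trans ∩ˡ BR) ∩ʳ) R∩E₁) ⊆-refl)

        AB⊆ : J A B ⊆ J A₁ B₂
        AB⊆ = J-least (J-flat A₁ B₂) (⊆-trans A⊆ (J-mono a₁ b₂ ⊆-refl (∩-greatest (⊆-trans ∩ˡ FB) ∩ʳ)))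
          (⊆-trans B⊆ (J-mono a₁ b₂ (∩-greatest (⊆-trans ∩ˡ FA) ∩ʳ) ⊆-refl))

        AB⊆K : J A B ⊆ K
        AB⊆K = J-least K-flat (⊆-trans AK K₁⊆K) (⊆-trans BR R⊆K)

        left : J A B ∩ K₁ ⊆ A
        left = ⊆-trans (cover₀ (flat-∩ (J-flat A B) K₁-flat) (⊆-trans ∩ˡ AB⊆K)) (J-least a
          (⊆-trans (∩-greatest (⊆-trans ∩ˡ (⊆-trans ∩ˡ AB⊆)) ∩ʳ) (⊆-trans (left₀ a₁ ∩ʳ b₂ ∩ʳ) ∩ˡ))
          (⊆-trans (∩-greatest (⊆-trans ∩ˡ ∩ʳ) ∩ʳ) (⊆-trans K₁∩R₀ (⊆-trans ∩ˡ FA))))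

        right : J A B ∩ R ⊆ B
        right = ⊆-trans (cover₀ (flat-∩ (J-flat A B) R-flat) (⊆-trans ∩ˡ AB⊆K)) (J-least b
          (⊆-trans (∩-greatest (⊆-trans ∩ˡ ∩ʳ) ∩ʳ) (⊆-trans R∩E₁ (⊆-trans ∩ˡ FB)))
          (⊆-trans (∩-greatest (⊆-trans ∩ˡ (⊆-trans ∩ˡ AB⊆)) ∩ʳ) (⊆-trans (right₀ a₁ ∩ʳ b₂ ∩ʳ) ∩ˡ)))

        rank : r (J A B) ℕ.+ r F ≡ r A ℕ.+ r B
        rank = begin
          r (J A B) ℕ.+ r F                                    ≡⟨ cong₂ (λ C D → r C ℕ.+ r D) (⊆-antisym AB⊆ (J-mono a b ∩ˡ ∩ˡ))
                                                                    (⊆-antisym (cover₀ F-flat F⊆K) (J-least F-flat ∩ˡ ∩ˡ)) ⟩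
          r (J A₁ B₂) ℕ.+ r (J F₁ FR)                          ≡⟨ cong₂ ℕ._+_ (rank-additive a₁ ∩ʳ b₂ ∩ʳ) (rank-additive F₁-flat ∩ʳ FR-flat ∩ʳ) ⟩
          (r A₁ ℕ.+ r B₂) ℕ.+ (r F₁ ℕ.+ r FR)                  ≡⟨ solve 4 (λ a b f g → (a :+ b) :+ (f :+ g) := (a :+ g) :+ (f :+ b)) refl (r A₁) (r B₂) (r F₁) (r FR) ⟩
          (r A₁ ℕ.+ r FR) ℕ.+ (r F₁ ℕ.+ r B₂)                  ≡⟨ cong₂ ℕ._+_ (rank-additive a₁ ∩ʳ FR-flat ∩ʳ) (rank-additive F₁-flat ∩ʳ b₂ ∩ʳ) ⟨
          r (J A₁ FR) ℕ.+ r (J F₁ B₂)                          ≡⟨ cong₂ (λ C D → r C ℕ.+ r D) (⊆-antisym A⊆ (J-least a ∩ˡ (⊆-trans ∩ˡ FA)))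
                                                                    (⊆-antisym B⊆ (J-least b (⊆-trans ∩ˡ FB) ∩ˡ)) ⟨
          r A ℕ.+ r B                                          ∎
          where
          open ≡-Reasoning
          open import Data.Nat.Solver using (module +-*-Solver)
          open +-*-Solver using (solve; _:+_; _:=_)

      -- E₁ is the only factor whose position depends on A: all others lie in R, where A ∨ B and K₁
      -- ∨ B both cut out B.
      count : ∀ {A B} → Flat A → F ⊆ A → A ⊆ K₁ → Flat B → F ⊆ B → B ⊆ R →
        factorCount (J A B) K ≡ (if does (A ≟S K₁) then 0 else 1) ℕ.+ factorCount (J K₁ B) K
      count {A} {B} a FA AK b FB BR = trans (length-filter-remove (λ C → ¬? (C ⊆? J A B)) (λ C → ¬? (C ⊆? J K₁ B))
          (maxElems-unique (below 𝒢 K)) E₁∈ (λ h → h (⊆-trans (Jˡ E₁-flat F-flat) (Jˡ K₁-flat b)))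
          (λ i ne h le → h (⊆-trans (∩-greatest le (⊆-trans (other⊆R i ne) (Jˡ R₀-flat F-flat))) (⊆-trans (right K₁-flat F⊆K₁ ⊆-refl b FB BR) (Jʳ a b))))
          (λ i ne h le → h (⊆-trans (∩-greatest le (⊆-trans (other⊆R i ne) (Jˡ R₀-flat F-flat))) (⊆-trans (right a FA AK b FB BR) (Jʳ K₁-flat b)))))
        (cong (ℕ._+ factorCount (J K₁ B) K) (indicator (E₁ ⊆? J A B) (A ≟S K₁)))
        where
        indicator : (d : Dec (E₁ ⊆ J A B)) (e : Dec (A ≡ K₁)) → (if does (¬? d) then 1 else 0) ≡ (if does e then 0 else 1)
        indicator (yes _) (yes _) = refl
        indicator (no _)  (no _)  = refl
        indicator (yes h) (no ne) = ⊥-elim (ne (⊆-antisym AK (⊆-trans (∩-greatest (J-least (J-flat A B) h (⊆-trans FA (Jˡ a b))) ⊆-refl) (left a FA AK b FB BR))))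
        indicator (no h) (yes refl) = ⊥-elim (h (⊆-trans (Jˡ E₁-flat F-flat) (Jˡ a b)))

    split : Split F K
    split = record
      { K₁ = K₁ ; R = R ; K₁-flat = K₁-flat ; R-flat = R-flat ; F⊆K₁ = F⊆K₁ ; K₁⊆K = K₁⊆K ; F⊆R = F⊆R ; R⊆K = R⊆K
      ; K₁∈ = relBS⁺ F (proj₁ (∈-factors⁻ E₁∈)) (proj₂ (proj₂ outside-factor))
      ; K₁⊈F = λ le → proj₂ (proj₂ outside-factor) (⊆-trans (Jˡ E₁-flat F-flat) le)
      ; side = side
      ; cover = λ h FH HK → ⊆-trans (cover₀ h HK) (J-mono (flat-∩ h K₁-flat) (flat-∩ h R-flat)
          (∩-greatest ∩ˡ (⊆-trans ∩ʳ (Jˡ E₁-flat F-flat))) (∩-greatest ∩ˡ (⊆-trans ∩ʳ (Jˡ R₀-flat F-flat))))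
      ; left = left ; right = right ; rank = rank ; count = count }
      where
      side : ∀ {G} → T (relBS F G) → G ⊆ K → G ⊆ K₁ ⊎ G ⊆ R
      side {G} t le with relBS⁻ F G t
      ... | G₀ , g , _ , refl with below-split g (⊆-trans (Jˡ (𝒢-flat g) F-flat) le)
      ... | inj₁ p = inj₁ (J-mono E₁-flat F-flat p ⊆-refl)
      ... | inj₂ p = inj₂ (J-mono R₀-flat F-flat p ⊆-refl)

  base⊆relBS : ∀ {F A} → Flat F → T (relBS F A) → F ⊆ A
  base⊆relBS {F} {A} f t = let G , g , _ , eq = relBS⁻ F A t in subst (F ⊆_) (sym eq) (Jʳ (𝒢-flat g) f)

  relBS⊈base : ∀ {F A} → Flat F → T (relBS F A) → A ⊈ F
  relBS⊈base {F} {A} f t le = let G , g , nle , eq = relBS⁻ F A t in nle (⊆-trans (Jˡ (𝒢-flat g) f) (subst (_⊆ F) eq le))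

  -- Split [F, K ∨ H] along a factor K₁. A common lower member G, not contained in F, forces K and H
  -- onto the same side. If that side were R, then K₁ ⊆ K ∨ H ⊆ R would give K₁ ⊆ F. Hence both lie
  -- in K₁, and their join is K₁, which is a member.
  relBS-join : ∀ {F G K H} → Flat F → T (relBS F G) → T (relBS F K) → T (relBS F H) → G ⊆ K → G ⊆ H → T (relBS F (J K H))
  relBS-join {F} {G} {K} {H} f g k h gk gh = decide (side k (Jˡ kf hf)) (side h (Jʳ kf hf))
    where
    kf = relBS-flat {F} k
    hf = relBS-flat {F} h
    N = J K H
    open Split (split f (J-flat K H) (⊆-trans (base⊆relBS f k) (Jˡ kf hf)) (λ le → relBS⊈base f k (⊆-trans (Jˡ kf hf) le)))
    K₁∩R⊆F : K₁ ∩ R ⊆ F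
    K₁∩R⊆F = ⊆-trans (∩-greatest (⊆-trans ∩ˡ (Jˡ K₁-flat f)) ∩ʳ) (right K₁-flat F⊆K₁ ⊆-refl f ⊆-refl F⊆R)
    decide : K ⊆ K₁ ⊎ K ⊆ R → H ⊆ K₁ ⊎ H ⊆ R → T (relBS F N)
    decide (inj₁ p) (inj₁ q) = subst (T ∘ relBS F) (⊆-antisym K₁⊆K (J-least K₁-flat p q)) K₁∈
    decide (inj₂ p) (inj₂ q) = ⊥-elim (K₁⊈F (⊆-trans (∩-greatest ⊆-refl (⊆-trans K₁⊆K (J-least R-flat p q))) K₁∩R⊆F))
    decide (inj₁ p) (inj₂ q) = ⊥-elim (relBS⊈base f g (⊆-trans (∩-greatest (⊆-trans gk p) (⊆-trans gh q)) K₁∩R⊆F))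
    decide (inj₂ p) (inj₁ q) = ⊥-elim (relBS⊈base f g (⊆-trans (∩-greatest (⊆-trans gh q) (⊆-trans gk p)) K₁∩R⊆F))

-- Nested sets

module Weights (Rg : CommutativeRing 0ℓ 0ℓ) (x a : CommutativeRing.Carrier Rg)
  (a-unfold : CommutativeRing._≈_ Rg a (CommutativeRing._+_ Rg (CommutativeRing.1# Rg) (CommutativeRing._*_ Rg x a))) where
  open CommutativeRing Rg renaming (refl to ≈-refl; sym to ≈-sym; trans to ≈-trans; reflexive to ≈-reflexive) hiding (zero)
  open Sums Rg
  open import Algebra.Properties.Semiring.Exp semiring using (_^_)
  open import Algebra.Solver.Ring.NaturalCoefficients.Default commutativeSemiring using (solve; _:+_; _:*_; _:=_; con)
  open import Relation.Binary.Reasoning.Setoid setoid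

  -- In closed form x + ... + x^(c-1), an empty sum for c = 0 and c = 1.
  w : ℕ → Carrier
  w zero          = 0#
  w (suc zero)    = 0#
  w (suc (suc c)) = w (suc c) + x ^ suc c

  -- The sum formula x + ... + x^c = (x - x^(c+1))/(1 - x), free of division and subtraction.
  w-geometric : ∀ c → w (suc c) + a * x ^ suc c ≈ x * a
  w-geometric zero    = begin
    0# + a * (x * 1#) ≈⟨ solve 2 (λ a x → con 0 :+ a :* (x :* con 1) := x :* a) ≈-refl a x ⟩
    x * a             ∎
  w-geometric (suc c) = begin
    w (suc c) + x ^ suc c + a * (x * x ^ suc c)    ≈⟨ solve 4 (λ w p a x → w :+ p :+ a :* (x :* p) := w :+ (con 1 :+ x :* a) :* p) ≈-refl (w (suc c)) (x ^ suc c) a x ⟩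
    w (suc c) + (1# + x * a) * x ^ suc c           ≈⟨ +-congˡ (*-congʳ a-unfold) ⟨
    w (suc c) + a * x ^ suc c                      ≈⟨ w-geometric c ⟩
    x * a                                          ∎

  -- The value 0 at exponent 0 is what enforces nestedness: the chosen flats strictly below G then
  -- already join to G, and the quotient ring vanishes.
  step : ℕ → Carrier → Carrier → Carrier
  step zero u v    = 0#
  step (suc c) u v = u + w (suc c) * v

  step-cong : ∀ c {u u′ v v′} → u ≈ u′ → v ≈ v′ → step c u v ≈ step c u′ v′
  step-cong zero p q    = ≈-refl
  step-cong (suc c) p q = +-cong p (*-congˡ q)

  module Nested {X : Set} (b : List X → X → ℕ) where

    -- The weighted sum of φ (S ++ T) over the S ⊆ L that are nested relative to T.
    𝒩 : List X → List X → (List X → Carrier) → Carrier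
    𝒩 [] T φ      = φ T
    𝒩 (G ∷ L) T φ = step (b T G) (𝒩 L T φ) (𝒩 L (G ∷ T) φ)

    -- Compares two runs over the same list that start from different chosen flats. The relation Q
    -- has to survive every choice and to guarantee equal exponents; its main use is to compare runs
    -- with and without K₁.
    𝒩-simulate : ∀ (Q : List X → List X → Set) L {φ ψ} →
      (∀ {G S T} → G ∈ L → Q S T → Q (G ∷ S) (G ∷ T)) → (∀ {G S T} → G ∈ L → Q S T → b S G ≡ b T G) →
      (∀ {S T} → Q S T → φ S ≈ ψ T) → ∀ {S T} → Q S T → 𝒩 L S φ ≈ 𝒩 L T ψ
    𝒩-simulate Q [] add same h q      = h q
    𝒩-simulate Q (G ∷ L) {φ} {ψ} add same h {S} {T} q = begin
      step (b S G) (𝒩 L S φ) (𝒩 L (G ∷ S) φ) ≈⟨ ≈-reflexive (cong (λ c → step c (𝒩 L S φ) (𝒩 L (G ∷ S) φ)) (same (here refl) q)) ⟩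
      step (b T G) (𝒩 L S φ) (𝒩 L (G ∷ S) φ) ≈⟨ step-cong (b T G) (go q) (go (add (here refl) q)) ⟩
      step (b T G) (𝒩 L T ψ) (𝒩 L (G ∷ T) ψ) ∎
      where
      go : ∀ {S T} → Q S T → 𝒩 L S φ ≈ 𝒩 L T ψ
      go = 𝒩-simulate Q L (λ i → add (there i)) (λ i → same (there i)) h

    𝒩-cong : ∀ (Inv : List X → Set) L {φ ψ} → (∀ {G T} → G ∈ L → Inv T → Inv (G ∷ T)) →
      (∀ {T} → Inv T → φ T ≈ ψ T) → ∀ {T} → Inv T → 𝒩 L T φ ≈ 𝒩 L T ψ
    𝒩-cong Inv L add h i = 𝒩-simulate (λ S T → S ≡ T × Inv T) L
      (λ { j (refl , i) → refl , add j i }) (λ { j (refl , _) → refl }) (λ { (refl , i) → h i }) (refl , i)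

    𝒩-zero : ∀ L T → 𝒩 L T (λ _ → 0#) ≈ 0#
    𝒩-zero [] T      = ≈-refl
    𝒩-zero (G ∷ L) T = ≈-trans (step-cong (b T G) (𝒩-zero L T) (𝒩-zero L (G ∷ T))) (vanish (b T G))
      where
      vanish : ∀ c → step c 0# 0# ≈ 0#
      vanish zero    = ≈-refl
      vanish (suc c) = solve 1 (λ w → con 0 :+ w :* con 0 := con 0) ≈-refl (w (suc c))

    𝒩-vanish : ∀ (Inv : List X → Set) L {φ} → (∀ {G T} → G ∈ L → Inv T → Inv (G ∷ T)) →
      (∀ {T} → Inv T → φ T ≈ 0#) → ∀ {T} → Inv T → 𝒩 L T φ ≈ 0#
    𝒩-vanish Inv L add h i = ≈-trans (𝒩-cong Inv L add h i) (𝒩-zero L _)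

    𝒩-+ : ∀ L T φ ψ → 𝒩 L T (λ S → φ S + ψ S) ≈ 𝒩 L T φ + 𝒩 L T ψ
    𝒩-+ [] T φ ψ      = ≈-refl
    𝒩-+ (G ∷ L) T φ ψ = ≈-trans (step-cong (b T G) (𝒩-+ L T φ ψ) (𝒩-+ L (G ∷ T) φ ψ)) (split (b T G) (𝒩 L T φ) _ _ _)
      where
      split : ∀ c u v s t → step c (u + v) (s + t) ≈ step c u s + step c v t
      split zero u v s t    = ≈-sym (+-identityˡ 0#)
      split (suc c) u v s t = solve 5 (λ u v s t w → (u :+ v) :+ w :* (s :+ t) := (u :+ w :* s) :+ (v :+ w :* t)) ≈-refl u v s t (w (suc c))

    𝒩-* : ∀ L T c φ → 𝒩 L T (λ S → c * φ S) ≈ c * 𝒩 L T φ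
    𝒩-* [] T c φ      = ≈-refl
    𝒩-* (G ∷ L) T c φ = ≈-trans (step-cong (b T G) (𝒩-* L T c φ) (𝒩-* L (G ∷ T) c φ)) (scale (b T G) (𝒩 L T φ) _)
      where
      scale : ∀ d u v → step d (c * u) (c * v) ≈ c * step d u v
      scale zero u v    = ≈-sym (zeroʳ c)
      scale (suc d) u v = solve 4 (λ c u v w → c :* u :+ w :* (c :* v) := c :* (u :+ w :* v)) ≈-refl c u v (w (suc d))

    𝒩-∑ : ∀ {I : Set} L T (is : List I) (φ : I → List X → Carrier) → 𝒩 L T (λ S → ∑ is (λ i → φ i S)) ≈ ∑ is (λ i → 𝒩 L T (φ i))
    𝒩-∑ L T [] φ       = ≈-trans (𝒩-cong (λ _ → ⊤) L (λ _ _ → tt) (λ _ → ≈-reflexive (∑-foldr [] _)) tt) (≈-trans (𝒩-zero L T) (≈-reflexive (sym (∑-foldr [] _))))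
    𝒩-∑ L T (i ∷ is) φ = begin
      𝒩 L T (λ S → ∑ (i ∷ is) (λ i → φ i S))                 ≈⟨ 𝒩-cong (λ _ → ⊤) L (λ _ _ → tt) (λ {S} _ → ∑-∷ i is (λ i → φ i S)) tt ⟩
      𝒩 L T (λ S → φ i S + ∑ is (λ i → φ i S))               ≈⟨ 𝒩-+ L T (φ i) _ ⟩
      𝒩 L T (φ i) + 𝒩 L T (λ S → ∑ is (λ i → φ i S))         ≈⟨ +-congˡ (𝒩-∑ L T is φ) ⟩
      𝒩 L T (φ i) + ∑ is (λ i → 𝒩 L T (φ i))                 ≈⟨ ∑-∷ i is _ ⟨
      ∑ (i ∷ is) (λ i → 𝒩 L T (φ i))                         ∎

    𝒩-++ : ∀ L L′ T φ → 𝒩 (L ++ L′) T φ ≈ 𝒩 L T (λ S → 𝒩 L′ S φ)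
    𝒩-++ [] L′ T φ      = ≈-refl
    𝒩-++ (G ∷ L) L′ T φ = step-cong (b T G) (𝒩-++ L L′ T φ) (𝒩-++ L L′ (G ∷ T) φ)

  𝒩-map : ∀ {X Y : Set} (b : List X → X → ℕ) (b′ : List Y → Y → ℕ) (f : X → Y) (Ok : X → Set) L T →
    All Ok L → All Ok T → (∀ {T G} → All Ok T → Ok G → b T G ≡ b′ (map f T) (f G)) →
    Nested.𝒩 b L T (λ _ → 1#) ≈ Nested.𝒩 b′ (map f L) (map f T) (λ _ → 1#)
  𝒩-map b b′ f Ok [] T [] t h            = ≈-refl
  𝒩-map b b′ f Ok (G ∷ L) T (g ∷ l) t h  = begin
    step (b T G) _ _                  ≈⟨ step-cong (b T G) (𝒩-map b b′ f Ok L T l t h) (𝒩-map b b′ f Ok L (G ∷ T) l (g ∷ t) h) ⟩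
    step (b T G) _ _                  ≈⟨ ≈-reflexive (cong (λ c → step c _ _) (h t g)) ⟩
    step (b′ (map f T) (f G)) _ _     ∎

filter-filter : ∀ {A : Set} {P Q R : A → Set} (P? : ∀ x → Dec (P x)) (Q? : ∀ x → Dec (Q x)) (R? : ∀ x → Dec (R x)) →
  (∀ {x} → P x → Q x → R x) → (∀ {x} → R x → P x × Q x) → ∀ xs → filter Q? (filter P? xs) ≡ filter R? xs
filter-filter P? Q? R? f g [] = refl
filter-filter P? Q? R? f g (x ∷ xs) with P? x
... | no ¬p = trans (filter-filter P? Q? R? f g xs) (sym (List.filter-reject R? (¬p ∘ proj₁ ∘ g)))
... | yes p with Q? x
... | yes q = trans (cong (x ∷_) (filter-filter P? Q? R? f g xs)) (sym (List.filter-accept R? (f p q)))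
... | no ¬q = trans (filter-filter P? Q? R? f g xs) (sym (List.filter-reject R? (¬q ∘ proj₂ ∘ g)))

module NestedSums {n : ℕ} (M : Polymatroid n) (𝒢 : SetOfFlats n)
  (isM : IsPolymatroid M) (loopless : Loopless M) (isB : IsBuildingSet M 𝒢)
  (Rg : CommutativeRing 0ℓ 0ℓ) (x a : CommutativeRing.Carrier Rg)
  (a-unfold : CommutativeRing._≈_ Rg a (CommutativeRing._+_ Rg (CommutativeRing.1# Rg) (CommutativeRing._*_ Rg x a))) where
  open Relative M 𝒢 isM loopless isB public
  open CommutativeRing Rg renaming (refl to ≈-refl; sym to ≈-sym; trans to ≈-trans; reflexive to ≈-reflexive) hiding (zero)
  open Sums Rg public
  open Weights Rg x a a-unfold public
  open import Relation.Binary.Reasoning.Setoid setoid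
  private
    X = Subset n
    r = rk M

  interval : X → X → List X
  interval F K = filter (λ A → (F ⊆? A) ×-dec (A ⊆? K)) (flats M)

  interval-unique : ∀ F K → Unique (interval F K)
  interval-unique F K = Unique.filter⁺ _ flats-unique

  ∈-interval⁺ : ∀ {F K A} → Flat A → F ⊆ A → A ⊆ K → A ∈ interval F K
  ∈-interval⁺ {F} {K} a p q = ∈-filter⁺ (λ A → (F ⊆? A) ×-dec (A ⊆? K)) (∈-flats a) (p , q)

  ∈-interval⁻ : ∀ {F K A} → A ∈ interval F K → Flat A × F ⊆ A × A ⊆ K
  ∈-interval⁻ {F} {K} i = let j , p = ∈-filter⁻ (λ A → (F ⊆? A) ×-dec (A ⊆? K)) {xs = flats M} i in ∈-flats⁻ j , p

  module Over {F : X} (F-flat : Flat F) where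

    rel : X → Set
    rel G = T (relBS F G)

    relList : X → List X
    relList K = filter (λ G → Tdec (relBS F G ∧ (G ⊆ᵇ K))) (allSubsets n)

    ∈-relList⁻ : ∀ {K G} → G ∈ relList K → rel G × G ⊆ K
    ∈-relList⁻ {K} {G} i = let t = proj₂ (∈-filter⁻ (λ G → Tdec (relBS F G ∧ (G ⊆ᵇ K))) {xs = allSubsets n} i) in
      proj₁ (T-∧⁻ {relBS F G} t) , ⊆ᵇ⁻ G K (proj₂ (T-∧⁻ {relBS F G} t))

    ∈-relList⁺ : ∀ {K G} → rel G → G ⊆ K → G ∈ relList K
    ∈-relList⁺ {K} {G} g le = ∈-filter⁺ (λ G → Tdec (relBS F G ∧ (G ⊆ᵇ K))) (∈-allSubsets G) (T-∧⁺ g (⊆ᵇ⁺ G K le))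

    relList-sorted : ∀ K → AllPairs (λ A B → B ⊈ A) (relList K)
    relList-sorted K = AllPairs.filter⁺ (λ G → Tdec (relBS F G ∧ (G ⊆ᵇ K))) (allSubsets-sorted n)

    opaque
      ⋁F : List X → X
      ⋁F T = ⋁ M (F ∷ T)

      ⋁F≡⋁ : ∀ T → ⋁F T ≡ ⋁ M (F ∷ T)
      ⋁F≡⋁ T = refl

      ⋁F-flat : ∀ T → Flat (⋁F T)
      ⋁F-flat T = ⋁-flat (F ∷ T)

      private
        within : ∀ {T A} → All rel T → A ∈ F ∷ T → A ⊆ ground M
        within t (here refl) = flat⊆ F-flat
        within t (there i)   = flat⊆ (relBS-flat {F} (All.lookup t i))

      F⊆⋁F : ∀ {T} → All rel T → F ⊆ ⋁F T
      F⊆⋁F {T} t = ⋁-upper {F ∷ T} (within t) (here refl)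

      ⋁F-upper : ∀ {T A} → All rel T → A ∈ T → A ⊆ ⋁F T
      ⋁F-upper {T} t i = ⋁-upper {F ∷ T} (within t) (there i)

      ⋁F-least : ∀ {T C} → Flat C → F ⊆ C → (∀ {A} → A ∈ T → A ⊆ C) → ⋁F T ⊆ C
      ⋁F-least {T} c p h = ⋁-least {F ∷ T} c λ { (here refl) → p ; (there i) → h i }

    below-in : List X → X → List X
    below-in T G = filter (λ A → Tdec (A ⊊ᵇ G)) T

    ∈-below⁺ : ∀ {T G A} → A ∈ T → A ⊊ G → A ∈ below-in T G
    ∈-below⁺ {G = G} {A} i lt = ∈-filter⁺ (λ A → Tdec (A ⊊ᵇ G)) i (⊊ᵇ⁺ A G lt)

    ∈-below⁻ : ∀ {T G A} → A ∈ below-in T G → A ∈ T × A ⊊ G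
    ∈-below⁻ {T} {G} {A} i = let j , t = ∈-filter⁻ (λ A → Tdec (A ⊊ᵇ G)) {xs = T} i in j , ⊊ᵇ⁻ A G t

    below-rel : ∀ {T} G → All rel T → All rel (below-in T G)
    below-rel G t = All.filter⁺ (λ A → Tdec (A ⊊ᵇ G)) t

    supF : List X → X → X
    supF T G = ⋁F (below-in T G)

    supF⊆ : ∀ {T G} → Flat G → F ⊆ G → supF T G ⊆ G
    supF⊆ {T} {G} g le = ⋁F-least g le (λ i → proj₁ (proj₂ (∈-below⁻ {T} i)))

    supF⊆⋁F : ∀ {T} G → All rel T → supF T G ⊆ ⋁F T
    supF⊆⋁F {T} G t = ⋁F-least (⋁F-flat T) (F⊆⋁F t) (λ i → ⋁F-upper t (proj₁ (∈-below⁻ {T} {G} i)))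

    supF-cong : ∀ {S T G} → All rel S → All rel T → (∀ {A} → A ∈ S → A ⊊ G → A ∈ T) → (∀ {A} → A ∈ T → A ⊊ G → A ∈ S) → supF S G ≡ supF T G
    supF-cong {S} {T} {G} s t f g = ⊆-antisym (half s t f) (half t s g)
      where
      half : ∀ {S T} → All rel S → All rel T → (∀ {A} → A ∈ S → A ⊊ G → A ∈ T) → supF S G ⊆ supF T G
      half {S} {T} s t f = ⋁F-least (⋁F-flat (below-in T G)) (F⊆⋁F (below-rel G t))
        (λ i → let j , lt = ∈-below⁻ {S} i in ⋁F-upper (below-rel G t) (∈-below⁺ (f j lt) lt))

    opaque
      b : List X → X → ℕ
      b T G = r G ∸ r (supF T G)

      b≡ : ∀ T G → b T G ≡ r G ∸ r (supF T G)
      b≡ T G = refl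

      b-cong : ∀ {S T G} → supF S G ≡ supF T G → b S G ≡ b T G
      b-cong {G = G} eq = cong (λ A → r G ∸ r A) eq

      b-zero⇒ : ∀ {T G} → rel G → b T G ≡ 0 → G ⊆ supF T G
      b-zero⇒ {T} {G} g eq = decidable-stable (G ⊆? supF T G) λ nle →
        ℕ.<⇒≱ (rank-strict (⋁F-flat (below-in T G)) (relBS-flat {F} g) (supF⊆ {T} (relBS-flat {F} g) (base⊆relBS F-flat g)) nle) (ℕ.m∸n≡0⇒m≤n eq)

      b-suc⇒ : ∀ {T G c} → b T G ≡ suc c → supF T G ≢ G
      b-suc⇒ {T} {G} eq e with trans (sym eq) (trans (cong (λ A → r G ∸ r A) e) (ℕ.n∸n≡0 (r G)))
      ... | ()

    open Nested b

    H : X → Carrier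
    H K = 𝒩 (relList K) [] (λ _ → 1#)

    at : X → List X → Carrier
    at J T = ⟦ ⋁F T ≟S J ⟧

    W : X → Carrier
    W J = 𝒩 (relList J) [] (at J)

    AllIn : X → List X → Set
    AllIn K T = All (λ G → rel G × G ⊆ K) T

    at-vanish : ∀ L {T J A} → All rel L → All rel T → A ∈ T → A ⊈ J → 𝒩 L T (at J) ≈ 0#
    at-vanish L {T} {J} {A} l t i nle = 𝒩-vanish (λ T → All rel T × A ∈ T) L
      (λ j (t , i) → All.lookup l j ∷ t , there i)
      (λ {T} (t , i) → ⟦⟧-no (⋁F T ≟S J) (λ eq → nle (subst (A ⊆_) eq (⋁F-upper t i)))) (t , i)

    -- A chosen G outside J makes the join J impossible, so only the branch without G counts. If the
    -- exponent at G is 0, the left side vanishes; so does the right side, because the flats chosen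
    -- so far already have a join containing G.
    at-filter : ∀ L {T J} → All rel L → All rel T → 𝒩 L T (at J) ≈ 𝒩 (filter (_⊆? J) L) T (at J)
    at-filter [] l t = ≈-refl
    at-filter (G ∷ L) {T} {J} (g ∷ l) t with G ⊆? J
    ... | yes le = step-cong (b T G) (at-filter L l t) (at-filter L l (g ∷ t))
    ... | no nle = cases (b T G) refl
      where
      cases : ∀ c → b T G ≡ c → step c (𝒩 L T (at J)) (𝒩 L (G ∷ T) (at J)) ≈ 𝒩 (filter (_⊆? J) L) T (at J)
      cases zero eq = ≈-sym (𝒩-vanish (λ S → All rel S × (∀ {A} → A ∈ T → A ∈ S)) (filter (_⊆? J) L)
        (λ j (s , h) → All.lookup l (proj₁ (∈-filter⁻ (_⊆? J) {xs = L} j)) ∷ s , there ∘ h)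
        (λ {S} (s , h) → ⟦⟧-no (⋁F S ≟S J) (λ e → nle (⊆-trans (b-zero⇒ {T} g eq) (subst (supF T G ⊆_) e
          (⋁F-least (⋁F-flat S) (F⊆⋁F s) (λ i → ⋁F-upper s (h (proj₁ (∈-below⁻ {T} i))))))))) (t , id))
      cases (suc c) eq = begin
        𝒩 L T (at J) + w (suc c) * 𝒩 L (G ∷ T) (at J)    ≈⟨ +-cong (at-filter L l t) (*-congˡ (at-vanish L l (g ∷ t) (here refl) nle)) ⟩
        𝒩 (filter (_⊆? J) L) T (at J) + w (suc c) * 0#   ≈⟨ ≈-trans (+-congˡ (zeroʳ _)) (+-identityʳ _) ⟩
        𝒩 (filter (_⊆? J) L) T (at J)                    ∎

    relList-rel : ∀ K → All rel (relList K)
    relList-rel K = All.tabulate (proj₁ ∘ ∈-relList⁻)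

    filter-relList : ∀ {J K} → J ⊆ K → filter (_⊆? J) (relList K) ≡ relList J
    filter-relList {J} {K} le = filter-filter (λ G → Tdec (relBS F G ∧ (G ⊆ᵇ K))) (_⊆? J) (λ G → Tdec (relBS F G ∧ (G ⊆ᵇ J)))
      (λ {G} t gj → T-∧⁺ (proj₁ (T-∧⁻ {relBS F G} t)) (⊆ᵇ⁺ G J gj))
      (λ {G} t → let g , s = T-∧⁻ {relBS F G} t ; gj = ⊆ᵇ⁻ G J s in T-∧⁺ g (⊆ᵇ⁺ G K (⊆-trans gj le)) , gj) (allSubsets n)

    W-in : ∀ {J K} → J ⊆ K → 𝒩 (relList K) [] (at J) ≈ W J
    W-in {J} {K} le = ≈-trans (at-filter (relList K) (relList-rel K) []) (≈-reflexive (cong (λ L → 𝒩 L [] (at J)) (filter-relList le)))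

    H-sum : ∀ {K} → Flat K → F ⊆ K → H K ≈ ∑ (interval F K) W
    H-sum {K} k le = begin
      𝒩 (relList K) [] (λ _ → 1#)
        ≈⟨ 𝒩-cong (AllIn K) (relList K) (λ j t → ∈-relList⁻ j ∷ t) (λ {T} t → total T t) [] ⟩
      𝒩 (relList K) [] (λ T → ∑ (interval F K) (λ J → at J T))
        ≈⟨ 𝒩-∑ (relList K) [] (interval F K) at ⟩
      ∑ (interval F K) (λ J → 𝒩 (relList K) [] (at J))
        ≈⟨ ∑-cong (interval F K) (λ i → W-in (proj₂ (proj₂ (∈-interval⁻ i)))) ⟩
      ∑ (interval F K) W ∎
      where
      total : ∀ T → AllIn K T → 1# ≈ ∑ (interval F K) (λ J → at J T)
      total T t = ≈-sym (≈-trans (∑-single (λ J → at J T) (interval-unique F K)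
        (∈-interval⁺ (⋁F-flat T) (F⊆⋁F (All.map proj₁ t)) (⋁F-least k le (λ i → proj₂ (All.lookup t i))))
        (λ {J} _ ne → ⟦⟧-no (⋁F T ≟S J) (ne ∘ sym))) (⟦⟧-yes (⋁F T ≟S ⋁F T) refl))

-- Adding a factor to a nested set

AllPairs-middle : ∀ {A : Set} {R : A → A → Set} xs {v ys} → AllPairs R (xs ++ v ∷ ys) → All (λ x → R x v) xs × All (R v) ys
AllPairs-middle [] (p ∷ _)       = [] , p
AllPairs-middle (x ∷ xs) (p ∷ a) = let l , r = AllPairs-middle xs a in All.head (All.++⁻ʳ xs p) ∷ l , r

module Recursion {n : ℕ} (M : Polymatroid n) (𝒢 : SetOfFlats n)
  (isM : IsPolymatroid M) (loopless : Loopless M) (isB : IsBuildingSet M 𝒢)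
  (Rg : CommutativeRing 0ℓ 0ℓ) (x a : CommutativeRing.Carrier Rg)
  (a-unfold : CommutativeRing._≈_ Rg a (CommutativeRing._+_ Rg (CommutativeRing.1# Rg) (CommutativeRing._*_ Rg x a))) where
  open NestedSums M 𝒢 isM loopless isB Rg x a a-unfold
  open CommutativeRing Rg renaming (refl to ≈-refl; sym to ≈-sym; trans to ≈-trans; reflexive to ≈-reflexive) hiding (zero)
  open import Relation.Binary.Reasoning.Setoid setoid
  private
    X = Subset n
    r = rk M

  module _ {F K : X} (F-flat : Flat F) (K-flat : Flat K) (sp : Split F K) where
    open Split sp
    open Over F-flat
    open Nested b
    private
      K₁∩R : K₁ ∩ R ⊆ F
      K₁∩R = ⊆-trans (∩-greatest (⊆-trans ∩ˡ (Jˡ K₁-flat F-flat)) ∩ʳ) (right K₁-flat F⊆K₁ ⊆-refl F-flat ⊆-refl F⊆R)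

      K₁⊈R : K₁ ⊈ R
      K₁⊈R le = K₁⊈F (⊆-trans (∩-greatest ⊆-refl le) K₁∩R)

      K₁-rel∈ : K₁ ∈ relList K
      K₁-rel∈ = ∈-relList⁺ K₁∈ K₁⊆K

      L₁ = proj₁ (∈-∃++ K₁-rel∈)
      L₂ = proj₁ (proj₂ (∈-∃++ K₁-rel∈))

      relList≡ : relList K ≡ L₁ ++ K₁ ∷ L₂
      relList≡ = proj₂ (proj₂ (∈-∃++ K₁-rel∈))

      middle : All (λ G → K₁ ⊈ G) L₁ × All (λ G → G ⊈ K₁) L₂
      middle = AllPairs-middle L₁ (subst (AllPairs _) relList≡ (relList-sorted K))

      Typed : X → Set
      Typed G = rel G × ((G ⊆ K₁ × K₁ ⊈ G) ⊎ G ⊆ R)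

      L₁-typed : ∀ {G} → G ∈ L₁ → Typed G
      L₁-typed {G} i with ∈-relList⁻ (subst (G ∈_) (sym relList≡) (∈-++⁺ˡ i))
      ... | g , le with side g le
      ... | inj₁ p = g , inj₁ (p , All.lookup (proj₁ middle) i)
      ... | inj₂ p = g , inj₂ p

      -- Members that come after K₁ are not contained in it, so they lie in R. From K₁ onwards the
      -- run therefore leaves the part inside K₁ unchanged.
      L₂-rel : ∀ {G} → G ∈ L₂ → rel G × G ⊆ R
      L₂-rel {G} i with ∈-relList⁻ (subst (G ∈_) (sym relList≡) (∈-++⁺ʳ L₁ (there i)))
      ... | g , le with side g le
      ... | inj₁ p = ⊥-elim (All.lookup (proj₂ middle) i p)
      ... | inj₂ p = g , p

      rels : ∀ {T} → All Typed T → All rel T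
      rels = All.map proj₁

      part₁ part₂ : List X → X
      part₁ T = supF T K₁
      part₂ T = ⋁F (filter (_⊆? R) T)

      part₂-rel : ∀ {T} → All Typed T → All rel (filter (_⊆? R) T)
      part₂-rel t = All.filter⁺ (_⊆? R) (rels t)

      F⊆part₁ : ∀ {T} → All Typed T → F ⊆ part₁ T
      F⊆part₁ t = F⊆⋁F (below-rel K₁ (rels t))

      part₁⊆ : ∀ {T} → part₁ T ⊆ K₁
      part₁⊆ {T} = supF⊆ {T} K₁-flat F⊆K₁

      F⊆part₂ : ∀ {T} → All Typed T → F ⊆ part₂ T
      F⊆part₂ t = F⊆⋁F (part₂-rel t)

      part₂⊆ : ∀ {T} → part₂ T ⊆ R
      part₂⊆ {T} = ⋁F-least R-flat F⊆R (λ i → proj₂ (∈-filter⁻ (_⊆? R) {xs = T} i))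

      part₁-flat : ∀ T → Flat (part₁ T)
      part₁-flat T = ⋁F-flat (below-in T K₁)

      part₂-flat : ∀ T → Flat (part₂ T)
      part₂-flat T = ⋁F-flat (filter (_⊆? R) T)

      part₂-upper : ∀ {T A} → All Typed T → A ∈ T → A ⊆ R → A ⊆ part₂ T
      part₂-upper t i le = ⋁F-upper (part₂-rel t) (∈-filter⁺ (_⊆? R) i le)

      ⋁-parts : ∀ {T} → All Typed T → ⋁F T ≡ J (part₁ T) (part₂ T)
      ⋁-parts {T} t = ⊆-antisym
        (⋁F-least (J-flat _ _) (⊆-trans (F⊆part₁ t) (Jˡ (part₁-flat T) (part₂-flat T))) each)
        (J-least (⋁F-flat T) (supF⊆⋁F K₁ (rels t)) (⋁F-least (⋁F-flat T) (F⊆⋁F (rels t))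
          (λ i → ⋁F-upper (rels t) (proj₁ (∈-filter⁻ (_⊆? R) {xs = T} i)))))
        where
        each : ∀ {A} → A ∈ T → A ⊆ J (part₁ T) (part₂ T)
        each i with proj₂ (All.lookup t i)
        ... | inj₁ lt = ⊆-trans (⋁F-upper (below-rel K₁ (rels t)) (∈-below⁺ i lt)) (Jˡ (part₁-flat T) (part₂-flat T))
        ... | inj₂ le = ⊆-trans (part₂-upper t i le) (Jʳ (part₁-flat T) (part₂-flat T))

    J-injectiveˡ : ∀ {A B A′ B′} → Flat A → F ⊆ A → A ⊆ K₁ → Flat B → F ⊆ B → B ⊆ R →
      Flat A′ → F ⊆ A′ → A′ ⊆ K₁ → Flat B′ → F ⊆ B′ → B′ ⊆ R → J A B ≡ J A′ B′ → A ≡ A′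
    J-injectiveˡ a p q b s t a′ p′ q′ b′ s′ t′ eq = ⊆-antisym
      (⊆-trans (∩-greatest (subst (_ ⊆_) eq (Jˡ a b)) q) (left a′ p′ q′ b′ s′ t′))
      (⊆-trans (∩-greatest (subst (_ ⊆_) (sym eq) (Jˡ a′ b′)) q′) (left a p q b s t))

    J-injectiveʳ : ∀ {A B A′ B′} → Flat A → F ⊆ A → A ⊆ K₁ → Flat B → F ⊆ B → B ⊆ R →
      Flat A′ → F ⊆ A′ → A′ ⊆ K₁ → Flat B′ → F ⊆ B′ → B′ ⊆ R → J A B ≡ J A′ B′ → B ≡ B′
    J-injectiveʳ a p q b s t a′ p′ q′ b′ s′ t′ eq = ⊆-antisym
      (⊆-trans (∩-greatest (subst (_ ⊆_) eq (Jʳ a b)) t) (right a′ p′ q′ b′ s′ t′))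
      (⊆-trans (∩-greatest (subst (_ ⊆_) (sym eq) (Jʳ a′ b′)) t′) (right a p q b s t))

    below-K₁ : List X
    below-K₁ = filter (λ A → ¬? (A ≟S K₁)) (interval F K₁)

    ∈-below-K₁⁻ : ∀ {A} → A ∈ below-K₁ → Flat A × F ⊆ A × A ⊆ K₁ × A ≢ K₁
    ∈-below-K₁⁻ i = let j , ne = ∈-filter⁻ (λ A → ¬? (A ≟S K₁)) {xs = interval F K₁} i
                        f , p , q = ∈-interval⁻ j in f , p , q , ne

    module _ {B : X} (B-flat : Flat B) (F⊆B : F ⊆ B) (B⊆R : B ⊆ R) where
      private
        inK : ∀ {A} → A ⊆ K₁ → J A B ⊆ K
        inK le = J-least K-flat (⊆-trans le K₁⊆K) (⊆-trans B⊆R R⊆K)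

        split₁ : ∀ {A T} → Flat A → F ⊆ A → A ⊆ K₁ → All Typed T → ⋁F T ≡ J A B → part₁ T ≡ A
        split₁ {T = T} a p q t eq = J-injectiveˡ (part₁-flat T) (F⊆part₁ t) (part₁⊆ {T}) (part₂-flat T) (F⊆part₂ t) (part₂⊆ {T}) a p q B-flat F⊆B B⊆R
          (trans (sym (⋁-parts t)) eq)

        L₂-keeps : ∀ {G T} → G ∈ L₂ → All Typed T → part₁ (G ∷ T) ≡ part₁ T
        L₂-keeps {G} {T} j t = let g , le = L₂-rel j in supF-cong (g ∷ rels t) (rels t)
          (λ { (here refl) lt → ⊥-elim (relBS⊈base F-flat g (⊆-trans (∩-greatest (proj₁ lt) le) K₁∩R)) ; (there i) _ → i })
          (λ i _ → there i)

        other-part : ∀ {A T} → Flat A → F ⊆ A → A ⊆ K₁ → All Typed T → part₁ T ≢ A → 𝒩 L₂ T (at (J A B)) ≈ 0#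
        other-part {A} {T} f p q t ne = 𝒩-vanish (λ S → All Typed S × part₁ S ≡ part₁ T) L₂
          (λ j (s , e) → (proj₁ (L₂-rel j) , inj₂ (proj₂ (L₂-rel j))) ∷ s , trans (L₂-keeps j s) e)
          (λ {S} (s , e) → ⟦⟧-no (⋁F S ≟S J A B) (λ eq → ne (trans (sym e) (split₁ f p q s eq)))) (t , refl)

        record Paired (T₀ S T : List X) : Set where
          field
            S-rel : All rel S
            T-typed : All Typed T
            same-part : part₁ T ≡ part₁ T₀
            S⊆ : ∀ {A} → A ∈ S → A ≡ K₁ ⊎ A ∈ T
            T⊆ : ∀ {A} → A ∈ T → A ∈ S
            K₁∈S : K₁ ∈ S

        -- Later members lie in R and cannot contain K₁, so choosing K₁ leaves their exponents
        -- alone. It changes the join in one component only, from `part₁ T₀` to K₁.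
        with-K₁ : ∀ {T₀} → All Typed T₀ → 𝒩 L₂ (K₁ ∷ T₀) (at (J K₁ B)) ≈ 𝒩 L₂ T₀ (at (J (part₁ T₀) B))
        with-K₁ {T₀} t₀ = 𝒩-simulate (Paired T₀) L₂ add same value
          record { S-rel = K₁∈ ∷ rels t₀ ; T-typed = t₀ ; same-part = refl
                 ; S⊆ = λ { (here refl) → inj₁ refl ; (there i) → inj₂ i } ; T⊆ = there ; K₁∈S = here refl }
          where
          open Paired
          add : ∀ {G S T} → G ∈ L₂ → Paired T₀ S T → Paired T₀ (G ∷ S) (G ∷ T)
          add j p .S-rel     = proj₁ (L₂-rel j) ∷ p .S-rel
          add j p .T-typed   = (proj₁ (L₂-rel j) , inj₂ (proj₂ (L₂-rel j))) ∷ p .T-typed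
          add j p .same-part = trans (L₂-keeps j (p .T-typed)) (p .same-part)
          add j p .S⊆ (here refl) = inj₂ (here refl)
          add j p .S⊆ (there i) with p .S⊆ i
          ... | inj₁ e = inj₁ e
          ... | inj₂ k = inj₂ (there k)
          add j p .T⊆ (here refl) = here refl
          add j p .T⊆ (there i)   = there (p .T⊆ i)
          add j p .K₁∈S = there (p .K₁∈S)
          same : ∀ {G S T} → G ∈ L₂ → Paired T₀ S T → b S G ≡ b T G
          same {G} {S} {T} j p = b-cong {S} {T} {G} (supF-cong (p .S-rel) (rels (p .T-typed)) only (λ i _ → p .T⊆ i))
            where
            only : ∀ {A} → A ∈ S → A ⊊ G → A ∈ T
            only i lt with p .S⊆ i
            ... | inj₁ refl = ⊥-elim (K₁⊈R (⊆-trans (proj₁ lt) (proj₂ (L₂-rel j))))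
            ... | inj₂ k    = k
          value : ∀ {S T} → Paired T₀ S T → at (J K₁ B) S ≈ at (J (part₁ T₀) B) T
          value {S} {T} p = ⟦⟧-cong (⋁F S ≟S J K₁ B) (⋁F T ≟S J (part₁ T₀) B)
            (λ eq → trans ⋁T (cong (J (part₁ T₀)) (J-injectiveʳ K₁-flat F⊆K₁ ⊆-refl (part₂-flat T) (F⊆part₂ t) (part₂⊆ {T})
              K₁-flat F⊆K₁ ⊆-refl B-flat F⊆B B⊆R (trans (sym ⋁S) eq))))
            (λ eq → trans ⋁S (cong (J K₁) (J-injectiveʳ (part₁-flat T₀) (F⊆part₁ t₀) (part₁⊆ {T₀}) (part₂-flat T) (F⊆part₂ t) (part₂⊆ {T})
              (part₁-flat T₀) (F⊆part₁ t₀) (part₁⊆ {T₀}) B-flat F⊆B B⊆R (trans (sym ⋁T) eq))))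
            where
            t = p .T-typed
            ⋁T : ⋁F T ≡ J (part₁ T₀) (part₂ T)
            ⋁T = trans (⋁-parts t) (cong (λ A → J A (part₂ T)) (p .same-part))
            each : ∀ {A} → A ∈ S → A ⊆ J K₁ (part₂ T)
            each i with p .S⊆ i
            ... | inj₁ refl = Jˡ K₁-flat (part₂-flat T)
            ... | inj₂ k with proj₂ (All.lookup t k)
            ... | inj₁ lt = ⊆-trans (proj₁ lt) (Jˡ K₁-flat (part₂-flat T))
            ... | inj₂ le = ⊆-trans (part₂-upper t k le) (Jʳ K₁-flat (part₂-flat T))
            ⋁S : ⋁F S ≡ J K₁ (part₂ T)
            ⋁S = ⊆-antisym (⋁F-least (J-flat _ _) (⊆-trans F⊆K₁ (Jˡ K₁-flat (part₂-flat T))) each)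
              (J-least (⋁F-flat S) (⋁F-upper (p .S-rel) (p .K₁∈S)) (⋁F-least (⋁F-flat S) (F⊆⋁F (p .S-rel))
                (λ i → ⋁F-upper (p .S-rel) (p .T⊆ (proj₁ (∈-filter⁻ (_⊆? R) {xs = T} i))))))

        local : ∀ T → All Typed T → 𝒩 (K₁ ∷ L₂) T (at (J K₁ B)) ≈ ∑ below-K₁ (λ A → w (r K₁ ∸ r A) * 𝒩 (K₁ ∷ L₂) T (at (J A B)))
        local T t = cases (b T K₁) refl
          where
          cases : ∀ c → b T K₁ ≡ c → step c (𝒩 L₂ T (at (J K₁ B))) (𝒩 L₂ (K₁ ∷ T) (at (J K₁ B))) ≈
            ∑ below-K₁ (λ A → w (r K₁ ∸ r A) * step c (𝒩 L₂ T (at (J A B))) (𝒩 L₂ (K₁ ∷ T) (at (J A B))))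
          cases zero eq    = ≈-sym (∑-zero below-K₁ (λ _ → zeroʳ _))
          -- If K₁ is not chosen, the part inside K₁ stays at s ≠ K₁, so the join K₁ ∨ B requires
          -- K₁, and its weight is given by r K₁ - r s. On the right only A = s contributes, and
          -- only through the runs that avoid K₁.
          cases (suc c) eq = begin
            𝒩 L₂ T (at (J K₁ B)) + w (suc c) * 𝒩 L₂ (K₁ ∷ T) (at (J K₁ B))
              ≈⟨ +-cong (other-part K₁-flat F⊆K₁ ⊆-refl t s≢K₁) (*-congˡ (with-K₁ t)) ⟩
            0# + w (suc c) * 𝒩 L₂ T (at (J s B))
              ≈⟨ ≈-trans (+-identityˡ _) (*-congʳ (≈-reflexive (cong w (trans (sym eq) (b≡ T K₁))))) ⟩
            w (r K₁ ∸ r s) * 𝒩 L₂ T (at (J s B))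
              ≈⟨ ∑-single (λ A → w (r K₁ ∸ r A) * 𝒩 L₂ T (at (J A B))) (Unique.filter⁺ (λ A → ¬? (A ≟S K₁)) (interval-unique F K₁))
                   (∈-filter⁺ (λ A → ¬? (A ≟S K₁)) (∈-interval⁺ (part₁-flat T) (F⊆part₁ t) (part₁⊆ {T})) s≢K₁)
                   (λ i ne → let f , p , q , _ = ∈-below-K₁⁻ i in ≈-trans (*-congˡ (other-part f p q t (ne ∘ sym))) (zeroʳ _)) ⟨
            ∑ below-K₁ (λ A → w (r K₁ ∸ r A) * 𝒩 L₂ T (at (J A B)))
              ≈⟨ ∑-cong below-K₁ (λ i → *-congˡ (≈-sym (absent i))) ⟩
            ∑ below-K₁ (λ A → w (r K₁ ∸ r A) * (𝒩 L₂ T (at (J A B)) + w (suc c) * 𝒩 L₂ (K₁ ∷ T) (at (J A B)))) ∎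
            where
            s = part₁ T
            s≢K₁ : s ≢ K₁
            s≢K₁ = b-suc⇒ {T} {K₁} eq
            absent : ∀ {A} → A ∈ below-K₁ → 𝒩 L₂ T (at (J A B)) + w (suc c) * 𝒩 L₂ (K₁ ∷ T) (at (J A B)) ≈ 𝒩 L₂ T (at (J A B))
            absent {A} i = let f , p , q , ne = ∈-below-K₁⁻ i in
              ≈-trans (+-congˡ (≈-trans (*-congˡ (at-vanish L₂ (All.tabulate (proj₁ ∘ L₂-rel)) (K₁∈ ∷ rels t) (here refl)
                (λ le → ne (⊆-antisym q (⊆-trans (∩-greatest le ⊆-refl) (left f p q B-flat F⊆B B⊆R)))))) (zeroʳ _))) (+-identityʳ _)

      -- The factor K₁ can be added to the nested sets whose join is A ∨ B with A < K₁, and every nested set with join K₁ ∨ B arises so.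
      W-recursion : W (J K₁ B) ≈ ∑ below-K₁ (λ A → w (r K₁ ∸ r A) * W (J A B))
      W-recursion = begin
        W (J K₁ B)                                                       ≈⟨ expand ⊆-refl ⟩
        𝒩 L₁ [] (λ T → 𝒩 (K₁ ∷ L₂) T (at (J K₁ B)))
          ≈⟨ 𝒩-cong (All Typed) L₁ (λ j t → L₁-typed j ∷ t) (λ {T} → local T) [] ⟩
        𝒩 L₁ [] (λ T → ∑ below-K₁ (λ A → w (r K₁ ∸ r A) * 𝒩 (K₁ ∷ L₂) T (at (J A B))))
          ≈⟨ 𝒩-∑ L₁ [] below-K₁ _ ⟩
        ∑ below-K₁ (λ A → 𝒩 L₁ [] (λ T → w (r K₁ ∸ r A) * 𝒩 (K₁ ∷ L₂) T (at (J A B))))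
          ≈⟨ ∑-cong below-K₁ (λ {A} i → let _ , _ , q , _ = ∈-below-K₁⁻ i in
               ≈-trans (𝒩-* L₁ [] (w (r K₁ ∸ r A)) (λ T → 𝒩 (K₁ ∷ L₂) T (at (J A B)))) (*-congˡ (≈-sym (expand q)))) ⟩
        ∑ below-K₁ (λ A → w (r K₁ ∸ r A) * W (J A B))                    ∎
        where
        expand : ∀ {A} → A ⊆ K₁ → W (J A B) ≈ 𝒩 L₁ [] (λ T → 𝒩 (K₁ ∷ L₂) T (at (J A B)))
        expand {A} le = begin
          W (J A B)                                       ≈⟨ W-in (inK le) ⟨
          𝒩 (relList K) [] (at (J A B))                   ≈⟨ ≈-reflexive (cong (λ L → 𝒩 L [] (at (J A B))) relList≡) ⟩
          𝒩 (L₁ ++ K₁ ∷ L₂) [] (at (J A B))               ≈⟨ 𝒩-++ L₁ (K₁ ∷ L₂) [] (at (J A B)) ⟩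
          𝒩 L₁ [] (λ T → 𝒩 (K₁ ∷ L₂) T (at (J A B)))      ∎

-- Incidence algebra

∸-split : ∀ {k k₁ c j j₁ f b} → j₁ ℕ.+ f ≡ k₁ ℕ.+ b → j ℕ.+ f ≡ c ℕ.+ b → c ≤ k₁ → j ≤ k → j₁ ≤ k → k ∸ j ≡ (k₁ ∸ c) ℕ.+ (k ∸ j₁)
∸-split {k} {k₁} {c} {j} {j₁} {f} {b} e₁ e c≤ j≤ j₁≤ = ℕ.+-cancelʳ-≡ j _ _ (begin
  (k ∸ j) ℕ.+ j                        ≡⟨ ℕ.m∸n+n≡m j≤ ⟩
  k                                    ≡⟨ ℕ.m∸n+n≡m j₁≤ ⟨
  (k ∸ j₁) ℕ.+ j₁                      ≡⟨ cong ((k ∸ j₁) ℕ.+_) joins ⟩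
  (k ∸ j₁) ℕ.+ ((k₁ ∸ c) ℕ.+ j)        ≡⟨ ℕ.+-assoc (k ∸ j₁) _ _ ⟨
  (k ∸ j₁) ℕ.+ (k₁ ∸ c) ℕ.+ j          ≡⟨ cong (ℕ._+ j) (ℕ.+-comm (k ∸ j₁) _) ⟩
  (k₁ ∸ c) ℕ.+ (k ∸ j₁) ℕ.+ j          ∎)
  where
  open ≡-Reasoning
  joins : j₁ ≡ (k₁ ∸ c) ℕ.+ j
  joins = ℕ.+-cancelʳ-≡ f _ _ (begin
    j₁ ℕ.+ f                    ≡⟨ e₁ ⟩
    k₁ ℕ.+ b                    ≡⟨ cong (ℕ._+ b) (ℕ.m∸n+n≡m c≤) ⟨
    (k₁ ∸ c) ℕ.+ c ℕ.+ b        ≡⟨ ℕ.+-assoc (k₁ ∸ c) c b ⟩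
    (k₁ ∸ c) ℕ.+ (c ℕ.+ b)      ≡⟨ cong ((k₁ ∸ c) ℕ.+_) e ⟨
    (k₁ ∸ c) ℕ.+ (j ℕ.+ f)      ≡⟨ ℕ.+-assoc (k₁ ∸ c) j f ⟨
    (k₁ ∸ c) ℕ.+ j ℕ.+ f        ∎)

module Identities {n : ℕ} (M : Polymatroid n) (𝒢 : SetOfFlats n)
  (isM : IsPolymatroid M) (loopless : Loopless M) (isB : IsBuildingSet M 𝒢)
  (Rg : CommutativeRing 0ℓ 0ℓ) (x a : CommutativeRing.Carrier Rg)
  (a-unfold : CommutativeRing._≈_ Rg a (CommutativeRing._+_ Rg (CommutativeRing.1# Rg) (CommutativeRing._*_ Rg x a))) where
  open NestedSums M 𝒢 isM loopless isB Rg x a a-unfold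
  open Recursion M 𝒢 isM loopless isB Rg x a a-unfold
  open CommutativeRing Rg renaming (refl to ≈-refl; sym to ≈-sym; trans to ≈-trans; reflexive to ≈-reflexive) hiding (zero)
  open import Algebra.Properties.Semiring.Exp semiring using (_^_; ^-homo-*)
  open import Algebra.Properties.Ring ring using (+-cancelʳ)
  open import Algebra.Solver.Ring.NaturalCoefficients.Default commutativeSemiring using (solve; _:+_; _:*_; _:=_; con)
  open import Relation.Binary.Reasoning.Setoid setoid
  private
    X = Subset n
    r = rk M

  interval-upper : ∀ {F A K} → A ⊆ K → filter (_⊆? A) (interval F K) ≡ interval F A
  interval-upper {F} {A} {K} le = filter-filter (λ B → (F ⊆? B) ×-dec (B ⊆? K)) (_⊆? A) (λ B → (F ⊆? B) ×-dec (B ⊆? A))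
    (λ (p , _) q → p , q) (λ (p , q) → (p , ⊆-trans q le) , q) (flats M)

  interval-lower : ∀ {F A K} → F ⊆ A → filter (A ⊆?_) (interval F K) ≡ interval A K
  interval-lower {F} {A} {K} le = filter-filter (λ B → (F ⊆? B) ×-dec (B ⊆? K)) (A ⊆?_) (λ B → (A ⊆? B) ×-dec (B ⊆? K))
    (λ (_ , q) p → p , q) (λ (p , q) → (⊆-trans le p , q) , p) (flats M)

  ∑-triangle : ∀ F K (f : X → X → Carrier) →
    ∑ (interval F K) (λ A → ∑ (interval F A) (f A)) ≈ ∑ (interval F K) (λ B → ∑ (interval B K) (λ A → f A B))
  ∑-triangle F K f = begin
    ∑ I (λ A → ∑ (interval F A) (f A))
      ≈⟨ ∑-cong I (λ {A} i → ≈-trans (≈-reflexive (cong (λ l → ∑ l (f A)) (sym (interval-upper (proj₂ (proj₂ (∈-interval⁻ i))))))) (∑-filter (_⊆? A) I (f A))) ⟩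
    ∑ I (λ A → ∑ I (λ B → ⟦ B ⊆? A ⟧ * f A B))
      ≈⟨ ∑-swap I I (λ A B → ⟦ B ⊆? A ⟧ * f A B) ⟩
    ∑ I (λ B → ∑ I (λ A → ⟦ B ⊆? A ⟧ * f A B))
      ≈⟨ ∑-cong I (λ {B} i → ≈-trans (≈-sym (∑-filter (B ⊆?_) I (λ A → f A B))) (≈-reflexive (cong (λ l → ∑ l (λ A → f A B)) (interval-lower (proj₁ (proj₂ (∈-interval⁻ i))))))) ⟩
    ∑ I (λ B → ∑ (interval B K) (λ A → f A B)) ∎
    where I = interval F K

  ∑-bottom : ∀ {F K} f → Flat F → F ⊆ K → ∑ (interval F K) f ≈ f F + ∑ (filter (λ A → ¬? (A ≟S F)) (interval F K)) f
  ∑-bottom f F-flat le = ∑-remove f _≟S_ (interval-unique _ _) (∈-interval⁺ F-flat ⊆-refl le)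

  ∑-point : ∀ {F} f → Flat F → ∑ (interval F F) f ≈ f F
  ∑-point f F-flat = ∑-single f (interval-unique _ _) (∈-interval⁺ F-flat ⊆-refl ⊆-refl)
    (λ i ne → let _ , p , q = ∈-interval⁻ i in ⊥-elim (ne (⊆-antisym q p)))

  larger : ∀ {F A} → F ⊆ A → A ≢ F → n ∸ ∣ A ∣ < n ∸ ∣ F ∣
  larger {F} {A} le ne = ℕ.∸-monoʳ-< (p⊂q⇒∣p∣<∣q∣ {p = F} {q = A} (le , ⊈⇒∃ (λ h → ne (⊆-antisym h le)))) (∣p∣≤n A)

  flat-induction : (Q : X → Set) → (∀ {F} → Flat F → (∀ {A} → Flat A → F ⊆ A → A ≢ F → Q A) → Q F) → ∀ {F} → Flat F → Q F
  flat-induction Q step {F} f = go (suc (n ∸ ∣ F ∣)) f ℕ.≤-refl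
    where
    go : ∀ k {F} → Flat F → n ∸ ∣ F ∣ < k → Q F
    go (suc k) f (s≤s le) = step f (λ a p ne → go k a (ℕ.<-≤-trans (larger p ne) le))

  module _ {P Q : X → X → Carrier} (P-diag : ∀ {F} → Flat F → P F F ≈ 1#)
    (PQ : ∀ {F K} → Flat F → Flat K → F ⊆ K → ∑ (interval F K) (λ J → P F J * Q J K) ≈ ⟦ F ≟S K ⟧) where

    -- From PQ = 1 and associativity, P(QP) = P. Since P is 1 on the diagonal, this equation at
    -- (F,K) isolates (QP)(F,K). By induction from larger flats down to F, the other terms
    -- contribute only P(F,K) at A = K, which cancels the right side.
    inverse-swap : ∀ {F K} → Flat F → Flat K → F ⊆ K → ∑ (interval F K) (λ J → Q F J * P J K) ≈ ⟦ F ≟S K ⟧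
    inverse-swap {K = K} F-flat K-flat = flat-induction (λ F → F ⊆ K → QP F K ≈ ⟦ F ≟S K ⟧) (λ {F} → induct F) F-flat
      where
      QP : X → X → Carrier
      QP F K = ∑ (interval F K) (λ J → Q F J * P J K)
      through : ∀ {F} → Flat F → F ⊆ K → ∑ (interval F K) (λ A → P F A * QP A K) ≈ P F K
      through {F} f le = begin
        ∑ (interval F K) (λ A → P F A * QP A K)
          ≈⟨ ∑-cong (interval F K) (λ {A} _ → ≈-trans (∑-*ˡ (interval A K) (P F A) _) (∑-cong (interval A K) (λ _ → ≈-sym (*-assoc _ _ _)))) ⟩
        ∑ (interval F K) (λ A → ∑ (interval A K) (λ B → P F A * Q A B * P B K))
          ≈⟨ ∑-triangle F K (λ B A → P F A * Q A B * P B K) ⟨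
        ∑ (interval F K) (λ B → ∑ (interval F B) (λ A → P F A * Q A B * P B K))
          ≈⟨ ∑-cong (interval F K) (λ {B} i → let b , p , q = ∈-interval⁻ i in
               ≈-trans (≈-sym (∑-*ʳ (interval F B) (P B K) _)) (*-congʳ (PQ f b p))) ⟩
        ∑ (interval F K) (λ B → ⟦ F ≟S B ⟧ * P B K)
          ≈⟨ ∑-single (λ B → ⟦ F ≟S B ⟧ * P B K) (interval-unique F K) (∈-interval⁺ f ⊆-refl le)
               (λ {B} _ ne → ≈-trans (*-congʳ (⟦⟧-no (F ≟S B) (ne ∘ sym))) (zeroˡ _)) ⟩
        ⟦ F ≟S F ⟧ * P F K
          ≈⟨ ≈-trans (*-congʳ (⟦⟧-yes (F ≟S F) refl)) (*-identityˡ _) ⟩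
        P F K ∎
      induct : ∀ F → Flat F → (∀ {A} → Flat A → F ⊆ A → A ≢ F → A ⊆ K → QP A K ≈ ⟦ A ≟S K ⟧) → F ⊆ K → QP F K ≈ ⟦ F ≟S K ⟧
      induct F f ih le = decide (F ≟S K)
        where
        above = filter (λ A → ¬? (A ≟S F)) (interval F K)
        above⁻ : ∀ {A} → A ∈ above → A ∈ interval F K × A ≢ F
        above⁻ i = ∈-filter⁻ (λ A → ¬? (A ≟S F)) {xs = interval F K} i
        decide : (d : Dec (F ≡ K)) → QP F K ≈ ⟦ d ⟧
        decide (yes refl) = begin
          QP F F                                          ≈⟨ ∑-point _ f ⟩
          Q F F * P F F                                   ≈⟨ *-comm _ _ ⟩
          P F F * Q F F                                   ≈⟨ ∑-point (λ J → P F J * Q J F) f ⟨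
          ∑ (interval F F) (λ J → P F J * Q J F)          ≈⟨ ≈-trans (PQ f f ⊆-refl) (⟦⟧-yes (F ≟S F) refl) ⟩
          1#                                              ∎
        decide (no F≢K) = +-cancelʳ (P F K) _ _ (begin
          QP F K + P F K
            ≈⟨ +-cong (≈-trans (*-congʳ (P-diag f)) (*-identityˡ _)) tail ⟨
          P F F * QP F K + ∑ above (λ A → P F A * QP A K)
            ≈⟨ ∑-bottom (λ A → P F A * QP A K) f le ⟨
          ∑ (interval F K) (λ A → P F A * QP A K)
            ≈⟨ through f le ⟩
          P F K
            ≈⟨ +-identityˡ _ ⟨
          0# + P F K ∎)
          where
          tail : ∑ above (λ A → P F A * QP A K) ≈ P F K
          tail = begin
            ∑ above (λ A → P F A * QP A K)
              ≈⟨ ∑-cong above (λ i → let j , ne = above⁻ i ; A-flat , p , q = ∈-interval⁻ j in *-congˡ (ih A-flat p ne q)) ⟩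
            ∑ above (λ A → P F A * ⟦ A ≟S K ⟧)
              ≈⟨ ∑-single (λ A → P F A * ⟦ A ≟S K ⟧) (Unique.filter⁺ (λ A → ¬? (A ≟S F)) (interval-unique F K))
                   (∈-filter⁺ (λ A → ¬? (A ≟S F)) (∈-interval⁺ K-flat le ⊆-refl) (F≢K ∘ sym))
                   (λ {A} _ ne → ≈-trans (*-congˡ (⟦⟧-no (A ≟S K) ne)) (zeroʳ _)) ⟩
            P F K * ⟦ K ≟S K ⟧
              ≈⟨ ≈-trans (*-congˡ (⟦⟧-yes (K ≟S K) refl)) (*-identityʳ _) ⟩
            P F K ∎

  module Main (mob : X → X → Carrier)
    (mob-sum : ∀ {F K} → Flat F → Flat K → F ⊆ K → ∑ (interval F K) (mob F) ≈ ⟦ F ≟S K ⟧) where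

    charPoly : X → X → Carrier
    charPoly F K = ∑ (interval F K) (λ J → mob F J * x ^ (r K ∸ r J))

    private
      mob-diag : ∀ {F} → Flat F → mob F F ≈ 1#
      mob-diag {F} f = ≈-trans (≈-sym (∑-point (mob F) f)) (≈-trans (mob-sum f f ⊆-refl) (⟦⟧-yes (F ≟S F) refl))

      -- The Möbius function is given by its sums over the upper argument; exchanging the factors of
      -- its inverse gives the sums over the lower one.
      mob-dual : ∀ {F K} → Flat F → Flat K → F ⊆ K → ∑ (interval F K) (λ J → 1# * mob J K) ≈ ⟦ F ≟S K ⟧
      mob-dual = inverse-swap {mob} {λ _ _ → 1#} mob-diag
        (λ {F} {K} f k le → ≈-trans (∑-cong (interval F K) (λ _ → *-identityʳ _)) (mob-sum f k le))

    charPoly-sum : ∀ {A K} → Flat A → Flat K → A ⊆ K → ∑ (interval A K) (λ J → charPoly J K) ≈ x ^ (r K ∸ r A)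
    charPoly-sum {A} {K} A-flat K-flat le = begin
      ∑ (interval A K) (λ J → ∑ (interval J K) (λ B → mob J B * x ^ (r K ∸ r B)))
        ≈⟨ ∑-triangle A K (λ B J → mob J B * x ^ (r K ∸ r B)) ⟨
      ∑ (interval A K) (λ B → ∑ (interval A B) (λ J → mob J B * x ^ (r K ∸ r B)))
        ≈⟨ ∑-cong (interval A K) (λ {B} i → let b , p , _ = ∈-interval⁻ i in
             ≈-trans (≈-sym (∑-*ʳ (interval A B) (x ^ (r K ∸ r B)) _)) (*-congʳ (≈-trans (∑-cong (interval A B) (λ _ → ≈-sym (*-identityˡ _))) (mob-dual A-flat b p)))) ⟩
      ∑ (interval A K) (λ B → ⟦ A ≟S B ⟧ * x ^ (r K ∸ r B))
        ≈⟨ ∑-single (λ B → ⟦ A ≟S B ⟧ * x ^ (r K ∸ r B)) (interval-unique A K) (∈-interval⁺ A-flat ⊆-refl le)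
             (λ {B} _ ne → ≈-trans (*-congʳ (⟦⟧-no (A ≟S B) (ne ∘ sym))) (zeroˡ _)) ⟩
      ⟦ A ≟S A ⟧ * x ^ (r K ∸ r A)
        ≈⟨ ≈-trans (*-congʳ (⟦⟧-yes (A ≟S A) refl)) (*-identityˡ _) ⟩
      x ^ (r K ∸ r A) ∎

    kernel : X → X → Carrier
    kernel J K = charPoly J K * a ^ factorCount J K

    module _ {F K : X} (F-flat : Flat F) (K-flat : Flat K) (sp : Split F K) where
      open Split sp
      open Over F-flat

      private
        J-mono : ∀ {A A′ B B′} → Flat A′ → Flat B′ → A ⊆ A′ → B ⊆ B′ → J A B ⊆ J A′ B′
        J-mono a b p q = J-least (J-flat _ _) (⊆-trans p (Jˡ a b)) (⊆-trans q (Jʳ a b))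

        top : J K₁ R ≡ K
        top = ⊆-antisym (J-least K-flat K₁⊆K R⊆K) (⊆-trans (cover K-flat (⊆-trans F⊆K₁ K₁⊆K) ⊆-refl) (J-mono K₁-flat R-flat ∩ʳ ∩ʳ))

        bottom : J F F ≡ F
        bottom = ⊆-antisym (J-least F-flat ⊆-refl ⊆-refl) (Jˡ F-flat F-flat)

      ∑-product : ∀ {C A D B} → Flat C → Flat A → Flat D → Flat B → F ⊆ C → C ⊆ A → A ⊆ K₁ → F ⊆ D → D ⊆ B → B ⊆ R → ∀ f →
        ∑ (interval (J C D) (J A B)) f ≈ ∑ (interval D B) (λ B′ → ∑ (interval C A) (λ A′ → f (J A′ B′)))
      ∑-product {C} {A} {D} {B} c a d b FC CA AK FD DB BR f = ≈-trans
        (∑-reindex f (λ p → J (proj₂ p) (proj₁ p)) (λ H → H ∩ R , H ∩ K₁) (interval-unique _ _)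
          (Unique.cartesianProduct⁺ (interval-unique D B) (interval-unique C A)) to from)
        (∑-cartesianProduct (interval D B) (interval C A) _)
        where
        to : ∀ {p} → p ∈ cartesianProduct (interval D B) (interval C A) →
          J (proj₂ p) (proj₁ p) ∈ interval (J C D) (J A B) × (J (proj₂ p) (proj₁ p) ∩ R , J (proj₂ p) (proj₁ p) ∩ K₁) ≡ p
        to {B′ , A′} i =
          let j , k = ∈-cartesianProduct⁻ (interval D B) (interval C A) i
              b′ , DB′ , BB′ = ∈-interval⁻ j
              a′ , CA′ , AA′ = ∈-interval⁻ k
              FA = ⊆-trans FC CA′ ; AK₁ = ⊆-trans AA′ AK ; FB = ⊆-trans FD DB′ ; BR′ = ⊆-trans BB′ BR
          in ∈-interval⁺ (J-flat A′ B′) (J-mono a′ b′ CA′ DB′) (J-mono a b AA′ BB′) ,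
             cong₂ _,_ (⊆-antisym (right a′ FA AK₁ b′ FB BR′) (∩-greatest (Jʳ a′ b′) BR′))
                       (⊆-antisym (left a′ FA AK₁ b′ FB BR′) (∩-greatest (Jˡ a′ b′) AK₁))
        from : ∀ {H} → H ∈ interval (J C D) (J A B) →
          (H ∩ R , H ∩ K₁) ∈ cartesianProduct (interval D B) (interval C A) × J (H ∩ K₁) (H ∩ R) ≡ H
        from {H} i =
          let h , p , q = ∈-interval⁻ i
              FA = ⊆-trans FC CA ; FB = ⊆-trans FD DB
          in ∈-cartesianProduct⁺
               (∈-interval⁺ (flat-∩ h R-flat) (∩-greatest (⊆-trans (Jʳ c d) p) (⊆-trans DB BR))
                 (⊆-trans (∩-greatest (⊆-trans ∩ˡ q) ∩ʳ) (right a FA AK b FB BR)))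
               (∈-interval⁺ (flat-∩ h K₁-flat) (∩-greatest (⊆-trans (Jˡ c d) p) (⊆-trans CA AK))
                 (⊆-trans (∩-greatest (⊆-trans ∩ˡ q) ∩ʳ) (left a FA AK b FB BR))) ,
             ⊆-antisym (J-least h ∩ˡ ∩ˡ) (cover h (⊆-trans FC (⊆-trans (Jˡ c d) p)) (⊆-trans q (J-least K-flat (⊆-trans AK K₁⊆K) (⊆-trans BR R⊆K))))

      module _ {C : X} (C-flat : Flat C) (F⊆C : F ⊆ C) (C⊆K₁ : C ⊆ K₁) where

        -- Both sides have the same sums over the intervals [B,R].
        charPoly-column : ∀ {B} → Flat B → F ⊆ B → B ⊆ R →
          ∑ (interval C K₁) (λ A → charPoly (J A B) K) ≈ x ^ (r K₁ ∸ r C) * charPoly (J K₁ B) K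
        charPoly-column {B} b = flat-induction (λ B → F ⊆ B → B ⊆ R → f B ≈ g B) induct b
          where
          f g : X → Carrier
          f B = ∑ (interval C K₁) (λ A → charPoly (J A B) K)
          g B = x ^ (r K₁ ∸ r C) * charPoly (J K₁ B) K
          module _ {B} (b : Flat B) (FB : F ⊆ B) (BR : B ⊆ R) where
            f-sum : ∑ (interval B R) f ≈ x ^ (r K ∸ r (J C B))
            f-sum = begin
              ∑ (interval B R) f
                ≈⟨ ∑-product C-flat K₁-flat b R-flat F⊆C C⊆K₁ ⊆-refl FB BR ⊆-refl (λ A → charPoly A K) ⟨
              ∑ (interval (J C B) (J K₁ R)) (λ A → charPoly A K)
                ≈⟨ ≈-reflexive (cong (λ H → ∑ (interval (J C B) H) (λ A → charPoly A K)) top) ⟩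
              ∑ (interval (J C B) K) (λ A → charPoly A K)
                ≈⟨ charPoly-sum (J-flat C B) K-flat (J-least K-flat (⊆-trans C⊆K₁ K₁⊆K) (⊆-trans BR R⊆K)) ⟩
              x ^ (r K ∸ r (J C B)) ∎
            g-sum : ∑ (interval B R) g ≈ x ^ (r K₁ ∸ r C) * x ^ (r K ∸ r (J K₁ B))
            g-sum = begin
              ∑ (interval B R) g
                ≈⟨ ∑-*ˡ (interval B R) _ _ ⟨
              x ^ (r K₁ ∸ r C) * ∑ (interval B R) (λ B′ → charPoly (J K₁ B′) K)
                ≈⟨ *-congˡ (∑-cong (interval B R) (λ {B′} _ → ≈-sym (∑-point (λ A → charPoly (J A B′) K) K₁-flat))) ⟩
              x ^ (r K₁ ∸ r C) * ∑ (interval B R) (λ B′ → ∑ (interval K₁ K₁) (λ A → charPoly (J A B′) K))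
                ≈⟨ *-congˡ (∑-product K₁-flat K₁-flat b R-flat F⊆K₁ ⊆-refl ⊆-refl FB BR ⊆-refl (λ A → charPoly A K)) ⟨
              x ^ (r K₁ ∸ r C) * ∑ (interval (J K₁ B) (J K₁ R)) (λ A → charPoly A K)
                ≈⟨ *-congˡ (≈-reflexive (cong (λ H → ∑ (interval (J K₁ B) H) (λ A → charPoly A K)) top)) ⟩
              x ^ (r K₁ ∸ r C) * ∑ (interval (J K₁ B) K) (λ A → charPoly A K)
                ≈⟨ *-congˡ (charPoly-sum (J-flat K₁ B) K-flat (J-least K-flat K₁⊆K (⊆-trans BR R⊆K))) ⟩
              x ^ (r K₁ ∸ r C) * x ^ (r K ∸ r (J K₁ B)) ∎
            ranks : r K ∸ r (J C B) ≡ (r K₁ ∸ r C) ℕ.+ (r K ∸ r (J K₁ B))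
            ranks = ∸-split (rank K₁-flat F⊆K₁ ⊆-refl b FB BR) (rank C-flat F⊆C C⊆K₁ b FB BR) (rank-mono K₁-flat C⊆K₁)
              (rank-mono K-flat (J-least K-flat (⊆-trans C⊆K₁ K₁⊆K) (⊆-trans BR R⊆K))) (rank-mono K-flat (J-least K-flat K₁⊆K (⊆-trans BR R⊆K)))
          induct : ∀ {B} → Flat B → (∀ {A} → Flat A → B ⊆ A → A ≢ B → F ⊆ A → A ⊆ R → f A ≈ g A) → F ⊆ B → B ⊆ R → f B ≈ g B
          induct {B} b ih FB BR = +-cancelʳ (∑ above g) _ _ (begin
            f B + ∑ above g             ≈⟨ +-congˡ (∑-cong above (λ i → let j , ne = ∈-filter⁻ (λ A → ¬? (A ≟S B)) {xs = interval B R} i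
                                                                            v , p , q = ∈-interval⁻ j in ih v p ne (⊆-trans FB p) q)) ⟨
            f B + ∑ above f             ≈⟨ ∑-bottom f b BR ⟨
            ∑ (interval B R) f          ≈⟨ f-sum b FB BR ⟩
            x ^ (r K ∸ r (J C B))       ≈⟨ ≈-reflexive (cong (x ^_) (ranks b FB BR)) ⟩
            x ^ ((r K₁ ∸ r C) ℕ.+ (r K ∸ r (J K₁ B))) ≈⟨ ^-homo-* x (r K₁ ∸ r C) _ ⟩
            x ^ (r K₁ ∸ r C) * x ^ (r K ∸ r (J K₁ B)) ≈⟨ g-sum b FB BR ⟨
            ∑ (interval B R) g          ≈⟨ ∑-bottom g b BR ⟩
            g B + ∑ above g             ∎)
            where above = filter (λ A → ¬? (A ≟S B)) (interval B R)

      module _ {B : X} (B-flat : Flat B) (F⊆B : F ⊆ B) (B⊆R : B ⊆ R) where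
        private
          -- The share of the factor K₁ in the power of a at A ∨ B. The remaining power does not
          -- depend on A.
          α : X → Carrier
          α A = if does (A ≟S K₁) then 1# else a

          α-top : α K₁ ≈ 1#
          α-top with K₁ ≟S K₁
          ... | yes _ = ≈-refl
          ... | no ne = ⊥-elim (ne refl)

          α-below : ∀ {A} → A ≢ K₁ → α A ≈ a
          α-below {A} ne with A ≟S K₁
          ... | yes eq = ⊥-elim (ne eq)
          ... | no _   = ≈-refl

          χB : X → Carrier
          χB A = charPoly (J A B) K

          tailSum : X → Carrier
          tailSum C = ∑ (interval C K₁) (λ A → α A * χB A)

          tailSum-top : tailSum K₁ ≈ χB K₁
          tailSum-top = ≈-trans (∑-point _ K₁-flat) (≈-trans (*-congʳ α-top) (*-identityˡ _))

          -- Put d = r K₁ - r C. By `charPoly-column` the values `χB` add up to x^d `χB K₁` over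
          -- [C,K₁]. Weighting all but the top one by a gives (1 - a + a x^d) `χB K₁`, and 1 - a =
          -- -x a makes the bracket equal to -(x + ... + x^(d-1)).
          tailSum-below : ∀ {C} → C ∈ below-K₁ F-flat K-flat sp → tailSum C + w (r K₁ ∸ r C) * χB K₁ ≈ 0#
          tailSum-below {C} i = positive (r K₁ ∸ r C) refl
            where
            c = ∈-below-K₁⁻ F-flat K-flat sp i
            C-flat = proj₁ c
            F⊆C = proj₁ (proj₂ c)
            C⊆K₁ = proj₁ (proj₂ (proj₂ c))
            C≢K₁ = proj₂ (proj₂ (proj₂ c))
            rest = filter (λ A → ¬? (A ≟S K₁)) (interval C K₁)
            K₁∈I = ∈-interval⁺ K₁-flat C⊆K₁ ⊆-refl
            tail : tailSum C ≈ χB K₁ + a * ∑ rest χB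
            tail = begin
              tailSum C                                      ≈⟨ ∑-remove (λ A → α A * χB A) _≟S_ (interval-unique C K₁) K₁∈I ⟩
              α K₁ * χB K₁ + ∑ rest (λ A → α A * χB A)       ≈⟨ +-cong (≈-trans (*-congʳ α-top) (*-identityˡ _)) (∑-cong rest (λ j →
                                                                  *-congʳ (α-below (proj₂ (∈-filter⁻ (λ A → ¬? (A ≟S K₁)) {xs = interval C K₁} j))))) ⟩
              χB K₁ + ∑ rest (λ A → a * χB A)                ≈⟨ +-congˡ (∑-*ˡ rest a χB) ⟨
              χB K₁ + a * ∑ rest χB                          ∎
            column : χB K₁ + ∑ rest χB ≈ x ^ (r K₁ ∸ r C) * χB K₁
            column = ≈-trans (≈-sym (∑-remove χB _≟S_ (interval-unique C K₁) K₁∈I)) (charPoly-column C-flat F⊆C C⊆K₁ B-flat F⊆B B⊆R)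
            positive : ∀ d → r K₁ ∸ r C ≡ d → tailSum C + w d * χB K₁ ≈ 0#
            positive zero eq    = ⊥-elim (ℕ.<⇒≱ (rank-strict C-flat K₁-flat C⊆K₁ (λ le → C≢K₁ (⊆-antisym C⊆K₁ le))) (ℕ.m∸n≡0⇒m≤n eq))
            positive (suc d) eq = +-cancelʳ (a * χB K₁) _ _ (begin
              tailSum C + w (suc d) * χB K₁ + a * χB K₁
                ≈⟨ +-congʳ (+-congʳ tail) ⟩
              χB K₁ + a * ∑ rest χB + w (suc d) * χB K₁ + a * χB K₁
                ≈⟨ solve 4 (λ c a s w → c :+ a :* s :+ w :* c :+ a :* c := c :+ a :* (c :+ s) :+ w :* c) ≈-refl (χB K₁) a (∑ rest χB) (w (suc d)) ⟩
              χB K₁ + a * (χB K₁ + ∑ rest χB) + w (suc d) * χB K₁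
                ≈⟨ +-congʳ (+-congˡ (*-congˡ (≈-trans column (*-congʳ (≈-reflexive (cong (x ^_) eq)))))) ⟩
              χB K₁ + a * (x ^ suc d * χB K₁) + w (suc d) * χB K₁
                ≈⟨ solve 4 (λ c a p w → c :+ a :* (p :* c) :+ w :* c := (con 1 :+ (w :+ a :* p)) :* c) ≈-refl (χB K₁) a (x ^ suc d) (w (suc d)) ⟩
              (1# + (w (suc d) + a * x ^ suc d)) * χB K₁
                ≈⟨ *-congʳ (≈-trans (+-congˡ (w-geometric d)) (≈-sym a-unfold)) ⟩
              a * χB K₁
                ≈⟨ +-identityˡ _ ⟨
              0# + a * χB K₁ ∎)

          -- The recursion for W writes the term at K₁ as a sum over A ⊊ K₁, and by `tailSum-below`
          -- each summand cancels the term at A.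
          row : ∀ {B′} → B′ ∈ interval F B → ∑ (interval F K₁) (λ A′ → W (J A′ B′) * tailSum A′) ≈ 0#
          row {B′} i = let b′ , p , q = ∈-interval⁻ i in begin
            ∑ (interval F K₁) (λ A′ → W (J A′ B′) * tailSum A′)
              ≈⟨ ∑-remove (λ A′ → W (J A′ B′) * tailSum A′) _≟S_ (interval-unique F K₁) (∈-interval⁺ K₁-flat F⊆K₁ ⊆-refl) ⟩
            W (J K₁ B′) * tailSum K₁ + ∑ bel (λ A′ → W (J A′ B′) * tailSum A′)
              ≈⟨ +-congʳ (*-cong (W-recursion F-flat K-flat sp b′ p (⊆-trans q B⊆R)) tailSum-top) ⟩
            ∑ bel (λ A → w (r K₁ ∸ r A) * W (J A B′)) * χB K₁ + ∑ bel (λ A′ → W (J A′ B′) * tailSum A′)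
              ≈⟨ +-congʳ (∑-*ʳ bel (χB K₁) _) ⟩
            ∑ bel (λ A → w (r K₁ ∸ r A) * W (J A B′) * χB K₁) + ∑ bel (λ A′ → W (J A′ B′) * tailSum A′)
              ≈⟨ ∑-+ bel _ _ ⟨
            ∑ bel (λ A → w (r K₁ ∸ r A) * W (J A B′) * χB K₁ + W (J A B′) * tailSum A)
              ≈⟨ ∑-zero bel (λ {A} j → ≈-trans (solve 4 (λ w v c t → w :* v :* c :+ v :* t := v :* (t :+ w :* c)) ≈-refl (w (r K₁ ∸ r A)) (W (J A B′)) (χB K₁) (tailSum A))
                   (≈-trans (*-congˡ (tailSum-below j)) (zeroʳ _))) ⟩
            0# ∎
            where bel = below-K₁ F-flat K-flat sp

          H-product : ∀ {A} → Flat A → F ⊆ A → A ⊆ K₁ → H (J A B) ≈ ∑ (interval F B) (λ B′ → ∑ (interval F A) (λ A′ → W (J A′ B′)))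
          H-product {A} v p q = begin
            H (J A B)                                                  ≈⟨ H-sum (J-flat A B) (⊆-trans p (Jˡ v B-flat)) ⟩
            ∑ (interval F (J A B)) W                                   ≈⟨ ≈-reflexive (cong (λ C → ∑ (interval C (J A B)) W) (sym bottom)) ⟩
            ∑ (interval (J F F) (J A B)) W                             ≈⟨ ∑-product F-flat v F-flat B-flat ⊆-refl p q ⊆-refl F⊆B B⊆R W ⟩
            ∑ (interval F B) (λ B′ → ∑ (interval F A) (λ A′ → W (J A′ B′))) ∎

          γ = a ^ factorCount (J K₁ B) K

          weight : ∀ {A} → Flat A → F ⊆ A → A ⊆ K₁ → a ^ factorCount (J A B) K ≈ α A * γ
          weight {A} v p q = ≈-trans (≈-reflexive (cong (a ^_) (count v p q B-flat F⊆B B⊆R)))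
            (≈-trans (^-homo-* a (if does (A ≟S K₁) then 0 else 1) (factorCount (J K₁ B) K)) (*-congʳ (power (does (A ≟S K₁)))))
            where
            power : ∀ t → a ^ (if t then 0 else 1) ≈ (if t then 1# else a)
            power true  = ≈-refl
            power false = *-identityʳ a

        -- With H expanded into nested sets and the sums interchanged, each B′ contributes a
        -- multiple of its `row`.
        fibre : ∑ (interval F K₁) (λ A → H (J A B) * kernel (J A B) K) ≈ 0#
        fibre = begin
          ∑ (interval F K₁) (λ A → H (J A B) * kernel (J A B) K)
            ≈⟨ ∑-cong (interval F K₁) (λ i → let v , p , q = ∈-interval⁻ i in *-cong (H-product v p q) (*-congˡ (weight v p q))) ⟩
          ∑ (interval F K₁) (λ A → ∑ (interval F B) (λ B′ → ∑ (interval F A) (λ A′ → W (J A′ B′))) * (χB A * (α A * γ)))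
            ≈⟨ ∑-cong (interval F K₁) (λ {A} _ → expand A) ⟩
          ∑ (interval F K₁) (λ A → ∑ (interval F B) (λ B′ → ∑ (interval F A) (λ A′ → W (J A′ B′) * (α A * χB A) * γ)))
            ≈⟨ ∑-swap (interval F K₁) (interval F B) (λ A B′ → ∑ (interval F A) (λ A′ → W (J A′ B′) * (α A * χB A) * γ)) ⟩
          ∑ (interval F B) (λ B′ → ∑ (interval F K₁) (λ A → ∑ (interval F A) (λ A′ → W (J A′ B′) * (α A * χB A) * γ)))
            ≈⟨ ∑-zero (interval F B) (λ {B′} i → vanish i) ⟩
          0# ∎
          where
          expand : ∀ A → ∑ (interval F B) (λ B′ → ∑ (interval F A) (λ A′ → W (J A′ B′))) * (χB A * (α A * γ)) ≈
            ∑ (interval F B) (λ B′ → ∑ (interval F A) (λ A′ → W (J A′ B′) * (α A * χB A) * γ))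
          expand A = ≈-trans (∑-*ʳ (interval F B) _ _) (∑-cong (interval F B) (λ {B′} _ → ≈-trans (∑-*ʳ (interval F A) _ _)
            (∑-cong (interval F A) (λ {A′} _ → solve 4 (λ v c l g → v :* (c :* (l :* g)) := v :* (l :* c) :* g) ≈-refl (W (J A′ B′)) (χB A) (α A) γ))))
          vanish : ∀ {B′} → B′ ∈ interval F B → ∑ (interval F K₁) (λ A → ∑ (interval F A) (λ A′ → W (J A′ B′) * (α A * χB A) * γ)) ≈ 0#
          vanish {B′} i = begin
            ∑ (interval F K₁) (λ A → ∑ (interval F A) (λ A′ → W (J A′ B′) * (α A * χB A) * γ))
              ≈⟨ ∑-triangle F K₁ (λ A A′ → W (J A′ B′) * (α A * χB A) * γ) ⟩
            ∑ (interval F K₁) (λ A′ → ∑ (interval A′ K₁) (λ A → W (J A′ B′) * (α A * χB A) * γ))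
              ≈⟨ ∑-cong (interval F K₁) (λ {A′} _ → ≈-trans (≈-sym (∑-*ʳ (interval A′ K₁) γ _)) (*-congʳ (≈-sym (∑-*ˡ (interval A′ K₁) (W (J A′ B′)) _)))) ⟩
            ∑ (interval F K₁) (λ A′ → W (J A′ B′) * tailSum A′ * γ)
              ≈⟨ ∑-*ʳ (interval F K₁) γ _ ⟨
            ∑ (interval F K₁) (λ A′ → W (J A′ B′) * tailSum A′) * γ
              ≈⟨ ≈-trans (*-congʳ (row i)) (zeroˡ γ) ⟩
            0# ∎

      H-kernel-zero : ∑ (interval F K) (λ A → H A * kernel A K) ≈ 0#
      H-kernel-zero = begin
        ∑ (interval F K) (λ A → H A * kernel A K)
          ≈⟨ ≈-reflexive (cong₂ (λ C D → ∑ (interval C D) (λ A → H A * kernel A K)) (sym bottom) (sym top)) ⟩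
        ∑ (interval (J F F) (J K₁ R)) (λ A → H A * kernel A K)
          ≈⟨ ∑-product F-flat K₁-flat F-flat R-flat ⊆-refl F⊆K₁ ⊆-refl ⊆-refl F⊆R ⊆-refl (λ A → H A * kernel A K) ⟩
        ∑ (interval F R) (λ B → ∑ (interval F K₁) (λ A → H (J A B) * kernel (J A B) K))
          ≈⟨ ∑-zero (interval F R) (λ i → let b , p , q = ∈-interval⁻ i in fibre b p q) ⟩
        0# ∎

    -- The series H depends on a proof that its base is flat; extension by zero makes it a function
    -- on all pairs, as the incidence algebra requires.
    hilb : X → X → Carrier
    hilb F K with Tdec (isFlat M F)
    ... | yes f = Over.H f K
    ... | no _  = 0#

    hilb≡H : ∀ {F} (f : Flat F) K → hilb F K ≡ Over.H f K
    hilb≡H {F} f K with Tdec (isFlat M F)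
    ... | yes f′ = cong (λ g → Over.H g K) (T-irrelevant f′ f)
    ... | no ¬f  = ⊥-elim (¬f f)

    hilb-diag : ∀ {F} → Flat F → hilb F F ≈ 1#
    hilb-diag {F} f = ≈-trans (≈-reflexive (hilb≡H f F)) (≈-reflexive (cong (λ L → Nested.𝒩 (Over.b f) L [] (λ _ → 1#)) empty))
      where
      open Over f
      empty : relList F ≡ []
      empty with relList F | ∈-relList⁻ {F}
      ... | []    | _ = refl
      ... | G ∷ _ | h = let g , le = h (here refl) in ⊥-elim (relBS⊈base f g le)

    charPoly-diag : ∀ {F} → Flat F → charPoly F F ≈ 1#
    charPoly-diag {F} f = begin
      charPoly F F                                 ≈⟨ ∑-point (λ J → charPoly J F) f ⟨
      ∑ (interval F F) (λ J → charPoly J F)        ≈⟨ charPoly-sum f f ⊆-refl ⟩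
      x ^ (r F ∸ r F)                              ≈⟨ ≈-reflexive (cong (x ^_) (ℕ.n∸n≡0 (r F))) ⟩
      1#                                           ∎

    kernel-diag : ∀ {F} → Flat F → kernel F F ≈ 1#
    kernel-diag {F} f = ≈-trans (*-congʳ (charPoly-diag f)) (≈-trans (*-identityˡ _) (≈-reflexive (cong (λ L → a ^ length L)
      (List.filter-none (λ A → ¬? (A ⊆? F)) {factors F} (All.tabulate λ i ¬le → ¬le (proj₂ (∈-factors⁻ i)))))))

    second-identity : ∀ {F K} → Flat F → Flat K → F ⊆ K → ∑ (interval F K) (λ J → hilb F J * kernel J K) ≈ ⟦ F ≟S K ⟧
    second-identity {F} {K} f k le with F ≟S K
    ... | yes refl = ≈-trans (∑-point _ f) (≈-trans (*-cong (hilb-diag f) (kernel-diag f)) (*-identityˡ 1#))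
    ... | no ne    = ≈-trans (∑-cong (interval F K) (λ {J} _ → *-congʳ (≈-reflexive (hilb≡H f J))))
                       (H-kernel-zero f k (split f k le (λ h → ne (⊆-antisym le h))))

    first-identity : ∀ {F K} → Flat F → Flat K → F ⊆ K → ∑ (interval F K) (λ J → kernel F J * hilb J K) ≈ ⟦ F ≟S K ⟧
    first-identity = inverse-swap {hilb} {kernel} hilb-diag second-identity

-- Minors

─⁻ : ∀ {n} (p q : Subset n) {e} → e ∈ˢ p ─ q → e ∈ˢ p × e ∉ˢ q
─⁻ p q e∈ = p─q⊆p p q e∈ , outside p q e∈
  where
  outside : ∀ {n} (p q : Subset n) {e} → e ∈ˢ p ─ q → e ∉ˢ q
  outside (_ ∷ p) (true ∷ q) {zero} () _
  outside (_ ∷ p) (false ∷ q) {zero} _ ()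
  outside (_ ∷ p) (_ ∷ q) {suc e} (Vec.there i) (Vec.there j) = outside p q i j

module _ {n : ℕ} {F : Subset n} where

  ∪─ : ∀ {A K} → A ⊆ K ─ F → (A ∪ F) ─ F ≡ A
  ∪─ {A} {K} le = ⊆-antisym
    (λ e∈ → let i , e∉ = ─⁻ (A ∪ F) F e∈ in [ id , (λ j → ⊥-elim (e∉ j)) ]′ (x∈p∪q⁻ A F i))
    (λ e∈ → x∈p∧x∉q⇒x∈p─q (∪ˡ {A = A} {F} e∈) (proj₂ (─⁻ K F (le e∈))))

  ─∪ : ∀ {B} → F ⊆ B → (B ─ F) ∪ F ≡ B
  ─∪ {B} le = ⊆-antisym (∪-least (p─q⊆p B F) le) λ {e} e∈ → cases e∈ (e ∈? F)
    where
    cases : ∀ {e} → e ∈ˢ B → Dec (e ∈ˢ F) → e ∈ˢ (B ─ F) ∪ F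
    cases e∈ (yes f) = ∪ʳ {A = B ─ F} f
    cases e∈ (no ¬f) = ∪ˡ {A = B ─ F} {F} (x∈p∧x∉q⇒x∈p─q e∈ ¬f)

  ─-mono : ∀ {B K} → B ⊆ K → B ─ F ⊆ K ─ F
  ─-mono {B} le e∈ = let i , e∉ = ─⁻ B F e∈ in x∈p∧x∉q⇒x∈p─q (le i) e∉

  ∪-mono : ∀ {A B} → A ⊆ B → A ∪ F ⊆ B ∪ F
  ∪-mono {A} {B} le = ∪-least (⊆-trans le ∪ˡ) (∪ʳ {A = B})

  ∪⊆ : ∀ {A K} → F ⊆ K → A ⊆ K ─ F → A ∪ F ⊆ K
  ∪⊆ {A} {K} fk le = ∪-least (⊆-trans le (p─q⊆p K F)) fk

  ∪-reflects : ∀ {A B K} → A ⊆ K ─ F → B ⊆ K ─ F → A ∪ F ⊆ B ∪ F → A ⊆ B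
  ∪-reflects {A} {B} a b le = subst (_⊆ B) (∪─ a) (subst ((A ∪ F) ─ F ⊆_) (∪─ b) (─-mono le))

-- Adding F to sets disjoint from it preserves the order of enumeration.
map-∪-filter : ∀ {n} (F : Subset n) {p q : Subset n → Bool} →
  (∀ {A} → T (p A) → (A ∪ F) ─ F ≡ A) → (∀ {A} → T (p A) → T (q (A ∪ F))) →
  (∀ {B} → T (q B) → (B ─ F) ∪ F ≡ B) → (∀ {B} → T (q B) → T (p (B ─ F))) →
  map (_∪ F) (filter (λ A → Tdec (p A)) (allSubsets n)) ≡ filter (λ B → Tdec (q B)) (allSubsets n)
map-∪-filter [] {p} {q} h₁ h₂ h₃ h₄ with p [] | q [] | h₂ {[]} | h₄ {[]}
... | true  | true  | _ | _ = refl
... | false | false | _ | _ = refl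
... | true  | false | h | _ = ⊥-elim (h tt)
... | false | true  | _ | h = ⊥-elim (h tt)
map-∪-filter {suc n} (f ∷ F) {p} {q} h₁ h₂ h₃ h₄ = trans
  (trans (cong (map (_∪ (f ∷ F))) (List.filter-++ p? (map (false ∷_) 𝒫) (map (true ∷_) 𝒫))) (List.map-++ (_∪ (f ∷ F)) (filter p? (map (false ∷_) 𝒫)) (filter p? (map (true ∷_) 𝒫))))
  (trans (halves f h₁ h₂ h₃ h₄) (sym (List.filter-++ q? (map (false ∷_) 𝒫) (map (true ∷_) 𝒫))))
  where
  𝒫 = allSubsets n
  p? : ∀ A → Dec (T (p A))
  p? A = Tdec (p A)
  q? : ∀ A → Dec (T (q A))
  q? A = Tdec (q A)
  half : ∀ s t f → (∀ A → (s ∷ A) ∪ (f ∷ F) ≡ t ∷ (A ∪ F)) →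
    (∀ {A} → T (p (s ∷ A)) → (A ∪ F) ─ F ≡ A) → (∀ {A} → T (p (s ∷ A)) → T (q (t ∷ (A ∪ F)))) →
    (∀ {B} → T (q (t ∷ B)) → (B ─ F) ∪ F ≡ B) → (∀ {B} → T (q (t ∷ B)) → T (p (s ∷ (B ─ F)))) →
    map (_∪ (f ∷ F)) (filter p? (map (s ∷_) 𝒫)) ≡ filter q? (map (t ∷_) 𝒫)
  half s t f eq k₁ k₂ k₃ k₄ = begin
    map (_∪ (f ∷ F)) (filter p? (map (s ∷_) 𝒫))              ≡⟨ cong (map (_∪ (f ∷ F))) (filter-map p? (s ∷_) 𝒫) ⟩
    map (_∪ (f ∷ F)) (map (s ∷_) (filter (λ A → p? (s ∷ A)) 𝒫)) ≡⟨ List.map-∘ (filter (λ A → p? (s ∷ A)) 𝒫) ⟨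
    map (λ A → (s ∷ A) ∪ (f ∷ F)) (filter (λ A → p? (s ∷ A)) 𝒫) ≡⟨ List.map-cong eq (filter (λ A → p? (s ∷ A)) 𝒫) ⟩
    map (λ A → t ∷ (A ∪ F)) (filter (λ A → p? (s ∷ A)) 𝒫)    ≡⟨ List.map-∘ (filter (λ A → p? (s ∷ A)) 𝒫) ⟩
    map (t ∷_) (map (_∪ F) (filter (λ A → p? (s ∷ A)) 𝒫))    ≡⟨ cong (map (t ∷_)) (map-∪-filter F k₁ k₂ k₃ k₄) ⟩
    map (t ∷_) (filter (λ B → q? (t ∷ B)) 𝒫)                 ≡⟨ filter-map q? (t ∷_) 𝒫 ⟨
    filter q? (map (t ∷_) 𝒫)                                 ∎
    where open ≡-Reasoning
  none : ∀ (r : Subset (suc n) → Bool) t → (∀ {A} → ¬ T (r (t ∷ A))) → filter (λ A → Tdec (r A)) (map (t ∷_) 𝒫) ≡ []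
  none r t h = List.filter-none (λ A → Tdec (r A)) (All.map⁺ (All.universal (λ A → h) 𝒫))
  Hyp₁ Hyp₂ Hyp₃ Hyp₄ : Bool → Set
  Hyp₁ f = ∀ {A} → T (p A) → (A ∪ (f ∷ F)) ─ (f ∷ F) ≡ A
  Hyp₂ f = ∀ {A} → T (p A) → T (q (A ∪ (f ∷ F)))
  Hyp₃ f = ∀ {B} → T (q B) → (B ─ (f ∷ F)) ∪ (f ∷ F) ≡ B
  Hyp₄ f = ∀ {B} → T (q B) → T (p (B ─ (f ∷ F)))
  halves : ∀ f → Hyp₁ f → Hyp₂ f → Hyp₃ f → Hyp₄ f →
    map (_∪ (f ∷ F)) (filter p? (map (false ∷_) 𝒫)) ++ map (_∪ (f ∷ F)) (filter p? (map (true ∷_) 𝒫)) ≡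
    filter q? (map (false ∷_) 𝒫) ++ filter q? (map (true ∷_) 𝒫)
  halves false h₁ h₂ h₃ h₄ = cong₂ _++_
    (half false false false (λ _ → refl) (λ t → cong Vec.tail (h₁ t)) h₂ (λ t → cong Vec.tail (h₃ t)) h₄)
    (half true true false (λ _ → refl) (λ t → cong Vec.tail (h₁ t)) h₂ (λ t → cong Vec.tail (h₃ t)) h₄)
  halves true h₁ h₂ h₃ h₄ = begin
    map (_∪ (true ∷ F)) (filter p? (map (false ∷_) 𝒫)) ++ map (_∪ (true ∷ F)) (filter p? (map (true ∷_) 𝒫))
      ≡⟨ cong₂ (λ l m → l ++ map (_∪ (true ∷ F)) m) (half false true true (λ _ → refl) (λ t → cong Vec.tail (h₁ t)) h₂ (λ t → cong Vec.tail (h₃ t)) h₄)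
           (none p true (λ t → absurd (cong Vec.head (h₁ t)))) ⟩
    filter q? (map (true ∷_) 𝒫) ++ []
      ≡⟨ List.++-identityʳ _ ⟩
    filter q? (map (true ∷_) 𝒫)
      ≡⟨ cong (_++ filter q? (map (true ∷_) 𝒫)) (none q false (λ t → absurd (sym (cong Vec.head (h₃ t))))) ⟨
    filter q? (map (false ∷_) 𝒫) ++ filter q? (map (true ∷_) 𝒫) ∎
    where
    open ≡-Reasoning
    absurd : ∀ {A : Set} → false ≡ true → A
    absurd ()

∸-cancel : ∀ m {k f} → f ≤ k → (m ∸ f) ∸ (k ∸ f) ≡ m ∸ k
∸-cancel m {k} {f} le = trans (ℕ.∸-+-assoc m f (k ∸ f)) (cong (m ∸_) (ℕ.m+[n∸m]≡n le))

∸-submodular : ∀ {p q s t f} → f ≤ p → f ≤ q → f ≤ s → f ≤ t → p ℕ.+ q ≤ s ℕ.+ t → (p ∸ f) ℕ.+ (q ∸ f) ≤ (s ∸ f) ℕ.+ (t ∸ f)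
∸-submodular {p} {q} {s} {t} {f} fp fq fs ft le = ℕ.+-cancelʳ-≤ (f ℕ.+ f) _ _
  (subst₂ _≤_ (regroup fp fq) (regroup fs ft) le)
  where
  open import Data.Nat.Solver using (module +-*-Solver)
  open +-*-Solver using (solve; _:+_; _:=_)
  regroup : ∀ {a b} → f ≤ a → f ≤ b → a ℕ.+ b ≡ (a ∸ f) ℕ.+ (b ∸ f) ℕ.+ (f ℕ.+ f)
  regroup {a} {b} fa fb = trans (sym (cong₂ ℕ._+_ (ℕ.m∸n+n≡m fa) (ℕ.m∸n+n≡m fb)))
    (solve 3 (λ a b f → (a :+ f) :+ (b :+ f) := (a :+ b) :+ (f :+ f)) refl (a ∸ f) (b ∸ f) f)

module _ {n : ℕ} (M : Polymatroid n) (𝒢 : SetOfFlats n)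
  (isM : IsPolymatroid M) (loopless : Loopless M) (isB : IsBuildingSet M 𝒢) where
  open Relative M 𝒢 isM loopless isB

  -- P and 𝒢P are the minor of M on the interval [F,K], with the flats of P shifted by F.
  record IsMinor (F K : Subset n) (P : Polymatroid n) (𝒢P : SetOfFlats n) : Set where
    field
      F-flat  : Flat F
      K-flat  : Flat K
      F⊆K     : F ⊆ K
      ground≡ : ground P ≡ K ─ F
      rank≡   : ∀ A → A ⊆ K ─ F → rk P A ≡ rk M (A ∪ F) ∸ rk M F
      𝒢⇒      : ∀ A → T (𝒢P A) → A ⊆ K ─ F × T (relBS F (A ∪ F))
      𝒢⇐      : ∀ A → A ⊆ K ─ F → T (relBS F (A ∪ F)) → T (𝒢P A)

  module Minor {F K P 𝒢P} (isMinor : IsMinor F K P 𝒢P) where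
    open IsMinor isMinor
    private
      X = Subset n
      r = rk M
      f = r F
      G = K ─ F

    up⊆ : ∀ {A} → A ⊆ G → A ∪ F ⊆ ground M
    up⊆ le = ⊆-trans (∪⊆ F⊆K le) (flat⊆ K-flat)

    base≤ : ∀ {A} → A ⊆ G → f ≤ r (A ∪ F)
    base≤ {A} le = IsPolymatroid.rk-mono isM _ _ (up⊆ le) (∪ʳ {A = A})

    private
      in-ground : ∀ {A} → A ⊆ ground P → A ⊆ G
      in-ground {A} = subst (A ⊆_) ground≡

    minor-isPolymatroid : IsPolymatroid P
    minor-isPolymatroid = record
      { rk-∅ = trans (rank≡ ⊥ ⊥⊆) (trans (cong (λ A → r A ∸ f) (∪-identityˡ F)) (ℕ.n∸n≡0 f))
      ; rk-mono = λ A B B⊆ A⊆B → mono (⊆-trans A⊆B (in-ground B⊆)) (in-ground B⊆) A⊆B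
      ; rk-submod = λ A B A⊆ B⊆ → submod (in-ground A⊆) (in-ground B⊆) }
      where
      mono : ∀ {A B} → A ⊆ G → B ⊆ G → A ⊆ B → rk P A ≤ rk P B
      mono {A} {B} a b le = subst₂ _≤_ (sym (rank≡ A a)) (sym (rank≡ B b))
        (ℕ.∸-monoˡ-≤ f (IsPolymatroid.rk-mono isM _ _ (up⊆ b) (∪-mono le)))
      submod : ∀ {A B} → A ⊆ G → B ⊆ G → rk P (A ∪ B) ℕ.+ rk P (A ∩ B) ≤ rk P A ℕ.+ rk P B
      submod {A} {B} a b = subst₂ _≤_ (sym (cong₂ ℕ._+_ (rank≡ _ ab) (rank≡ _ a∩b))) (sym (cong₂ ℕ._+_ (rank≡ A a) (rank≡ B b)))
        (∸-submodular (base≤ ab) (base≤ a∩b) (base≤ a) (base≤ b)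
          (subst (_≤ r (A ∪ F) ℕ.+ r (B ∪ F)) (cong₂ (λ C D → r C ℕ.+ r D)
              (⊆-antisym (∪-least (∪-mono ∪ˡ) (∪-mono ∪ʳ)) (∪-least (∪-least (⊆-trans ∪ˡ ∪ˡ) (⊆-trans ∪ˡ ∪ʳ)) (⊆-trans (∪ʳ {A = A}) ∪ˡ)))
              (sym (∪-distribʳ-∩ F A B)))
            (IsPolymatroid.rk-submod isM _ _ (up⊆ a) (up⊆ b))))
        where
        ab : A ∪ B ⊆ G
        ab = ∪-least a b
        a∩b : A ∩ B ⊆ G
        a∩b = ⊆-trans ∩ˡ a

    module FP = Flats P minor-isPolymatroid

    minor-flat⁺ : ∀ {A} → A ⊆ G → Flat (A ∪ F) → T (isFlat P A)
    minor-flat⁺ {A} le fl = FP.flat⁺ (subst (A ⊆_) (sym ground≡) le) λ {e} e∈ e∉ →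
      let e∈G = subst (e ∈ˢ_) ground≡ e∈
          e∈K , e∉F = ─⁻ K F e∈G
          Ae⊆ : A ∪ ⁅ e ⁆ ⊆ G
          Ae⊆ = ∪-least le (⁅⁆⊆ e∈G)
      in subst₂ _<_ (sym (rank≡ A le)) (sym (rank≡ _ Ae⊆)) (ℕ.∸-monoˡ-<
          (subst (λ C → r (A ∪ F) < r C) (swap A ⁅ e ⁆) (flat-rank fl (flat⊆ K-flat e∈K) (λ h → [ e∉ , e∉F ]′ (x∈p∪q⁻ A F h))))
          (base≤ le))
      where
      swap : ∀ A E → (A ∪ F) ∪ E ≡ (A ∪ E) ∪ F
      swap A E = ⊆-antisym (∪-least (∪-mono ∪ˡ) (⊆-trans ∪ʳ ∪ˡ)) (∪-least (∪-least (⊆-trans ∪ˡ ∪ˡ) ∪ʳ) (⊆-trans (∪ʳ {A = A}) ∪ˡ))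

    -- An element in the closure of A ∪ F but outside A ∪ F would raise the rank of A in the minor,
    -- hence that of A ∪ F in M; but closure preserves rank.
    minor-flat⁻ : ∀ {A} → T (isFlat P A) → A ⊆ G × Flat (A ∪ F)
    minor-flat⁻ {A} fl = le , subst Flat (⊆-antisym cl⊆ (closure-⊇ (up⊆ le))) (closure-flat (A ∪ F))
      where
      le : A ⊆ G
      le = in-ground (FP.flat⊆ fl)
      cl⊆ : cl (A ∪ F) ⊆ A ∪ F
      cl⊆ {e} e∈ = decidable-stable (e ∈? (A ∪ F)) λ e∉ →
        let e∈K = closure-least K-flat (∪⊆ F⊆K le) e∈
            e∈G = x∈p∧x∉q⇒x∈p─q e∈K (e∉ ∘ ∪ʳ {A = A})
            Ae⊆ : A ∪ ⁅ e ⁆ ⊆ G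
            Ae⊆ = ∪-least le (⁅⁆⊆ e∈G)
            lt = FP.flat-rank fl (subst (e ∈ˢ_) (sym ground≡) e∈G) (e∉ ∘ ∪ˡ {A = A} {F})
            lt′ = subst₂ _<_ (rank≡ A le) (rank≡ _ Ae⊆) lt
        in ℕ.<-irrefl (sym (rank-closure (up⊆ le))) (ℕ.<-≤-trans
             (subst₂ _<_ (ℕ.m∸n+n≡m (base≤ le)) (ℕ.m∸n+n≡m (base≤ Ae⊆)) (ℕ.+-monoˡ-< f lt′))
             (rank-mono (closure-flat (A ∪ F)) (∪-least (∪-least (⊆-trans ∪ˡ (closure-⊇ (up⊆ le))) (⁅⁆⊆ e∈)) (⊆-trans (∪ʳ {A = A}) (closure-⊇ (up⊆ le))))))

    down-flat : ∀ {B} → Flat B → F ⊆ B → B ⊆ K → T (isFlat P (B ─ F))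
    down-flat b FB BK = minor-flat⁺ (─-mono BK) (subst Flat (sym (─∪ FB)) b)

    minor-𝒢-flat : ∀ {A} → T (𝒢P A) → T (isFlat P A)
    minor-𝒢-flat {A} g = let le , t = 𝒢⇒ A g in minor-flat⁺ le (relBS-flat {F} t)

    -- The bottom of the minor corresponds to F, so F heads the list on the right and accounts for
    -- the empty join.
    up-⋁ : ∀ T′ → All (λ A → T (isFlat P A)) T′ → ⋁ P T′ ∪ F ≡ ⋁ M (F ∷ map (_∪ F) T′)
    up-⋁ T′ t = ⊆-antisym
      (⊆-trans (∪-mono (FP.⋁-least {T′} (down-flat C-flat F⊆C C⊆K) λ {A} i →
          subst (_⊆ C ─ F) (∪─ (proj₁ (minor-flat⁻ (All.lookup t i)))) (─-mono (⋁-upper {F ∷ map (_∪ F) T′} within (there (∈-map⁺ (_∪ F) i))))))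
        (⊆-reflexive (─∪ F⊆C)))
      (⋁-least {F ∷ map (_∪ F) T′} (proj₂ (minor-flat⁻ (FP.⋁-flat T′))) λ
        { (here refl) → ∪ʳ {A = ⋁ P T′}
        ; (there i) → let A , j , eq = ∈-map⁻ (_∪ F) i in subst (_⊆ ⋁ P T′ ∪ F) (sym eq)
            (∪-mono (FP.⋁-upper {T′} (λ j → FP.flat⊆ (All.lookup t j)) j)) })
      where
      C = ⋁ M (F ∷ map (_∪ F) T′)
      inside : ∀ {A} → A ∈ F ∷ map (_∪ F) T′ → A ⊆ K
      inside (here refl) = F⊆K
      inside (there i)   = let A , j , eq = ∈-map⁻ (_∪ F) i in subst (_⊆ K) (sym eq) (∪⊆ F⊆K (proj₁ (minor-flat⁻ (All.lookup t j))))
      within : ∀ {A} → A ∈ F ∷ map (_∪ F) T′ → A ⊆ ground M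
      within i = ⊆-trans (inside i) (flat⊆ K-flat)
      C-flat : Flat C
      C-flat = ⋁-flat (F ∷ map (_∪ F) T′)
      F⊆C : F ⊆ C
      F⊆C = ⋁-upper {F ∷ map (_∪ F) T′} within (here refl)
      C⊆K : C ⊆ K
      C⊆K = ⋁-least {F ∷ map (_∪ F) T′} K-flat inside

    minor-𝒢-join : ∀ {A B C} → T (𝒢P A) → T (𝒢P B) → T (𝒢P C) → A ⊆ B → A ⊆ C → T (𝒢P (⋁ P (B ∷ C ∷ [])))
    minor-𝒢-join {A} {B} {C} a b c ab ac = 𝒢⇐ _ (proj₁ (minor-flat⁻ (FP.⋁-flat (B ∷ C ∷ []))))
      (subst (T ∘ relBS F) (sym eq) (relBS-join F-flat (proj₂ (𝒢⇒ A a)) b′ c′ (∪-mono ab) (∪-mono ac)))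
      where
      b′ = proj₂ (𝒢⇒ B b)
      c′ = proj₂ (𝒢⇒ C c)
      bf = relBS-flat {F} b′
      cf = relBS-flat {F} c′
      eq : ⋁ P (B ∷ C ∷ []) ∪ F ≡ J (B ∪ F) (C ∪ F)
      eq = trans (up-⋁ (B ∷ C ∷ []) (minor-𝒢-flat b ∷ minor-𝒢-flat c ∷ [])) (⊆-antisym
        (⋁-least {F ∷ (B ∪ F) ∷ (C ∪ F) ∷ []} (J-flat _ _) λ
          { (here refl) → ⊆-trans (∪ʳ {A = B}) (Jˡ bf cf) ; (there (here refl)) → Jˡ bf cf ; (there (there (here refl))) → Jʳ bf cf })
        (J-least (⋁-flat (F ∷ (B ∪ F) ∷ (C ∪ F) ∷ [])) (⋁-upper {F ∷ (B ∪ F) ∷ (C ∪ F) ∷ []} within (there (here refl)))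
          (⋁-upper {F ∷ (B ∪ F) ∷ (C ∪ F) ∷ []} within (there (there (here refl))))))
        where
        within : ∀ {D} → D ∈ F ∷ (B ∪ F) ∷ (C ∪ F) ∷ [] → D ⊆ ground M
        within (here refl)                 = flat⊆ F-flat
        within (there (here refl))         = flat⊆ bf
        within (there (there (here refl))) = flat⊆ cf

    module JP = JoinClosed P minor-isPolymatroid 𝒢P minor-𝒢-flat minor-𝒢-join

    ⊊-up⁺ : ∀ {A B} → A ⊆ G → B ⊆ G → A ⊊ B → A ∪ F ⊊ B ∪ F
    ⊊-up⁺ a b (le , nle) = ∪-mono le , λ h → nle (∪-reflects b a h)

    ⊊-up⁻ : ∀ {A B} → A ⊆ G → B ⊆ G → A ∪ F ⊊ B ∪ F → A ⊊ B
    ⊊-up⁻ a b (le , nle) = ∪-reflects a b le , λ h → nle (∪-mono h)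

-- The Hilbert series as a sum over nested sets

module _ (Rg : CommutativeRing 0ℓ 0ℓ) (x a : CommutativeRing.Carrier Rg)
  (a-unfold : CommutativeRing._≈_ Rg a (CommutativeRing._+_ Rg (CommutativeRing.1# Rg) (CommutativeRing._*_ Rg x a)))
  {n : ℕ} {𝒢 : Subset n → Set} {b : List (Subset n) → Subset n → ℕ} (exps : Exponents 𝒢 b) where
  open CommutativeRing Rg renaming (sym to ≈-sym; trans to ≈-trans; reflexive to ≈-reflexive) hiding (zero; refl)
  open Sums Rg
  open Weights Rg x a a-unfold
  open Nested b
  open Basis exps
  open import Algebra.Properties.Semiring.Exp semiring using (_^_; ^-homo-*)
  open import Relation.Binary.Reasoning.Setoid setoid

  degreeSum : ∀ {k} → List (Functional k) → Carrier
  degreeSum Φ = ∑ Φ (λ f → x ^ proj₁ f)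

  -- The layers shift degrees by 1 up to c, while the exponent of G is c + 1; hence the weight x +
  -- ... + x^c = `w (suc c)`.
  degreeSum-layers : ∀ {k} (Y : Poly k) c Ψ → degreeSum (layers Y c Ψ) ≈ w (suc c) * degreeSum Ψ
  degreeSum-layers Y zero Ψ    = ≈-trans (≈-reflexive (∑-foldr [] _)) (≈-sym (zeroˡ _))
  degreeSum-layers Y (suc c) Ψ = begin
    degreeSum (layers Y c Ψ ++ map (layer Y c) Ψ)              ≈⟨ ∑-++ (layers Y c Ψ) _ ⟩
    degreeSum (layers Y c Ψ) + degreeSum (map (layer Y c) Ψ)   ≈⟨ +-cong (degreeSum-layers Y c Ψ) (∑-map (layer Y c) Ψ) ⟩
    w (suc c) * degreeSum Ψ + ∑ Ψ (λ f → x ^ (suc c ℕ.+ proj₁ f)) ≈⟨ +-congˡ (≈-trans (∑-cong Ψ (λ {f} _ → ^-homo-* x (suc c) (proj₁ f))) (≈-sym (∑-*ˡ Ψ (x ^ suc c) _))) ⟩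
    w (suc c) * degreeSum Ψ + x ^ suc c * degreeSum Ψ          ≈⟨ distribʳ _ _ _ ⟨
    w (suc (suc c)) * degreeSum Ψ                              ∎

  degreeSum-duals : ∀ L T → degreeSum (duals L T) ≈ 𝒩 L T (λ _ → 1#)
  degreeSum-duals [] T      = ≈-trans (∑-∷ _ [] _) (≈-trans (+-congˡ (≈-reflexive (∑-foldr [] _))) (+-identityʳ 1#))
  degreeSum-duals (G ∷ L) T = cases (b T G)
    where
    Y = Relations.up L G
    cases : ∀ c → degreeSum (extend Y c (duals L T) (duals L (G ∷ T))) ≈ step c (𝒩 L T (λ _ → 1#)) (𝒩 L (G ∷ T) (λ _ → 1#))
    cases zero    = ≈-reflexive (∑-foldr [] _)
    cases (suc c) = begin
      degreeSum (map (base Y (suc c)) (duals L T) ++ layers Y c (duals L (G ∷ T)))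
        ≈⟨ ∑-++ (map (base Y (suc c)) (duals L T)) _ ⟩
      degreeSum (map (base Y (suc c)) (duals L T)) + degreeSum (layers Y c (duals L (G ∷ T)))
        ≈⟨ +-cong (≈-trans (∑-map (base Y (suc c)) (duals L T)) (degreeSum-duals L T)) (≈-trans (degreeSum-layers Y c (duals L (G ∷ T))) (*-congˡ (degreeSum-duals L (G ∷ T)))) ⟩
      𝒩 L T (λ _ → 1#) + w (suc c) * 𝒩 L (G ∷ T) (λ _ → 1#) ∎

filter-cong-All : ∀ {A : Set} {P Q : A → Set} (P? : ∀ x → Dec (P x)) (Q? : ∀ x → Dec (Q x)) {xs} →
  All (λ x → (P x → Q x) × (Q x → P x)) xs → filter P? xs ≡ filter Q? xs
filter-cong-All P? Q? []                   = refl
filter-cong-All P? Q? (_∷_ {x} (f , g) a) with P? x | Q? x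
... | yes _ | yes _ = cong (x ∷_) (filter-cong-All P? Q? a)
... | no _  | no _  = filter-cong-All P? Q? a
... | yes p | no q  = ⊥-elim (q (f p))
... | no p  | yes q = ⊥-elim (p (g q))

-- Series for Hilbert functions, Möbius functions and characteristic polynomials

module 𝒮 = CommutativeRing seriesRing
open import Algebra.Properties.Semiring.Exp 𝒮.semiring public using () renaming (_^_ to _^ˢ_; ^-homo-* to ^ˢ-homo-*)
module 𝒮∑ = Sums seriesRing

∑-at : ∀ {A : Set} (xs : List A) (f : A → Series) d → 𝒮∑.∑ xs f d ≡ sumℤ (map (λ y → f y d) xs)
∑-at xs f d = trans (cong (λ g → g d) (𝒮∑.∑-foldr xs f)) (go xs)
  where
  go : ∀ xs → foldr (λ y s → f y 𝒮.+ s) 𝒮.0# xs d ≡ sumℤ (map (λ y → f y d) xs)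
  go []       = refl
  go (y ∷ ys) = cong (λ u → f y d ℤ.+ u) (go ys)

xS^ : ∀ e d → (xS ^ˢ e) d ≡ (if does (e ℕ.≟ d) then ℤ.1ℤ else ℤ.0ℤ)
xS^ zero zero       = refl
xS^ zero (suc d)    = refl
xS^ (suc e) zero    = xS⊛-zero (xS ^ˢ e)
xS^ (suc e) (suc d) = trans (xS⊛-suc (xS ^ˢ e) d) (xS^ e d)

degreeSum-at : ∀ {B : Set} (Φ : List (ℕ × B)) d → 𝒮∑.∑ Φ (λ f → xS ^ˢ proj₁ f) d ≡ ℤ.+ length (filter (λ f → proj₁ f ℕ.≟ d) Φ)
degreeSum-at Φ d = trans (∑-at Φ _ d) (go Φ)
  where
  go : ∀ Φ → sumℤ (map (λ f → (xS ^ˢ proj₁ f) d) Φ) ≡ ℤ.+ length (filter (λ f → proj₁ f ℕ.≟ d) Φ)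
  go []            = refl
  go ((e , v) ∷ Φ) with e ℕ.≡ᵇ d | xS^ e d
  ... | true  | eq = cong₂ ℤ._+_ eq (go Φ)
  ... | false | eq = trans (cong₂ ℤ._+_ eq (go Φ)) (ℤ.+-identityˡ (ℤ.+ length (filter (λ f → proj₁ f ℕ.≟ d) Φ)))

constant : ℤ → Series
constant z zero    = z
constant z (suc _) = ℤ.0ℤ

constant-⊛ : ∀ z g d → (constant z ⊛ g) d ≡ z ℤ.* g d
constant-⊛ z g d = trans (⊛≡cauchy (constant z) g d) (go d)
  where
  go : ∀ d → cauchy (constant z) g d ≡ z ℤ.* g d
  go zero    = refl
  go (suc d) = trans (cong (λ u → z ℤ.* g (suc d) ℤ.+ u) (cauchy-zero g d)) (ℤ.+-identityʳ _)

constant-sum : ∀ {A : Set} (xs : List A) (g : A → ℤ) → 𝒮∑.∑ xs (λ y → constant (g y)) 𝒮.≈ constant (sumℤ (map g xs))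
constant-sum xs g zero    = ∑-at xs _ 0
constant-sum xs g (suc d) = trans (∑-at xs _ (suc d)) (zeros xs)
  where
  zeros : ∀ {A : Set} (xs : List A) → sumℤ (map (λ _ → ℤ.0ℤ) xs) ≡ ℤ.0ℤ
  zeros []       = refl
  zeros (_ ∷ xs) = trans (ℤ.+-identityˡ _) (zeros xs)

module Möbius {n : ℕ} (P : Polymatroid n) (isP : IsPolymatroid P) (loopless : Loopless P) where
  open Flats P isP
  private X = Subset n

  μ-⊥ : ∀ k → μ-fuel P k ⊥ ≡ ℤ.1ℤ
  μ-⊥ zero = refl
  μ-⊥ (suc k) with ⊥ ≟S (⊥ {n})
  ... | yes _ = refl
  ... | no ne = ⊥-elim (ne refl)

  ∣A∣≤0⇒⊥ : ∀ {A : X} → ∣ A ∣ ≤ 0 → A ≡ ⊥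
  ∣A∣≤0⇒⊥ {A} le = ⊆-antisym (λ {e} e∈ → ⊥-elim (ℕ.<⇒≱ (ℕ.<-≤-trans (ℕ.≤-reflexive (sym (∣⁅x⁆∣≡1 e))) (p⊆q⇒∣p∣≤∣q∣ (⁅⁆⊆ e∈))) le)) ⊥⊆

  strictly-below : X → List X
  strictly-below A = filter (λ B → Tdec (B ⊊ᵇ A)) (flats P)

  smaller : ∀ {A B k} → B ∈ strictly-below A → ∣ A ∣ ≤ suc k → ∣ B ∣ ≤ k
  smaller {A} {B} i le = let le′ , nle = ⊊ᵇ⁻ B A (proj₂ (∈-filter⁻ (λ B → Tdec (B ⊊ᵇ A)) {xs = flats P} i)) in
    ℕ.≤-pred (ℕ.<-≤-trans (p⊂q⇒∣p∣<∣q∣ {p = B} {q = A} (le′ , ⊈⇒∃ nle)) le)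

  sum-cong : ∀ {f g : X → ℤ} xs → (∀ {A} → A ∈ xs → f A ≡ g A) → foldr ℤ._+_ ℤ.0ℤ (map f xs) ≡ foldr ℤ._+_ ℤ.0ℤ (map g xs)
  sum-cong [] h       = refl
  sum-cong (A ∷ xs) h = cong₂ ℤ._+_ (h (here refl)) (sum-cong xs (h ∘ there))

  -- Each recursive call strictly shrinks the flat, so fuel of at least its size runs out only at
  -- the empty set, where the default value 1 is correct.
  μ-stable : ∀ k k′ A → ∣ A ∣ ≤ k → ∣ A ∣ ≤ k′ → μ-fuel P k A ≡ μ-fuel P k′ A
  μ-stable zero k′ A le le′ with refl ← ∣A∣≤0⇒⊥ {A} le       = sym (μ-⊥ k′)
  μ-stable (suc k) zero A le le′ with refl ← ∣A∣≤0⇒⊥ {A} le′ = μ-⊥ (suc k)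
  μ-stable (suc k) (suc k′) A le le′ = cong (λ s → if A ≡ᵇ ⊥ then ℤ.1ℤ else ℤ.- s)
    (sum-cong (strictly-below A) (λ {B} i → μ-stable k k′ B (smaller i le) (smaller i le′)))

  μ-recursion : ∀ {A} → A ≢ ⊥ → μ P A ≡ ℤ.- sumℤ (map (μ P) (strictly-below A))
  μ-recursion {A} A≢⊥ = go n (∣p∣≤n A)
    where
    go : ∀ k → ∣ A ∣ ≤ k → μ-fuel P k A ≡ ℤ.- sumℤ (map (μ P) (strictly-below A))
    go zero le    = ⊥-elim (A≢⊥ (∣A∣≤0⇒⊥ le))
    go (suc k) le with A ≟S ⊥
    ... | yes eq = ⊥-elim (A≢⊥ eq)
    ... | no _   = cong ℤ.-_ (sum-cong (strictly-below A) (λ {B} i → μ-stable k n B (smaller i le) (∣p∣≤n B)))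

  open 𝒮∑
  open import Relation.Binary.Reasoning.Setoid 𝒮.setoid

  μ-sum : ∀ {D} → Flat D → ∑ (filter (_⊆? D) (flats P)) (λ A → constant (μ P A)) 𝒮.≈ ⟦ ⊥ ≟S D ⟧
  μ-sum {D} d with ⊥ ≟S D
  ... | yes refl = begin
    ∑ (filter (_⊆? ⊥) (flats P)) (λ A → constant (μ P A))
      ≈⟨ ∑-single (λ A → constant (μ P A)) (Unique.filter⁺ (_⊆? ⊥) flats-unique) (∈-filter⁺ (_⊆? ⊥) (∈-flats loopless) ⊆-refl)
           (λ i ne → ⊥-elim (ne (⊆-antisym (proj₂ (∈-filter⁻ (_⊆? ⊥) {xs = flats P} i)) ⊥⊆))) ⟩
    constant (μ P ⊥)  ≈⟨ (λ { zero → μ-⊥ n ; (suc _) → refl }) ⟩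
    𝒮.1# ∎
  ... | no ne = begin
    ∑ (filter (_⊆? D) (flats P)) (λ A → constant (μ P A))
      ≈⟨ ∑-remove′ ⟩
    constant (μ P D) 𝒮.+ ∑ (filter (λ A → ¬? (A ≟S D)) (filter (_⊆? D) (flats P))) (λ A → constant (μ P A))
      ≈⟨ 𝒮.+-congˡ {constant (μ P D)} (𝒮.reflexive (cong (λ l → ∑ l (λ A → constant (μ P A)))
           (filter-filter (_⊆? D) (λ A → ¬? (A ≟S D)) (λ A → Tdec (A ⊊ᵇ D))
             (λ {A} le ne → ⊊ᵇ⁺ A D (le , λ h → ne (⊆-antisym le h))) (λ {A} t → let le , nle = ⊊ᵇ⁻ A D t in le , λ { refl → nle ⊆-refl }) (flats P)))) ⟩
    constant (μ P D) 𝒮.+ ∑ (strictly-below D) (λ A → constant (μ P A))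
      ≈⟨ 𝒮.+-congˡ {constant (μ P D)} (constant-sum (strictly-below D) (μ P)) ⟩
    constant (μ P D) 𝒮.+ constant (sumℤ (map (μ P) (strictly-below D)))
      ≈⟨ (λ { zero → trans (cong (λ u → u ℤ.+ sumℤ (map (μ P) (strictly-below D))) (μ-recursion (ne ∘ sym))) (ℤ.+-inverseˡ (sumℤ (map (μ P) (strictly-below D)))) ; (suc _) → refl }) ⟩
    𝒮.0# ∎
    where
    ∑-remove′ : ∑ (filter (_⊆? D) (flats P)) (λ A → constant (μ P A)) 𝒮.≈
      constant (μ P D) 𝒮.+ ∑ (filter (λ A → ¬? (A ≟S D)) (filter (_⊆? D) (flats P))) (λ A → constant (μ P A))
    ∑-remove′ = Sums.∑-remove seriesRing (λ A → constant (μ P A)) _≟S_ (Unique.filter⁺ (_⊆? D) flats-unique) (∈-filter⁺ (_⊆? D) (∈-flats d) ⊆-refl)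

  χ-sum : χ P 𝒮.≈ ∑ (flats P) (λ A → constant (μ P A) 𝒮.* xS ^ˢ (rk P (ground P) ∸ rk P A))
  χ-sum d = sym (trans (∑-at (flats P) _ d) (go (flats P)))
    where
    e : X → ℕ
    e A = rk P (ground P) ∸ rk P A
    go : ∀ Fs → sumℤ (map (λ A → (constant (μ P A) ⊛ (xS ^ˢ e A)) d) Fs) ≡ sumℤ (map (μ P) (filter (λ A → e A ℕ.≟ d) Fs))
    go []       = refl
    go (A ∷ Fs) with e A ℕ.≡ᵇ d | xS^ (e A) d
    ... | true  | eq = cong₂ ℤ._+_ (trans (constant-⊛ (μ P A) (xS ^ˢ e A) d) (trans (cong (μ P A ℤ.*_) eq) (ℤ.*-identityʳ (μ P A)))) (go Fs)
    ... | false | eq = trans (cong₂ ℤ._+_ (trans (constant-⊛ (μ P A) (xS ^ˢ e A) d) (trans (cong (μ P A ℤ.*_) eq) (ℤ.*-zeroʳ (μ P A)))) (go Fs))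
                         (ℤ.+-identityˡ (sumℤ (map (μ P) (filter (λ A → e A ℕ.≟ d) Fs))))

-- Restrictions and contractions as intervals

module Assembly {n : ℕ} (M : Polymatroid n) (𝒢 : SetOfFlats n)
  (isM : IsPolymatroid M) (loopless : Loopless M) (isB : IsBuildingSet M 𝒢) where
  open NestedSums M 𝒢 isM loopless isB seriesRing xS geometric geometric-unfold
  open Identities M 𝒢 isM loopless isB seriesRing xS geometric geometric-unfold
  private
    X = Subset n
    r = rk M
    E = ground M
    module SR = Relation.Binary.Reasoning.Setoid 𝒮.setoid

  module OfMinor {F K P 𝒢P} (isMinor : IsMinor M 𝒢 isM loopless isB F K P 𝒢P) where
    open IsMinor isMinor
    open Minor M 𝒢 isM loopless isB isMinor
    open Over F-flat

    flats-interval : map (_∪ F) (flats P) ≡ interval F K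
    flats-interval = trans
      (map-∪-filter F {isFlat P} {λ B → isFlat M B ∧ ((F ⊆ᵇ B) ∧ (B ⊆ᵇ K))}
        (λ t → ∪─ (proj₁ (minor-flat⁻ t)))
        (λ {A} t → let le , fl = minor-flat⁻ t in T-∧⁺ fl (T-∧⁺ (⊆ᵇ⁺ F (A ∪ F) (∪ʳ {A = A})) (⊆ᵇ⁺ (A ∪ F) K (∪⊆ F⊆K le))))
        (λ {B} t → ─∪ (proj₁ (proj₂ (parts B t))))
        (λ {B} t → let fl , p , q = parts B t in down-flat fl p q))
      (sym (filter-filter (λ B → Tdec (isFlat M B)) (λ B → (F ⊆? B) ×-dec (B ⊆? K)) (λ B → Tdec (isFlat M B ∧ ((F ⊆ᵇ B) ∧ (B ⊆ᵇ K))))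
        (λ {B} fl (p , q) → T-∧⁺ fl (T-∧⁺ (⊆ᵇ⁺ F B p) (⊆ᵇ⁺ B K q))) (λ {B} t → parts B t) (allSubsets n)))
      where
      parts : ∀ B → T (isFlat M B ∧ ((F ⊆ᵇ B) ∧ (B ⊆ᵇ K))) → Flat B × F ⊆ B × B ⊆ K
      parts B t = let fl , s = T-∧⁻ {isFlat M B} t ; p , q = T-∧⁻ {F ⊆ᵇ B} s in fl , ⊆ᵇ⁻ F B p , ⊆ᵇ⁻ B K q

    gens-relList : map (_∪ F) (gens P 𝒢P) ≡ relList K
    gens-relList = map-∪-filter F {𝒢P} {λ B → relBS F B ∧ (B ⊆ᵇ K)}
      (λ {A} t → ∪─ (proj₁ (𝒢⇒ A t)))
      (λ {A} t → let le , g = 𝒢⇒ A t in T-∧⁺ g (⊆ᵇ⁺ (A ∪ F) K (∪⊆ F⊆K le)))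
      (λ {B} t → ─∪ (base⊆relBS F-flat (proj₁ (T-∧⁻ {relBS F B} t))))
      (λ {B} t → let g , le = T-∧⁻ {relBS F B} t in 𝒢⇐ (B ─ F) (─-mono (⊆ᵇ⁻ B K le)) (subst (T ∘ relBS F) (sym (─∪ (base⊆relBS F-flat g))) g))

    exponent≡ : ∀ {T′ A} → All (T ∘ 𝒢P) T′ → T (𝒢P A) → Presentation.exponent P 𝒢P T′ A ≡ b (map (_∪ F) T′) (A ∪ F)
    exponent≡ {T′} {A} t g = begin
      rk P A ∸ rk P (⋁ P Bs)                                   ≡⟨ cong₂ _∸_ (rank≡ A A⊆) (rank≡ (⋁ P Bs) V⊆) ⟩
      (r (A ∪ F) ∸ r F) ∸ (r (⋁ P Bs ∪ F) ∸ r F)               ≡⟨ ∸-cancel (r (A ∪ F)) (base≤ V⊆) ⟩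
      r (A ∪ F) ∸ r (⋁ P Bs ∪ F)                               ≡⟨ cong (λ C → r (A ∪ F) ∸ r C) joins ⟩
      r (A ∪ F) ∸ r (supF (map (_∪ F) T′) (A ∪ F))             ≡⟨ b≡ (map (_∪ F) T′) (A ∪ F) ⟨
      b (map (_∪ F) T′) (A ∪ F)                                ∎
      where
      open ≡-Reasoning
      Bs = filter (λ G → Tdec (G ⊊ᵇ A)) T′
      A⊆ = proj₁ (𝒢⇒ A g)
      V⊆ = proj₁ (minor-flat⁻ (FP.⋁-flat Bs))
      filters : map (_∪ F) Bs ≡ below-in (map (_∪ F) T′) (A ∪ F)
      filters = trans (cong (map (_∪ F)) (filter-cong-All (λ G → Tdec (G ⊊ᵇ A)) (λ G → Tdec ((G ∪ F) ⊊ᵇ (A ∪ F))) (All.map (λ {B} bt →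
            let B⊆ = proj₁ (𝒢⇒ B bt) in (λ s → ⊊ᵇ⁺ (B ∪ F) (A ∪ F) (⊊-up⁺ B⊆ A⊆ (⊊ᵇ⁻ B A s))) , (λ s → ⊊ᵇ⁺ B A (⊊-up⁻ B⊆ A⊆ (⊊ᵇ⁻ (B ∪ F) (A ∪ F) s)))) t)))
        (sym (filter-map (λ G → Tdec (G ⊊ᵇ (A ∪ F))) (_∪ F) T′))
      joins : ⋁ P Bs ∪ F ≡ supF (map (_∪ F) T′) (A ∪ F)
      joins = trans (up-⋁ Bs (All.filter⁺ (λ G → Tdec (G ⊊ᵇ A)) (All.map minor-𝒢-flat t)))
        (trans (sym (⋁F≡⋁ (map (_∪ F) Bs))) (cong ⋁F filters))

    hilbert-series : ∀ {h} → IsHilbertFn P 𝒢P h → fromℕS h 𝒮.≈ H K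
    hilbert-series {h} hilb = 𝒮.trans (λ d → trans (cong ℤ.+_ (Presentation.hilbert-count P 𝒢P JP.exponents JP.upper hilb d))
        (sym (degreeSum-at (Basis.duals JP.exponents (gens P 𝒢P) []) d)))
      (𝒮.trans (degreeSum-duals seriesRing xS geometric geometric-unfold JP.exponents (gens P 𝒢P) [])
      (𝒮.trans (𝒩-map (Presentation.exponent P 𝒢P) b (_∪ F) (T ∘ 𝒢P) (gens P 𝒢P) [] (All.all-filter (λ G → Tdec (𝒢P G)) (allSubsets n)) [] exponent≡)
        (𝒮.reflexive (cong (λ L → Nested.𝒩 b L [] (λ _ → 𝒮.1#)) gens-relList))))

    minorμ : X → Series
    minorμ A = constant (μ P (A ─ F))

    private
      minor-loopless : Loopless P
      minor-loopless = minor-flat⁺ ⊥⊆ (subst Flat (sym (∪-identityˡ F)) F-flat)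

      module MP = Möbius P minor-isPolymatroid minor-loopless

      flats⊆ : ∀ {A} → A ∈ flats P → A ⊆ K ─ F
      flats⊆ i = proj₁ (minor-flat⁻ (FP.∈-flats⁻ i))

    minorμ-sum : ∀ {J} → Flat J → F ⊆ J → J ⊆ K → ∑ (interval F J) minorμ 𝒮.≈ ⟦ F ≟S J ⟧
    minorμ-sum {J} j FJ JK = begin
      ∑ (interval F J) minorμ
        ≈⟨ 𝒮.reflexive (cong (λ l → ∑ l minorμ) (trans (sym (interval-upper JK)) (cong (filter (_⊆? J)) (sym flats-interval)))) ⟩
      ∑ (filter (_⊆? J) (map (_∪ F) (flats P))) minorμ
        ≈⟨ 𝒮.reflexive (cong (λ l → ∑ l minorμ) (filter-map (_⊆? J) (_∪ F) (flats P))) ⟩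
      ∑ (map (_∪ F) (filter (λ A → (A ∪ F) ⊆? J) (flats P))) minorμ
        ≈⟨ ∑-map (_∪ F) (filter (λ A → (A ∪ F) ⊆? J) (flats P)) ⟩
      ∑ (filter (λ A → (A ∪ F) ⊆? J) (flats P)) (λ A → minorμ (A ∪ F))
        ≈⟨ 𝒮.reflexive (cong (λ l → ∑ l (λ A → minorμ (A ∪ F))) (filter-cong-All (λ A → (A ∪ F) ⊆? J) (_⊆? (J ─ F)) (All.tabulate λ i →
             (λ AJ {e} → subst (_⊆ J ─ F) (∪─ (flats⊆ i)) (─-mono AJ) {e}) , (λ AJ {e} → ∪⊆ FJ AJ {e}))))  ⟩
      ∑ (filter (_⊆? (J ─ F)) (flats P)) (λ A → minorμ (A ∪ F))
        ≈⟨ ∑-cong (filter (_⊆? (J ─ F)) (flats P)) (λ i → 𝒮.reflexive (cong (λ A → constant (μ P A)) (∪─ (flats⊆ (proj₁ (∈-filter⁻ (_⊆? (J ─ F)) {xs = flats P} i)))))) ⟩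
      ∑ (filter (_⊆? (J ─ F)) (flats P)) (λ A → constant (μ P A))
        ≈⟨ MP.μ-sum (down-flat j FJ JK) ⟩
      ⟦ ⊥ ≟S (J ─ F) ⟧
        ≈⟨ ⟦⟧-cong (⊥ ≟S (J ─ F)) (F ≟S J) (λ eq → trans (sym (∪-identityˡ F)) (trans (cong (_∪ F) eq) (─∪ FJ)))
             (λ { refl → ⊆-antisym ⊥⊆ (λ e∈ → let i , e∉ = ─⁻ F F e∈ in ⊥-elim (e∉ i)) }) ⟩
      ⟦ F ≟S J ⟧ ∎
      where open SR

    minorχ : χ P 𝒮.≈ ∑ (interval F K) (λ J → minorμ J 𝒮.* xS ^ˢ (r K ∸ r J))
    minorχ = begin
      χ P
        ≈⟨ MP.χ-sum ⟩
      ∑ (flats P) (λ A → constant (μ P A) 𝒮.* xS ^ˢ (rk P (ground P) ∸ rk P A))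
        ≈⟨ ∑-cong (flats P) (λ {A} i →
             𝒮.reflexive (cong₂ (λ C e → constant (μ P C) 𝒮.* xS ^ˢ e) (sym (∪─ (flats⊆ i))) (ranks (flats⊆ i)))) ⟩
      ∑ (flats P) (λ A → minorμ (A ∪ F) 𝒮.* xS ^ˢ (r K ∸ r (A ∪ F)))
        ≈⟨ ∑-map (_∪ F) (flats P) ⟨
      ∑ (map (_∪ F) (flats P)) (λ J → minorμ J 𝒮.* xS ^ˢ (r K ∸ r J))
        ≈⟨ 𝒮.reflexive (cong (λ l → ∑ l (λ J → minorμ J 𝒮.* xS ^ˢ (r K ∸ r J))) flats-interval) ⟩
      ∑ (interval F K) (λ J → minorμ J 𝒮.* xS ^ˢ (r K ∸ r J)) ∎
      where
      open SR
      ranks : ∀ {A} → A ⊆ K ─ F → rk P (ground P) ∸ rk P A ≡ r K ∸ r (A ∪ F)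
      ranks {A} le = trans (cong₂ _∸_ (trans (cong (rk P) ground≡) (trans (rank≡ (K ─ F) ⊆-refl) (cong (λ C → r C ∸ r F) (─∪ F⊆K)))) (rank≡ A le))
        (∸-cancel (r K) (base≤ le))

  -- The sums over all intervals [F,J] determine a function recursively. Thus the Möbius function of
  -- any minor based at F agrees with that of the contraction by F.
  möbius-unique : ∀ {F K} {f g : X → Series} → Flat F →
    (∀ {J} → Flat J → F ⊆ J → J ⊆ K → ∑ (interval F J) f 𝒮.≈ ⟦ F ≟S J ⟧) →
    (∀ {J} → Flat J → F ⊆ J → J ⊆ K → ∑ (interval F J) g 𝒮.≈ ⟦ F ≟S J ⟧) →
    ∀ {J} → Flat J → F ⊆ J → J ⊆ K → f J 𝒮.≈ g J
  möbius-unique {F} {K} {f} {g} F-flat hf hg {J} j p q = go (suc ∣ J ∣) j p q ℕ.≤-refl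
    where
    open import Algebra.Properties.Ring 𝒮.ring using (+-cancelʳ)
    go : ∀ k {J} → Flat J → F ⊆ J → J ⊆ K → ∣ J ∣ < k → f J 𝒮.≈ g J
    go (suc k) {J} j p q (s≤s le) = +-cancelʳ (∑ proper g) (f J) (g J) (begin
      f J 𝒮.+ ∑ proper g        ≈⟨ 𝒮.+-congˡ {f J} (∑-cong proper (λ i →
                                    let l , ne = ∈-filter⁻ (λ A → ¬? (A ≟S J)) {xs = interval F J} i
                                        A-flat , FA , AJ = ∈-interval⁻ l
                                    in go k A-flat FA (⊆-trans AJ q) (ℕ.<-≤-trans (p⊂q⇒∣p∣<∣q∣ (AJ , ⊈⇒∃ (λ h → ne (⊆-antisym AJ h)))) le))) ⟨
      f J 𝒮.+ ∑ proper f        ≈⟨ ∑-remove f _≟S_ (interval-unique F J) (∈-interval⁺ j p ⊆-refl) ⟨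
      ∑ (interval F J) f       ≈⟨ 𝒮.trans (hf j p q) (𝒮.sym (hg j p q)) ⟩
      ∑ (interval F J) g       ≈⟨ ∑-remove g _≟S_ (interval-unique F J) (∈-interval⁺ j p ⊆-refl) ⟩
      g J 𝒮.+ ∑ proper g        ∎)
      where
      open SR
      proper = filter (λ A → ¬? (A ≟S J)) (interval F J)

  E-flat : Flat E
  E-flat = flat-ground

  𝒢⇒rel : ∀ {A} → T (𝒢 A) → T (relBS ⊥ (A ∪ ⊥))
  𝒢⇒rel {A} g = subst (T ∘ relBS ⊥) (trans (⊆-antisym (J-least (𝒢-flat g) ⊆-refl ⊥⊆) (Jˡ (𝒢-flat g) loopless)) (sym (∪-identityʳ A))) (relBS⁺ ⊥ g (𝒢-nonempty g))

  rel⇒𝒢 : ∀ {A} → T (relBS ⊥ (A ∪ ⊥)) → T (𝒢 A)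
  rel⇒𝒢 {A} t = let G , g , _ , eq = relBS⁻ ⊥ (A ∪ ⊥) t in
    subst (T ∘ 𝒢) (trans (⊆-antisym (Jˡ (𝒢-flat g) loopless) (J-least (𝒢-flat g) ⊆-refl ⊥⊆)) (trans (sym eq) (∪-identityʳ A))) g

  rank-⊥ : ∀ A → r A ≡ r (A ∪ ⊥) ∸ r ⊥
  rank-⊥ A = sym (cong₂ (λ B c → r B ∸ c) (∪-identityʳ A) (IsPolymatroid.rk-∅ isM))

  whole : IsMinor M 𝒢 isM loopless isB ⊥ E M 𝒢
  whole = record
    { F-flat = loopless ; K-flat = E-flat ; F⊆K = ⊥⊆ ; ground≡ = sym (p─⊥≡p E) ; rank≡ = λ A _ → rank-⊥ A
    ; 𝒢⇒ = λ A g → (λ {e} → subst (A ⊆_) (sym (p─⊥≡p E)) (flat⊆ (𝒢-flat g)) {e}) , 𝒢⇒rel g ; 𝒢⇐ = λ A _ → rel⇒𝒢 }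

  restriction : ∀ {K} → Flat K → IsMinor M 𝒢 isM loopless isB ⊥ K (M ∣ʳ K) (restrictBS 𝒢 K)
  restriction {K} k = record
    { F-flat = loopless ; K-flat = k ; F⊆K = ⊥⊆ ; ground≡ = sym (p─⊥≡p K) ; rank≡ = λ A _ → rank-⊥ A
    ; 𝒢⇒ = λ A t → let g , le = T-∧⁻ {𝒢 A} t in (λ {e} → subst (A ⊆_) (sym (p─⊥≡p K)) (⊆ᵇ⁻ A K le) {e}) , 𝒢⇒rel g
    ; 𝒢⇐ = λ A le t → T-∧⁺ (rel⇒𝒢 t) (⊆ᵇ⁺ A K (subst (A ⊆_) (p─⊥≡p K) le)) }

  contractBS⁻ : ∀ F A → T (contractBS M 𝒢 F A) → ∃ λ G → T (𝒢 G) × G ⊈ F × A ≡ J G F ─ F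
  contractBS⁻ F A t = let G , _ , h = find (Any.any⁻ _ (allSubsets n) t)
                          g , h′ = T-∧⁻ {𝒢 G} h
                          s , e = T-∧⁻ {not (G ⊆ᵇ F)} h′
                      in G , g , (λ le → T-not⁻ s (⊆ᵇ⁺ G F le)) , trans (≡ᵇ⁻ A _ e) (cong (_─ F) (sym (J≡⋁ G F)))

  contractBS⁺ : ∀ F {G} → T (𝒢 G) → G ⊈ F → T (contractBS M 𝒢 F (J G F ─ F))
  contractBS⁺ F {G} g nle = Any.any⁺ _ (lose (∈-allSubsets G) (T-∧⁺ g (T-∧⁺ (T-not⁺ (nle ∘ ⊆ᵇ⁻ G F)) (≡ᵇ⁺ (J G F ─ F) _ (cong (_─ F) (J≡⋁ G F))))))

  contraction : ∀ {F} → Flat F → IsMinor M 𝒢 isM loopless isB F E (M /ᶜ F) (contractBS M 𝒢 F)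
  contraction {F} f = record
    { F-flat = f ; K-flat = E-flat ; F⊆K = flat⊆ f ; ground≡ = refl ; rank≡ = λ _ _ → refl
    ; 𝒢⇒ = λ A t → let G , g , nle , eq = contractBS⁻ F A t in
        (λ {e} → subst (_⊆ E ─ F) (sym eq) (─-mono (flat⊆ (J-flat G F))) {e}) ,
        subst (T ∘ relBS F) (sym (trans (cong (_∪ F) eq) (─∪ (Jʳ (𝒢-flat g) f)))) (relBS⁺ F g nle)
    ; 𝒢⇐ = λ A le t → let G , g , nle , eq = relBS⁻ F (A ∪ F) t in
        subst (T ∘ contractBS M 𝒢 F) (trans (cong (_─ F) (sym eq)) (∪─ le)) (contractBS⁺ F g nle) }

  -- The contraction by F supplies μ(F,J) for all flats J above F at once, so one family of
  -- contractions serves as the Möbius function of the whole lattice.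
  open Main (λ F J → constant (μ (M /ᶜ F) (J ─ F)))
    (λ f k le → OfMinor.minorμ-sum (contraction f) k le (flat⊆ k))

  χ-charPoly : ∀ {F K P 𝒢P} → IsMinor M 𝒢 isM loopless isB F K P 𝒢P → χ P 𝒮.≈ charPoly F K
  χ-charPoly {F} {K} m = 𝒮.trans (OfMinor.minorχ m) (∑-cong (interval F K) (λ {J} i → let j , p , q = ∈-interval⁻ i in
    𝒮.*-congʳ {xS ^ˢ (r K ∸ r J)} (möbius-unique F-flat (OfMinor.minorμ-sum m)
      (λ l FL _ → OfMinor.minorμ-sum (contraction F-flat) l FL (flat⊆ l)) j p q)))
    where open IsMinor m

  hilbert≈ : ∀ {F K P 𝒢P h} → IsMinor M 𝒢 isM loopless isB F K P 𝒢P → IsHilbertFn P 𝒢P h → fromℕS h 𝒮.≈ hilb F K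
  hilbert≈ {K = K} m hf = 𝒮.trans (OfMinor.hilbert-series m hf) (𝒮.reflexive (sym (hilb≡H (IsMinor.F-flat m) K)))

  factorCount-⊥ : ∀ K → factorCount ⊥ K ≡ length (maxElems (restrictBS 𝒢 K))
  factorCount-⊥ K = cong length (List.filter-all (λ A → ¬? (A ⊆? ⊥)) {factors K} (All.tabulate λ i → 𝒢-nonempty (proj₁ (∈-factors⁻ i))))

  -- The factors of the contraction are the joins with F of the factors of E not contained in F.
  -- Distinct such factors stay incomparable after joining with F, and every member of the
  -- contraction lies below one of them.
  factorCount-contraction : ∀ {F} → Flat F → factorCount F E ≡ length (maxElems (contractBS M 𝒢 F))
  factorCount-contraction {F} f = trans (sym (List.length-map shift outer)) (↭-length (↭-unique
      (map-unique injective (Unique.filter⁺ (λ A → ¬? (A ⊆? F)) (maxElems-unique (below 𝒢 E))))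
      (maxElems-unique (contractBS M 𝒢 F)) to from))
    where
    outer : List X
    outer = filter (λ A → ¬? (A ⊆? F)) (factors E)
    shift : X → X
    shift A = J A F ─ F
    outer⁻ : ∀ {A} → A ∈ outer → A ∈ factors E × A ⊈ F
    outer⁻ i = ∈-filter⁻ (λ A → ¬? (A ⊆? F)) {xs = factors E} i
    J⊇F : ∀ {A} → T (𝒢 A) → F ⊆ J A F
    J⊇F g = Jʳ (𝒢-flat g) f
    unshift : ∀ {A B} → T (𝒢 A) → T (𝒢 B) → shift A ⊆ shift B → J A F ⊆ J B F
    unshift a b le = subst₂ _⊆_ (─∪ (J⊇F a)) (─∪ (J⊇F b)) (∪-mono le)
    -- If B ≠ A, then B lies in the complement R of A, so B ∨ F is inside (F ∩ A) ∨ R. Its component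
    -- in A is then at most F ∩ A, and A would be contained in F.
    separated : ∀ {A B} → A ∈ factors E → A ⊈ F → B ∈ factors E → J A F ⊆ J B F → B ≡ A
    separated {A} {B} i nle j le = decidable-stable (B ≟S A) λ ne → nle (⊆-trans (⊆-trans (∩-greatest (⊆-trans (Jˡ a f) (⊆-trans le
        (J-least (J-flat (F ∩ A) R) (⊆-trans (other⊆R j ne) (Jʳ (flat-∩ f a) R-flat))
          (⊆-trans (cover f (flat⊆ f)) (J-least (J-flat (F ∩ A) R) (Jˡ (flat-∩ f a) R-flat) (⊆-trans ∩ʳ (Jʳ (flat-∩ f a) R-flat))))))) ⊆-refl)
        (left (flat-∩ f a) ∩ʳ R-flat ⊆-refl)) ∩ˡ)
      where
      open Decomposition E-flat i
      a = 𝒢-flat (proj₁ (∈-factors⁻ i))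
    injective : ∀ {A B} → A ∈ outer → B ∈ outer → shift A ≡ shift B → A ≡ B
    injective i j eq = let p , nle = outer⁻ i ; q , _ = outer⁻ j in
      sym (separated p nle q (unshift (proj₁ (∈-factors⁻ p)) (proj₁ (∈-factors⁻ q)) (⊆-reflexive eq)))
    to : ∀ {B} → B ∈ map shift outer → B ∈ maxElems (contractBS M 𝒢 F)
    to i with ∈-map⁻ shift i
    ... | A , j , refl = let p , nle = outer⁻ j ; g = proj₁ (∈-factors⁻ p) in
      ∈-maxElems⁺ {contractBS M 𝒢 F} (contractBS⁺ F g nle , λ {H} t le →
        let G , g′ , nle′ , eq = contractBS⁻ F H t
            C , q , GC = below-factor g′ (flat⊆ (𝒢-flat g′))
            c = proj₁ (∈-factors⁻ q)
            CA = separated p nle q (⊆-trans (unshift g g′ (subst (shift A ⊆_) eq le)) (J-least (J-flat C F) (⊆-trans GC (Jˡ (𝒢-flat c) f)) (J⊇F c)))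
        in subst (_⊆ shift A) (sym eq) (─-mono (J-least (J-flat A F) (⊆-trans GC (subst (_⊆ J A F) (sym CA) (Jˡ (𝒢-flat g) f))) (J⊇F g))))
    from : ∀ {B} → B ∈ maxElems (contractBS M 𝒢 F) → B ∈ map shift outer
    from {B} i with ∈-maxElems⁻ {contractBS M 𝒢 F} i
    ... | t , maximal with contractBS⁻ F B t
    ... | G , g , nle , refl with below-factor g (flat⊆ (𝒢-flat g))
    ... | C , q , GC = subst (_∈ map shift outer)
        (⊆-antisym (maximal (contractBS⁺ F c C⊈F) le) le)
        (∈-map⁺ shift (∈-filter⁺ (λ A → ¬? (A ⊆? F)) q C⊈F))
      where
      c = proj₁ (∈-factors⁻ q)
      C⊈F : C ⊈ F
      C⊈F h = nle (⊆-trans GC h)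
      le : shift G ⊆ shift C
      le = ─-mono (J-least (J-flat C F) (⊆-trans GC (Jˡ (𝒢-flat c) f)) (J⊇F c))

-- The two identities

oneMinusX-power : ∀ m → oneMinusX ^S m ≡ oneMinusX ^ˢ m
oneMinusX-power zero    = refl
oneMinusX-power (suc m) = cong (oneMinusX ⊛_) (oneMinusX-power m)

geometric-cancel : ∀ c → geometric ^ˢ c 𝒮.* oneMinusX ^ˢ c 𝒮.≈ 𝒮.1#
geometric-cancel zero    = 𝒮.*-identityˡ 𝒮.1#
geometric-cancel (suc c) = begin
  (geometric 𝒮.* geometric ^ˢ c) 𝒮.* (oneMinusX 𝒮.* oneMinusX ^ˢ c)
    ≈⟨ solve 4 (λ g p o q → (g :* p) :* (o :* q) := (o :* g) :* (p :* q)) (λ _ → refl) geometric (geometric ^ˢ c) oneMinusX (oneMinusX ^ˢ c) ⟩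
  (oneMinusX 𝒮.* geometric) 𝒮.* (geometric ^ˢ c 𝒮.* oneMinusX ^ˢ c)
    ≈⟨ 𝒮.*-cong {oneMinusX 𝒮.* geometric} {𝒮.1#} oneMinusX⊛geometric (geometric-cancel c) ⟩
  𝒮.1# 𝒮.* 𝒮.1#
    ≈⟨ 𝒮.*-identityˡ 𝒮.1# ⟩
  𝒮.1# ∎
  where
  open Relation.Binary.Reasoning.Setoid 𝒮.setoid
  open import Algebra.Solver.Ring.NaturalCoefficients.Default 𝒮.commutativeSemiring using (solve; _:*_; _:=_)

clear-denominator : ∀ (t : Series) {c N} → c ≤ N → (t 𝒮.* geometric ^ˢ c) 𝒮.* (oneMinusX ^S N) 𝒮.≈ t ⊛ (oneMinusX ^S (N ∸ c))
clear-denominator t {c} {N} le = begin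
  (t 𝒮.* geometric ^ˢ c) 𝒮.* (oneMinusX ^S N)
    ≈⟨ 𝒮.*-congˡ {t 𝒮.* geometric ^ˢ c} (𝒮.trans (𝒮.reflexive (trans (oneMinusX-power N) (cong (oneMinusX ^ˢ_) (sym (ℕ.m+[n∸m]≡n le))))) (^ˢ-homo-* oneMinusX c (N ∸ c))) ⟩
  (t 𝒮.* geometric ^ˢ c) 𝒮.* (oneMinusX ^ˢ c 𝒮.* oneMinusX ^ˢ (N ∸ c))
    ≈⟨ solve 4 (λ t g o q → (t :* g) :* (o :* q) := (g :* o) :* (t :* q)) (λ _ → refl) t (geometric ^ˢ c) (oneMinusX ^ˢ c) (oneMinusX ^ˢ (N ∸ c)) ⟩
  (geometric ^ˢ c 𝒮.* oneMinusX ^ˢ c) 𝒮.* (t 𝒮.* oneMinusX ^ˢ (N ∸ c))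
    ≈⟨ 𝒮.*-congʳ {t 𝒮.* oneMinusX ^ˢ (N ∸ c)} (geometric-cancel c) ⟩
  𝒮.1# 𝒮.* (t 𝒮.* oneMinusX ^ˢ (N ∸ c))
    ≈⟨ 𝒮.trans (𝒮.*-identityˡ (t 𝒮.* oneMinusX ^ˢ (N ∸ c))) (𝒮.*-congˡ {t} (𝒮.reflexive (sym (oneMinusX-power (N ∸ c))))) ⟩
  t 𝒮.* (oneMinusX ^S (N ∸ c)) ∎
  where
  open Relation.Binary.Reasoning.Setoid 𝒮.setoid
  open import Algebra.Solver.Ring.NaturalCoefficients.Default 𝒮.commutativeSemiring using (solve; _:*_; _:=_)

summand≤sum : ∀ {A : Set} (c : A → ℕ) {xs y} → y ∈ xs → c y ≤ sum (map c xs)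
summand≤sum c {y ∷ xs} (here refl) = ℕ.m≤m+n (c y) _
summand≤sum c {z ∷ xs} (there i)   = ℕ.≤-trans (summand≤sum c i) (ℕ.m≤n+m _ (c z))

clear-denominators : ∀ {A : Set} (xs : List A) (c : A → ℕ) (t : A → Series) (h : Series) →
  h 𝒮.≈ 𝒮∑.∑ xs (λ y → t y 𝒮.* geometric ^ˢ c y) →
  ∀ d → (h ⊛ (oneMinusX ^S sum (map c xs))) d ≡ sumS (map (λ y → t y ⊛ (oneMinusX ^S (sum (map c xs) ∸ c y))) xs) d
clear-denominators xs c t h eq d = trans (identity d) (trans (∑-at xs _ d) (cong sumℤ (List.map-∘ xs)))
  where
  N = sum (map c xs)
  identity : h 𝒮.* (oneMinusX ^S N) 𝒮.≈ 𝒮∑.∑ xs (λ y → t y ⊛ (oneMinusX ^S (N ∸ c y)))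
  identity = 𝒮.trans (𝒮.*-congʳ {oneMinusX ^S N} eq) (𝒮.trans (𝒮∑.∑-*ʳ xs (oneMinusX ^S N) _)
    (𝒮∑.∑-cong xs (λ {y} i → clear-denominator (t y) (summand≤sum c i))))

isolate : ∀ {A : Set} (_≟_ : ∀ u v → Dec (u ≡ v)) {xs : List A} {y} f → Unique xs → y ∈ xs → 𝒮∑.∑ xs f 𝒮.≈ 𝒮.0# →
  f y 𝒮.≈ 𝒮∑.∑ (filter (λ z → ¬? (z ≟ y)) xs) (λ z → negS (f z))
isolate _≟_ {xs} {y} f u i eq = +-cancelʳ (∑ ys f) (f y) _ (𝒮.trans (𝒮.sym (∑-remove f _≟_ u i)) (𝒮.trans eq
    (𝒮.sym (𝒮.trans (𝒮.sym (∑-+ ys (λ z → negS (f z)) f)) (∑-zero ys (λ {z} _ → 𝒮.-‿inverseˡ (f z)))))))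
  where
  open 𝒮∑
  open import Algebra.Properties.Ring 𝒮.ring using (+-cancelʳ)
  ys = filter (λ z → ¬? (z ≟ y)) xs

module _ {n : ℕ} (M : Polymatroid n) (𝒢 : SetOfFlats n)
  (isM : IsPolymatroid M) (loopless : Loopless M) (nonempty : Nonempty (ground M)) (isB : IsBuildingSet M 𝒢) where
  open NestedSums M 𝒢 isM loopless isB seriesRing xS geometric geometric-unfold
  open Identities M 𝒢 isM loopless isB seriesRing xS geometric geometric-unfold
  open Assembly M 𝒢 isM loopless isB
  open Main (λ F J → constant (μ (M /ᶜ F) (J ─ F)))
    (λ f k le → OfMinor.minorμ-sum (contraction f) k le (flat⊆ k))
  open import Algebra.Properties.Ring 𝒮.ring using (-‿distribˡ-*; -‿distribʳ-*)
  open import Algebra.Solver.Ring.NaturalCoefficients.Default 𝒮.commutativeSemiring using (solve; _:*_; _:=_)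
  private
    E = ground M

    ⊥≢E : ⊥ ≢ E
    ⊥≢E eq = let e , e∈ = nonempty in ∉⊥ (subst (e ∈ˢ_) (sym eq) e∈)

    all-flats : interval ⊥ E ≡ flats M
    all-flats = List.filter-all (λ A → (⊥ ⊆? A) ×-dec (A ⊆? E)) (All.tabulate (λ i → ⊥⊆ , (λ {e} → flat⊆ (∈-flats⁻ i) {e})))

    other-flats : ∀ A → filter (λ F → ¬? (F ≟S A)) (interval ⊥ E) ≡ filter (λ F → Tdec (not (F ≡ᵇ A))) (flats M)
    other-flats A = trans (cong (filter (λ F → ¬? (F ≟S A))) all-flats)
      (List.filter-≐ (λ F → ¬? (F ≟S A)) (λ F → Tdec (not (F ≡ᵇ A))) ((λ {F} ne → T-not⁺ (ne ∘ ≡ᵇ⁻ F A)) , (λ {F} t eq → T-not⁻ t (≡ᵇ⁺ F A eq))) (flats M))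

    other⁻ : ∀ A {F} → F ∈ filter (λ F → Tdec (not (F ≡ᵇ A))) (flats M) → T (isFlat M F) × T (not (F ≡ᵇ A))
    other⁻ A i = let j , t = ∈-filter⁻ (λ F → Tdec (not (F ≡ᵇ A))) {xs = flats M} i in ∈-flats⁻ j , t

  first-series : ∀ {hM} → IsHilbertFn M 𝒢 hM → ∀ {hC : Subset n → ℕ → ℕ} →
    (∀ F → T (isFlat M F) → T (not (F ≡ᵇ ⊥)) → IsHilbertFn (M /ᶜ F) (contractBS M 𝒢 F) (hC F)) →
    fromℕS hM 𝒮.≈ ∑ (filter (λ F → Tdec (not (F ≡ᵇ ⊥))) (flats M))
      (λ F → (negS (χ (M ∣ʳ F)) ⊛ fromℕS (hC F)) 𝒮.* geometric ^ˢ length (maxElems (restrictBS 𝒢 F)))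
  first-series {hM} hilbM {hC} hilbC = begin
    fromℕS hM
      ≈⟨ hilbert≈ whole hilbM ⟩
    hilb ⊥ E
      ≈⟨ 𝒮.trans (𝒮.*-congʳ {hilb ⊥ E} (kernel-diag loopless)) (𝒮.*-identityˡ (hilb ⊥ E)) ⟨
    kernel ⊥ ⊥ 𝒮.* hilb ⊥ E
      -- As the ground set is nonempty, the full sum is δ(∅,E) = 0. Its term at F = ∅ is the Hilbert
      -- series of M, which therefore equals minus the sum of the others.
      ≈⟨ isolate _≟S_ (λ F → kernel ⊥ F 𝒮.* hilb F E) (interval-unique ⊥ E) (∈-interval⁺ loopless ⊆-refl ⊥⊆)
           (𝒮.trans (first-identity loopless E-flat ⊥⊆) (⟦⟧-no (⊥ ≟S E) ⊥≢E)) ⟩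
    ∑ (filter (λ F → ¬? (F ≟S ⊥)) (interval ⊥ E)) (λ F → negS (kernel ⊥ F 𝒮.* hilb F E))
      ≈⟨ 𝒮.reflexive (cong (λ l → ∑ l (λ F → negS (kernel ⊥ F 𝒮.* hilb F E))) (other-flats ⊥)) ⟩
    ∑ Fs (λ F → negS (kernel ⊥ F 𝒮.* hilb F E))
      ≈⟨ ∑-cong Fs (λ {F} i → let f , t = other⁻ ⊥ i in summand F f (hilbC F f t)) ⟩
    ∑ Fs (λ F → (negS (χ (M ∣ʳ F)) ⊛ fromℕS (hC F)) 𝒮.* geometric ^ˢ length (maxElems (restrictBS 𝒢 F))) ∎
    where
    open Relation.Binary.Reasoning.Setoid 𝒮.setoid
    Fs = filter (λ F → Tdec (not (F ≡ᵇ ⊥))) (flats M)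
    summand : ∀ F → Flat F → IsHilbertFn (M /ᶜ F) (contractBS M 𝒢 F) (hC F) →
      negS (kernel ⊥ F 𝒮.* hilb F E) 𝒮.≈ (negS (χ (M ∣ʳ F)) ⊛ fromℕS (hC F)) 𝒮.* geometric ^ˢ length (maxElems (restrictBS 𝒢 F))
    summand F f hC-F = begin
      negS ((charPoly ⊥ F 𝒮.* g) 𝒮.* hilb F E)
        ≈⟨ 𝒮.trans (-‿distribˡ-* (charPoly ⊥ F 𝒮.* g) (hilb F E)) (𝒮.*-congʳ {hilb F E} (-‿distribˡ-* (charPoly ⊥ F) g)) ⟩
      (negS (charPoly ⊥ F) 𝒮.* g) 𝒮.* hilb F E
        ≈⟨ solve 3 (λ c g h → (c :* g) :* h := (c :* h) :* g) (λ _ → refl) (negS (charPoly ⊥ F)) g (hilb F E) ⟩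
      (negS (charPoly ⊥ F) 𝒮.* hilb F E) 𝒮.* g
        ≈⟨ 𝒮.*-cong {negS (charPoly ⊥ F) 𝒮.* hilb F E} {negS (χ (M ∣ʳ F)) 𝒮.* fromℕS (hC F)}
             (𝒮.*-cong {negS (charPoly ⊥ F)} {negS (χ (M ∣ʳ F))} (𝒮.-‿cong (𝒮.sym (χ-charPoly (restriction f)))) (𝒮.sym (hilbert≈ (contraction f) hC-F)))
             (𝒮.reflexive (cong (geometric ^ˢ_) (factorCount-⊥ F))) ⟩
      (negS (χ (M ∣ʳ F)) ⊛ fromℕS (hC F)) 𝒮.* geometric ^ˢ length (maxElems (restrictBS 𝒢 F)) ∎
      where g = geometric ^ˢ factorCount ⊥ F

  second-series : ∀ {hM} → IsHilbertFn M 𝒢 hM → ∀ {hR : Subset n → ℕ → ℕ} →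
    (∀ F → T (isFlat M F) → T (not (F ≡ᵇ ground M)) → IsHilbertFn (M ∣ʳ F) (restrictBS 𝒢 F) (hR F)) →
    fromℕS hM 𝒮.≈ ∑ (filter (λ F → Tdec (not (F ≡ᵇ ground M))) (flats M))
      (λ F → (fromℕS (hR F) ⊛ negS (χ (M /ᶜ F))) 𝒮.* geometric ^ˢ length (maxElems (contractBS M 𝒢 F)))
  second-series {hM} hilbM {hR} hilbR = begin
    fromℕS hM
      ≈⟨ hilbert≈ whole hilbM ⟩
    hilb ⊥ E
      ≈⟨ 𝒮.trans (𝒮.*-congˡ {hilb ⊥ E} (kernel-diag E-flat)) (𝒮.*-identityʳ (hilb ⊥ E)) ⟨
    hilb ⊥ E 𝒮.* kernel E E
      -- In this order of the factors the Hilbert series of M is the term at F = E, where the kernel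
      -- is 1.
      ≈⟨ isolate _≟S_ (λ F → hilb ⊥ F 𝒮.* kernel F E) (interval-unique ⊥ E) (∈-interval⁺ E-flat ⊥⊆ ⊆-refl)
           (𝒮.trans (second-identity loopless E-flat ⊥⊆) (⟦⟧-no (⊥ ≟S E) ⊥≢E)) ⟩
    ∑ (filter (λ F → ¬? (F ≟S E)) (interval ⊥ E)) (λ F → negS (hilb ⊥ F 𝒮.* kernel F E))
      ≈⟨ 𝒮.reflexive (cong (λ l → ∑ l (λ F → negS (hilb ⊥ F 𝒮.* kernel F E))) (other-flats E)) ⟩
    ∑ Fs (λ F → negS (hilb ⊥ F 𝒮.* kernel F E))
      ≈⟨ ∑-cong Fs (λ {F} i → let f , t = other⁻ E i in summand F f (hilbR F f t)) ⟩
    ∑ Fs (λ F → (fromℕS (hR F) ⊛ negS (χ (M /ᶜ F))) 𝒮.* geometric ^ˢ length (maxElems (contractBS M 𝒢 F))) ∎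
    where
    open Relation.Binary.Reasoning.Setoid 𝒮.setoid
    Fs = filter (λ F → Tdec (not (F ≡ᵇ E))) (flats M)
    summand : ∀ F → Flat F → IsHilbertFn (M ∣ʳ F) (restrictBS 𝒢 F) (hR F) →
      negS (hilb ⊥ F 𝒮.* kernel F E) 𝒮.≈ (fromℕS (hR F) ⊛ negS (χ (M /ᶜ F))) 𝒮.* geometric ^ˢ length (maxElems (contractBS M 𝒢 F))
    summand F f hR-F = begin
      negS (hilb ⊥ F 𝒮.* (charPoly F E 𝒮.* g))
        ≈⟨ 𝒮.trans (-‿distribʳ-* (hilb ⊥ F) (charPoly F E 𝒮.* g)) (𝒮.*-congˡ {hilb ⊥ F} (-‿distribˡ-* (charPoly F E) g)) ⟩
      hilb ⊥ F 𝒮.* (negS (charPoly F E) 𝒮.* g)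
        ≈⟨ 𝒮.*-assoc (hilb ⊥ F) (negS (charPoly F E)) g ⟨
      (hilb ⊥ F 𝒮.* negS (charPoly F E)) 𝒮.* g
        ≈⟨ 𝒮.*-cong {hilb ⊥ F 𝒮.* negS (charPoly F E)} {fromℕS (hR F) 𝒮.* negS (χ (M /ᶜ F))}
             (𝒮.*-cong {hilb ⊥ F} {fromℕS (hR F)} (𝒮.sym (hilbert≈ (restriction f) hR-F)) (𝒮.-‿cong (𝒮.sym (χ-charPoly (contraction f)))))
             (𝒮.reflexive (cong (geometric ^ˢ_) (factorCount-contraction f))) ⟩
      (fromℕS (hR F) ⊛ negS (χ (M /ᶜ F))) 𝒮.* geometric ^ˢ length (maxElems (contractBS M 𝒢 F)) ∎
      where g = geometric ^ˢ factorCount F E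

theorem1p1 : ∀ {n : ℕ} (M : Polymatroid n) (𝒢 : SetOfFlats n) →
  IsPolymatroid M → Loopless M → Nonempty (ground M) → IsBuildingSet M 𝒢 →
  (hM : ℕ → ℕ) → IsHilbertFn M 𝒢 hM →
  (hC : Subset n → ℕ → ℕ) →
  (∀ F → T (isFlat M F) → T (not (F ≡ᵇ ⊥)) →
    IsHilbertFn (M /ᶜ F) (contractBS M 𝒢 F) (hC F)) →
  (hR : Subset n → ℕ → ℕ) →
  (∀ F → T (isFlat M F) → T (not (F ≡ᵇ ground M)) →
    IsHilbertFn (M ∣ʳ F) (restrictBS 𝒢 F) (hR F)) →
  -- first identity, multiplied through by (1-x)^N₁ with N₁ = Σ_F |f(𝒢|_F)|
  (let Fs₁ = filter (λ F → Tdec (not (F ≡ᵇ ⊥))) (flats M)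
       c₁ = λ F → length (maxElems (restrictBS 𝒢 F))
       N₁ = sum (map c₁ Fs₁)
   in ∀ d → (fromℕS hM ⊛ (oneMinusX ^S N₁)) d
            ≡ sumS (map (λ F → (negS (χ (M ∣ʳ F)) ⊛ fromℕS (hC F))
                                ⊛ (oneMinusX ^S (N₁ ∸ c₁ F))) Fs₁) d)
  ×
  -- second identity, multiplied through by (1-x)^N₂ with N₂ = Σ_F |f(𝒢/F)|
  (let Fs₂ = filter (λ F → Tdec (not (F ≡ᵇ ground M))) (flats M)
       c₂ = λ F → length (maxElems (contractBS M 𝒢 F))
       N₂ = sum (map c₂ Fs₂)
   in ∀ d → (fromℕS hM ⊛ (oneMinusX ^S N₂)) d
            ≡ sumS (map (λ F → (fromℕS (hR F) ⊛ negS (χ (M /ᶜ F)))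
                                ⊛ (oneMinusX ^S (N₂ ∸ c₂ F))) Fs₂) d)
theorem1p1 M 𝒢 isM loopless nonempty isB hM hilbM hC hilbC hR hilbR =
  clear-denominators _ (λ F → length (maxElems (restrictBS 𝒢 F))) (λ F → negS (χ (M ∣ʳ F)) ⊛ fromℕS (hC F)) (fromℕS hM)
    (first-series M 𝒢 isM loopless nonempty isB hilbM hilbC) ,
  clear-denominators _ (λ F → length (maxElems (contractBS M 𝒢 F))) (λ F → fromℕS (hR F) ⊛ negS (χ (M /ᶜ F))) (fromℕS hM)
    (second-series M 𝒢 isM loopless nonempty isB hilbM hilbR)
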